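{- Let $M$ be a $3$-connected matroid with a $3$-connected simple minor $N$ such that $k:=r(M)-r(N)\ge 2$. Then $M$ has a free family of cardinality $\lceil k/2\rceil+1$ each of whose members is either a singleton set $\{x\}$ with $x$ vertically $N$-contractible in $M$, or an $N$-filament of $M$.
   Context: For a $3$-connected matroid $M$ with an $N$-minor, an element $x$ (or a set $X$) is vertically $N$-contractible if $\mathrm{si}(M/x)$ (resp. $\mathrm{si}(M/X)$), the simplification, is a $3$-connected matroid with an $N$-minor. A line of $M$ is a rank-$2$ set of elements. For $n\ge 3$, a sequence $x_1,\dots,x_n,y_1,\dots,y_n$ of elements of $M$ is an $N$-carambole of $M$ if $L:=\{y_1,\dots,y_n\}$ is a vertically $N$-contractible line of $M$ with $n$ distinct elements and, for each $i\in\{1,\dots,n\}$, $(L-y_i)\cup x_i$ is a cocircuit of $M$; $L$ is then called the filament of the carambole, and a set that is the filament of some $N$-carambole of $M$ is called an $N$-filament of $M$. A family $\{X_1,\dots,X_n\}$ of subsets of $E(M)$ is free if $M|(X_1\cup\cdots\cup X_n)=M|X_1\oplus\cdots\oplus M|X_n$. -}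

module Defs where

open import Algebra.Properties.CommutativeSemigroup using (interchange)
open import Data.Bool.Base using (true; false)
open import Data.Fin.Base as Fin using (Fin; zero; suc)
import Data.Fin.Properties as Fin
open import Data.Fin.Subset
open import Data.Fin.Subset.Properties
open import Data.List.Base as List using (List)
open import Data.Nat.Base using (ℕ; zero; suc; _+_; _∸_; _≤_; _<_; z≤n; s≤s)
open import Data.Nat.Properties
open import Data.Product.Base using (Σ; ∃; ∃₂; _×_; _,_; proj₁; proj₂)
open import Data.Sum.Base using (inj₁; inj₂)
open import Data.Vec.Base as Vec using ([]; _∷_; here; there)
open import Function.Base using (_∘_)
open import Function.Bundles using (_↔_; _⇔_; module Inverse)
open import Function.Definitions using (Injective)
open import Relation.Binary.PropositionalEquality
open import Relation.Nullary
open import Relation.Nullary.Decidable using (map′; decidable-stable)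

open import Algebra.Properties.CommutativeMonoid.Sum +-0-commutativeMonoid
  using (sum-syntax; ∑-distrib-+)

private
  variable
    m n s : ℕ

------------------------------------------------------------------------
-- Auxiliary facts on finite sets and truncated subtraction

private

  ─⁻ : ∀ (p q : Subset n) {x} → x ∈ p ─ q → x ∉ q
  ─⁻ (_ ∷ p) (outside ∷ q) (there x∈) (there x∈q) = ─⁻ p q x∈ x∈q
  ─⁻ (_ ∷ p) (inside  ∷ q) (there x∈) (there x∈q) = ─⁻ p q x∈ x∈q

  ∪-mono : ∀ {p p′ q q′ : Subset n} → p ⊆ p′ → q ⊆ q′ → p ∪ q ⊆ p′ ∪ q′
  ∪-mono {p = p} {q = q} f g x∈ with x∈p∪q⁻ p q x∈
  ... | inj₁ x∈p = x∈p∪q⁺ (inj₁ (f x∈p))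
  ... | inj₂ x∈q = x∈p∪q⁺ (inj₂ (g x∈q))

  ∪-lub : ∀ {p q t : Subset n} → p ⊆ t → q ⊆ t → p ∪ q ⊆ t
  ∪-lub {p = p} {q = q} f g x∈ with x∈p∪q⁻ p q x∈
  ... | inj₁ x∈p = f x∈p
  ... | inj₂ x∈q = g x∈q

  ∩-mono : ∀ {p p′ q q′ : Subset n} → p ⊆ p′ → q ⊆ q′ → p ∩ q ⊆ p′ ∩ q′
  ∩-mono {p = p} {q = q} f g x∈ with x∈p∩q⁻ p q x∈
  ... | x∈p , x∈q = x∈p∩q⁺ (f x∈p , g x∈q)

  ⊆-split : ∀ (p q : Subset n) → p ⊆ q ∪ (p ─ q)
  ⊆-split p q {x} x∈p with x ∈? q
  ... | yes x∈q = x∈p∪q⁺ (inj₁ x∈q)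
  ... | no  x∉q = x∈p∪q⁺ (inj₂ (x∈p∧x∉q⇒x∈p─q x∈p x∉q))

  ∣∪∣+∣∩∣ : ∀ (p q : Subset n) → ∣ p ∪ q ∣ + ∣ p ∩ q ∣ ≡ ∣ p ∣ + ∣ q ∣
  ∣∪∣+∣∩∣ []            []            = refl
  ∣∪∣+∣∩∣ (inside  ∷ p) (inside  ∷ q) = cong suc (trans (+-suc _ _)
    (trans (cong suc (∣∪∣+∣∩∣ p q)) (sym (+-suc _ _))))
  ∣∪∣+∣∩∣ (inside  ∷ p) (outside ∷ q) = cong suc (∣∪∣+∣∩∣ p q)
  ∣∪∣+∣∩∣ (outside ∷ p) (inside  ∷ q) =
    trans (cong suc (∣∪∣+∣∩∣ p q)) (sym (+-suc _ _))
  ∣∪∣+∣∩∣ (outside ∷ p) (outside ∷ q) = ∣∪∣+∣∩∣ p q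

  ∣disjoint∣ : ∀ {p q t : Subset n} → Empty (p ∩ q) → p ⊆ t → q ⊆ t →
               ∣ p ∣ + ∣ q ∣ ≤ ∣ t ∣
  ∣disjoint∣ {n = n} {p} {q} {t} e f g = begin
    ∣ p ∣ + ∣ q ∣          ≡⟨ ∣∪∣+∣∩∣ p q ⟨
    ∣ p ∪ q ∣ + ∣ p ∩ q ∣  ≡⟨ cong (λ u → ∣ p ∪ q ∣ + ∣ u ∣) (Empty-unique e) ⟩
    ∣ p ∪ q ∣ + ∣ ⊥ {n} ∣  ≡⟨ cong (∣ p ∪ q ∣ +_) (∣⊥∣≡0 n) ⟩
    ∣ p ∪ q ∣ + 0          ≡⟨ +-identityʳ _ ⟩
    ∣ p ∪ q ∣              ≤⟨ p⊆q⇒∣p∣≤∣q∣ (∪-lub f g) ⟩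
    ∣ t ∣                  ∎
    where open ≤-Reasoning

  ∣─∣ : ∀ (p t : Subset n) → p ⊆ t → ∣ p ∣ + ∣ t ─ p ∣ ≤ ∣ t ∣
  ∣─∣ p t p⊆t = ∣disjoint∣ empty p⊆t (p─q⊆p t p)
    where
    empty : Empty (p ∩ (t ─ p))
    empty (x , x∈) with x∈p∩q⁻ p (t ─ p) x∈
    ... | x∈p , x∈─ = ─⁻ t p x∈─ x∈p

  ∑-mono : (f g : Fin s → ℕ) → (∀ i → f i ≤ g i) →
           ∑[ i < s ] f i ≤ ∑[ i < s ] g i
  ∑-mono {zero}  f g h = z≤n
  ∑-mono {suc s} f g h = +-mono-≤ (h zero) (∑-mono (f ∘ suc) (g ∘ suc) (h ∘ suc))

  ∑-disjoint : (B : Fin s → Subset n) (t : Subset n) →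
               (∀ i j → i ≢ j → Empty (B i ∩ B j)) → (∀ i → B i ⊆ t) →
               ∑[ i < s ] ∣ B i ∣ ≤ ∣ t ∣
  ∑-disjoint {zero}  B t disj sub = z≤n
  ∑-disjoint {suc s} B t disj sub = ≤-trans
    (+-monoʳ-≤ ∣ B zero ∣
      (∑-disjoint (B ∘ suc) (t ─ B zero)
        (λ i j i≢j → disj (suc i) (suc j) (i≢j ∘ Fin.suc-injective))
        (λ i {x} x∈ → x∈p∧x∉q⇒x∈p─q (sub (suc i) x∈)
          (λ x∈₀ → disj zero (suc i) (λ ()) (x , x∈p∩q⁺ (x∈₀ , x∈))))))
    (∣─∣ (B zero) t (sub zero))

  ∸-submodular : ∀ {a b c d} t → t ≤ a → t ≤ b → t ≤ c → t ≤ d →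
                 a + b ≤ c + d → (a ∸ t) + (b ∸ t) ≤ (c ∸ t) + (d ∸ t)
  ∸-submodular {a} {b} {c} {d} t ta tb tc td h = +-cancelʳ-≤ (t + t) _ _
    (subst₂ _≤_ (restore ta tb) (restore tc td) h)
    where
    restore : ∀ {u v} → t ≤ u → t ≤ v → u + v ≡ (u ∸ t) + (v ∸ t) + (t + t)
    restore {u} {v} tu tv = trans
      (cong₂ _+_ (sym (m∸n+n≡m tu)) (sym (m∸n+n≡m tv)))
      (interchange +-commutativeSemigroup (u ∸ t) t (v ∸ t) t)

------------------------------------------------------------------------
-- Matroids

-- A finite matroid given by its rank function.  The ground set E is a
-- subset of an ambient Fin n, so that minors live in the same ambient
-- type; the values of r outside the subsets of E carry no meaning.

record Matroid (n : ℕ) : Set where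
  field
    E : Subset n
    r : Subset n → ℕ
    r-bounded    : ∀ {X} → X ⊆ E → r X ≤ ∣ X ∣
    r-monotone   : ∀ {X Y} → X ⊆ Y → Y ⊆ E → r X ≤ r Y
    r-submodular : ∀ {X Y} → X ⊆ E → Y ⊆ E → r (X ∪ Y) + r (X ∩ Y) ≤ r X + r Y

  rank : ℕ
  rank = r E

open Matroid public

private

  r-∪ : ∀ (M : Matroid n) {X Y} → X ⊆ E M → Y ⊆ E M → r M (X ∪ Y) ≤ r M X + r M Y
  r-∪ M X⊆ Y⊆ = ≤-trans (m≤m+n _ _) (r-submodular M X⊆ Y⊆)

  r-split : ∀ (M : Matroid n) {X Z} → X ⊆ E M → Z ⊆ E M →
            r M Z ≤ ∣ X ∣ + r M (Z ─ X)
  r-split M {X} {Z} X⊆ Z⊆ = ≤-trans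
    (r-monotone M (⊆-split Z X) (∪-lub X⊆ Z─X⊆))
    (≤-trans (r-∪ M X⊆ Z─X⊆) (+-monoˡ-≤ _ (r-bounded M X⊆)))
    where
    Z─X⊆ : Z ─ X ⊆ E M
    Z─X⊆ = Z⊆ ∘ p─q⊆p Z X

-- Equality and isomorphism of matroids.

infix 4 _≐_ _≅_

_≐_ : Matroid n → Matroid n → Set
M ≐ N = E M ≡ E N × (∀ X → X ⊆ E M → r M X ≡ r N X)

Element : Matroid n → Set
Element M = ∃ (_∈ E M)

-- The hypothesis relating X and Y says that Y is the image of X.

_≅_ : Matroid m → Matroid n → Set
M ≅ N = Σ (Element M ↔ Element N) λ φ →
  ∀ X Y → X ⊆ E M → Y ⊆ E N →
  (∀ (e : Element M) → proj₁ e ∈ X ⇔ proj₁ (Inverse.to φ e) ∈ Y) →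
  r M X ≡ r N Y

------------------------------------------------------------------------
-- Restriction, deletion, contraction, duality and direct sums

infixl 8 _↾_ _∖_ _/_
infix  9 _*

-- Intersecting with E M makes restriction and contraction total in X;
-- they are only meant for X ⊆ E M.

_↾_ : Matroid n → Subset n → Matroid n
M ↾ X = record
  { E            = E M ∩ X
  ; r            = r M
  ; r-bounded    = λ Y⊆ → r-bounded M (p∩q⊆p (E M) X ∘ Y⊆)
  ; r-monotone   = λ Y⊆Z Z⊆ → r-monotone M Y⊆Z (p∩q⊆p (E M) X ∘ Z⊆)
  ; r-submodular = λ Y⊆ Z⊆ →
      r-submodular M (p∩q⊆p (E M) X ∘ Y⊆) (p∩q⊆p (E M) X ∘ Z⊆)
  }

_∖_ : Matroid n → Subset n → Matroid n
M ∖ X = M ↾ (E M ─ X)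

_/_ : Matroid n → Subset n → Matroid n
M / X = record
  { E            = E M ─ X
  ; r            = λ Y → r M (Y ∪ T) ∸ r M T
  ; r-bounded    = λ {Y} Y⊆ → ≤-trans
      (∸-monoˡ-≤ (r M T) (r-∪ M (lower Y⊆) T⊆))
      (≤-trans (≤-reflexive (m+n∸n≡m (r M Y) (r M T))) (r-bounded M (lower Y⊆)))
  ; r-monotone   = λ Y⊆Z Z⊆ →
      ∸-monoˡ-≤ (r M T) (r-monotone M (∪-mono Y⊆Z ⊆-refl) (with-T Z⊆))
  ; r-submodular = λ {Y} {Z} Y⊆ Z⊆ →
      ∸-submodular (r M T)
        (above (∪-lub Y⊆ Z⊆)) (above (Y⊆ ∘ p∩q⊆p Y Z)) (above Y⊆) (above Z⊆)
        (≤-trans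
          (+-mono-≤
            (r-monotone M
              (∪-lub (∪-mono (p⊆p∪q T) (p⊆p∪q T))
                     (p⊆p∪q (Z ∪ T) ∘ q⊆p∪q Y T))
              (∪-lub (with-T Y⊆) (with-T Z⊆)))
            (r-monotone M
              (∪-lub (∩-mono (p⊆p∪q T) (p⊆p∪q T))
                     (λ x∈ → x∈p∩q⁺ (q⊆p∪q Y T x∈ , q⊆p∪q Z T x∈)))
              (with-T Y⊆ ∘ p∩q⊆p (Y ∪ T) (Z ∪ T))))
          (r-submodular M (with-T Y⊆) (with-T Z⊆)))
  }
  where
  T : Subset _
  T = E M ∩ X

  T⊆ : T ⊆ E M
  T⊆ = p∩q⊆p (E M) X

  lower : ∀ {Y} → Y ⊆ E M ─ X → Y ⊆ E M
  lower Y⊆ = p─q⊆p (E M) X ∘ Y⊆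

  with-T : ∀ {Y} → Y ⊆ E M ─ X → Y ∪ T ⊆ E M
  with-T Y⊆ = ∪-lub (lower Y⊆) T⊆

  above : ∀ {Y} → Y ⊆ E M ─ X → r M T ≤ r M (Y ∪ T)
  above {Y} Y⊆ = r-monotone M (q⊆p∪q Y T) (with-T Y⊆)

_* : Matroid n → Matroid n
M * = record
  { E            = E M
  ; r            = λ X → (∣ X ∣ + r M (E M ─ X)) ∸ rank M
  ; r-bounded    = λ {X} X⊆ → ≤-trans
      (∸-monoˡ-≤ (rank M) (+-monoʳ-≤ ∣ X ∣ (r-monotone M (p─q⊆p (E M) X) ⊆-refl)))
      (≤-reflexive (m+n∸n≡m ∣ X ∣ (rank M)))
  ; r-monotone   = λ X⊆Y Y⊆ → ∸-monoˡ-≤ (rank M) (mono X⊆Y Y⊆)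
  ; r-submodular = λ {X} {Y} X⊆ Y⊆ →
      ∸-submodular (rank M)
        (above (∪-lub X⊆ Y⊆)) (above (X⊆ ∘ p∩q⊆p X Y)) (above X⊆) (above Y⊆)
        (submod X Y)
  }
  where
  mono : ∀ {X Y} → X ⊆ Y → Y ⊆ E M →
         ∣ X ∣ + r M (E M ─ X) ≤ ∣ Y ∣ + r M (E M ─ Y)
  mono {X} {Y} X⊆Y Y⊆ = begin
    ∣ X ∣ + r M (E M ─ X)
      ≤⟨ +-monoʳ-≤ ∣ X ∣ (r-split M (Y⊆ ∘ p─q⊆p Y X) (p─q⊆p (E M) X)) ⟩
    ∣ X ∣ + (∣ Y ─ X ∣ + r M (E M ─ X ─ (Y ─ X)))
      ≤⟨ +-monoʳ-≤ ∣ X ∣ (+-monoʳ-≤ ∣ Y ─ X ∣ (r-monotone M inner (p─q⊆p (E M) Y))) ⟩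
    ∣ X ∣ + (∣ Y ─ X ∣ + r M (E M ─ Y))
      ≡⟨ +-assoc ∣ X ∣ _ _ ⟨
    ∣ X ∣ + ∣ Y ─ X ∣ + r M (E M ─ Y)
      ≤⟨ +-monoˡ-≤ _ (∣─∣ X Y X⊆Y) ⟩
    ∣ Y ∣ + r M (E M ─ Y) ∎
    where
    open ≤-Reasoning
    inner : E M ─ X ─ (Y ─ X) ⊆ E M ─ Y
    inner {x} x∈ = x∈p∧x∉q⇒x∈p─q (p─q⊆p (E M) X x∈′)
      (λ x∈Y → ─⁻ (E M ─ X) (Y ─ X) x∈ (x∈p∧x∉q⇒x∈p─q x∈Y (─⁻ (E M) X x∈′)))
      where
      x∈′ : x ∈ E M ─ X
      x∈′ = p─q⊆p (E M ─ X) (Y ─ X) x∈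

  above : ∀ {X} → X ⊆ E M → rank M ≤ ∣ X ∣ + r M (E M ─ X)
  above X⊆ = r-split M X⊆ ⊆-refl

  submod : ∀ X Y →
           (∣ X ∪ Y ∣ + r M (E M ─ (X ∪ Y))) + (∣ X ∩ Y ∣ + r M (E M ─ (X ∩ Y)))
           ≤ (∣ X ∣ + r M (E M ─ X)) + (∣ Y ∣ + r M (E M ─ Y))
  submod X Y = begin
    (∣ X ∪ Y ∣ + r M (E M ─ (X ∪ Y))) + (∣ X ∩ Y ∣ + r M (E M ─ (X ∩ Y)))
      ≡⟨ interchange +-commutativeSemigroup ∣ X ∪ Y ∣ _ _ _ ⟩
    (∣ X ∪ Y ∣ + ∣ X ∩ Y ∣) + (r M (E M ─ (X ∪ Y)) + r M (E M ─ (X ∩ Y)))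
      ≤⟨ +-mono-≤ (≤-reflexive (∣∪∣+∣∩∣ X Y)) ranks ⟩
    (∣ X ∣ + ∣ Y ∣) + (r M (E M ─ X) + r M (E M ─ Y))
      ≡⟨ interchange +-commutativeSemigroup ∣ X ∣ _ _ _ ⟩
    (∣ X ∣ + r M (E M ─ X)) + (∣ Y ∣ + r M (E M ─ Y)) ∎
    where
    open ≤-Reasoning
    meet : E M ─ (X ∪ Y) ⊆ (E M ─ X) ∩ (E M ─ Y)
    meet x∈ = x∈p∩q⁺
      ( x∈p∧x∉q⇒x∈p─q x∈E (x∉ ∘ p⊆p∪q Y)
      , x∈p∧x∉q⇒x∈p─q x∈E (x∉ ∘ q⊆p∪q X Y))
      where
      x∈E = p─q⊆p (E M) (X ∪ Y) x∈
      x∉  = ─⁻ (E M) (X ∪ Y) x∈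
    join : E M ─ (X ∩ Y) ⊆ (E M ─ X) ∪ (E M ─ Y)
    join {x} x∈ with x ∈? X
    ... | no  x∉X = x∈p∪q⁺ (inj₁ (x∈p∧x∉q⇒x∈p─q (p─q⊆p (E M) (X ∩ Y) x∈) x∉X))
    ... | yes x∈X = x∈p∪q⁺ (inj₂ (x∈p∧x∉q⇒x∈p─q (p─q⊆p (E M) (X ∩ Y) x∈)
      (λ x∈Y → ─⁻ (E M) (X ∩ Y) x∈ (x∈p∩q⁺ (x∈X , x∈Y)))))
    ranks : r M (E M ─ (X ∪ Y)) + r M (E M ─ (X ∩ Y))
            ≤ r M (E M ─ X) + r M (E M ─ Y)
    ranks = ≤-trans
      (≤-trans
        (+-mono-≤
          (r-monotone M meet (p─q⊆p (E M) X ∘ p∩q⊆p _ _))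
          (r-monotone M join (∪-lub (p─q⊆p (E M) X) (p─q⊆p (E M) Y))))
        (≤-reflexive (+-comm (r M ((E M ─ X) ∩ (E M ─ Y))) _)))
      (r-submodular M (p─q⊆p (E M) X) (p─q⊆p (E M) Y))

PairwiseDisjoint : (Fin s → Subset n) → Set
PairwiseDisjoint X = ∀ i j → i ≢ j → Empty (X i ∩ X j)

⋃ᶠ : (Fin s → Subset n) → Subset n
⋃ᶠ X = ⋃ (List.tabulate X)

⨁ : (Ms : Fin s → Matroid n) → PairwiseDisjoint (E ∘ Ms) → Matroid n
⨁ {s = s} Ms disj = record
  { E            = ⋃ᶠ (E ∘ Ms)
  ; r            = λ X → ∑[ i < s ] r (Ms i) (X ∩ E (Ms i))
  ; r-bounded    = λ {X} _ → ≤-trans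
      (∑-mono _ _ (λ i → r-bounded (Ms i) (p∩q⊆q X (E (Ms i)))))
      (∑-disjoint (λ i → X ∩ E (Ms i)) X
        (λ i j i≢j (x , x∈) → disj i j i≢j
          (x , ∩-mono (p∩q⊆q X (E (Ms i))) (p∩q⊆q X (E (Ms j))) x∈))
        (λ i → p∩q⊆p X (E (Ms i))))
  ; r-monotone   = λ {X} {Y} X⊆Y _ → ∑-mono _ _
      (λ i → r-monotone (Ms i) (∩-mono X⊆Y ⊆-refl) (p∩q⊆q Y (E (Ms i))))
  ; r-submodular = λ {X} {Y} _ _ → subst₂ _≤_
      (∑-distrib-+ (λ i → r (Ms i) ((X ∪ Y) ∩ E (Ms i)))
                   (λ i → r (Ms i) ((X ∩ Y) ∩ E (Ms i))))
      (∑-distrib-+ (λ i → r (Ms i) (X ∩ E (Ms i)))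
                   (λ i → r (Ms i) (Y ∩ E (Ms i))))
      (∑-mono _ _ (λ i → summand i X Y))
  }
  where
  summand : ∀ i X Y →
            r (Ms i) ((X ∪ Y) ∩ E (Ms i)) + r (Ms i) ((X ∩ Y) ∩ E (Ms i))
            ≤ r (Ms i) (X ∩ E (Ms i)) + r (Ms i) (Y ∩ E (Ms i))
  summand i X Y = ≤-trans
    (+-mono-≤
      (r-monotone (Ms i) distrib (∪-lub (p∩q⊆q X F) (p∩q⊆q Y F)))
      (r-monotone (Ms i)
        (λ x∈ → let x∈∩ , x∈F = x∈p∩q⁻ (X ∩ Y) F x∈
                    x∈X , x∈Y = x∈p∩q⁻ X Y x∈∩
                in x∈p∩q⁺ (x∈p∩q⁺ (x∈X , x∈F) , x∈p∩q⁺ (x∈Y , x∈F)))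
        (p∩q⊆q X F ∘ p∩q⊆p (X ∩ F) (Y ∩ F))))
    (r-submodular (Ms i) (p∩q⊆q X F) (p∩q⊆q Y F))
    where
    F : Subset _
    F = E (Ms i)
    distrib : (X ∪ Y) ∩ F ⊆ (X ∩ F) ∪ (Y ∩ F)
    distrib x∈ with x∈p∩q⁻ (X ∪ Y) F x∈
    ... | x∈∪ , x∈F with x∈p∪q⁻ X Y x∈∪
    ... | inj₁ x∈X = x∈p∪q⁺ (inj₁ (x∈p∩q⁺ (x∈X , x∈F)))
    ... | inj₂ x∈Y = x∈p∪q⁺ (inj₂ (x∈p∩q⁺ (x∈Y , x∈F)))

-- "M has an N-minor": some minor of M is isomorphic to N.

HasMinor : Matroid m → Matroid n → Set
HasMinor M N = ∃₂ λ C D →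
  C ⊆ E M × D ⊆ E M × Empty (C ∩ D) × (M / C ∖ D) ≅ N

------------------------------------------------------------------------
-- Circuits, cocircuits and simplification

Independent : Matroid n → Subset n → Set
Independent M X = X ⊆ E M × r M X ≡ ∣ X ∣

Dependent : Matroid n → Subset n → Set
Dependent M X = X ⊆ E M × r M X < ∣ X ∣

Circuit : Matroid n → Subset n → Set
Circuit M C = Dependent M C × (∀ D → D ⊂ C → Independent M D)

Cocircuit : Matroid n → Subset n → Set
Cocircuit M = Circuit (M *)

Loop : Matroid n → Fin n → Set
Loop M e = Circuit M ⁅ e ⁆

Parallel : Matroid n → Fin n → Fin n → Set
Parallel M e f = e ≢ f × Circuit M (⁅ e ⁆ ∪ ⁅ f ⁆)

Simple : Matroid n → Set
Simple M = (∀ e → ¬ Loop M e) × (∀ e f → ¬ Parallel M e f)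

circuit? : (M : Matroid n) (C : Subset n) → Dec (Circuit M C)
circuit? M C = ((C ⊆? E M) ×-dec (r M C <? ∣ C ∣)) ×-dec minimal?
  where
  independent? : ∀ D → Dec (Independent M D)
  independent? D = (D ⊆? E M) ×-dec (r M D ≟ ∣ D ∣)

  minimal? : Dec (∀ D → D ⊂ C → Independent M D)
  minimal? = map′
    (λ none D D⊂C → decidable-stable (independent? D) (λ ¬i → none (D , D⊂C , ¬i)))
    (λ all (D , D⊂C , ¬i) → ¬i (all D D⊂C))
    (¬? (anySubset? (λ D → (D ⊂? C) ×-dec ¬? (independent? D))))

-- The simplification keeps the least element of each parallel class of
-- non-loops; any other choice of representatives gives an isomorphic
-- matroid.

Representative : Matroid n → Fin n → Set
Representative M e =
  e ∈ E M × ¬ Loop M e × ¬ (∃ λ f → f Fin.< e × Parallel M f e)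

representative? : (M : Matroid n) (e : Fin n) → Dec (Representative M e)
representative? M e = (e ∈? E M) ×-dec (¬? (circuit? M ⁅ e ⁆) ×-dec
  ¬? (Fin.any? (λ f →
    (f Fin.<? e) ×-dec (¬? (f Fin.≟ e) ×-dec circuit? M (⁅ f ⁆ ∪ ⁅ e ⁆)))))

si : Matroid n → Matroid n
si M = M ↾ Vec.tabulate (λ e → does (representative? M e))

------------------------------------------------------------------------
-- Connectivity

-- (X , E M ─ X) is a k-separation; the last condition is
-- r(X) + r(E − X) − r(M) < k.

Separation : Matroid n → ℕ → Subset n → Set
Separation M k X =
  X ⊆ E M × k ≤ ∣ X ∣ × k ≤ ∣ E M ─ X ∣ ×
  r M X + r M (E M ─ X) < rank M + k

ThreeConnected : Matroid n → Set
ThreeConnected M = ∀ k → 1 ≤ k → k < 3 → ¬ ∃ (Separation M k)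

------------------------------------------------------------------------
-- Vertically N-contractible sets, caramboles, filaments, free families

VerticallyContractible : Matroid m → Matroid n → Subset m → Set
VerticallyContractible M N X =
  X ⊆ E M × ThreeConnected (si (M / X)) × HasMinor (si (M / X)) N

Line : Matroid n → Subset n → Set
Line M L = L ⊆ E M × r M L ≡ 2

filament : (Fin s → Fin n) → Subset n
filament y = ⋃ᶠ (λ i → ⁅ y i ⁆)

record IsCarambole (M : Matroid m) (N : Matroid n)
                   (x y : Fin s → Fin m) : Set where
  field
    3≤s          : 3 ≤ s
    x∈E          : ∀ i → x i ∈ E M
    y∈E          : ∀ i → y i ∈ E M
    y-distinct   : Injective _≡_ _≡_ y
    line         : Line M (filament y)
    contractible : VerticallyContractible M N (filament y)
    cocircuit    : ∀ i → Cocircuit M ((filament y - y i) ∪ ⁅ x i ⁆)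

IsFilament : Matroid m → Matroid n → Subset m → Set
IsFilament {m} M N L = ∃ λ s → ∃₂ λ (x y : Fin s → Fin m) →
  IsCarambole M N x y × L ≡ filament y

-- The direct sum is only defined for pairwise disjoint ground sets, so
-- disjointness of the members is part of freeness.

Free : Matroid n → (Fin s → Subset n) → Set
Free M X = (∀ i → X i ⊆ E M) ×
  Σ (PairwiseDisjoint (λ i → E (M ↾ X i))) λ disj →
    M ↾ ⋃ᶠ X ≐ ⨁ (λ i → M ↾ X i) disj

{-# OPTIONS --safe #-}
-- A point of M that is not vertically contractible while keeping a copy of
-- N lies on the guts of a vertical 3-separation, one side of which contains
-- at most one element of the copy. Uncrossing two such separations of least
-- rank leaves only planes, and two crossing planes force either a line l all
-- of whose sets l − z extend by a contractible point to a cocircuit (the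
-- filament of a carambole) or one exceptional configuration around a
-- contractible point, called Alpha below.
--
-- A maximal free family of a contractible points and q filaments spans all
-- contractible points and filaments up to exchanges. The Alpha points
-- outside its span S form a chain; its length τ and q are bounded against
-- each other by submodularity, applied to S plus a chain prefix and to the
-- complement of S plus the lines used so far. Since S and the chain span
-- the contracted flat, k ≤ a + 2q + τ, whence k + 2 ≤ 2 (a + q).
--
-- The combinatorics runs under double negation; being contractible, being a
-- filament and being free are decided by finite search, so that the
-- witnesses are recovered at the end.

module Submission where

open import Data.Bool.Base using (Bool; true; false; _∧_; _∨_; not; T; if_then_else_)
import Data.Bool.Properties as Bool
open import Data.Empty using (⊥; ⊥-elim)
open import Data.Fin.Base as Fin using (Fin)
import Data.Fin.Properties as Fin
open import Data.Fin.Subset using (Subset; _─_; ∣_∣; ⁅_⁆)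
import Data.Fin.Subset as S
import Data.Fin.Subset.Properties as S
open import Data.List.Base as List using (List; []; _∷_; length)
open import Data.List.Membership.Propositional using () renaming (_∈_ to _∈ₗ_)
open import Data.List.Membership.Propositional.Properties using (∈-allFin)
open import Data.List.Relation.Unary.All using (All; []; _∷_)
open import Data.List.Relation.Unary.Any using (here; there)
open import Data.Nat.Base using (ℕ; zero; suc; _+_; _*_; _∸_; _≤_; _<_; _≤ᵇ_; z≤n; s≤s; ⌈_/2⌉)
open import Data.Nat.Properties
open import Algebra.Properties.CommutativeMonoid.Sum +-0-commutativeMonoid using (sum-syntax)
open import Data.Product.Base using (Σ; ∃; ∃₂; _×_; _,_; _,′_; proj₁; proj₂)
open import Data.Sum.Base using (_⊎_; inj₁; inj₂; [_,_]′)
open import Data.Unit.Base using (⊤; tt)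
open import Data.Vec.Base as Vec using (Vec; []; _∷_; lookup; tabulate)
open import Data.Vec.Properties using ([]=⇒lookup; lookup⇒[]=; lookup∘tabulate) renaming (≡-dec to Vec-≡-dec)
open import Data.Vec.Properties.WithK using ([]=-irrelevant)
open import Function.Base using (_∘_; id; _$_; case_of_)
open import Function.Bundles using (_⇔_; mk⇔; mk↔ₛ′; module Inverse; module Equivalence)
open import Function.Definitions using (Injective)
open import Relation.Binary.Definitions using (DecidableEquality; tri<; tri≈; tri>)
open import Relation.Binary.PropositionalEquality
open import Relation.Nullary
open import Relation.Nullary.Decidable using (decidable-stable; dec-true; map′; _×-dec_; _⊎-dec_; _→-dec_; ¬?)
open import Relation.Unary using (Decidable)

-- A vertical 3-separation at `y` is kept as a cover by two non-spanning flats through `y` whose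
-- ranks sum to `ρ + 2`. Covers, unlike partitions, allow overlaps and closures, so uncrossing is
-- plain submodularity, and simplification enters only where the definitions demand it.
--
-- A chosen point adds 1 to the rank of the family and a filament 2, so with `k ≤ a + 2q + τ` the
-- bound `k + 2 ≤ 2 (a + q)` needs `a ≥ τ + 2`. For `τ > 0` the contractible points attached to the
-- last Alpha point force this. For `τ = 0` it fails only if `a ≤ 1`, and then `q ≥ 1` since
-- `k ≥ 2`; the chosen points are given up and one filament is exchanged for three of its tips, the
-- points that complete its cocircuits.
--
-- Which side of a separation is small is settled by counting: two small sides leave two elements of
-- the copy elsewhere, provided that `N` has four. If `N` has at most three elements, its rank is at
-- most 2, and a copy can be found after contracting any set whose contraction is vertically
-- 3-connected of rank at least that of `N`; a trivial notion of copy then serves during the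
-- combinatorics.

private
  variable
    P : Set

-- Sets of points as Boolean predicates

record Sub (P : Set) : Set where
  no-eta-equality
  constructor sub
  field
    mem : P → Bool
open Sub public

infix  4 _⊆_ _∈_ _∉_
infixr 7 _∩_
infixr 6 _∪_

-- Wrapping the pointwise implication in a record keeps both sets readable from the type of an
-- inclusion.
record _⊆_ {P : Set} (X Y : Sub P) : Set where
  constructor incl
  field
    at : ∀ z → T (mem X z) → T (mem Y z)
open _⊆_ public

_∪_ _∩_ : Sub P → Sub P → Sub P
mem (X ∪ Y) z = mem X z ∨ mem Y z
mem (X ∩ Y) z = mem X z ∧ mem Y z

∁ : Sub P → Sub P
mem (∁ X) z = not (mem X z)

∅ 𝕌 : Sub P
mem ∅ z = false
mem 𝕌 z = true

record DecEq (P : Set) : Set where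
  constructor deceq
  field
    _≟ᵖ_ : DecidableEquality P
open DecEq ⦃ ... ⦄ public

⟨_⟩ : ⦃ DecEq P ⦄ → P → Sub P
mem ⟨ y ⟩ z = does (y ≟ᵖ z)

-- Membership is inclusion of a singleton, and non-membership is inclusion in the complement, so
-- that `sets` treats points and sets alike.
_∈_ _∉_ : ⦃ DecEq P ⦄ → P → Sub P → Set
z ∈ X = ⟨ z ⟩ ⊆ X
z ∉ X = ⟨ z ⟩ ⊆ ∁ X

-- Boolean inclusions between sets are decided pointwise by truth tables.

infixr 7 _⊓_
infixr 6 _⊔_
infix  4 _⊑_
infixr 3 _⇛_
infix  3 ⊢_

data SetExp : Set where
  svar    : ℕ → SetExp
  _⊔_ _⊓_ : SetExp → SetExp → SetExp
  ∼_      : SetExp → SetExp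
  𝟘 𝟙     : SetExp

data Inclusion : Set where
  _⊑_ : SetExp → SetExp → Inclusion

data SetSequent : Set where
  ⊢_  : Inclusion → SetSequent
  _⇛_ : Inclusion → SetSequent → SetSequent

nth : {A : Set} → A → List A → ℕ → A
nth d []       i       = d
nth d (x ∷ xs) zero    = x
nth d (x ∷ xs) (suc i) = nth d xs i

⟦_⟧ˢ : SetExp → List (Sub P) → Sub P
⟦ svar i ⟧ˢ Γ = nth ∅ Γ i
⟦ a ⊔ b ⟧ˢ Γ = ⟦ a ⟧ˢ Γ ∪ ⟦ b ⟧ˢ Γ
⟦ a ⊓ b ⟧ˢ Γ = ⟦ a ⟧ˢ Γ ∩ ⟦ b ⟧ˢ Γ
⟦ ∼ a ⟧ˢ Γ = ∁ (⟦ a ⟧ˢ Γ)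
⟦ 𝟘 ⟧ˢ Γ = ∅
⟦ 𝟙 ⟧ˢ Γ = 𝕌

⟦_⟧ⁱ : SetSequent → List (Sub P) → Set
⟦ ⊢ (a ⊑ b) ⟧ⁱ Γ = ⟦ a ⟧ˢ Γ ⊆ ⟦ b ⟧ˢ Γ
⟦ (a ⊑ b) ⇛ s ⟧ⁱ Γ = ⟦ a ⟧ˢ Γ ⊆ ⟦ b ⟧ˢ Γ → ⟦ s ⟧ⁱ Γ

bool : SetExp → List Bool → Bool
bool (svar i) Γ = nth false Γ i
bool (a ⊔ b) Γ = bool a Γ ∨ bool b Γ
bool (a ⊓ b) Γ = bool a Γ ∧ bool b Γ
bool (∼ a) Γ = not (bool a Γ)
bool 𝟘 Γ = false
bool 𝟙 Γ = true

-- One row of a truth table: hypotheses and conclusion are tested at the same point. That a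
-- singleton has a single element is invisible here; such facts go through `_∈?_` and `same`.
holds : SetSequent → List Bool → Bool
holds (⊢ (a ⊑ b)) Γ = if bool a Γ then bool b Γ else true
holds ((a ⊑ b) ⇛ s) Γ =
  if (if bool a Γ then bool b Γ else true) then holds s Γ else true

tautology : ℕ → (List Bool → Bool) → Bool
tautology zero    f = f []
tautology (suc n) f =
  tautology n (λ Γ → f (true ∷ Γ)) ∧ tautology n (λ Γ → f (false ∷ Γ))

point : P → List (Sub P) → List Bool
point z = List.map (λ X → mem X z)

T-∧ : ∀ {a b} → T (a ∧ b) → T a × T b
T-∧ {true} t = tt , t

tautology-sound : ∀ (Γ : List (Sub P)) f → T (tautology (List.length Γ) f) →
                  ∀ z → T (f (point z Γ))
tautology-sound []      f t z = t
tautology-sound (X ∷ Γ) f t z with mem X z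
... | true  = tautology-sound Γ _ (proj₁ (T-∧ t)) z
... | false = tautology-sound Γ _
  (proj₂ (T-∧ {tautology (List.length Γ) (λ Γ → f (true ∷ Γ))} t)) z

mem-bool : ∀ e (Γ : List (Sub P)) z → mem (⟦ e ⟧ˢ Γ) z ≡ bool e (point z Γ)
mem-bool (svar i) Γ z = go Γ i
  where
  go : ∀ Γ i → mem (nth ∅ Γ i) z ≡ nth false (point z Γ) i
  go []      i       = refl
  go (X ∷ Γ) zero    = refl
  go (X ∷ Γ) (suc i) = go Γ i
mem-bool (a ⊔ b) Γ z = cong₂ _∨_ (mem-bool a Γ z) (mem-bool b Γ z)
mem-bool (a ⊓ b) Γ z = cong₂ _∧_ (mem-bool a Γ z) (mem-bool b Γ z)
mem-bool (∼ a) Γ z = cong not (mem-bool a Γ z)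
mem-bool 𝟘 Γ z = refl
mem-bool 𝟙 Γ z = refl

sequent-sound : ∀ s (Γ : List (Sub P)) → (∀ z → T (holds s (point z Γ))) → ⟦ s ⟧ⁱ Γ
sequent-sound (⊢ (a ⊑ b)) Γ h = incl λ z za → subst T (sym (mem-bool b Γ z))
  (use (bool a (point z Γ)) (h z) (subst T (mem-bool a Γ z) za))
  where
  use : ∀ c {d} → T (if c then d else true) → T c → T d
  use true t _ = t
sequent-sound ((a ⊑ b) ⇛ s) Γ h i = sequent-sound s Γ λ z →
  use (bool a (point z Γ)) (h z)
    (λ ta → subst T (mem-bool b Γ z) (at i z (subst T (sym (mem-bool a Γ z)) ta)))
  where
  use : ∀ c {d e} → T (if (if c then d else true) then e else true) → (T c → T d) → T e
  use true {true} t _ = t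
  use true {false} t f = ⊥-elim (f tt)
  use false t _ = t

SetSequentⁿ : ℕ → Set
SetSequentⁿ zero    = SetSequent
SetSequentⁿ (suc n) = SetExp → SetSequentⁿ n

closeˢ : ∀ n → SetSequentⁿ n → SetSequent
closeˢ zero    s = s
closeˢ (suc n) f = closeˢ n (f (svar n))

∀ˢ : {P : Set} → ℕ → SetSequent → List (Sub P) → Set
∀ˢ zero    s Γ = ⟦ s ⟧ⁱ Γ
∀ˢ {P} (suc n) s Γ = (X : Sub P) → ∀ˢ n s (X ∷ Γ)

-- The instances of the set variables and the proofs of the hypotheses of
-- the sequent f follow as further arguments; likewise for linear below.
sets : ∀ n (f : SetSequentⁿ n) {_ : T (tautology n (holds (closeˢ n f)))} →
       ∀ˢ {P} n (closeˢ n f) []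
sets n f {t} = go n [] (subst (λ k → T (tautology k (holds (closeˢ n f)))) (sym (+-identityʳ n)) t)
  where
  go : ∀ k Γ → T (tautology (k + List.length Γ) (holds (closeˢ n f))) →
       ∀ˢ k (closeˢ n f) Γ
  go zero    Γ t = sequent-sound (closeˢ n f) Γ (tautology-sound Γ _ t)
  go (suc k) Γ t X = go k (X ∷ Γ)
    (subst (λ j → T (tautology j (holds (closeˢ n f)))) (sym (+-suc k _)) t)

-- Linear inequalities over ℕ: a sequent is valid if the sum of its
-- hypotheses yields the conclusion after cancellation.

infixl 6 _⊕_
infix  4 _≼_
infixr 3 _⇒_
infix  3 ⊩_

data LinExp : Set where
  lvar : ℕ → LinExp
  _⊕_  : LinExp → LinExp → LinExp
  ↑_   : LinExp → LinExp
  num  : ℕ → LinExp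

data Inequality : Set where
  _≼_ : LinExp → LinExp → Inequality

data LinSequent : Set where
  ⊩_  : Inequality → LinSequent
  ⊩⊥  : LinSequent
  _⇒_ : Inequality → LinSequent → LinSequent

⟦_⟧ˡ : LinExp → List ℕ → ℕ
⟦ lvar i ⟧ˡ Γ = nth 0 Γ i
⟦ a ⊕ b ⟧ˡ Γ = ⟦ a ⟧ˡ Γ + ⟦ b ⟧ˡ Γ
⟦ ↑ a ⟧ˡ Γ = suc (⟦ a ⟧ˡ Γ)
⟦ num k ⟧ˡ Γ = k

⟦_⟧ᵖ : LinSequent → List ℕ → Set
⟦ ⊩ (a ≼ b) ⟧ᵖ Γ = ⟦ a ⟧ˡ Γ ≤ ⟦ b ⟧ˡ Γ
⟦ ⊩⊥ ⟧ᵖ Γ = ⊥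
⟦ (a ≼ b) ⇒ s ⟧ᵖ Γ = ⟦ a ⟧ˡ Γ ≤ ⟦ b ⟧ˡ Γ → ⟦ s ⟧ᵖ Γ

const : LinExp → ℕ
const (lvar i) = 0
const (a ⊕ b) = const a + const b
const (↑ a) = suc (const a)
const (num k) = k

coef : LinExp → ℕ → ℕ
coef (lvar zero)    zero    = 1
coef (lvar zero)    (suc j) = 0
coef (lvar (suc i)) zero    = 0
coef (lvar (suc i)) (suc j) = coef (lvar i) j
coef (a ⊕ b) j = coef a j + coef b j
coef (↑ a) j = coef a j
coef (num k) j = 0

dot : (ℕ → ℕ) → List ℕ → ℕ
dot c []      = 0
dot c (x ∷ Γ) = c 0 * x + dot (c ∘ suc) Γ

dot-zero : ∀ Γ → dot (λ _ → 0) Γ ≡ 0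
dot-zero []      = refl
dot-zero (x ∷ Γ) = dot-zero Γ

dot-var : ∀ i Γ → dot (coef (lvar i)) Γ ≡ nth 0 Γ i
dot-var i       []      = refl
dot-var zero    (x ∷ Γ) = trans (cong₂ _+_ (+-identityʳ x) (dot-zero Γ)) (+-identityʳ x)
dot-var (suc i) (x ∷ Γ) = dot-var i Γ

+-swap₄ : ∀ a b c d → (a + b) + (c + d) ≡ (a + c) + (b + d)
+-swap₄ a b c d = begin
  (a + b) + (c + d)  ≡⟨ +-assoc a b (c + d) ⟩
  a + (b + (c + d))  ≡⟨ cong (a +_) (+-assoc b c d) ⟨
  a + ((b + c) + d)  ≡⟨ cong (λ e → a + (e + d)) (+-comm b c) ⟩
  a + ((c + b) + d)  ≡⟨ cong (a +_) (+-assoc c b d) ⟩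
  a + (c + (b + d))  ≡⟨ +-assoc a c (b + d) ⟨
  (a + c) + (b + d)  ∎
  where open ≡-Reasoning

dot-+ : ∀ c d Γ → dot (λ j → c j + d j) Γ ≡ dot c Γ + dot d Γ
dot-+ c d []      = refl
dot-+ c d (x ∷ Γ) = trans
  (cong₂ _+_ (*-distribʳ-+ x (c 0) (d 0)) (dot-+ (c ∘ suc) (d ∘ suc) Γ))
  (+-swap₄ (c 0 * x) (d 0 * x) _ _)

linear-form : ∀ e Γ → ⟦ e ⟧ˡ Γ ≡ const e + dot (coef e) Γ
linear-form (lvar i) Γ = sym (dot-var i Γ)
linear-form (a ⊕ b) Γ = trans
  (cong₂ _+_ (linear-form a Γ) (linear-form b Γ))
  (trans (+-swap₄ (const a) _ (const b) _)
         (cong (const a + const b +_) (sym (dot-+ (coef a) (coef b) Γ))))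
linear-form (↑ a) Γ = cong suc (linear-form a Γ)
linear-form (num k) Γ = sym (trans (cong (k +_) (dot-zero Γ)) (+-identityʳ k))

coefs≤ : ℕ → (ℕ → ℕ) → (ℕ → ℕ) → Bool
coefs≤ zero    c d = true
coefs≤ (suc n) c d = (c 0 ≤ᵇ d 0) ∧ coefs≤ n (c ∘ suc) (d ∘ suc)

below : ℕ → LinExp → LinExp → Bool
below n a b = (const a ≤ᵇ const b) ∧ coefs≤ n (coef a) (coef b)

dot-mono : ∀ c d Γ → T (coefs≤ (List.length Γ) c d) → dot c Γ ≤ dot d Γ
dot-mono c d []      t = z≤n
dot-mono c d (x ∷ Γ) t = +-mono-≤
  (*-monoˡ-≤ x (≤ᵇ⇒≤ (c 0) (d 0) (proj₁ (T-∧ t))))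
  (dot-mono (c ∘ suc) (d ∘ suc) Γ (proj₂ (T-∧ {c 0 ≤ᵇ d 0} t)))

below-sound : ∀ a b Γ → T (below (List.length Γ) a b) → ⟦ a ⟧ˡ Γ ≤ ⟦ b ⟧ˡ Γ
below-sound a b Γ t = subst₂ _≤_ (sym (linear-form a Γ)) (sym (linear-form b Γ))
  (+-mono-≤ (≤ᵇ⇒≤ (const a) (const b) (proj₁ (T-∧ t)))
            (dot-mono (coef a) (coef b) Γ (proj₂ (T-∧ {const a ≤ᵇ const b} t))))

-- `l` and `r` add up the two sides of the hypotheses read so far. If `a + r ≤ b + l` holds
-- coefficientwise, then `l ≤ r` and cancellation of `r` give `a ≤ b`. Every hypothesis has weight
-- one, so an inequality needed twice is supplied twice.
valid : ℕ → LinSequent → LinExp → LinExp → Bool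
valid n (⊩ (a ≼ b)) l r = below n (a ⊕ r) (b ⊕ l)
valid n ⊩⊥ l r = below n (num 1 ⊕ r) (num 0 ⊕ l)
valid n ((a ≼ b) ⇒ s) l r = valid n s (l ⊕ a) (r ⊕ b)

valid-sound : ∀ s l r Γ → T (valid (List.length Γ) s l r) →
              ⟦ l ⟧ˡ Γ ≤ ⟦ r ⟧ˡ Γ → ⟦ s ⟧ᵖ Γ
valid-sound (⊩ (a ≼ b)) l r Γ t h = +-cancelʳ-≤ (⟦ r ⟧ˡ Γ) _ _
  (≤-trans (below-sound (a ⊕ r) (b ⊕ l) Γ t) (+-monoʳ-≤ (⟦ b ⟧ˡ Γ) h))
valid-sound ⊩⊥ l r Γ t h =
  1+n≰n (≤-trans (below-sound (num 1 ⊕ r) (num 0 ⊕ l) Γ t) h)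
valid-sound ((a ≼ b) ⇒ s) l r Γ t h = λ i →
  valid-sound s (l ⊕ a) (r ⊕ b) Γ t (+-mono-≤ h i)

LinSequentⁿ : ℕ → Set
LinSequentⁿ zero    = LinSequent
LinSequentⁿ (suc n) = LinExp → LinSequentⁿ n

closeˡ : ∀ n → LinSequentⁿ n → LinSequent
closeˡ zero    s = s
closeˡ (suc n) f = closeˡ n (f (lvar n))

∀ˡ : ℕ → LinSequent → List ℕ → Set
∀ˡ zero    s Γ = ⟦ s ⟧ᵖ Γ
∀ˡ (suc n) s Γ = (x : ℕ) → ∀ˡ n s (x ∷ Γ)

linear : ∀ n (f : LinSequentⁿ n) {_ : T (valid n (closeˡ n f) (num 0) (num 0))} →
         ∀ˡ n (closeˡ n f) []
linear n f {t} = go n [] (subst (λ k → T (valid k s (num 0) (num 0))) (sym (+-identityʳ n)) t)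
  where
  s = closeˡ n f
  go : ∀ k Γ → T (valid (k + List.length Γ) s (num 0) (num 0)) → ∀ˡ k s Γ
  go zero    Γ t = valid-sound s (num 0) (num 0) Γ t z≤n
  go (suc k) Γ t x = go k (x ∷ Γ)
    (subst (λ j → T (valid j s (num 0) (num 0))) (sym (+-suc k _)) t)

-- Rank functions and closure

infix 3 ¬¬_

¬¬_ : Set → Set
¬¬ A = (A → ⊥) → ⊥

em : (A : Set) → ¬¬ (A ⊎ ¬ A)
em A k = k (inj₂ (k ∘ inj₁))

≤-by-contra : ∀ {m n} → (suc n ≤ m → ⊥) → m ≤ n
≤-by-contra h = ≮⇒≥ h

≤-or-> : ∀ m n → m ≤ n ⊎ suc n ≤ m
≤-or-> m n with m ≤? n
... | yes h = inj₁ h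
... | no h  = inj₂ (≰⇒> h)

T-not : ∀ {b} → ¬ T b → T (not b)
T-not {true}  n = n tt
T-not {false} n = tt

not-T : ∀ {b} → T (not b) → ¬ T b
not-T {false} _ ()

decT : ∀ b → T b ⊎ ¬ T b
decT true  = inj₁ tt
decT false = inj₂ id

module _ {P : Set} ⦃ _ : DecEq P ⦄ where

  self : ∀ (z : P) → T (mem ⟨ z ⟩ z)
  self z with z ≟ᵖ z
  ... | yes _ = tt
  ... | no n = n refl

  same : ∀ {z y : P} → z ∈ ⟨ y ⟩ → y ≡ z
  same {z} {y} h with y ≟ᵖ z | at h z (self z)
  ... | yes e | _  = e
  ... | no _  | ()

  ∈-intro : ∀ {z} {X : Sub P} → T (mem X z) → z ∈ X
  ∈-intro {z} {X} t = incl λ w tw → go w tw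
    where
    go : ∀ w → T (mem ⟨ z ⟩ w) → T (mem X w)
    go w tw with z ≟ᵖ w
    ... | yes refl = t

  ∈-elim : ∀ {z} {X : Sub P} → z ∈ X → T (mem X z)
  ∈-elim {z} h = at h z (self z)

  _∈?_ : ∀ z (X : Sub P) → z ∈ X ⊎ z ∉ X
  z ∈? X with decT (mem X z)
  ... | inj₁ t = inj₁ (∈-intro t)
  ... | inj₂ n = inj₂ (∈-intro (T-not n))

  nonempty : ∀ {z : P} → ¬ (z ∈ ∅)
  nonempty h = ∈-elim h

  clash : ∀ {X : Sub P} z → z ∈ X → z ∉ X → ⊥
  clash z p q = not-T (∈-elim q) (∈-elim p)

  apart : ∀ {z y : P} → ¬ (z ≡ y) → z ∉ ⟨ y ⟩
  apart {z} {y} n with z ∈? ⟨ y ⟩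
  ... | inj₂ h = h
  ... | inj₁ h = ⊥-elim (n (sym (same h)))

  ⊆-intro : ∀ {X Y : Sub P} → (∀ z → z ∈ X → z ∉ Y → ⊥) → X ⊆ Y
  ⊆-intro {X} {Y} h = incl λ z zx → case decT (mem Y z) of λ where
    (inj₁ t) → t
    (inj₂ n) → ⊥-elim (h z (∈-intro zx) (∈-intro (T-not n)))

  ⊈-witness : ∀ {X Y : Sub P} → ¬ (X ⊆ Y) → ¬¬ (∃ λ z → z ∈ X × z ∉ Y)
  ⊈-witness n k = n (⊆-intro λ z zx zy → k (z , zx , zy))

-- Instead of bounding ranks by cardinalities, only the empty set and the points are bounded;
-- submodularity supplies the rest. The list `points` is the source of finiteness.
record Ranked (P : Set) ⦃ _ : DecEq P ⦄ : Set where
  field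
    r       : Sub P → ℕ
    mono    : ∀ {X Y} → X ⊆ Y → r X ≤ r Y
    submod  : ∀ X Y → r (X ∪ Y) + r (X ∩ Y) ≤ r X + r Y
    r-∅     : r ∅ ≤ 0
    r-point : ∀ z → r ⟨ z ⟩ ≤ 1
    points  : List P
    listed  : ∀ z → z ∈ₗ points

module Closure {P : Set} ⦃ _ : DecEq P ⦄ (M : Ranked P) where
  open Ranked M

  ρ : ℕ
  ρ = r 𝕌

  sm : ∀ {U V} X Y → U ⊆ X ∪ Y → V ⊆ X ∩ Y → r U + r V ≤ r X + r Y
  sm X Y p q = ≤-trans (+-mono-≤ (mono p) (mono q)) (submod X Y)

  add : ∀ X Y → r (X ∪ Y) ≤ r X + r Y
  add X Y = ≤-trans (m≤m+n _ _) (submod X Y)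

  step : ∀ X z → r (X ∪ ⟨ z ⟩) ≤ suc (r X)
  step X z = (linear 3 (λ a b c → (a ≼ num 1) ⇒ (b ≼ c ⊕ a) ⇒ ⊩ (b ≼ ↑ c)) (r ⟨ z ⟩) (r (X ∪ ⟨ z ⟩)) (r X) (r-point z)
    (add X ⟨ z ⟩))

  setOf : List P → Sub P
  setOf []       = ∅
  setOf (z ∷ zs) = ⟨ z ⟩ ∪ setOf zs

  ∈-setOf : ∀ {z zs} → z ∈ₗ zs → z ∈ setOf zs
  ∈-setOf {z} {y ∷ zs} (here refl) = (sets 2 (λ a b → ⊢ (a ⊑ a ⊔ b)) ⟨ z ⟩ (setOf zs))
  ∈-setOf {z} {y ∷ zs} (there h) = (sets 3 (λ a b c → (a ⊑ b) ⇛ ⊢ (a ⊑ c ⊔ b)) ⟨ z ⟩ (setOf zs) ⟨ y ⟩ (∈-setOf h))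

  -- The points of `Y` are added one at a time along `points`: by submodularity, a point that does
  -- not raise the rank of `X` does not raise that of a larger set.
  absorb : ∀ X Y → (∀ z → z ∈ Y → r (X ∪ ⟨ z ⟩) ≤ r X) → r (X ∪ Y) ≤ r X
  absorb X Y h = ≤-trans (mono all) (go points)
    where
    all : X ∪ Y ⊆ X ∪ (Y ∩ setOf points)
    all = ⊆-intro λ z zx zy → (nonempty (sets 4 (λ a b c d → (a ⊑ b) ⇛ (a ⊑ c ⊔ d) ⇛ (a ⊑ ∼ (c ⊔ d ⊓ b)) ⇛ ⊢ (a ⊑ 𝟘))
      ⟨ z ⟩ (setOf points) X Y (∈-setOf (listed z)) zx zy))
    go : ∀ zs → r (X ∪ (Y ∩ setOf zs)) ≤ r X
    go [] = mono (sets 2 (λ a b → ⊢ (a ⊔ b ⊓ 𝟘 ⊑ a)) X Y)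
    go (z ∷ zs) with z ∈? Y
    ... | inj₂ z∉Y = ≤-trans (mono (X∪⊆ z∉Y)) (go zs)
      where
      X∪⊆ : z ∉ Y → X ∪ (Y ∩ setOf (z ∷ zs)) ⊆ X ∪ (Y ∩ setOf zs)
      X∪⊆ z∉Y = sets 4 (λ x y a b → (a ⊑ ∼ y) ⇛ ⊢ (x ⊔ y ⊓ (a ⊔ b) ⊑ x ⊔ y ⊓ b))
        X Y ⟨ z ⟩ (setOf zs) z∉Y
    ... | inj₁ z∈Y = (linear 4 (λ a b c d → (b ⊕ a ≼ d ⊕ c) ⇒ (c ≼ a) ⇒ (d ≼ a) ⇒ ⊩ (b ≼ a)) (r X) (r (X ∪ Y ∩ (⟨ z ⟩
      ∪ setOf zs))) (r (X ∪ Y ∩ setOf zs)) (r (X ∪ ⟨ z ⟩)) s (go zs) (h z z∈Y))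
      where
      s : r (X ∪ (Y ∩ setOf (z ∷ zs))) + r X
          ≤ r (X ∪ ⟨ z ⟩) + r (X ∪ (Y ∩ setOf zs))
      s = sm (X ∪ ⟨ z ⟩) (X ∪ (Y ∩ setOf zs))
        (sets 4 (λ x y a b → ⊢ (x ⊔ y ⊓ (a ⊔ b) ⊑ (x ⊔ a) ⊔ x ⊔ y ⊓ b)) X Y ⟨ z ⟩ (setOf zs))
        (sets 4 (λ x y a b → ⊢ (x ⊑ (x ⊔ a) ⊓ (x ⊔ y ⊓ b))) X Y ⟨ z ⟩ (setOf zs))

  Flat : Sub P → Set
  Flat F = ∀ z → r (F ∪ ⟨ z ⟩) ≤ r F → z ∈ F

  cl : Sub P → Sub P
  mem (cl X) z = r (X ∪ ⟨ z ⟩) ≤ᵇ r X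

  ∈-cl : ∀ {X z} → r (X ∪ ⟨ z ⟩) ≤ r X → z ∈ cl X
  ∈-cl h = ∈-intro (≤⇒≤ᵇ h)

  cl-∈ : ∀ {X z} → z ∈ cl X → r (X ∪ ⟨ z ⟩) ≤ r X
  cl-∈ h = ≤ᵇ⇒≤ _ _ (∈-elim h)

  ⊆cl : ∀ X → X ⊆ cl X
  ⊆cl X = ⊆-intro λ z z∈X z∉cl →
    let z∈cl = ∈-cl {X} {z} (mono (sets 2 (λ a b → (a ⊑ b) ⇛ ⊢ (b ⊔ a ⊑ b)) ⟨ z ⟩ X z∈X)) in (nonempty (sets 2 (λ a b
          → (a ⊑ ∼ b) ⇛ (a ⊑ b) ⇛ ⊢ (a ⊑ 𝟘)) ⟨ z ⟩ (cl X) z∉cl z∈cl))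

  r-cl : ∀ X → r (cl X) ≤ r X
  r-cl X = ≤-trans (mono (sets 2 (λ a b → ⊢ (a ⊑ b ⊔ a)) (cl X) X)) (absorb X (cl X) (λ z → cl-∈))

  -- Otherwise submodularity would make the flat `F` absorb `z` as well. Most strict rank increases
  -- below arise in this way, by naming a flat that contains `X` and misses `z`.
  out : ∀ {F X z} → Flat F → X ⊆ F → z ∉ F → suc (r X) ≤ r (X ∪ ⟨ z ⟩)
  out {F} {X} {z} fl X⊆F z∉F = ≰⇒> λ h →
    let s : r (F ∪ ⟨ z ⟩) + r X ≤ r F + r (X ∪ ⟨ z ⟩)
        s = sm F (X ∪ ⟨ z ⟩) (sets 3 (λ a b c → ⊢ (a ⊔ b ⊑ a ⊔ c ⊔ b)) F ⟨ z ⟩ X) (sets 3 (λ a b c → (a ⊑ b) ⇛ ⊢ (a ⊑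
          b ⊓ (a ⊔ c))) X F ⟨ z ⟩ X⊆F)
        z∈F = fl z (linear 4 (λ a b c d → (a ≼ b) ⇒ (c ⊕ b ≼ d ⊕ a) ⇒ ⊩ (c ≼ d)) (r (X ∪ ⟨ z ⟩)) (r X) (r (F ∪ ⟨ z ⟩))
          (r F) h s)
    in (nonempty (sets 2 (λ a b → (a ⊑ ∼ b) ⇛ (a ⊑ b) ⇛ ⊢ (a ⊑ 𝟘)) ⟨ z ⟩ F z∉F z∈F))

  -- The standard way to push a line or a plane into a flat: `X` consists of points known to lie in
  -- `F` and already has the rank of `Z`.
  spanned : ∀ {F X Z} → Flat F → X ⊆ F → X ⊆ Z → r Z ≤ r X → Z ⊆ F
  spanned {F} {X} {Z} fl X⊆F X⊆Z h = ⊆-intro λ z z∈Z z∉F →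
    let m = mono {X ∪ ⟨ z ⟩} {Z} (sets 3 (λ a b c → (a ⊑ b) ⇛ (c ⊑ b) ⇛ ⊢ (a ⊔ c ⊑ b)) X Z ⟨ z ⟩ X⊆Z z∈Z) in (linear 3
          (λ a b c → (↑ a ≼ b) ⇒ (c ≼ a) ⇒ (b ≼ c) ⇒ ⊩⊥) (r X) (r (X ∪ ⟨ z ⟩)) (r Z) (out fl X⊆F z∉F) h m)

  cl-flat : ∀ X → Flat (cl X)
  cl-flat X z h = ∈-cl (≤-trans (mono (Xz z)) (≤-trans h (r-cl X)))
    where
    Xz : ∀ z → X ∪ ⟨ z ⟩ ⊆ cl X ∪ ⟨ z ⟩
    Xz z = (sets 3 (λ a b c → (a ⊑ b) ⇛ ⊢ (a ⊔ c ⊑ b ⊔ c)) X (cl X) ⟨ z ⟩ (⊆cl X))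

  ∩-flat : ∀ {F G} → Flat F → Flat G → Flat (F ∩ G)
  ∩-flat {F} {G} fF fG z h =
    let p = spanned {F} {F ∩ G} {(F ∩ G) ∪ ⟨ z ⟩} fF (sets 2 (λ a b → ⊢ (a ⊓ b ⊑ a)) F G) (sets 3 (λ a b c → ⊢ (a ⊓ b
          ⊑ a ⊓ b ⊔ c)) F G ⟨ z ⟩) h
        q = spanned {G} {F ∩ G} {(F ∩ G) ∪ ⟨ z ⟩} fG (sets 3 (λ a b c → (a ⊓ b ⊔ c ⊑ a) ⇛ ⊢ (a ⊓ b ⊑ b)) F G ⟨ z ⟩ p)
          (sets 3 (λ a b c → (a ⊓ b ⊔ c ⊑ a) ⇛ ⊢ (a ⊓ b ⊑ a ⊓ b ⊔ c)) F G ⟨ z ⟩ p) h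
    in (sets 3 (λ a b c → (a ⊓ b ⊔ c ⊑ a) ⇛ (a ⊓ b ⊔ c ⊑ b) ⇛ ⊢ (c ⊑ a ⊓ b)) F G ⟨ z ⟩ p q)

-- Separations through a point

module Separations {P : Set} ⦃ _ : DecEq P ⦄ (M : Ranked P)
  (simple : ∀ {y z} → z ∉ ⟨ y ⟩ → 2 ≤ Ranked.r M (⟨ y ⟩ ∪ ⟨ z ⟩))
  (vc3 : ∀ A B → 𝕌 ⊆ A ∪ B → Ranked.r M A < Ranked.r M 𝕌 → Ranked.r M B < Ranked.r M 𝕌 →
         2 + Ranked.r M 𝕌 ≤ Ranked.r M A + Ranked.r M B) where
  open Ranked M
  open Closure M

  -- A vertical 3-separation with `y` in its guts. Both sides are flats, so that `out` and `spanned`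
  -- apply to them; `tight` and `low` together fix the rank sum at `2 + ρ`.
  record Sep (y : P) (A B : Sub P) : Set where
    field
      cover : 𝕌 ⊆ A ∪ B
      inA   : y ∈ A
      inB   : y ∈ B
      ltA   : r A < ρ
      ltB   : r B < ρ
      tight : r A + r B ≤ 2 + ρ
      low   : 2 + ρ ≤ r A + r B
      flA   : Flat A
      flB   : Flat B
  open Sep

  flip : ∀ {y A B} → Sep y A B → Sep y B A
  flip {y} {A} {B} s = record
    { cover = (sets 2 (λ a b → (𝟙 ⊑ a ⊔ b) ⇛ ⊢ (𝟙 ⊑ b ⊔ a)) A B (cover s))
    ; inA = inB s ; inB = inA s ; ltA = ltB s ; ltB = ltA s
    ; tight = (linear 3 (λ a b c → (b ⊕ a ≼ num 2 ⊕ c) ⇒ ⊩ (a ⊕ b ≼ num 2 ⊕ c)) (r B) (r A) ρ (tight s))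
    ; low = (linear 3 (λ a b c → (num 2 ⊕ a ≼ c ⊕ b) ⇒ ⊩ (num 2 ⊕ a ≼ b ⊕ c)) ρ (r B) (r A) (low s))
    ; flA = flB s ; flB = flA s }

  mkSep : ∀ {y} A B → 𝕌 ⊆ A ∪ B → y ∈ A → y ∈ B → r A < ρ → r B < ρ →
          r A + r B ≤ 2 + ρ → Sep y (cl A) (cl B)
  mkSep {y} A B c yA yB lA lB t = record
    { cover = c′
    ; inA = (sets 3 (λ a b c → (a ⊑ b) ⇛ (c ⊑ a) ⇛ ⊢ (c ⊑ b)) A (cl A) ⟨ y ⟩ (⊆cl A) yA)
    ; inB = (sets 3 (λ a b c → (a ⊑ b) ⇛ (c ⊑ a) ⇛ ⊢ (c ⊑ b)) B (cl B) ⟨ y ⟩ (⊆cl B) yB)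
    ; ltA = lA′
    ; ltB = lB′
    ; tight = (linear 5 (λ a b c d e → (a ≼ b) ⇒ (c ≼ d) ⇒ (d ⊕ b ≼ num 2 ⊕ e) ⇒ ⊩ (c ⊕ a ≼ num 2 ⊕ e)) (r (cl B)) (r
      B) (r (cl A)) (r A) ρ (r-cl B) (r-cl A) t)
    ; low = vc3 _ _ c′ lA′ lB′
    ; flA = cl-flat A ; flB = cl-flat B }
    where
    c′ : 𝕌 ⊆ cl A ∪ cl B
    c′ = (sets 4 (λ a b c d → (a ⊑ b) ⇛ (c ⊑ d) ⇛ (𝟙 ⊑ c ⊔ a) ⇛ ⊢ (𝟙 ⊑ d ⊔ b)) B (cl B) A (cl A) (⊆cl B) (⊆cl A) c)
    lA′ : r (cl A) < ρ
    lA′ = (linear 3 (λ a b c → (a ≼ b) ⇒ (↑ b ≼ c) ⇒ ⊩ (↑ a ≼ c)) (r (cl A)) (r A) ρ (r-cl A) lA)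
    lB′ : r (cl B) < ρ
    lB′ = (linear 3 (λ a b c → (a ≼ b) ⇒ (↑ b ≼ c) ⇒ ⊩ (↑ a ≼ c)) (r (cl B)) (r B) ρ (r-cl B) lB)

  -- `X` and `B` still cover everything, and `vc3` forbids a rank sum below that of the separation.
  -- In particular the part of `A` outside `B` spans `A`.
  spans : ∀ {y A B} X → Sep y A B → X ⊆ A → A ⊆ X ∪ B → r A ≤ r X
  spans {y} {A} {B} X s X⊆A A⊆ =
    let l = vc3 X B (sets 3 (λ a b c → (𝟙 ⊑ a ⊔ b) ⇛ (a ⊑ c ⊔ b) ⇛ ⊢ (𝟙 ⊑ c ⊔ b)) A B X (cover s) A⊆) (linear 3 (λ a b
          c → (a ≼ b) ⇒ (↑ b ≼ c) ⇒ ⊩ (↑ a ≼ c)) (r X) (r A) ρ (mono X⊆A) (ltA s)) (ltB s) in (linear 4 (λ a b c d →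
          (b ⊕ a ≼ num 2 ⊕ c) ⇒ (num 2 ⊕ c ≼ d ⊕ a) ⇒ ⊩ (b ≼ d)) (r B) (r A) ρ (r X) (tight s) l)

  -- Vertical 3-connectivity of the contraction by `y`, read in the original matroid: both sides and
  -- the whole lose one in rank, so the constant 2 becomes 3.
  Contractible : P → Set
  Contractible y = ∀ A B → 𝕌 ⊆ A ∪ B → y ∈ A → y ∈ B → r A < ρ → r B < ρ →
                   3 + ρ ≤ r A + r B

  not-contractible : ∀ {y} → ¬ Contractible y → ¬¬ (∃₂ λ A B → Sep y A B)
  not-contractible {y} n k = n λ A B c yA yB lA lB →
    ≤-by-contra λ h → k (cl A , cl B , mkSep A B c yA yB lA lB (linear 3 (λ a b c → (↑ (b ⊕ a) ≼ num 3 ⊕ c) ⇒ ⊩ (b ⊕ a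
      ≼ num 2 ⊕ c)) (r B) (r A) ρ h))

  -- If `A ⊆ A′`, then `B ∩ B′` and `A′` still cover, so `B ∩ B′` has the rank of `B′`, and the flat
  -- `B` swallows `B′` together with `y′`.
  A⊈A′ : ∀ {y y′ A B A′ B′} → Sep y A B → Sep y′ A′ B′ → y′ ∉ B → ¬ (A ⊆ A′)
  A⊈A′ {y} {y′} {A} {B} {A′} {B′} s s′ y′∉B A⊆A′ =
    let l = vc3 (B ∩ B′) A′ (sets 4 (λ a b c d → (𝟙 ⊑ a ⊔ b) ⇛ (𝟙 ⊑ c ⊔ d) ⇛ (a ⊑ c) ⇛ ⊢ (𝟙 ⊑ b ⊓ d ⊔ c)) A B A′ B′
          (cover s) (cover s′) A⊆A′) (linear 3 (λ a b c → (a ≼ b) ⇒ (↑ b ≼ c) ⇒ ⊩ (↑ a ≼ c)) (r (B ∩ B′)) (r B) ρ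
          (mono {B ∩ B′} {B} (sets 2 (λ b c → ⊢ (b ⊓ c ⊑ b)) B B′)) (ltB s)) (ltA s′)
        B′⊆B = spanned {B} {B ∩ B′} {B′} (flB s) (sets 2 (λ a b → ⊢ (a ⊓ b ⊑ a)) B B′) (sets 2 (λ a b → ⊢ (a ⊓ b ⊑ b))
          B B′) (linear 4 (λ a b c d → (b ⊕ a ≼ num 2 ⊕ c) ⇒ (num 2 ⊕ c ≼ d ⊕ b) ⇒ ⊩ (a ≼ d)) (r B′) (r A′) ρ (r (B ∩
          B′)) (tight s′) l)
    in (nonempty (sets 3 (λ a b c → (a ⊑ b) ⇛ (a ⊑ ∼ c) ⇛ (b ⊑ c) ⇛ ⊢ (a ⊑ 𝟘)) ⟨ y′ ⟩ B′ B (inB s′) y′∉B B′⊆B))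

  module _ {y P′ H} (sy : Sep y P′ H) (plane : r P′ ≤ 3) where

    hyperplane : ρ ≤ suc (r H)
    hyperplane = (linear 3 (λ a b c → (num 2 ⊕ a ≼ c ⊕ b) ⇒ (c ≼ num 3) ⇒ ⊩ (a ≼ ↑ b)) ρ (r H) (r P′) (low sy) plane)

    module _ {c} (c∈P : c ∈ P′) (c∉H : c ∉ H) where

      -- If the plane lay in `A`, the side `B` could be cut down to `B ∩ H`, which loses `c` and
      -- hence rank, although `vc3` allows no loss.
      P⊈A : ∀ {A B} → Sep c A B → ¬ (P′ ⊆ A)
      P⊈A {A} {B} sc P⊆A =
        let m = mono {B ∩ H} {B} (sets 2 (λ a b → ⊢ (a ⊓ b ⊑ a)) B H)
            l = vc3 A (B ∩ H) (sets 4 (λ a b c d → (𝟙 ⊑ a ⊔ b) ⇛ (𝟙 ⊑ c ⊔ d) ⇛ (a ⊑ c) ⇛ ⊢ (𝟙 ⊑ c ⊔ d ⊓ b)) P′ H A B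
              (cover sy) (cover sc) P⊆A) (ltA sc) (linear 3 (λ a b c → (↑ a ≼ b) ⇒ (c ≼ a) ⇒ ⊩ (↑ c ≼ b)) (r B) ρ (r
              (B ∩ H)) (ltB sc) m)
            o = out {H} {B ∩ H} {c} (flB sy) (sets 2 (λ a b → ⊢ (a ⊓ b ⊑ b)) B H) c∉H
            n = mono {(B ∩ H) ∪ ⟨ c ⟩} {B} (sets 3 (λ a b c → (a ⊑ b) ⇛ ⊢ (b ⊓ c ⊔ a ⊑ b)) ⟨ c ⟩ B H (inB sc))
        in (linear 5 (λ a b c d e → (b ⊕ a ≼ num 2 ⊕ c) ⇒ (num 2 ⊕ c ≼ b ⊕ d) ⇒ (↑ d ≼ e) ⇒ (e ≼ a) ⇒ ⊩⊥) (r B) (r A)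
          ρ (r (B ∩ H)) (r (B ∩ H ∪ ⟨ c ⟩)) (tight sc) l o n)

      P∩A≤2 : ∀ {A B} → Sep c A B → r (P′ ∩ A) ≤ 2
      P∩A≤2 {A} {B} sc = ≤-by-contra λ h → P⊈A sc
        (spanned {A} {P′ ∩ A} {P′} (flA sc) (sets 2 (λ a b → ⊢ (a ⊓ b ⊑ b)) P′ A) (sets 2 (λ a b → ⊢ (a ⊓ b ⊑ a)) P′
          A) (linear 2 (λ a b → (a ≼ num 3) ⇒ (num 3 ≼ b) ⇒ ⊩ (a ≼ b)) (r P′) (r (P′ ∩ A)) plane h))

      -- A second common point would bring the line `P′ ∩ A` into `B`, and with it the whole plane.
      P∩AB⊆c : ∀ {A B} → Sep c A B → P′ ∩ A ∩ B ⊆ ⟨ c ⟩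
      P∩AB⊆c {A} {B} sc = ⊆-intro λ z z∈ z≠c →
        let p = simple {c} {z} z≠c
            q = P∩A≤2 sc
            s = spanned {B} {⟨ c ⟩ ∪ ⟨ z ⟩} {P′ ∩ A} (flB sc) (sets 5 (λ a b c d e → (a ⊑ b) ⇛ (c ⊑ d ⊓ e ⊓ b) ⇛ ⊢ (a
              ⊔ c ⊑ b)) ⟨ c ⟩ B ⟨ z ⟩ P′ A (inB sc) z∈) (sets 5 (λ a b c d e → (a ⊑ b) ⇛ (a ⊑ c) ⇛ (d ⊑ b ⊓ c ⊓ e) ⇛ ⊢
              (a ⊔ d ⊑ b ⊓ c)) ⟨ c ⟩ P′ A ⟨ z ⟩ B c∈P (inA sc) z∈) (linear 2 (λ a b → (num 2 ≼ a) ⇒ (b ≼ num 2) ⇒ ⊩ (b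
              ≼ a)) (r (⟨ c ⟩ ∪ ⟨ z ⟩)) (r (P′ ∩ A)) p q)
        in P⊈A (flip sc) (sets 3 (λ a b c → (𝟙 ⊑ a ⊔ b) ⇛ (c ⊓ a ⊑ b) ⇛ ⊢ (c ⊑ b)) A B P′ (cover sc) s)

  -- Configuration of two crossing separations, the first of which has a
  -- plane as a side: y lies on the guts of P, c in the cocircuit ∁ H ⊆ P,
  -- and P is the union of the lines P ∩ A ∋ y , c and P ∩ B ∋ c , u.

  record Conf (W : P → Set) (y c : P) (P′ H A B : Sub P) : Set where
    field
      y∉B  : y ∉ B
      lA2  : r (P′ ∩ A) ≤ 2
      lB2  : r (P′ ∩ B) ≤ 2
      P⊆AB : P′ ⊆ A ∪ B
      lH   : P′ ∩ A ∩ H ⊆ ⟨ y ⟩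
      lB   : P′ ∩ A ∩ B ⊆ ⟨ c ⟩
      d    : P
      d∈P  : d ∈ P′
      d∈A  : d ∈ A
      d≠y  : d ∉ ⟨ y ⟩
      d≠c  : d ∉ ⟨ c ⟩
      u    : P
      u∈P  : u ∈ P′
      u∈B  : u ∈ B
      u∉H  : u ∉ H
      u∉A  : u ∉ A
      Wu   : W u
      ∁H⊆  : ∁ H ⊆ (P′ ∩ A) ∪ ⟨ u ⟩

  -- What the argument uses about the copies of N obtained by contracting a
  -- flat Con k: Small k A B says that at most one element of the copy lies in
  -- A − B. The instance with Small trivial serves for |N| ≤ 3.
  record Tangles : Set₁ where
    field
      Copy  : Set
      Con   : Copy → Sub P
      Small : Copy → Sub P → Sub P → Set
      Con-flat : ∀ k → Flat (Con k)
      orient   : ∀ {k y A B} → y ∈ Con k → Sep y A B → ¬¬ (Small k A B ⊎ Small k B A)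
      extend   : ∀ {k y z A B} → y ∈ Con k → Sep y A B → Small k A B → z ∈ A → z ∉ B →
                 ¬¬ (∃ λ k′ → y ∈ Con k′ × z ∈ Con k′ × Small k′ A B)
      shrink   : ∀ {k A B A′ B′} → Small k A B → A′ ∩ ∁ B′ ⊆ A ∩ ∁ B → Small k A′ B′
      opposite : ∀ {k A B A′ B′} → Small k A B → Small k A′ B′ →
                 𝕌 ⊆ A ∪ B → 𝕌 ⊆ A′ ∪ B′ →
                 r (B ∩ B′) ≤ 1 ⊎ (r (B ∩ B′) ≤ 2 × ∃ λ z → z ∈ B ∩ B′ × z ∈ Con k) →
                 Small k B′ A′

  module Crossings (tangles : Tangles) where
    open Tangles tangles

    W : P → Set
    W y = Contractible y × ∃ λ k → y ∈ Con k

    non-W-sep : ∀ {y k} → y ∈ Con k → ¬ W y → ¬¬ (∃₂ λ A B → Sep y A B)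
    non-W-sep {y} {k} y∈k nW = not-contractible λ ct → nW (ct , k , y∈k)

    -- The one consequence of smallness that the configurations need: points of `A` outside `B` can
    -- be contracted by some copy.
    Supply : Sub P → Sub P → Set
    Supply A B = ∀ z → z ∈ A → z ∉ B → ¬¬ (∃ λ k → z ∈ Con k)

    supply-of : ∀ {y k A B} → y ∈ Con k → Sep y A B → Small k A B → Supply A B
    supply-of yk s sm z z∈ z∉ K = extend yk s sm z∈ z∉ λ (k′ , _ , zk , _) → K (k′ , zk)

    -- Pigeonhole: a separation at `u` has two of `y`, `c`, `d` on one side, hence their whole line.
    -- That side also contains `u`, so it meets the plane in rank 3, against `P∩A≤2`.
    third-line : ∀ {y c d u P′ H A} (sy : Sep y P′ H) → r P′ ≤ 3 →
                 u ∈ P′ → u ∉ H → Flat A →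
                 y ∈ P′ ∩ A → c ∈ P′ ∩ A → d ∈ P′ ∩ A →
                 c ∉ ⟨ y ⟩ → d ∉ ⟨ y ⟩ → d ∉ ⟨ c ⟩ → r (P′ ∩ A) ≤ 2 → u ∉ A →
                 Supply P′ H → ¬¬ W u
    third-line {y} {c} {d} {u} {P′} {H} {A} sy plane u∈P u∉H flA′ y∈ c∈ d∈ c≠y d≠y d≠c l2 u∉A supply nW =
      supply u u∈P u∉H λ (k′ , uk) →
      non-W-sep uk nW λ (A₁ , B₁ , su) →
      let two : ∀ {a b X Y} → Sep u X Y → a ∈ P′ ∩ A → b ∈ P′ ∩ A → b ∉ ⟨ a ⟩ →
                a ∈ X → b ∈ X → ⊥
          two {a} {b} {X} {Y} s a∈ b∈ b≠a aX bX =
            let p = simple {a} {b} b≠a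
                m = mono {⟨ a ⟩ ∪ ⟨ b ⟩} {P′ ∩ A} (sets 4 (λ a b c d → (a ⊑ b ⊓ c) ⇛ (d ⊑ b ⊓ c) ⇛ ⊢ (a ⊔ d ⊑ b ⊓ c))
                  ⟨ a ⟩ P′ A ⟨ b ⟩ a∈ b∈)
                t = spanned {X} {⟨ a ⟩ ∪ ⟨ b ⟩} {P′ ∩ A} (Sep.flA s) (sets 3 (λ a b c → (a ⊑ b) ⇛ (c ⊑ b) ⇛ ⊢ (a ⊔ c ⊑
                  b)) ⟨ a ⟩ X ⟨ b ⟩ aX bX) (sets 4 (λ a b c d → (a ⊑ b ⊓ c) ⇛ (d ⊑ b ⊓ c) ⇛ ⊢ (a ⊔ d ⊑ b ⊓ c)) ⟨ a ⟩
                  P′ A ⟨ b ⟩ a∈ b∈) (linear 2 (λ a b → (a ≼ num 2) ⇒ (num 2 ≼ b) ⇒ ⊩ (a ≼ b)) (r (P′ ∩ A)) (r (⟨ a ⟩ ∪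
                  ⟨ b ⟩)) l2 p)
                o = out {A} {P′ ∩ A} {u} flA′ (sets 2 (λ a b → ⊢ (a ⊓ b ⊑ b)) P′ A) u∉A
                uX = Sep.inA s
                n = mono {(P′ ∩ A) ∪ ⟨ u ⟩} {P′ ∩ X} (sets 4 (λ a b c d → (a ⊑ b) ⇛ (a ⊑ c) ⇛ (b ⊓ d ⊑ c) ⇛ ⊢ (b ⊓ d ⊔
                  a ⊑ b ⊓ c)) ⟨ u ⟩ P′ X A u∈P (inA s) t)
                q = P∩A≤2 sy plane u∈P u∉H s
            in (linear 4 (λ a b c d → (num 2 ≼ a) ⇒ (a ≼ b) ⇒ (↑ b ≼ c) ⇒ (c ≼ d) ⇒ (d ≼ num 2) ⇒ ⊩⊥) (r (⟨ a ⟩ ∪ ⟨ b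
              ⟩)) (r (P′ ∩ A)) (r (P′ ∩ A ∪ ⟨ u ⟩)) (r (P′ ∩ X)) p m o n q)
          side : ∀ z → z ∈ A₁ ⊎ z ∈ B₁
          side z = case z ∈? A₁ of λ where
            (inj₁ h) → inj₁ h
            (inj₂ h) → inj₂ (sets 3 (λ a b c → (a ⊑ ∼ b) ⇛ (𝟙 ⊑ b ⊔ c) ⇛ ⊢ (a ⊑ c)) ⟨ z ⟩ A₁ B₁ h (cover su))
      in case side y , side c , side d of λ where
        (inj₁ a , inj₁ b , _) → two su y∈ c∈ c≠y a b
        (inj₂ a , inj₂ b , _) → two (flip su) y∈ c∈ c≠y a b
        (inj₁ a , inj₂ b , inj₁ e) → two su y∈ d∈ d≠y a e
        (inj₂ a , inj₁ b , inj₂ e) → two (flip su) y∈ d∈ d≠y a e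
        (inj₁ a , inj₂ b , inj₂ e) → two (flip su) c∈ d∈ d≠c b e
        (inj₂ a , inj₁ b , inj₁ e) → two su c∈ d∈ d≠c b e

    -- `F` stands for the span of what has been counted. Points outside it are potential
    -- counterexamples, and they are never in `W`.
    module Exhaustion (F : Sub P) (F-flat : Flat F) (W⊆F : ∀ w → W w → w ∈ F) where

      -- The points of the plane outside `H` span it, so they are neither all on `P′ ∩ A` nor, up to
      -- `y` and `c`, all on `P′ ∩ B`. This yields `u` and `d`.
      conf : ∀ {y c P′ H A B} → Sep y P′ H → r P′ ≤ 3 → Supply P′ H →
             c ∈ P′ → c ∉ H → c ∉ F → Sep c A B → y ∈ A → ¬¬ Conf W y c P′ H A B
      conf {y} {c} {P′} {H} {A} {B} sy plane supply c∈P c∉H c∉F sc y∈A K =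
        ⊈-witness third λ (d , d∈ , d∉) →
        ⊈-witness off-line λ (u , u∈ , u∉) →
        let d≠y = (sets 7 (λ a b c d e f g → (a ⊑ b) ⇛ (c ⊑ d ⊓ ∼ e) ⇛ (c ⊑ ∼ (d ⊓ f ⊔ d ⊓ b ⊓ (a ⊔ g))) ⇛ ⊢ (c ⊑ ∼
              a)) ⟨ y ⟩ A ⟨ d ⟩ P′ H B ⟨ c ⟩ y∈A d∈ d∉)
            d≠c = (sets 7 (λ a b c d e f g → (a ⊑ b) ⇛ (c ⊑ d ⊓ ∼ e) ⇛ (c ⊑ ∼ (d ⊓ b ⊔ d ⊓ f ⊓ (g ⊔ a))) ⇛ ⊢ (c ⊑ ∼
              a)) ⟨ c ⟩ B ⟨ d ⟩ P′ H A ⟨ y ⟩ (inB sc) d∈ d∉)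
            W-of : ∀ z → z ∈ P′ → z ∉ H → z ∉ A → ¬¬ W z
            W-of z z∈P z∉H z∉A = third-line sy plane z∈P z∉H (Sep.flA sc)
              (sets 3 (λ a b c → (a ⊑ b) ⇛ (a ⊑ c) ⇛ ⊢ (a ⊑ b ⊓ c)) ⟨ y ⟩ P′ A (inA sy) y∈A) (sets 3 (λ a b c → (a ⊑
                b) ⇛ (a ⊑ c) ⇛ ⊢ (a ⊑ b ⊓ c)) ⟨ c ⟩ P′ A c∈P (inA sc)) (sets 7 (λ a b c d e f g → (𝟙 ⊑ a ⊔ b) ⇛ (c ⊑ d
                ⊓ ∼ e) ⇛ (c ⊑ ∼ (d ⊓ b ⊔ d ⊓ a ⊓ (f ⊔ g))) ⇛ ⊢ (c ⊑ d ⊓ a)) A B ⟨ d ⟩ P′ H ⟨ y ⟩ ⟨ c ⟩ (cover sc) d∈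
                d∉) c≠y d≠y d≠c lA2 z∉A supply
            u∉A = (sets 4 (λ a b c d → (a ⊑ b ⊓ ∼ c) ⇛ (a ⊑ ∼ (b ⊓ d)) ⇛ ⊢ (a ⊑ ∼ d)) ⟨ u ⟩ P′ H A u∈ u∉)
        in W-of u (sets 3 (λ a b c → (a ⊑ b ⊓ ∼ c) ⇛ ⊢ (a ⊑ b)) ⟨ u ⟩ P′ H u∈) (sets 3 (λ a b c → (a ⊑ b ⊓ ∼ c) ⇛ ⊢ (a
          ⊑ ∼ c)) ⟨ u ⟩ P′ H u∈) u∉A λ Wu →
        K record
          { y∉B = y∉B ; lA2 = lA2 ; lB2 = lB2 ; P⊆AB = (sets 3 (λ a b c → (𝟙 ⊑ a ⊔ b) ⇛ ⊢ (c ⊑ a ⊔ b)) A B P′ (cover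
            sc))
          ; lH = lH ; lB = lB ; d = d
          ; d∈P = (sets 3 (λ a b c → (a ⊑ b ⊓ ∼ c) ⇛ ⊢ (a ⊑ b)) ⟨ d ⟩ P′ H d∈) ; d∈A = (sets 7 (λ a b c d e f g → (𝟙 ⊑
            a ⊔ b) ⇛ (c ⊑ d ⊓ ∼ e) ⇛ (c ⊑ ∼ (d ⊓ b ⊔ d ⊓ a ⊓ (f ⊔ g))) ⇛ ⊢ (c ⊑ a)) A B ⟨ d ⟩ P′ H ⟨ y ⟩ ⟨ c ⟩ (cover
            sc) d∈ d∉) ; d≠y = d≠y ; d≠c = d≠c
          ; u = u ; u∈P = (sets 3 (λ a b c → (a ⊑ b ⊓ ∼ c) ⇛ ⊢ (a ⊑ b)) ⟨ u ⟩ P′ H u∈) ; u∈B = (sets 3 (λ a b c → (𝟙 ⊑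
            a ⊔ b) ⇛ (c ⊑ ∼ a) ⇛ ⊢ (c ⊑ b)) A B ⟨ u ⟩ (cover sc) u∉A) ; u∉H = (sets 3 (λ a b c → (a ⊑ b ⊓ ∼ c) ⇛ ⊢ (a
            ⊑ ∼ c)) ⟨ u ⟩ P′ H u∈) ; u∉A = u∉A
          ; Wu = Wu
          -- Each point of the cocircuit off the line `P′ ∩ A` is in `W`, hence in `F`. Two of them
          -- would span `P′ ∩ B` inside `F`, but this line contains `c`, which is outside `F`. So
          -- `u` is the only one.
          ; ∁H⊆ = ⊆-intro λ z z∉H z∉ →
              W-of z (sets 3 (λ a b c → (𝟙 ⊑ a ⊔ b) ⇛ (c ⊑ ∼ b) ⇛ ⊢ (c ⊑ a)) P′ H ⟨ z ⟩ (cover sy) z∉H) (sets 2 (λ a b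
                → (a ⊑ ∼ b) ⇛ ⊢ (a ⊑ ∼ b)) ⟨ z ⟩ H z∉H) (sets 5 (λ a b c d e → (𝟙 ⊑ a ⊔ b) ⇛ (c ⊑ ∼ b) ⇛ (c ⊑ ∼ (a ⊓ d
                ⊔ e)) ⇛ ⊢ (c ⊑ ∼ d)) P′ H ⟨ z ⟩ A ⟨ u ⟩ (cover sy) z∉H z∉) λ Wz →
              let z∈F = W⊆F z Wz
                  u∈F = W⊆F u Wu
                  p = simple {u} {z} (sets 4 (λ a b c d → (a ⊑ ∼ (b ⊓ c ⊔ d)) ⇛ ⊢ (a ⊑ ∼ d)) ⟨ z ⟩ P′ A ⟨ u ⟩ z∉)
                  t = spanned {F} {⟨ u ⟩ ∪ ⟨ z ⟩} {P′ ∩ B} F-flat (sets 3 (λ a b c → (a ⊑ b) ⇛ (c ⊑ b) ⇛ ⊢ (c ⊔ a ⊑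
                    b)) ⟨ z ⟩ F ⟨ u ⟩ z∈F u∈F)
                        (sets 6 (λ a b c d e f → (𝟙 ⊑ a ⊔ b) ⇛ (𝟙 ⊑ c ⊔ d) ⇛ (e ⊑ ∼ d) ⇛ (e ⊑ ∼ (c ⊓ a ⊔ f)) ⇛ (f ⊑ c
                          ⊓ ∼ d) ⇛ (f ⊑ ∼ (c ⊓ a)) ⇛ ⊢ (f ⊔ e ⊑ c ⊓ b)) A B P′ H ⟨ z ⟩ ⟨ u ⟩ (Sep.cover sc) (cover sy)
                          z∉H z∉ u∈ u∉) (linear 2 (λ a b → (a ≼ num 2) ⇒ (num 2 ≼ b) ⇒ ⊩ (a ≼ b)) (r (P′ ∩ B)) (r (⟨ u
                          ⟩ ∪ ⟨ z ⟩)) lB2 p)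
                  cB = Sep.inB sc
              in (nonempty (sets 4 (λ a b c d → (a ⊑ b) ⇛ (a ⊑ ∼ c) ⇛ (a ⊑ d) ⇛ (b ⊓ d ⊑ c) ⇛ ⊢ (a ⊑ 𝟘)) ⟨ c ⟩ P′ F B
                c∈P c∉F (inB sc) t))
          }
        where
        lA2 = P∩A≤2 sy plane c∈P c∉H sc
        lB2 = P∩A≤2 sy plane c∈P c∉H (flip sc)
        lB = P∩AB⊆c sy plane c∈P c∉H sc
        c≠y : c ∉ ⟨ y ⟩
        c≠y = (sets 3 (λ a b c → (a ⊑ b) ⇛ (c ⊑ ∼ b) ⇛ ⊢ (c ⊑ ∼ a)) ⟨ y ⟩ H ⟨ c ⟩ (inB sy) c∉H)
        y∉B : y ∉ B
        y∉B = (sets 6 (λ a b c d e f → (a ⊓ b ⊓ c ⊑ d) ⇛ (e ⊑ a) ⇛ (e ⊑ f) ⇛ (d ⊑ ∼ f) ⇛ (e ⊑ b) ⇛ ⊢ (e ⊑ ∼ c)) P′ A B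
          ⟨ c ⟩ ⟨ y ⟩ H lB (inA sy) (inB sy) c∉H y∈A)
        lH : P′ ∩ A ∩ H ⊆ ⟨ y ⟩
        lH = ⊆-intro λ z z∈ z≠y →
          let p = simple {y} {z} z≠y
              t = spanned {H} {⟨ y ⟩ ∪ ⟨ z ⟩} {P′ ∩ A} (Sep.flB sy) (sets 5 (λ a b c d e → (a ⊑ b) ⇛ (c ⊑ d ⊓ e ⊓ b) ⇛
                ⊢ (a ⊔ c ⊑ b)) ⟨ y ⟩ H ⟨ z ⟩ P′ A (inB sy) z∈) (sets 5 (λ a b c d e → (a ⊑ b) ⇛ (a ⊑ c) ⇛ (d ⊑ b ⊓ c ⊓
                e) ⇛ ⊢ (a ⊔ d ⊑ b ⊓ c)) ⟨ y ⟩ P′ A ⟨ z ⟩ H (inA sy) y∈A z∈) (linear 2 (λ a b → (a ≼ num 2) ⇒ (num 2 ≼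
                b) ⇒ ⊩ (a ≼ b)) (r (P′ ∩ A)) (r (⟨ y ⟩ ∪ ⟨ z ⟩)) lA2 p)
          in (nonempty (sets 4 (λ a b c d → (a ⊑ b) ⇛ (a ⊑ ∼ c) ⇛ (a ⊑ d) ⇛ (b ⊓ d ⊑ c) ⇛ ⊢ (a ⊑ 𝟘)) ⟨ c ⟩ P′ H A c∈P
            c∉H (inA sc) t))
        C-spans : r P′ ≤ r (P′ ∩ ∁ H)
        C-spans = spans (P′ ∩ ∁ H) sy (sets 2 (λ a b → ⊢ (a ⊓ ∼ b ⊑ a)) P′ H) (sets 2 (λ a b → ⊢ (a ⊑ a ⊓ ∼ b ⊔ b)) P′
          H)
        third : ¬ (P′ ∩ ∁ H ⊆ (P′ ∩ B) ∪ (P′ ∩ A ∩ (⟨ y ⟩ ∪ ⟨ c ⟩)))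
        third h =
          let m = mono {P′ ∩ ∁ H} {P′ ∩ B} (sets 6 (λ a b c d e f → (a ⊑ b) ⇛ (c ⊑ d) ⇛ (e ⊓ ∼ b ⊑ e ⊓ d ⊔ e ⊓ f ⊓ (a
                ⊔ c)) ⇛ ⊢ (e ⊓ ∼ b ⊑ e ⊓ d)) ⟨ y ⟩ H ⟨ c ⟩ B P′ A (inB sy) (inB sc) h) in (linear 5 (λ a b c d e → (a
                ≼ b) ⇒ (c ≼ num 2) ⇒ (↑ d ≼ e) ⇒ (num 2 ⊕ e ≼ a ⊕ d) ⇒ (b ≼ c) ⇒ ⊩⊥) (r P′) (r (P′ ∩ ∁ H)) (r (P′ ∩
                B)) (r H) ρ C-spans lB2 (ltB sy) (low sy) m)
        off-line : ¬ (P′ ∩ ∁ H ⊆ P′ ∩ A)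
        off-line h = let m = mono h in (linear 5 (λ a b c d e → (a ≼ b) ⇒ (c ≼ num 2) ⇒ (↑ d ≼ e) ⇒ (num 2 ⊕ e ≼ a ⊕
                           d) ⇒ (b ≼ c) ⇒ ⊩⊥) (r P′) (r (P′ ∩ ∁ H)) (r (P′ ∩ A)) (r H) ρ C-spans lA2 (ltB sy) (low sy)
                           m)

-- Two points of a plane whose separations share a line

module TwoLines {P : Set} ⦃ _ : DecEq P ⦄ (M : Ranked P)
  (simple : ∀ {y z} → z ∉ ⟨ y ⟩ → 2 ≤ Ranked.r M (⟨ y ⟩ ∪ ⟨ z ⟩))
  (vc3 : ∀ A B → 𝕌 ⊆ A ∪ B → Ranked.r M A < Ranked.r M 𝕌 → Ranked.r M B < Ranked.r M 𝕌 →
         2 + Ranked.r M 𝕌 ≤ Ranked.r M A + Ranked.r M B)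
  (tangles : Separations.Tangles M simple vc3) where
  open Ranked M
  open Closure M
  open Separations M simple vc3
  open Crossings tangles
  open Tangles tangles
  open Sep

  -- The bound makes `A` a plane. Otherwise either `A ∩ A′` is only the line through `y` and `c`,
  -- which drives `y` into `B′`, or it is larger, and then uncrossing leaves `B ∩ B′` nothing but
  -- `u`, against submodularity of `A′` and `B`.
  pair : ∀ {y c d u P′ H A B A′ B′} → Sep y P′ H → r P′ ≤ 3 →
         c ∈ P′ → c ∉ H → d ∈ P′ → d ∉ H → d ∉ ⟨ c ⟩ →
         Sep c A B → y ∈ A → d ∈ A → Sep d A′ B′ → y ∈ A′ →
         u ∈ P′ → u ∉ H → u ∉ A → ∁ H ⊆ (P′ ∩ A) ∪ ⟨ u ⟩ →
         ρ ≤ suc (r B)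
  pair {y} {c} {d} {u} {P′} {H} {A} {B} {A′} {B′} sy plane c∈P c∉H d∈P d∉H d≠c
       sc y∈A d∈A sd y∈A′ u∈P u∉H u∉A C⊆ = ≤-by-contra go
    where
    cA : c ∈ A
    cA = inA sc
    c≠y : c ∉ ⟨ y ⟩
    c≠y = (sets 3 (λ a b c → (a ⊑ b) ⇛ (c ⊑ ∼ b) ⇛ ⊢ (c ⊑ ∼ a)) ⟨ y ⟩ H ⟨ c ⟩ (inB sy) c∉H)
    d≠y : d ∉ ⟨ y ⟩
    d≠y = (sets 3 (λ a b c → (a ⊑ b) ⇛ (c ⊑ ∼ b) ⇛ ⊢ (c ⊑ ∼ a)) ⟨ y ⟩ H ⟨ d ⟩ (inB sy) d∉H)
    cy = simple {y} {c} c≠y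
    dy = simple {y} {d} d≠y
    dc = simple {c} {d} d≠c
    uc = simple {c} {u} (sets 3 (λ a b c → (a ⊑ b) ⇛ (c ⊑ ∼ b) ⇛ ⊢ (c ⊑ ∼ a)) ⟨ c ⟩ A ⟨ u ⟩ (inA sc) u∉A)
    lA = P∩A≤2 sy plane c∈P c∉H sc
    l⊆A′ : P′ ∩ A ⊆ A′
    l⊆A′ = spanned {A′} {⟨ y ⟩ ∪ ⟨ d ⟩} {P′ ∩ A} (flA sd) (sets 3 (λ a b c → (a ⊑ b) ⇛ (c ⊑ b) ⇛ ⊢ (c ⊔ a ⊑ b)) ⟨ d ⟩
      A′ ⟨ y ⟩ (inA sd) y∈A′) (sets 5 (λ a b c d e → (𝟙 ⊑ a ⊔ b) ⇛ (c ⊑ a) ⇛ (d ⊑ ∼ b) ⇛ (c ⊑ e) ⇛ (d ⊑ e) ⇛ ⊢ (c ⊔ d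
      ⊑ a ⊓ e)) P′ H ⟨ y ⟩ ⟨ d ⟩ A (cover sy) (inA sy) d∉H y∈A d∈A) (linear 2 (λ a b → (num 2 ≼ a) ⇒ (b ≼ num 2) ⇒ ⊩
      (b ≼ a)) (r (⟨ y ⟩ ∪ ⟨ d ⟩)) (r (P′ ∩ A)) dy lA)
    u∉A′ : u ∉ A′
    u∉A′ = case u ∈? A′ of λ where
      (inj₂ h) → h
      (inj₁ h) →
        let o = out {A} {P′ ∩ A} {u} (flA sc) (sets 2 (λ a b → ⊢ (a ⊓ b ⊑ b)) P′ A) u∉A
            m = mono {(P′ ∩ A) ∪ ⟨ u ⟩} {P′ ∩ A′} (sets 4 (λ a b c d → (a ⊑ b) ⇛ (a ⊑ c) ⇛ (b ⊓ d ⊑ c) ⇛ ⊢ (b ⊓ d ⊔ a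
              ⊑ b ⊓ c)) ⟨ u ⟩ P′ A′ A u∈P h l⊆A′)
            t = mono {⟨ y ⟩ ∪ ⟨ c ⟩} {P′ ∩ A} (sets 5 (λ a b c d e → (𝟙 ⊑ a ⊔ b) ⇛ (c ⊑ a) ⇛ (d ⊑ ∼ b) ⇛ (d ⊑ e) ⇛ (c
              ⊑ e) ⇛ ⊢ (c ⊔ d ⊑ a ⊓ e)) P′ H ⟨ y ⟩ ⟨ c ⟩ A (cover sy) (inA sy) c∉H (inA sc) y∈A)
            q = P∩A≤2 sy plane d∈P d∉H sd
        in ⊥-elim (linear 4 (λ a b c d → (↑ a ≼ b) ⇒ (b ≼ c) ⇒ (d ≼ a) ⇒ (c ≼ num 2) ⇒ (num 2 ≼ d) ⇒ ⊩⊥) (r (P′ ∩ A))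
          (r (P′ ∩ A ∪ ⟨ u ⟩)) (r (P′ ∩ A′)) (r (⟨ y ⟩ ∪ ⟨ c ⟩)) o m t q cy)
    u∈B : u ∈ B
    u∈B = (sets 3 (λ a b c → (𝟙 ⊑ a ⊔ b) ⇛ (c ⊑ ∼ a) ⇛ ⊢ (c ⊑ b)) A B ⟨ u ⟩ (cover sc) u∉A)
    u∈B′ : u ∈ B′
    u∈B′ = (sets 3 (λ a b c → (𝟙 ⊑ a ⊔ b) ⇛ (c ⊑ ∼ a) ⇛ ⊢ (c ⊑ b)) A′ B′ ⟨ u ⟩ (cover sd) u∉A′)
    lH : P′ ∩ A ∩ H ⊆ ⟨ y ⟩
    lH = ⊆-intro λ z z∈ z≠y →
      let p = simple {y} {z} z≠y
          t = spanned {H} {⟨ y ⟩ ∪ ⟨ z ⟩} {P′ ∩ A} (flB sy) (sets 5 (λ a b c d e → (a ⊑ b) ⇛ (c ⊑ d ⊓ e ⊓ b) ⇛ ⊢ (a ⊔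
            c ⊑ b)) ⟨ y ⟩ H ⟨ z ⟩ P′ A (inB sy) z∈) (sets 5 (λ a b c d e → (a ⊑ b) ⇛ (a ⊑ c) ⇛ (d ⊑ b ⊓ c ⊓ e) ⇛ ⊢ (a
            ⊔ d ⊑ b ⊓ c)) ⟨ y ⟩ P′ A ⟨ z ⟩ H (inA sy) y∈A z∈) (linear 2 (λ a b → (a ≼ num 2) ⇒ (num 2 ≼ b) ⇒ ⊩ (a ≼
            b)) (r (P′ ∩ A)) (r (⟨ y ⟩ ∪ ⟨ z ⟩)) lA p)
      in (nonempty (sets 4 (λ a b c d → (a ⊑ b) ⇛ (a ⊑ ∼ c) ⇛ (a ⊑ d) ⇛ (b ⊓ d ⊑ c) ⇛ ⊢ (a ⊑ 𝟘)) ⟨ c ⟩ P′ H A c∈P c∉H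
        (inA sc) t))
    y∉B′ : y ∉ B′
    y∉B′ = (sets 6 (λ a b c d e f → (a ⊓ b ⊓ c ⊑ d) ⇛ (e ⊑ a) ⇛ (e ⊑ f) ⇛ (d ⊑ ∼ f) ⇛ (e ⊑ b) ⇛ ⊢ (e ⊑ ∼ c)) P′ A′ B′
      ⟨ d ⟩ ⟨ y ⟩ H (P∩AB⊆c sy plane d∈P d∉H sd) (inA sy) (inB sy) d∉H y∈A′)
    go : ¬ (suc (suc (r B)) ≤ ρ)
    go h = case ≤-or-> (r (A ∩ A′)) 2 of λ where
        -- Now `A ∩ A′` lies in the plane, so `A ∩ H` without `y` avoids `A′` and lies in the flat
        -- `B′`. By `Ay` it spans `A ∩ H`, which contains `y`.
        (inj₁ le) →
          let t = spanned {P′} {⟨ y ⟩ ∪ ⟨ c ⟩} {A ∩ A′} (flA sy) (sets 3 (λ a b c → (a ⊑ b) ⇛ (c ⊑ b) ⇛ ⊢ (a ⊔ c ⊑ b))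
                ⟨ y ⟩ P′ ⟨ c ⟩ (inA sy) c∈P)
                    (sets 6 (λ a b c d e f → (a ⊓ b ⊑ c) ⇛ (d ⊑ b) ⇛ (𝟙 ⊑ a ⊔ e) ⇛ (f ⊑ a) ⇛ (d ⊑ ∼ e) ⇛ (f ⊑ b) ⇛ ⊢
                      (f ⊔ d ⊑ b ⊓ c)) P′ A A′ ⟨ c ⟩ H ⟨ y ⟩ l⊆A′ (inA sc) (cover sy) (inA sy) c∉H y∈A) (linear 2 (λ a
                      b → (a ≼ num 2) ⇒ (num 2 ≼ b) ⇒ ⊩ (a ≼ b)) (r (A ∩ A′)) (r (⟨ y ⟩ ∪ ⟨ c ⟩)) le cy)
              q = spanned {B′} {A ∩ H ∩ ∁ ⟨ y ⟩} {A ∩ H} (flB sd) (sets 6 (λ a b c d e f → (a ⊓ b ⊑ c) ⇛ (c ⊓ a ⊓ d ⊑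
                e) ⇛ (𝟙 ⊑ b ⊔ f) ⇛ ⊢ (a ⊓ d ⊓ ∼ e ⊑ f)) A A′ P′ H ⟨ y ⟩ B′ t lH (cover sd)) (sets 3 (λ a b c → ⊢ (a ⊓
                b ⊓ ∼ c ⊑ a ⊓ b)) A H ⟨ y ⟩) (linear 2 (λ a b → (a ≼ b) ⇒ ⊩ (a ≼ b)) (r (A ∩ H)) (r (A ∩ H ∩ ∁ ⟨ y ⟩))
                Ay)
          in (nonempty (sets 4 (λ a b c d → (a ⊑ ∼ b) ⇛ (a ⊑ c) ⇛ (a ⊑ d) ⇛ (d ⊓ c ⊑ b) ⇛ ⊢ (a ⊑ 𝟘)) ⟨ y ⟩ B′ H A y∉B′
            (inB sy) y∈A q))
        (inj₂ ge) → dense ge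
      where
      -- `B` and the plane share `c` and `u`, so their union gains only one in rank and is still not
      -- spanning.
      BP : r (B ∪ P′) ≤ suc (r B)
      BP = let s = sm {B ∪ P′} {⟨ c ⟩ ∪ ⟨ u ⟩} B P′ (sets 2 (λ a b → ⊢ (a ⊔ b ⊑ a ⊔ b)) B P′) (sets 5 (λ a b c d e →
                 (a ⊑ b) ⇛ (𝟙 ⊑ c ⊔ d) ⇛ (a ⊑ d) ⇛ (e ⊑ b) ⇛ (e ⊑ ∼ c) ⇛ ⊢ (a ⊔ e ⊑ d ⊓ b)) ⟨ c ⟩ P′ A B ⟨ u ⟩ c∈P
                 (cover sc) (inB sc) u∈P u∉A) in (linear 4 (λ a b c d → (num 2 ≼ a) ⇒ (b ≼ num 3) ⇒ (c ⊕ a ≼ d ⊕ b) ⇒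
                 ⊩ (c ≼ ↑ d)) (r (⟨ c ⟩ ∪ ⟨ u ⟩)) (r P′) (r (B ∪ P′)) (r B) uc plane s)
      -- `A ∩ H` without `y` and `B ∪ P′` cover everything. The rank that `vc3` demands is already
      -- that of `A ∩ H`, because `c` makes `A` larger than `A ∩ H`.
      Ay : r (A ∩ H) ≤ r (A ∩ H ∩ ∁ ⟨ y ⟩)
      Ay =
        let m = mono {A ∩ H ∩ ∁ ⟨ y ⟩} {A} (sets 3 (λ a b c → ⊢ (a ⊓ b ⊓ ∼ c ⊑ a)) A H ⟨ y ⟩)
            l = vc3 (A ∩ H ∩ ∁ ⟨ y ⟩) (B ∪ P′) (sets 5 (λ a b c d e → (𝟙 ⊑ a ⊔ b) ⇛ (c ⊑ a) ⇛ (𝟙 ⊑ d ⊔ e) ⇛ ⊢ (𝟙 ⊑ d ⊓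
              b ⊓ ∼ c ⊔ e ⊔ a)) P′ H ⟨ y ⟩ A B (cover sy) (inA sy) (cover sc)) (linear 3 (λ a b c → (↑ a ≼ b) ⇒ (c ≼
              a) ⇒ ⊩ (↑ c ≼ b)) (r A) ρ (r (A ∩ H ∩ ∁ ⟨ y ⟩)) (ltA sc) m) (linear 3 (λ a b c → (a ≼ ↑ b) ⇒ (↑ ↑ b ≼ c)
              ⇒ ⊩ (↑ a ≼ c)) (r (B ∪ P′)) (r B) ρ BP h)
            o = out {H} {A ∩ H} {c} (flB sy) (sets 2 (λ a b → ⊢ (a ⊓ b ⊑ b)) A H) c∉H
            n = mono {(A ∩ H) ∪ ⟨ c ⟩} {A} (sets 3 (λ a b c → (a ⊑ b) ⇛ ⊢ (b ⊓ c ⊔ a ⊑ b)) ⟨ c ⟩ A H (inA sc))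
        in (linear 7 (λ a b c d e f g → (a ≼ ↑ b) ⇒ (c ⊕ b ≼ num 2 ⊕ d) ⇒ (num 2 ⊕ d ≼ e ⊕ a) ⇒ (↑ f ≼ g) ⇒ (g ≼ c) ⇒
          ⊩ (f ≼ e)) (r (B ∪ P′)) (r B) (r A) ρ (r (A ∩ H ∩ ∁ ⟨ y ⟩)) (r (A ∩ H)) (r (A ∩ H ∪ ⟨ c ⟩)) BP (tight sc) l
          o n)
      dense : ¬ (3 ≤ r (A ∩ A′))
      dense ge =
        -- If `A ∪ A′` were not spanning, `vc3` for `A ∪ A′` and `B ∩ B′` together with `key` would
        -- exceed the total `2 (ρ + 2)` of the two separations.
        let span : ρ ≤ r (A ∪ A′)
            span = ≤-by-contra λ lt →
              let v = vc3 (A ∪ A′) (B ∩ B′) (sets 4 (λ a b c d → (𝟙 ⊑ a ⊔ b) ⇛ (𝟙 ⊑ c ⊔ d) ⇛ ⊢ (𝟙 ⊑ (c ⊔ a) ⊔ d ⊓ b))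
                    A′ B′ A B (cover sd) (cover sc)) lt (linear 3 (λ a b c → (a ≼ b) ⇒ (↑ b ≼ c) ⇒ ⊩ (↑ a ≼ c)) (r (B
                    ∩ B′)) (r B) ρ (mono {B ∩ B′} {B} (sets 2 (λ a b → ⊢ (a ⊓ b ⊑ a)) B B′)) (ltB sc))
              in (linear 9 (λ a b c d e f g h i → (b ⊕ a ≼ d ⊕ c) ⇒ (f ⊕ e ≼ h ⊕ g) ⇒ (num 3 ⊕ i ≼ e ⊕ b) ⇒ (h ⊕ d ≼
                num 2 ⊕ i) ⇒ (g ⊕ c ≼ num 2 ⊕ i) ⇒ (num 2 ⊕ i ≼ f ⊕ a) ⇒ ⊩⊥) (r (B ∩ B′)) (r (B ∪ B′)) (r B′) (r B) (r
                (A ∩ A′)) (r (A ∪ A′)) (r A′) (r A) ρ (submod B B′) (submod A A′) key (tight sc) (tight sd) v)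
            BB : r (B ∩ B′) ≤ 1
            BB = (linear 9 (λ a b c d e f g h i → (b ⊕ a ≼ d ⊕ c) ⇒ (f ⊕ e ≼ h ⊕ g) ⇒ (num 3 ⊕ i ≼ e ⊕ b) ⇒ (i ≼ f) ⇒
              (h ⊕ d ≼ num 2 ⊕ i) ⇒ (g ⊕ c ≼ num 2 ⊕ i) ⇒ ⊩ (a ≼ num 1)) (r (B ∩ B′)) (r (B ∪ B′)) (r B′) (r B) (r (A
              ∩ A′)) (r (A ∪ A′)) (r A′) (r A) ρ (submod B B′) (submod A A′) key span (tight sc) (tight sd))
            BB⊆u : B ∩ B′ ⊆ ⟨ u ⟩
            BB⊆u = ⊆-intro λ z z∈ z≠u →
              let p = simple {u} {z} z≠u
                  m = mono {⟨ u ⟩ ∪ ⟨ z ⟩} {B ∩ B′} (sets 4 (λ a b c d → (a ⊑ b) ⇛ (a ⊑ c) ⇛ (d ⊑ c ⊓ b) ⇛ ⊢ (a ⊔ d ⊑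
                    c ⊓ b)) ⟨ u ⟩ B′ B ⟨ z ⟩ u∈B′ u∈B z∈)
              in (linear 2 (λ a b → (a ≼ num 1) ⇒ (num 2 ≼ b) ⇒ (b ≼ a) ⇒ ⊩⊥) (r (B ∩ B′)) (r (⟨ u ⟩ ∪ ⟨ z ⟩)) BB p m)
            o₁ = out {A′} {A′} {u} (flA sd) (sets 1 (λ a → ⊢ (a ⊑ a)) A′) u∉A′
            m₁ = mono {A′ ∪ ⟨ u ⟩} {A′ ∪ B} (sets 3 (λ a b c → (a ⊑ b) ⇛ ⊢ (c ⊔ a ⊑ c ⊔ b)) ⟨ u ⟩ B A′ u∈B)
            -- The part of `B` outside `A` spans `B` and, apart from `u`, lies in `A′ ∩ B ∩ H`.
            -- Trading `u` for `c` shows that `A′ ∩ B` has at least the rank of `B`, so `A′ ∪ B`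
            -- could not exceed `A′` in rank; but `u` lies in `B` and outside `A′`.
            L = spans (B ∩ ∁ A) (flip sc) (sets 2 (λ a b → ⊢ (a ⊓ ∼ b ⊑ a)) B A) (sets 2 (λ a b → ⊢ (a ⊑ a ⊓ ∼ b ⊔ b))
              B A)
            m₂ = mono {B ∩ ∁ A} {(A′ ∩ B ∩ H) ∪ ⟨ u ⟩} (sets 7 (λ a b c d e f g → (𝟙 ⊑ a ⊔ b) ⇛ (∼ c ⊑ d ⊓ e ⊔ f) ⇛ (g
              ⊓ b ⊑ f) ⇛ ⊢ (g ⊓ ∼ e ⊑ a ⊓ g ⊓ c ⊔ f)) A′ B′ H P′ A ⟨ u ⟩ B (cover sd) C⊆ BB⊆u)
            s₂ = step (A′ ∩ B ∩ H) u
            o₃ = out {H} {A′ ∩ B ∩ H} {c} (flB sy) (sets 3 (λ a b c → ⊢ (a ⊓ b ⊓ c ⊑ c)) A′ B H) c∉H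
            m₃ = mono {(A′ ∩ B ∩ H) ∪ ⟨ c ⟩} {A′ ∩ B} (sets 7 (λ a b c d e f g → (a ⊑ b) ⇛ (a ⊑ c) ⇛ (𝟙 ⊑ d ⊔ e) ⇛ (f
              ⊑ ∼ b) ⇛ (c ⊓ e ⊑ f) ⇛ ⊢ (d ⊓ c ⊓ g ⊔ a ⊑ d ⊓ c)) ⟨ c ⟩ A B A′ B′ ⟨ u ⟩ H (inA sc) (inB sc) (cover sd)
              u∉A BB⊆u)
        in (linear 9 (λ a b c d e f g h i → (b ⊕ a ≼ d ⊕ c) ⇒ (↑ d ≼ e) ⇒ (e ≼ b) ⇒ (c ≼ f) ⇒ (f ≼ g) ⇒ (g ≼ ↑ h) ⇒ (↑
          h ≼ i) ⇒ (i ≼ a) ⇒ ⊩⊥) (r (A′ ∩ B)) (r (A′ ∪ B)) (r B) (r A′) (r (A′ ∪ ⟨ u ⟩)) (r (B ∩ ∁ A)) (r (A′ ∩ B ∩ H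
          ∪ ⟨ u ⟩)) (r (A′ ∩ B ∩ H)) (r (A′ ∩ B ∩ H ∪ ⟨ c ⟩)) (submod A′ B) o₁ m₁ L m₂ s₂ o₃ m₃)
        where
        -- If `B ∪ B′` is not spanning, it still spans the line through `c` and `d`. As `∁ H`
        -- consists of points of this line and `u`, the other side of the cover may be cut down to
        -- `A ∩ A′ ∩ H`; the third unit comes from `c`.
        key : 3 + ρ ≤ r (A ∩ A′) + r (B ∪ B′)
        key = case ≤-or-> ρ (r (B ∪ B′)) of λ where
          (inj₁ le) → (linear 3 (λ a b c → (num 3 ≼ a) ⇒ (b ≼ c) ⇒ ⊩ (num 3 ⊕ b ≼ a ⊕ c)) (r (A ∩ A′)) ρ (r (B ∪ B′))
            ge le)
          (inj₂ gt) →
            let s = sm {(B ∪ B′) ∪ (P′ ∩ A)} {⟨ c ⟩ ∪ ⟨ d ⟩} (B ∪ B′) (P′ ∩ A) (sets 1 (λ a → ⊢ (a ⊑ a)) ((B ∪ B′) ∪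
                  (P′ ∩ A))) (sets 6 (λ a b c d e f → (a ⊑ b) ⇛ (c ⊑ b) ⇛ (a ⊑ d) ⇛ (a ⊑ e) ⇛ (c ⊑ d) ⇛ (c ⊑ f) ⇛ ⊢ (a
                  ⊔ c ⊑ (e ⊔ f) ⊓ b ⊓ d)) ⟨ c ⟩ P′ ⟨ d ⟩ A B B′ c∈P d∈P (inA sc) (inB sc) d∈A (inB sd))
                m = mono {A ∩ A′ ∩ H} {A} (sets 3 (λ a b c → ⊢ (a ⊓ b ⊓ c ⊑ a)) A A′ H)
                l = vc3 (A ∩ A′ ∩ H) ((B ∪ B′) ∪ (P′ ∩ A)) (sets 7 (λ a b c d e f g → (a ⊑ b) ⇛ (∼ c ⊑ d ⊓ e ⊔ a) ⇛ (𝟙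
                  ⊑ f ⊔ g) ⇛ (𝟙 ⊑ e ⊔ b) ⇛ ⊢ (𝟙 ⊑ e ⊓ f ⊓ c ⊔ (b ⊔ g) ⊔ d ⊓ e)) ⟨ u ⟩ B H P′ A A′ B′ u∈B C⊆ (cover sd)
                  (cover sc)) (linear 3 (λ a b c → (↑ a ≼ b) ⇒ (c ≼ a) ⇒ ⊩ (↑ c ≼ b)) (r A) ρ (r (A ∩ A′ ∩ H)) (ltA
                  sc) m) (linear 5 (λ a b c d e → (b ⊕ a ≼ d ⊕ c) ⇒ (c ≼ num 2) ⇒ (num 2 ≼ a) ⇒ (↑ d ≼ e) ⇒ ⊩ (↑ b ≼
                  e)) (r (⟨ c ⟩ ∪ ⟨ d ⟩)) (r ((B ∪ B′) ∪ (P′ ∩ A))) (r (P′ ∩ A)) (r (B ∪ B′)) ρ s lA dc gt)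
                o = out {H} {A ∩ A′ ∩ H} {c} (flB sy) (sets 3 (λ a b c → ⊢ (a ⊓ b ⊓ c ⊑ c)) A A′ H) c∉H
                n = mono {(A ∩ A′ ∩ H) ∪ ⟨ c ⟩} {A ∩ A′} (sets 5 (λ a b c d e → (a ⊑ b) ⇛ (c ⊓ b ⊑ d) ⇛ (a ⊑ c) ⇛ ⊢ (b
                  ⊓ d ⊓ e ⊔ a ⊑ b ⊓ d)) ⟨ c ⟩ A P′ A′ H cA l⊆A′ c∈P)
            in (linear 8 (λ a b c d e f g h → (a ≼ num 2) ⇒ (num 2 ≼ b) ⇒ (c ⊕ b ≼ d ⊕ a) ⇒ (num 2 ⊕ e ≼ f ⊕ c) ⇒ (↑ f
              ≼ g) ⇒ (g ≼ h) ⇒ ⊩ (num 3 ⊕ e ≼ h ⊕ d)) (r (P′ ∩ A)) (r (⟨ c ⟩ ∪ ⟨ d ⟩)) (r ((B ∪ B′) ∪ (P′ ∩ A))) (r (B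
              ∪ B′)) ρ (r (A ∩ A′ ∩ H)) (r (A ∩ A′ ∩ H ∪ ⟨ c ⟩)) (r (A ∩ A′)) lA dc s l o n)

-- Filaments

module Filaments {P : Set} ⦃ _ : DecEq P ⦄ (M : Ranked P)
  (simple : ∀ {y z} → z ∉ ⟨ y ⟩ → 2 ≤ Ranked.r M (⟨ y ⟩ ∪ ⟨ z ⟩))
  (vc3 : ∀ A B → 𝕌 ⊆ A ∪ B → Ranked.r M A < Ranked.r M 𝕌 → Ranked.r M B < Ranked.r M 𝕌 →
         2 + Ranked.r M 𝕌 ≤ Ranked.r M A + Ranked.r M B)
  (tangles : Separations.Tangles M simple vc3) where
  open Ranked M
  open Closure M
  open Separations M simple vc3
  open Crossings tangles
  open Tangles tangles
  open TwoLines M simple vc3 tangles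
  open Sep
  open Conf

  -- l − z together with x is the cocircuit ∁ H.
  record Star (l : Sub P) (z : P) : Set where
    field
      H      : Sub P
      x      : P
      H-flat : Flat H
      corank : ρ ≤ suc (r H)
      ltH    : r H < ρ
      Wx     : W x
      x∉H    : x ∉ H
      z∈H    : z ∈ H
      C⊆     : ∁ H ⊆ (l ∩ ∁ ⟨ z ⟩) ∪ ⟨ x ⟩
      ⊆C     : l ∩ ∁ ⟨ z ⟩ ⊆ ∁ H

  -- The stars are doubly negated because their tips come from non-constructive choices; search
  -- recovers them at the end. `off-W` keeps filaments apart from chosen points and from all tips.
  record Filament (l : Sub P) : Set where
    field
      l≤2      : r l ≤ 2
      l-flat   : Flat l
      e₁ e₂ e₃ : P
      e₁∈      : e₁ ∈ l
      e₂∈      : e₂ ∈ l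
      e₃∈      : e₃ ∈ l
      e₁≠e₂    : e₁ ∉ ⟨ e₂ ⟩
      e₁≠e₃    : e₁ ∉ ⟨ e₃ ⟩
      e₂≠e₃    : e₂ ∉ ⟨ e₃ ⟩
      copy     : Copy
      l⊆Con    : l ⊆ Con copy
      off-W    : ∀ z → z ∈ l → ¬ W z
      star     : ∀ z → z ∈ l → ¬¬ Star l z

  -- An obstruction that is counted separately: l carries two cocircuits up to
  -- the points u₁, u₂, and with w they are independent.
  record Alpha (y : P) : Set where
    field
      l            : Sub P
      c′ w u₁ u₂   : P
      H₁ H₂        : Sub P
      Ww           : W w
      Wu₁          : W u₁
      Wu₂          : W u₂
      H₁-flat      : Flat H₁
      H₂-flat      : Flat H₂
      l≤2          : r l ≤ 2
      y∈l          : y ∈ l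
      c∈l          : c′ ∈ l
      w∈l          : w ∈ l
      y∈H₁         : y ∈ H₁
      c∉H₁         : c′ ∉ H₁
      y∉H₂         : y ∉ H₂
      C₁⊆          : ∁ H₁ ⊆ l ∪ ⟨ u₁ ⟩
      C₂⊆          : ∁ H₂ ⊆ l ∪ ⟨ u₂ ⟩
      w≠c          : c′ ∉ ⟨ w ⟩
      wuu          : 3 ≤ r ((⟨ w ⟩ ∪ ⟨ u₁ ⟩) ∪ ⟨ u₂ ⟩)

  oriented : ∀ {z A B} y → Sep z A B → ∃₂ λ A B → Sep z A B × y ∈ A
  oriented {z} {A} {B} y s = case y ∈? A of λ where
    (inj₁ h) → A , B , s , h
    (inj₂ h) → B , A , flip s , (sets 3 (λ a b c → (𝟙 ⊑ a ⊔ b) ⇛ (c ⊑ ∼ a) ⇛ ⊢ (c ⊑ b)) A B ⟨ y ⟩ (cover s) h)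

  -- The line is the meet of two planes. One extra point lies in the first plane off the line, the
  -- other in the second plane off the first, which makes them independent together with `w`.
  alpha : ∀ {y c w P′ H A B} → Sep y P′ H → Sep c A B →
          (cf : Conf W y c P′ H A B) (cf′ : Conf W c y A B P′ H) →
          w ∈ P′ ∩ A → W w → c ∉ ⟨ w ⟩ → c ∉ H → Alpha y
  alpha {y} {c} {w} {P′} {H} {A} {B} sy sc cf cf′ w∈ Ww c≠w c∉H = record
    { l = P′ ∩ A ; c′ = c ; w = w ; u₁ = u cf ; u₂ = u cf′ ; H₁ = H ; H₂ = B
    ; Ww = Ww ; Wu₁ = Wu cf ; Wu₂ = Wu cf′ ; H₁-flat = flB sy ; H₂-flat = flB sc
    ; l≤2 = lA2 cf
    ; y∈l = y∈l
    ; c∈l = c∈l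
    ; w∈l = w∈
    ; y∈H₁ = inB sy ; c∉H₁ = c∉H ; y∉H₂ = y∉B cf
    ; C₁⊆ = ∁H⊆ cf
    ; C₂⊆ = (sets 4 (λ a b c d → (∼ a ⊑ b ⊓ c ⊔ d) ⇛ ⊢ (∼ a ⊑ c ⊓ b ⊔ d)) B A P′ ⟨ Separations.Conf.u cf′ ⟩ (∁H⊆ cf′))
    ; w≠c = c≠w
    ; wuu = wuu′ }
    where
    y∈A : y ∈ A
    y∈A = (sets 3 (λ a b c → (𝟙 ⊑ a ⊔ b) ⇛ (c ⊑ ∼ b) ⇛ ⊢ (c ⊑ a)) A B ⟨ y ⟩ (cover sc) (y∉B cf))
    c∈P : c ∈ P′
    c∈P = (sets 5 (λ a b c d e → (a ⊑ b) ⇛ (∼ c ⊑ b ⊓ d ⊔ a) ⇛ (e ⊑ ∼ c) ⇛ ⊢ (e ⊑ b)) ⟨ Separations.Conf.u cf ⟩ P′ H A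
      ⟨ c ⟩ (u∈P cf) (∁H⊆ cf) (y∉B cf′))
    y∈l : y ∈ P′ ∩ A
    y∈l = (sets 3 (λ a b c → (a ⊑ b) ⇛ (a ⊑ c) ⇛ ⊢ (a ⊑ c ⊓ b)) ⟨ y ⟩ A P′ y∈A (inA sy))
    c∈l : c ∈ P′ ∩ A
    c∈l = (sets 3 (λ a b c → (a ⊑ b) ⇛ (a ⊑ c) ⇛ ⊢ (a ⊑ b ⊓ c)) ⟨ c ⟩ P′ A c∈P (inA sc))
    wuu′ : 3 ≤ r ((⟨ w ⟩ ∪ ⟨ u cf ⟩) ∪ ⟨ u cf′ ⟩)
    wuu′ =
      let p = simple {w} {u cf} (sets 4 (λ a b c d → (a ⊑ ∼ b) ⇛ (c ⊑ d ⊓ b) ⇛ ⊢ (a ⊑ ∼ c)) ⟨ Separations.Conf.u cf ⟩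
            A ⟨ w ⟩ P′ (u∉A cf) w∈)
          o = out {P′} {⟨ w ⟩ ∪ ⟨ u cf ⟩} {u cf′} (flA sy) (sets 4 (λ a b c d → (a ⊑ b) ⇛ (c ⊑ b ⊓ d) ⇛ ⊢ (c ⊔ a ⊑ b))
            ⟨ Separations.Conf.u cf ⟩ P′ ⟨ w ⟩ A (u∈P cf) w∈) (u∉A cf′)
      in (linear 2 (λ a b → (num 2 ≼ a) ⇒ (↑ a ≼ b) ⇒ ⊩ (num 3 ≼ b)) (r (⟨ w ⟩ ∪ ⟨ Separations.Conf.u cf ⟩)) (r ((⟨ w
        ⟩ ∪ ⟨ Separations.Conf.u cf ⟩) ∪ ⟨ Separations.Conf.u cf′ ⟩)) p o)

  module Exhaust (F : Sub P) (F-flat : Flat F) (W⊆F : ∀ w → W w → w ∈ F)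
    (Fil⊆F : ∀ l → Filament l → l ⊆ F) (Alpha⊆F : ∀ y → Alpha y → y ∈ F) where
    open Exhaustion F F-flat W⊆F

    not-W : ∀ {z} → z ∉ F → ¬ W z
    not-W {z} z∉F Wz = let z∈F = W⊆F z Wz in (nonempty (sets 2 (λ a b → (a ⊑ ∼ b) ⇛ (a ⊑ b) ⇛ ⊢ (a ⊑ 𝟘)) ⟨ z ⟩ F z∉F
                             z∈F))

    -- A line without contractible points would be a filament, hence inside `F`, but `y` is not. At
    -- `y` the star comes from `H`; at another point `z`, `pair` supplies a second plane, in which
    -- the two separations exchange roles.
    no-line : ∀ {y c k P′ H A B} → Sep y P′ H → r P′ ≤ 3 → y ∈ Con k → Small k P′ H →
              y ∉ F → c ∈ P′ → c ∉ H → Sep c A B → y ∈ A → Conf W y c P′ H A B →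
              ¬ (∀ z → z ∈ P′ ∩ A → ¬ W z)
    no-line {y} {c} {k} {P′} {H} {A} {B} sy plane yk sm₀ y∉F c∈P c∉H sc y∈A cf noW =
      extend yk sy sm₀ c∈P c∉H λ (k₀ , yk₀ , ck₀ , _) →
      let l⊆F = Fil⊆F (P′ ∩ A) record
            { l≤2 = lA2 cf
            ; l-flat = ∩-flat (flA sy) (flA sc)
            ; e₁ = y ; e₂ = c ; e₃ = d cf
            ; e₁∈ = y∈l ; e₂∈ = c∈l ; e₃∈ = (sets 3 (λ a b c → (a ⊑ b) ⇛ (a ⊑ c) ⇛ ⊢ (a ⊑ b ⊓ c)) ⟨ Separations.Conf.d
              cf ⟩ P′ A (d∈P cf) (d∈A cf))
            ; e₁≠e₂ = (sets 3 (λ a b c → (a ⊑ b) ⇛ (c ⊑ ∼ b) ⇛ ⊢ (c ⊑ ∼ a)) ⟨ c ⟩ B ⟨ y ⟩ (inB sc) (y∉B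
              cf)) ; e₁≠e₃ = ≠-sym (d≠y cf) ; e₂≠e₃ = ≠-sym (d≠c cf)
            ; copy = k₀
            ; l⊆Con = spanned {Con k₀} {⟨ y ⟩ ∪ ⟨ c ⟩} {P′ ∩ A} (Con-flat k₀) (sets 3 (λ a b c → (a ⊑ b) ⇛ (c ⊑ b) ⇛ ⊢
              (a ⊔ c ⊑ b)) ⟨ y ⟩ (Con k₀) ⟨ c ⟩ yk₀ ck₀)
                (sets 4 (λ a b c d → (a ⊑ b ⊓ c) ⇛ (d ⊑ b ⊓ c) ⇛ ⊢ (a ⊔ d ⊑ b ⊓ c)) ⟨ y ⟩ P′ A ⟨ c ⟩ y∈l c∈l) (linear
                  2 (λ a b → (num 2 ≼ a) ⇒ (b ≼ num 2) ⇒ ⊩ (b ≼ a)) (r (⟨ y ⟩ ∪ ⟨ c ⟩)) (r (P′ ∩ A)) yc (lA2 cf))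
            ; off-W = noW
            ; star = star₀ }
      in (nonempty (sets 4 (λ a b c d → (a ⊑ b ⊓ c) ⇛ (a ⊑ ∼ d) ⇛ (b ⊓ c ⊑ d) ⇛ ⊢ (a ⊑ 𝟘)) ⟨ y ⟩ P′ A F y∈l y∉F l⊆F))
      where
      ≠-sym : ∀ {a b : P} → a ∉ ⟨ b ⟩ → b ∉ ⟨ a ⟩
      ≠-sym {a} {b} h = apart λ e → nonempty {z = a} (subst (λ x → a ∈ ∁ ⟨ x ⟩ → a ∈ ∅) (sym e) (λ q → sets 1 (λ a → (a ⊑ ∼ a) ⇛ ⊢ (a ⊑ 𝟘)) ⟨ a ⟩ q) h)
      y∈l : y ∈ P′ ∩ A
      y∈l = (sets 3 (λ a b c → (a ⊑ b) ⇛ (a ⊑ c) ⇛ ⊢ (a ⊑ b ⊓ c)) ⟨ y ⟩ P′ A (inA sy) y∈A)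
      c∈l : c ∈ P′ ∩ A
      c∈l = (sets 3 (λ a b c → (a ⊑ b) ⇛ (a ⊑ c) ⇛ ⊢ (a ⊑ b ⊓ c)) ⟨ c ⟩ P′ A c∈P (inA sc))
      yc = simple {y} {c} (sets 3 (λ a b c → (a ⊑ b) ⇛ (c ⊑ ∼ b) ⇛ ⊢ (a ⊑ ∼ c)) ⟨ c ⟩ B ⟨ y ⟩ (inB sc) (y∉B cf))
      uA = u∉A cf
      star₀ : ∀ z → z ∈ P′ ∩ A → ¬¬ Star (P′ ∩ A) z
      star₀ z z∈l K = case z ∈? ⟨ y ⟩ of λ where
          (inj₁ h) → case same h of λ where
            refl → K record
              { H = H ; x = u cf ; H-flat = flB sy ; corank = hyperplane sy plane
              ; ltH = ltB sy ; Wx = Wu cf ; x∉H = u∉H cf ; z∈H = inB sy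
              ; C⊆ = (sets 5 (λ a b c d e → (a ⊑ b) ⇛ (∼ b ⊑ c ⊓ d ⊔ e) ⇛ ⊢ (∼ b ⊑ (c ⊓ d) ⊓ ∼ a ⊔ e)) ⟨ y ⟩ H P′ A ⟨
                Separations.Conf.u cf ⟩ (inB sy) (∁H⊆ cf))
              ; ⊆C = (sets 4 (λ a b c d → (a ⊓ b ⊓ c ⊑ d) ⇛ ⊢ ((a ⊓ b) ⊓ ∼ d ⊑ ∼ c)) P′ A H ⟨ y ⟩ (lH cf)) }
          (inj₂ z≠y) → star₁ z≠y
        where
        -- `pair` needs a second point of the line off `H`: this is `c`, unless `z` is `c` itself,
        -- and then `d`.
        another : z ∉ ⟨ y ⟩ → ∃ λ o → o ∈ P′ ∩ A × o ∉ H × o ∉ ⟨ z ⟩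
        another z≠y = case z ∈? ⟨ c ⟩ of λ where
          (inj₁ h) → case same h of λ where
            refl → d cf , (sets 3 (λ a b c → (a ⊑ b) ⇛ (a ⊑ c) ⇛ ⊢ (a ⊑ b ⊓ c)) ⟨ Separations.Conf.d cf ⟩ P′ A (d∈P
              cf) (d∈A cf)) , (sets 5 (λ a b c d e → (a ⊓ b ⊓ c ⊑ d) ⇛ (e ⊑ a) ⇛ (e ⊑ b) ⇛ (e ⊑ ∼ d) ⇛ ⊢ (e ⊑ ∼ c)) P′
              A H ⟨ y ⟩ ⟨ Separations.Conf.d cf ⟩ (lH cf) (d∈P cf) (d∈A cf) (d≠y cf)) , d≠c cf
          (inj₂ h) → c , c∈l , c∉H , ≠-sym h
        star₁ : z ∉ ⟨ y ⟩ → ⊥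
        star₁ z≠y =
          let z∈P : z ∈ P′
              z∈P = (sets 3 (λ a b c → (a ⊑ b ⊓ c) ⇛ ⊢ (a ⊑ b)) ⟨ z ⟩ P′ A z∈l)
              z∉H : z ∉ H
              z∉H = (sets 5 (λ a b c d e → (a ⊓ b ⊓ c ⊑ d) ⇛ (e ⊑ a ⊓ b) ⇛ (e ⊑ ∼ d) ⇛ ⊢ (e ⊑ ∼ c)) P′ A H ⟨ y ⟩ ⟨ z ⟩
                (lH cf) z∈l z≠y)
              o , o∈l , o∉H , o≠z = another z≠y
              o∈P : o ∈ P′
              o∈P = (sets 3 (λ a b c → (a ⊑ b ⊓ c) ⇛ ⊢ (a ⊑ b)) ⟨ o ⟩ P′ A o∈l)
              yz = simple {y} {z} z≠y
          in extend yk sy sm₀ z∈P z∉H λ (k₁ , yk₁ , zk₁ , sm₁) →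
          non-W-sep zk₁ (noW z z∈l) λ (_ , _ , s₀) →
          extend yk sy sm₀ o∈P o∉H λ (k₂ , yk₂ , ok₂ , sm₂) →
          non-W-sep ok₂ (noW o o∈l) λ (_ , _ , s₀′) →
          let A₁ , B₁ , s₁ , y∈A₁ = oriented y s₀
              A₂ , B₂ , s₂ , y∈A₂ = oriented y s₀′
              l₁ = P∩A≤2 sy plane z∈P z∉H s₁
              l⊆A₁ = spanned {A₁} {⟨ y ⟩ ∪ ⟨ z ⟩} {P′ ∩ A} (flA s₁) (sets 3 (λ a b c → (a ⊑ b) ⇛ (c ⊑ b) ⇛ ⊢ (c ⊔ a ⊑
                b)) ⟨ z ⟩ A₁ ⟨ y ⟩ (inA s₁) y∈A₁) (sets 4 (λ a b c d → (a ⊑ b ⊓ c) ⇛ (d ⊑ b ⊓ c) ⇛ ⊢ (a ⊔ d ⊑ b ⊓ c))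
                ⟨ y ⟩ P′ A ⟨ z ⟩ y∈l z∈l) (linear 2 (λ a b → (a ≼ num 2) ⇒ (num 2 ≼ b) ⇒ ⊩ (a ≼ b)) (r (P′ ∩ A)) (r (⟨
                y ⟩ ∪ ⟨ z ⟩)) (lA2 cf) yz)
              l₁⊆A = spanned {A} {⟨ y ⟩ ∪ ⟨ z ⟩} {P′ ∩ A₁} (flA sc) (sets 4 (λ a b c d → (a ⊑ b) ⇛ (c ⊑ d ⊓ b) ⇛ ⊢ (a
                ⊔ c ⊑ b)) ⟨ y ⟩ A ⟨ z ⟩ P′ y∈A z∈l) (sets 5 (λ a b c d e → (a ⊑ b) ⇛ (a ⊑ c) ⇛ (b ⊓ d ⊑ c) ⇛ (e ⊑ b ⊓
                d) ⇛ ⊢ (e ⊔ a ⊑ b ⊓ c)) ⟨ z ⟩ P′ A₁ A ⟨ y ⟩ z∈P (inA s₁) l⊆A₁ y∈l) (linear 2 (λ a b → (num 2 ≼ a) ⇒ (b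
                ≼ num 2) ⇒ ⊩ (b ≼ a)) (r (⟨ y ⟩ ∪ ⟨ z ⟩)) (r (P′ ∩ A₁)) yz l₁)
              uc∉A₁ : u cf ∉ A₁
              uc∉A₁ = (sets 5 (λ a b c d e → (a ⊓ b ⊑ c) ⇛ (𝟙 ⊑ a ⊔ d) ⇛ (e ⊑ ∼ d) ⇛ (e ⊑ ∼ c) ⇛ ⊢ (e ⊑ ∼ b)) P′ A₁ A
                H ⟨ Separations.Conf.u cf ⟩ l₁⊆A (cover sy) (u∉H cf) (u∉A cf))
              pr = pair sy plane z∈P z∉H o∈P o∉H o≠z s₁ y∈A₁ (sets 4 (λ a b c d → (a ⊑ b ⊓ c) ⇛ (b ⊓ c ⊑ d) ⇛ ⊢ (a ⊑
                d)) ⟨ o ⟩ P′ A A₁ o∈l l⊆A₁) s₂ y∈A₂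
                     (u∈P cf) (u∉H cf) uc∉A₁ (sets 5 (λ a b c d e → (∼ a ⊑ b ⊓ c ⊔ d) ⇛ (b ⊓ c ⊑ e) ⇛ ⊢ (∼ a ⊑ b ⊓ e ⊔
                       d)) H P′ A ⟨ Separations.Conf.u cf ⟩ A₁ (∁H⊆ cf) l⊆A₁)
              plane₁ : r A₁ ≤ 3
              plane₁ = (linear 3 (λ a b c → (b ⊕ a ≼ num 2 ⊕ c) ⇒ (c ≼ ↑ a) ⇒ ⊩ (b ≼ num 3)) (r B₁) (r A₁) ρ (tight
                s₁) pr)
              y∉B₁ : y ∉ B₁
              y∉B₁ = (sets 5 (λ a b c d e → (a ⊑ ∼ b) ⇛ (a ⊑ c) ⇛ (c ⊓ d ⊓ e ⊑ b) ⇛ (a ⊑ d) ⇛ ⊢ (a ⊑ ∼ e)) ⟨ y ⟩ ⟨ z ⟩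
                P′ A₁ B₁ (≠-sym z≠y) (inA sy) (P∩AB⊆c sy plane z∈P z∉H s₁) y∈A₁)
              H∩A₁≤2 : r (H ∩ A₁) ≤ 2
              H∩A₁≤2 =
                let o₁ = out {H} {H ∩ A₁} {z} (flB sy) (sets 2 (λ a b → ⊢ (a ⊓ b ⊑ a)) H A₁) z∉H
                    m₁ = mono {(H ∩ A₁) ∪ ⟨ z ⟩} {A₁} (sets 3 (λ a b c → (a ⊑ b) ⇛ ⊢ (c ⊓ b ⊔ a ⊑ b)) ⟨ z ⟩ A₁ H (inA
                      s₁))
                in (linear 3 (λ a b c → (a ≼ num 3) ⇒ (↑ b ≼ c) ⇒ (c ≼ a) ⇒ ⊩ (b ≼ num 2)) (r A₁) (r (H ∩ A₁)) (r (H ∩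
                  A₁ ∪ ⟨ z ⟩)) plane₁ o₁ m₁)
              finish : Small k₁ A₁ B₁ → ⊥
              finish sm₃ =
                -- The plane is now `A₁`, with guts point `z`, and the crossing separation is the
                -- original one at `y`. The extra point of `∁ B₁` becomes the tip for `z`.
                conf s₁ plane₁ (supply-of zk₁ s₁ sm₃) y∈A₁ y∉B₁ y∉F sy z∈P λ cf₁ →
                K record
                  { H = B₁ ; x = u cf₁ ; H-flat = flB s₁ ; corank = pr ; ltH = ltB s₁
                  ; Wx = Wu cf₁ ; x∉H = u∉H cf₁ ; z∈H = inB s₁
                  ; C⊆ = (sets 6 (λ a b c d e f → (∼ a ⊑ b ⊓ c ⊔ d) ⇛ (e ⊑ a) ⇛ (c ⊓ b ⊑ f) ⇛ ⊢ (∼ a ⊑ (c ⊓ f) ⊓ ∼ e ⊔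
                    d)) B₁ A₁ P′ ⟨ Separations.Conf.u cf₁ ⟩ ⟨ z ⟩ A (∁H⊆ cf₁) (inB s₁) l₁⊆A)
                  ; ⊆C = (sets 5 (λ a b c d e → (a ⊓ b ⊑ c) ⇛ (c ⊓ a ⊓ d ⊑ e) ⇛ ⊢ ((a ⊓ b) ⊓ ∼ e ⊑ ∼ d)) P′ A A₁ B₁ ⟨
                    z ⟩ l⊆A₁ (lH cf₁)) }
          -- If the other side is reported small, `opposite` turns it round: `H ∩ A₁` has rank at
          -- most 2 and contains the contracted point `y`.
          in orient zk₁ s₁ λ where
            (inj₁ sm₃) → finish sm₃
            (inj₂ sm₃) → finish (opposite sm₁ sm₃ (cover sy) (cover (flip s₁))
              (inj₂ (H∩A₁≤2 , y , (sets 5 (λ a b c d e → (a ⊑ b) ⇛ (c ⊓ d ⊑ e) ⇛ (a ⊑ c ⊓ d) ⇛ ⊢ (a ⊑ b ⊓ e)) ⟨ y ⟩ H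
                P′ A A₁ (inB sy) l⊆A₁ y∈l) , yk₁)))

-- Separations with a plane side

module Planes {P : Set} ⦃ _ : DecEq P ⦄ (M : Ranked P)
  (simple : ∀ {y z} → z ∉ ⟨ y ⟩ → 2 ≤ Ranked.r M (⟨ y ⟩ ∪ ⟨ z ⟩))
  (vc3 : ∀ A B → 𝕌 ⊆ A ∪ B → Ranked.r M A < Ranked.r M 𝕌 → Ranked.r M B < Ranked.r M 𝕌 →
         2 + Ranked.r M 𝕌 ≤ Ranked.r M A + Ranked.r M B)
  (tangles : Separations.Tangles M simple vc3) where
  open Ranked M
  open Closure M
  open Separations M simple vc3
  open Crossings tangles
  open Tangles tangles
  open TwoLines M simple vc3 tangles
  open Filaments M simple vc3 tangles
  open Sep
  open Conf

  module Exhaust₂ (F : Sub P) (F-flat : Flat F) (W⊆F : ∀ w → W w → w ∈ F)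
    (Fil⊆F : ∀ l → Filament l → l ⊆ F) (Alpha⊆F : ∀ y → Alpha y → y ∈ F) where
    open Exhaustion F F-flat W⊆F
    open Exhaust F F-flat W⊆F Fil⊆F Alpha⊆F

    -- The part of `A` outside `B` spans `A`; inside the flat `F` it would drag `y` along.
    escape : ∀ {y A B} → Sep y A B → y ∉ F → ¬¬ (∃ λ z → z ∈ A × z ∉ B × z ∉ F)
    escape {y} {A} {B} s y∉F K = ⊈-witness
      (λ h → let t = spanned {F} {A ∩ ∁ B} {A} F-flat h (sets 2 (λ a b → ⊢ (a ⊓ ∼ b ⊑ a)) A B) (spans (A ∩ ∁ B) s
                   (sets 2 (λ a b → ⊢ (a ⊓ ∼ b ⊑ a)) A B) (sets 2 (λ a b → ⊢ (a ⊑ a ⊓ ∼ b ⊔ b)) A B))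
                 yA = inA s
             in (nonempty (sets 3 (λ a b c → (a ⊑ ∼ b) ⇛ (c ⊑ b) ⇛ (a ⊑ c) ⇛ ⊢ (a ⊑ 𝟘)) ⟨ y ⟩ F A y∉F t yA)))
      λ (z , z∈ , z∉F) → K (z , (sets 3 (λ a b c → (a ⊑ b ⊓ ∼ c) ⇛ ⊢ (a ⊑ b)) ⟨ z ⟩ A B z∈) , (sets 3 (λ a b c → (a ⊑
        b ⊓ ∼ c) ⇛ ⊢ (a ⊑ ∼ c)) ⟨ z ⟩ A B z∈) , z∉F)

    -- If `y` lies in `A`, the line common to the two planes either carries a contractible point,
    -- and `y` is an Alpha point, or it is a filament. If `y` lies in `B`, a third separation, at a
    -- point `c₂` of `A` outside `B`, decides.
    no-two-planes : ∀ {y c k k′ P′ H A B} → Sep y P′ H → r P′ ≤ 3 →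
      y ∈ Con k → Small k P′ H → y ∉ F → c ∈ P′ → c ∉ H → c ∉ F →
      Sep c A B → r A ≤ 3 → c ∈ Con k′ → Small k′ A B → ⊥
    no-two-planes {y} {c} {k} {k′} {P′} {H} {A} {B} sy plane yk sm₁ y∉F c∈P c∉H c∉F sc plane′ ck sm₂ =
      case y ∈? A of λ where
        (inj₁ y∈A) →
          conf sy plane supply c∈P c∉H c∉F sc y∈A λ cf →
          conf sc plane′ supply′ y∈A (y∉B cf) y∉F sy c∈P λ cf′ →
          em (∃ λ w → w ∈ P′ ∩ A × W w) λ where
            (inj₁ (w , w∈ , Ww)) →
              let w∈F = W⊆F w Ww
                  y∈F = Alpha⊆F y (alpha sy sc cf cf′ w∈ Ww (sets 3 (λ a b c → (a ⊑ ∼ b) ⇛ (c ⊑ b) ⇛ ⊢ (a ⊑ ∼ c)) ⟨ c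
                    ⟩ F ⟨ w ⟩ c∉F w∈F) c∉H)
              in (nonempty (sets 2 (λ a b → (a ⊑ ∼ b) ⇛ (a ⊑ b) ⇛ ⊢ (a ⊑ 𝟘)) ⟨ y ⟩ F y∉F y∈F))
            (inj₂ none) → no-line sy plane yk sm₁ y∉F c∈P c∉H sc y∈A cf
              (λ z z∈ Wz → none (z , z∈ , Wz))
        (inj₂ y∉A) →
          let y∈B : y ∈ B
              y∈B = (sets 3 (λ a b c → (𝟙 ⊑ a ⊔ b) ⇛ (c ⊑ ∼ a) ⇛ ⊢ (c ⊑ b)) A B ⟨ y ⟩ (cover sc) y∉A)
          in
          conf sy plane supply c∈P c∉H c∉F (flip sc) y∈B λ cf →
          escape sc c∉F λ (c₂ , c₂∈A , c₂∉B , c₂∉F) →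
          extend ck sc sm₂ c₂∈A c₂∉B λ (k₂ , _ , c₂k , _) →
          non-W-sep c₂k (not-W c₂∉F) λ (_ , _ , s₀) →
          let A₂ , B₂ , s₂ , c∈A₂ = oriented c s₀ in
          conf sc plane′ supply′ c₂∈A c₂∉B c₂∉F s₂ c∈A₂ λ cf₂ →
          em (∃ λ w → w ∈ A ∩ A₂ × W w) λ where
            (inj₂ none) → no-line sc plane′ ck sm₂ c∉F c₂∈A c₂∉B s₂ c∈A₂ cf₂
              (λ z z∈ Wz → none (z , z∈ , Wz))
            (inj₁ _) → crossing cf s₂ c∈A₂ cf₂ c₂∈A c₂∉B c₂∉F
      where
      supply = supply-of yk sy sm₁
      supply′ = supply-of ck sc sm₂
      -- `u` completes the cocircuit `∁ H`. If it is in `A₂`, the line `A ∩ A₂` lies in the plane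
      -- `P′`; if not, this line lies in `H`, although `c` does not.
      crossing : ∀ {c₂ A₂ B₂} → (cf : Conf W y c P′ H B A) → Sep c₂ A₂ B₂ → c ∈ A₂ →
                 Conf W c c₂ A B A₂ B₂ → c₂ ∈ A → c₂ ∉ B → c₂ ∉ F → ⊥
      crossing {c₂} {A₂} {B₂} cf s₂ c∈A₂ cf₂ c₂∈A c₂∉B c₂∉F = case u cf ∈? A₂ of λ where
          (inj₁ u∈A₂) →
            let cu = simple {c} {u cf} c≠u
                l⊆P = spanned {P′} {⟨ c ⟩ ∪ ⟨ u cf ⟩} {A ∩ A₂} (flA sy) (sets 3 (λ a b c → (a ⊑ b) ⇛ (c ⊑ b) ⇛ ⊢ (a ⊔
                  c ⊑ b)) ⟨ c ⟩ P′ ⟨ Separations.Conf.u cf ⟩ c∈P (u∈P cf)) (sets 5 (λ a b c d e → (𝟙 ⊑ a ⊔ b) ⇛ (c ⊑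
                  a) ⇛ (d ⊑ ∼ b) ⇛ (c ⊑ e) ⇛ (d ⊑ e) ⇛ ⊢ (c ⊔ d ⊑ a ⊓ e)) A B ⟨ c ⟩ ⟨ Separations.Conf.u cf ⟩ A₂
                  (cover sc) (inA sc) (u∉A cf) c∈A₂ u∈A₂) (linear 2 (λ a b → (a ≼ num 2) ⇒ (num 2 ≼ b) ⇒ ⊩ (a ≼ b)) (r
                  (A ∩ A₂)) (r (⟨ c ⟩ ∪ ⟨ Separations.Conf.u cf ⟩)) (lA2 cf₂) cu)
                c₂∈P : c₂ ∈ P′
                c₂∈P = (sets 4 (λ a b c d → (a ⊑ b) ⇛ (a ⊑ c) ⇛ (c ⊓ b ⊑ d) ⇛ ⊢ (a ⊑ d)) ⟨ c₂ ⟩ A₂ A P′ (inA s₂) c₂∈A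
                  l⊆P)
                c₂∈H : c₂ ∈ H
                c₂∈H = case c₂ ∈? H of λ where
                  (inj₁ h) → h
                  (inj₂ h) → ⊥-elim (nonempty (sets 6 (λ a b c d e f → (∼ a ⊑ b ⊓ c ⊔ d) ⇛ (e ⊑ ∼ c) ⇛ (e ⊑ ∼ f) ⇛ (e
                    ⊑ ∼ a) ⇛ (d ⊑ f) ⇛ ⊢ (e ⊑ 𝟘)) H P′ B ⟨ Separations.Conf.u cf ⟩ ⟨ c₂ ⟩ F (∁H⊆ cf) c₂∉B c₂∉F h u∈F))
                -- The old cover is a separation at `c₂` as well. The planes `A` and `P′` then share
                -- the line through `c`, `c₂` and the contractible `u`, so `c` is an Alpha point.
                s₃ : Sep c₂ P′ H
                s₃ = record { cover = cover sy ; inA = c₂∈P ; inB = c₂∈H ; ltA = ltA sy ; ltB = ltB sy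
                            ; tight = tight sy ; low = low sy ; flA = flA sy ; flB = flB sy }
            in
            conf sc plane′ supply′ c₂∈A c₂∉B c₂∉F s₃ c∈P λ cf₃ →
            conf s₃ plane supply c∈P c∉H c∉F sc c₂∈A λ cf₄ →
            let c∈F = Alpha⊆F c (alpha sc s₃ cf₃ cf₄ (sets 3 (λ a b c → (a ⊑ b) ⇛ (a ⊑ c) ⇛ ⊢ (a ⊑ c ⊓ b)) ⟨
                  Separations.Conf.u cf ⟩ P′ A (u∈P cf) (u∈B cf)) (Wu cf) (sets 3 (λ a b c → (a ⊑ ∼ b) ⇛ (c ⊑ b) ⇛ ⊢
                  (a ⊑ ∼ c)) ⟨ c₂ ⟩ F ⟨ Separations.Conf.u cf ⟩ c₂∉F u∈F) c₂∉B) in (nonempty (sets 2 (λ a b → (a ⊑ ∼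
                  b) ⇛ (a ⊑ b) ⇛ ⊢ (a ⊑ 𝟘)) ⟨ c ⟩ F c∉F c∈F))
          (inj₂ u∉A₂) →
            let dc = simple {c₂} {d cf₂} (d≠c cf₂)
                H₁ : c₂ ∈ H
                H₁ = hit u∉A₂ c₂ (sets 3 (λ a b c → (a ⊑ b) ⇛ (a ⊑ c) ⇛ ⊢ (a ⊑ c ⊓ b)) ⟨ c₂ ⟩ A₂ A (inA s₂) c₂∈A)
                  (sets 3 (λ a b c → (a ⊑ b) ⇛ (c ⊑ ∼ b) ⇛ ⊢ (a ⊑ ∼ c)) ⟨ c₂ ⟩ B₂ ⟨ c ⟩ (inB s₂) (y∉B cf₂))
                H₂ : d cf₂ ∈ H
                H₂ = hit u∉A₂ (d cf₂) (sets 3 (λ a b c → (a ⊑ b) ⇛ (a ⊑ c) ⇛ ⊢ (a ⊑ b ⊓ c)) ⟨ Separations.Conf.d cf₂ ⟩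
                  A A₂ (d∈P cf₂) (d∈A cf₂)) (d≠y cf₂)
                t = spanned {H} {⟨ c₂ ⟩ ∪ ⟨ d cf₂ ⟩} {A ∩ A₂} (flB sy) (sets 3 (λ a b c → (a ⊑ b) ⇛ (c ⊑ b) ⇛ ⊢ (a ⊔ c
                  ⊑ b)) ⟨ c₂ ⟩ H ⟨ Separations.Conf.d cf₂ ⟩ H₁ H₂) (sets 4 (λ a b c d → (a ⊑ b) ⇛ (c ⊑ d) ⇛ (c ⊑ b) ⇛
                  (a ⊑ d) ⇛ ⊢ (a ⊔ c ⊑ d ⊓ b)) ⟨ c₂ ⟩ A₂ ⟨ Separations.Conf.d cf₂ ⟩ A (inA s₂) (d∈P cf₂) (d∈A cf₂)
                  c₂∈A) (linear 2 (λ a b → (a ≼ num 2) ⇒ (num 2 ≼ b) ⇒ ⊩ (a ≼ b)) (r (A ∩ A₂)) (r (⟨ c₂ ⟩ ∪ ⟨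
                  Separations.Conf.d cf₂ ⟩)) (lA2 cf₂) dc)
                c∈A = inA sc
            in (nonempty (sets 5 (λ a b c d e → (a ⊑ ∼ b) ⇛ (a ⊑ c) ⇛ (a ⊑ ∼ d) ⇛ (c ⊑ e ⊔ d) ⇛ (c ⊓ e ⊑ b) ⇛ ⊢ (a ⊑
              𝟘)) ⟨ c ⟩ H A B₂ A₂ c∉H (inA sc) (y∉B cf₂) (P⊆AB cf₂) t))
        where
        u∈F : u cf ∈ F
        u∈F = W⊆F _ (Wu cf)
        c≠u : u cf ∉ ⟨ c ⟩
        c≠u = (sets 3 (λ a b c → (a ⊑ ∼ b) ⇛ (c ⊑ b) ⇛ ⊢ (c ⊑ ∼ a)) ⟨ c ⟩ F ⟨ Separations.Conf.u cf ⟩ c∉F u∈F)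
        hit : u cf ∉ A₂ → ∀ z → z ∈ A ∩ A₂ → z ∉ ⟨ c ⟩ → z ∈ H
        hit u∉A₂ z z∈ z≠c = case z ∈? H of λ where
          (inj₁ h) → h
          (inj₂ h) → ⊥-elim (nonempty (sets 8 (λ a b c d e f g h → (∼ a ⊑ b ⊓ c ⊔ d) ⇛ (e ⊓ f ⊓ c ⊑ g) ⇛ (d ⊑ ∼ f) ⇛
            (h ⊑ e ⊓ f) ⇛ (h ⊑ ∼ g) ⇛ (h ⊑ ∼ a) ⇛ ⊢ (h ⊑ 𝟘)) H P′ B ⟨ Separations.Conf.u cf ⟩ A A₂ ⟨ c ⟩ ⟨ z ⟩ (∁H⊆
            cf) (lH cf₂) u∉A₂ z∈ z≠c h))

    -- The final inclusion lets the argument be repeated: a point of `P′` outside `H` and `F` is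
    -- again in `X`, so a second plane is available there.
    PlaneAt : P → Sub P → Set
    PlaneAt c X = ∃₂ λ P′ H → Sep c P′ H × r P′ ≤ 3 × (∃ λ k → c ∈ Con k × Small k P′ H) ×
                  P′ ∩ ∁ H ∩ ∁ F ⊆ X

    no-plane-field : ∀ X → (∀ c → c ∈ X → c ∉ F → ¬¬ PlaneAt c X) →
                     ∀ c → c ∈ X → c ∉ F → ⊥
    no-plane-field X planes c c∈X c∉F =
      planes c c∈X c∉F λ (P′ , H , s , plane , (k , ck , sm₁) , within) →
      escape s c∉F λ (z , z∈P , z∉H , z∉F) →
      planes z (sets 5 (λ a b c d e → (a ⊓ ∼ b ⊓ ∼ c ⊑ d) ⇛ (e ⊑ a) ⇛ (e ⊑ ∼ b) ⇛ (e ⊑ ∼ c) ⇛ ⊢ (e ⊑ d)) P′ H F X ⟨ z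
        ⟩ within z∈P z∉H z∉F) z∉F λ (P″ , H′ , s′ , plane′ , (k′ , zk , sm₂) , _) →
      no-two-planes s plane ck sm₁ c∉F z∈P z∉H z∉F s′ plane′ zk sm₂

    -- If `A ∩ A₁` has rank above 2 and `B ∩ B₁` rank above 1, uncrossing makes `A ∩ A₁` the small
    -- side of a separation at `c` of smaller rank, and `IH` leaves only a plane. If this fails for
    -- both `A₁` and `B₁`, one of these is itself a plane that barely meets `B`.
    planes-inside : ∀ {y k A B} → y ∈ Con k → Sep y A B → Small k A B → 4 ≤ r A →
      (∀ {z k′ A′ B′} → z ∉ F → z ∈ Con k′ → Sep z A′ B′ → Small k′ A′ B′ →
        r A′ < r A → 4 ≤ r A′ → ⊥) →
      ∀ c → c ∈ A ∩ ∁ B → c ∉ F → ¬¬ PlaneAt c (A ∩ ∁ B)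
    planes-inside {y} {k} {A} {B} yk s sm₀ big IH c c∈ c∉F K =
      extend yk s sm₀ c∈A c∉B λ (k₁ , yk₁ , ck₁ , sm₁) →
      non-W-sep ck₁ (not-W c∉F) λ (A₁ , B₁ , s₁) →
      let c1 : 1 ≤ r ⟨ c ⟩
          c1 = let o = out {B} {∅} {c} (flB s) (sets 1 (λ a → ⊢ (𝟘 ⊑ a)) B) c∉B
                   m = mono {∅ ∪ ⟨ c ⟩} {⟨ c ⟩} (sets 1 (λ a → ⊢ (𝟘 ⊔ a ⊑ a)) ⟨ c ⟩)
               in (linear 3 (λ a b c → (↑ a ≼ b) ⇒ (b ≼ c) ⇒ ⊩ (num 1 ≼ c)) (r ∅) (r (∅ ∪ ⟨ c ⟩)) (r ⟨ c ⟩) o m)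
      in case options sm₁ ck₁ s₁ , options sm₁ ck₁ (flip s₁) of λ where
        -- `A` would be the union of two sets of rank 2 that share `c`, hence of rank at most 3.
        (inj₁ a , inj₁ b) →
          let t = sm {A} {⟨ c ⟩} (A ∩ A₁) (A ∩ B₁) (sets 3 (λ a b c → (𝟙 ⊑ a ⊔ b) ⇛ ⊢ (c ⊑ c ⊓ a ⊔ c ⊓ b)) A₁ B₁ A
                (cover s₁)) (sets 4 (λ a b c d → (a ⊑ b) ⇛ (a ⊑ c) ⇛ (a ⊑ d) ⇛ ⊢ (a ⊑ (d ⊓ b) ⊓ d ⊓ c)) ⟨ c ⟩ A₁ B₁ A
                (inA s₁) (inB s₁) c∈A)
          in (linear 4 (λ a b c d → (num 4 ≼ a) ⇒ (b ≼ num 2) ⇒ (c ≼ num 2) ⇒ (num 1 ≼ d) ⇒ (a ⊕ d ≼ b ⊕ c) ⇒ ⊩⊥) (r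
            A) (r (A ∩ A₁)) (r (A ∩ B₁)) (r ⟨ c ⟩) big a b c1 t)
        -- `B` would have rank at most 2, but the side of a separation has rank at least 3.
        (inj₂ a , inj₂ b) →
          let t = mono {B} {(B ∩ B₁) ∪ (B ∩ A₁)} (sets 3 (λ a b c → (𝟙 ⊑ a ⊔ b) ⇛ ⊢ (c ⊑ c ⊓ b ⊔ c ⊓ a)) A₁ B₁ B
                (cover s₁)) in (linear 6 (λ a b c d e f → (a ≼ c ⊕ b) ⇒ (↑ d ≼ e) ⇒ (num 2 ⊕ e ≼ d ⊕ f) ⇒ (c ≼ num 1)
                ⇒ (b ≼ num 1) ⇒ (f ≼ a) ⇒ ⊩⊥) (r (B ∩ B₁ ∪ B ∩ A₁)) (r (B ∩ A₁)) (r (B ∩ B₁)) (r A) ρ (r B) (add (B ∩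
                B₁) (B ∩ A₁)) (ltA s) (low s) a b t)
        (inj₁ a , inj₂ b) → near sm₁ ck₁ s₁ a b
        (inj₂ a , inj₁ b) → near sm₁ ck₁ (flip s₁) b a
      where
      c∈A : c ∈ A
      c∈A = (sets 3 (λ a b c → (a ⊑ b ⊓ ∼ c) ⇛ ⊢ (a ⊑ b)) ⟨ c ⟩ A B c∈)
      c∉B : c ∉ B
      c∉B = (sets 3 (λ a b c → (a ⊑ b ⊓ ∼ c) ⇛ ⊢ (a ⊑ ∼ c)) ⟨ c ⟩ A B c∈)
      options : ∀ {k₁ A₁ B₁} → Small k₁ A B → c ∈ Con k₁ → Sep c A₁ B₁ → r (A ∩ A₁) ≤ 2 ⊎ r (B ∩ B₁) ≤ 1
      options {k₁} {A₁} {B₁} sm₁ ck₁ s₁ = case ≤-or-> (r (A ∩ A₁)) 2 of λ where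
          (inj₁ h) → inj₁ h
          (inj₂ h) → inj₂ (≤-by-contra λ h′ → both h h′)
        where
        both : 3 ≤ r (A ∩ A₁) → 2 ≤ r (B ∩ B₁) → ⊥
        both h h′ =
          let join : 2 + ρ ≤ r (A ∪ A₁) + r (B ∩ B₁)
              join = case ≤-or-> ρ (r (A ∪ A₁)) of λ where
                (inj₁ g) → (linear 3 (λ a b c → (num 2 ≼ a) ⇒ (b ≼ c) ⇒ ⊩ (num 2 ⊕ b ≼ c ⊕ a)) (r (B ∩ B₁)) ρ (r (A ∪
                  A₁)) h′ g)
                (inj₂ g) → vc3 (A ∪ A₁) (B ∩ B₁) (sets 4 (λ a b c d → (𝟙 ⊑ a ⊔ b) ⇛ (𝟙 ⊑ c ⊔ d) ⇛ ⊢ (𝟙 ⊑ (c ⊔ a) ⊔ d ⊓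
                  b)) A₁ B₁ A B (cover s₁) (cover s)) g
                  (linear 3 (λ a b c → (a ≼ b) ⇒ (↑ b ≼ c) ⇒ ⊩ (↑ a ≼ c)) (r (B ∩ B₁)) (r B) ρ (mono {B ∩ B₁} {B}
                    (sets 2 (λ a b → ⊢ (a ⊓ b ⊑ a)) B B₁)) (ltB s))
              meet : r (A ∩ A₁) + r (B ∪ B₁) ≤ 2 + ρ
              meet = (linear 9 (λ a b c d e f g h i → (b ⊕ a ≼ d ⊕ c) ⇒ (f ⊕ e ≼ h ⊕ g) ⇒ (h ⊕ d ≼ num 2 ⊕ i) ⇒ (g ⊕ c
                ≼ num 2 ⊕ i) ⇒ (num 2 ⊕ i ≼ f ⊕ a) ⇒ ⊩ (e ⊕ b ≼ num 2 ⊕ i)) (r (B ∩ B₁)) (r (B ∪ B₁)) (r B₁) (r B) (r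
                (A ∩ A₁)) (r (A ∪ A₁)) (r A₁) (r A) ρ (submod B B₁) (submod A A₁) (tight s) (tight s₁) join)
              m = mono {A ∩ A₁} {A} (sets 2 (λ a b → ⊢ (a ⊓ b ⊑ a)) A A₁)
              s₂ : Sep c (A ∩ A₁) (cl (B ∪ B₁))
              s₂ = record
                { cover = (sets 5 (λ a b c d e → (a ⊔ b ⊑ c) ⇛ (𝟙 ⊑ d ⊔ b) ⇛ (𝟙 ⊑ e ⊔ a) ⇛ ⊢ (𝟙 ⊑ e ⊓ d ⊔ c)) B B₁ (cl
                  (B ∪ B₁)) A₁ A (⊆cl (B ∪ B₁)) (cover s₁) (cover s))
                ; inA = (sets 3 (λ a b c → (a ⊑ b) ⇛ (a ⊑ c) ⇛ ⊢ (a ⊑ c ⊓ b)) ⟨ c ⟩ A₁ A (inA s₁) c∈A) ; inB = (sets 4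
                  (λ a b c d → (a ⊔ b ⊑ c) ⇛ (d ⊑ b) ⇛ ⊢ (d ⊑ c)) B B₁ (cl (B ∪ B₁)) ⟨ c ⟩ (⊆cl (B ∪ B₁)) (inB s₁))
                ; ltA = (linear 3 (λ a b c → (↑ a ≼ b) ⇒ (c ≼ a) ⇒ ⊩ (↑ c ≼ b)) (r A) ρ (r (A ∩ A₁)) (ltA s) m)
                ; ltB = (linear 4 (λ a b c d → (a ≼ b) ⇒ (num 3 ≼ c) ⇒ (c ⊕ b ≼ num 2 ⊕ d) ⇒ ⊩ (↑ a ≼ d)) (r (cl (B ∪
                  B₁))) (r (B ∪ B₁)) (r (A ∩ A₁)) ρ (r-cl (B ∪ B₁)) h meet)
                ; tight = (linear 4 (λ a b c d → (a ≼ b) ⇒ (c ⊕ b ≼ num 2 ⊕ d) ⇒ ⊩ (c ⊕ a ≼ num 2 ⊕ d)) (r (cl (B ∪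
                  B₁))) (r (B ∪ B₁)) (r (A ∩ A₁)) ρ (r-cl (B ∪ B₁)) meet)
                ; low = vc3 (A ∩ A₁) (cl (B ∪ B₁)) (sets 5 (λ a b c d e → (a ⊔ b ⊑ c) ⇛ (𝟙 ⊑ d ⊔ b) ⇛ (𝟙 ⊑ e ⊔ a) ⇛ ⊢
                  (𝟙 ⊑ e ⊓ d ⊔ c)) B B₁ (cl (B ∪ B₁)) A₁ A (⊆cl (B ∪ B₁)) (cover s₁) (cover s))
                    (linear 3 (λ a b c → (↑ a ≼ b) ⇒ (c ≼ a) ⇒ ⊩ (↑ c ≼ b)) (r A) ρ (r (A ∩ A₁)) (ltA s) m) (linear 4
                      (λ a b c d → (a ≼ b) ⇒ (num 3 ≼ c) ⇒ (c ⊕ b ≼ num 2 ⊕ d) ⇒ ⊩ (↑ a ≼ d)) (r (cl (B ∪ B₁))) (r (B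
                      ∪ B₁)) (r (A ∩ A₁)) ρ (r-cl (B ∪ B₁)) h meet)
                ; flA = ∩-flat (flA s) (flA s₁) ; flB = cl-flat (B ∪ B₁) }
              small : A ∩ A₁ ∩ ∁ (cl (B ∪ B₁)) ⊆ A ∩ ∁ B
              small = (sets 5 (λ a b c d e → (a ⊔ b ⊑ c) ⇛ ⊢ (d ⊓ e ⊓ ∼ c ⊑ d ⊓ ∼ a)) B B₁ (cl (B ∪ B₁)) A A₁ (⊆cl (B
                ∪ B₁)))
              sm₂ = shrink {k₁} {A} {B} {A ∩ A₁} {cl (B ∪ B₁)} sm₁ (sets 4 (λ a b c d → (a ⊓ b ⊓ ∼ c ⊑ a ⊓ ∼ d) ⇛ ⊢
                ((a ⊓ b) ⊓ ∼ c ⊑ a ⊓ ∼ d)) A A₁ (cl (B ∪ B₁)) B small)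
              lt : r (A ∩ A₁) < r A
              lt = ≰⇒> λ le → A⊈A′ s s₁ c∉B
                (let t = spanned {A₁} {A ∩ A₁} {A} (flA s₁) (sets 2 (λ a b → ⊢ (a ⊓ b ⊑ b)) A A₁) (sets 2 (λ a b → ⊢
                       (a ⊓ b ⊑ a)) A A₁) le in (sets 2 (λ a b → (a ⊑ b) ⇛ ⊢ (a ⊑ b)) A A₁ t))
          in case ≤-or-> (r (A ∩ A₁)) 3 of λ where
            (inj₁ g) → K (A ∩ A₁ , cl (B ∪ B₁) , s₂ , g , (k₁ , ck₁ , sm₂) , (sets 5 (λ a b c d e → (a ⊓ b ⊓ ∼ c ⊑ a ⊓
              ∼ d) ⇛ ⊢ ((a ⊓ b) ⊓ ∼ c ⊓ ∼ e ⊑ a ⊓ ∼ d)) A A₁ (cl (B ∪ B₁)) B F small))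
            (inj₂ g) → IH c∉F ck₁ s₂ sm₂ lt g
      near : ∀ {k₁ A₁ B₁} → Small k₁ A B → c ∈ Con k₁ → Sep c A₁ B₁ →
             r (A ∩ A₁) ≤ 2 → r (B ∩ A₁) ≤ 1 → ⊥
      near {k₁} {A₁} {B₁} sm₁ ck₁ s₁ h h′ =
        let m = mono {A₁} {(A ∩ A₁) ∪ (B ∩ A₁)} (sets 3 (λ a b c → (𝟙 ⊑ a ⊔ b) ⇛ ⊢ (c ⊑ a ⊓ c ⊔ b ⊓ c)) A B A₁ (cover
              s))
            plane : r A₁ ≤ 3
            plane = (linear 4 (λ a b c d → (a ≼ c ⊕ b) ⇒ (c ≼ num 2) ⇒ (b ≼ num 1) ⇒ (d ≼ a) ⇒ ⊩ (d ≼ num 3)) (r (A ∩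
              A₁ ∪ B ∩ A₁)) (r (B ∩ A₁)) (r (A ∩ A₁)) (r A₁) (add (A ∩ A₁) (B ∩ A₁)) h h′ m)
            finish : Small k₁ A₁ B₁ → ⊥
            finish sm₂ = K (A₁ , B₁ , s₁ , plane , (k₁ , ck₁ , sm₂) , inside plane sm₂)
        in orient ck₁ s₁ λ where
          (inj₁ sm₂) → finish sm₂
          (inj₂ sm₂) → finish (opposite sm₁ sm₂ (cover s) (cover (flip s₁)) (inj₁ h′))
        where
        -- An offending `z` would be the only point of `B ∩ A₁` and not in `A`. In a configuration
        -- at `z`, the line `A₁ ∩ A₂` then has two points of `A`, namely `c` and `d`, so the flat
        -- `A` would contain `z` after all.
        inside : r A₁ ≤ 3 → Small k₁ A₁ B₁ → A₁ ∩ ∁ B₁ ∩ ∁ F ⊆ A ∩ ∁ B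
        inside plane sm₂ = ⊆-intro λ z z∈ z∉ →
          let z∈A₁ : z ∈ A₁
              z∈A₁ = (sets 4 (λ a b c d → (a ⊑ b ⊓ ∼ c ⊓ ∼ d) ⇛ ⊢ (a ⊑ b)) ⟨ z ⟩ A₁ B₁ F z∈)
              z∉B₁ : z ∉ B₁
              z∉B₁ = (sets 4 (λ a b c d → (a ⊑ b ⊓ ∼ c ⊓ ∼ d) ⇛ ⊢ (a ⊑ ∼ c)) ⟨ z ⟩ A₁ B₁ F z∈)
              z∉F : z ∉ F
              z∉F = (sets 4 (λ a b c d → (a ⊑ b ⊓ ∼ c ⊓ ∼ d) ⇛ ⊢ (a ⊑ ∼ d)) ⟨ z ⟩ A₁ B₁ F z∈)
              z∈B : z ∈ B
              z∈B = (sets 3 (λ a b c → (𝟙 ⊑ a ⊔ b) ⇛ (c ⊑ ∼ (a ⊓ ∼ b)) ⇛ ⊢ (c ⊑ b)) A B ⟨ z ⟩ (cover s) z∉)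
              only : B ∩ A₁ ⊆ ⟨ z ⟩
              only = ⊆-intro λ v v∈ v≠z →
                let p = simple {z} {v} v≠z
                    q = mono {⟨ z ⟩ ∪ ⟨ v ⟩} {B ∩ A₁} (sets 4 (λ a b c d → (a ⊑ b ⊓ c) ⇛ (d ⊑ c) ⇛ (d ⊑ b) ⇛ ⊢ (d ⊔ a
                      ⊑ b ⊓ c)) ⟨ v ⟩ B A₁ ⟨ z ⟩ v∈ z∈A₁ z∈B)
                in (linear 2 (λ a b → (a ≼ num 1) ⇒ (num 2 ≼ b) ⇒ (b ≼ a) ⇒ ⊩⊥) (r (B ∩ A₁)) (r (⟨ z ⟩ ∪ ⟨ v ⟩)) h′ p
                  q)
              z∉A : z ∉ A
              z∉A = case z ∈? A of λ where
                (inj₂ g) → g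
                (inj₁ g) → ⊥-elim
                  (let q = mono {A₁} {A ∩ A₁} (sets 4 (λ a b c d → (𝟙 ⊑ a ⊔ b) ⇛ (c ⊑ a) ⇛ (b ⊓ d ⊑ c) ⇛ ⊢ (d ⊑ a ⊓
                         d)) A B ⟨ z ⟩ A₁ (cover s) g only) in (linear 4 (λ a b c d → (↑ a ≼ b) ⇒ (num 2 ⊕ b ≼ c ⊕ a)
                         ⇒ (d ≼ num 2) ⇒ (c ≼ d) ⇒ ⊩⊥) (r B₁) ρ (r A₁) (r (A ∩ A₁)) (ltB s₁) (low s₁) h q))
          in
          extend ck₁ s₁ sm₂ z∈A₁ z∉B₁ λ (k₂ , _ , zk , _) →
          non-W-sep zk (not-W z∉F) λ (_ , _ , s₀) →
          let A₂ , B₂ , s₂ , c∈A₂ = oriented c s₀ in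
          conf s₁ plane (supply-of ck₁ s₁ sm₂) z∈A₁ z∉B₁ z∉F s₂ c∈A₂ λ cf →
          let p = simple {c} {d cf} (d≠y cf)
              t = spanned {A} {⟨ c ⟩ ∪ ⟨ d cf ⟩} {A₁ ∩ A₂} (flA s) (sets 6 (λ a b c d e f → (𝟙 ⊑ a ⊔ b) ⇛ (c ⊑ d) ⇛ (c
                ⊑ ∼ e) ⇛ (f ⊑ a ⊓ ∼ b) ⇛ (b ⊓ d ⊑ e) ⇛ ⊢ (f ⊔ c ⊑ a)) A B ⟨ Separations.Conf.d cf ⟩ A₁ ⟨ z ⟩ ⟨ c ⟩
                (cover s) (d∈P cf) (d≠c cf) c∈ only)
                    (sets 5 (λ a b c d e → (a ⊑ b) ⇛ (a ⊑ ∼ c) ⇛ (b ⊑ d ⊔ c) ⇛ (e ⊑ b) ⇛ (e ⊑ d) ⇛ ⊢ (a ⊔ e ⊑ b ⊓ d))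
                      ⟨ c ⟩ A₁ B₂ A₂ ⟨ Separations.Conf.d cf ⟩ (inA s₁) (y∉B cf) (P⊆AB cf) (d∈P cf) (d∈A cf)) (linear
                      2 (λ a b → (a ≼ num 2) ⇒ (num 2 ≼ b) ⇒ ⊩ (a ≼ b)) (r (A₁ ∩ A₂)) (r (⟨ c ⟩ ∪ ⟨ Separations.Conf.d
                      cf ⟩)) (lA2 cf) p)
              z∈A₂ = inA s₂
          in (nonempty (sets 4 (λ a b c d → (a ⊑ b) ⇛ (a ⊑ ∼ c) ⇛ (b ⊓ d ⊑ c) ⇛ (a ⊑ d) ⇛ ⊢ (a ⊑ 𝟘)) ⟨ z ⟩ A₁ A A₂
            z∈A₁ z∉A t z∈A₂))

    -- Induction on the rank of the small side. If no smaller one of rank at least 4 exists, the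
    -- points of `A` outside `B` and `F` all have planes of the kind that `no-plane-field` excludes.
    no-solid : ∀ n {y k A B} → y ∉ F → y ∈ Con k → Sep y A B → Small k A B →
               r A ≤ n → 4 ≤ r A → ⊥
    no-solid zero    y∉F yk s sm₁ le ge with ≤-trans ge le
    ... | ()
    no-solid (suc n) {y} {k} {A} {B} y∉F yk s sm₁ le ge =
      escape s y∉F λ (c , c∈A , c∉B , c∉F) →
      no-plane-field (A ∩ ∁ B)
        (planes-inside yk s sm₁ ge
          (λ z∉F zk s′ sm′ lt ge′ → no-solid n z∉F zk s′ sm′ (≤-pred (≤-trans lt le)) ge′))
        c (sets 3 (λ a b c → (a ⊑ b) ⇛ (a ⊑ ∼ c) ⇛ ⊢ (a ⊑ b ⊓ ∼ c)) ⟨ c ⟩ A B c∈A c∉B) c∉F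

    plane-of : ∀ {c k} → c ∈ Con k → c ∉ F →
               ¬¬ (∃₂ λ P′ H → Sep c P′ H × r P′ ≤ 3 × Small k P′ H)
    plane-of {c} {k} ck c∉F K =
      non-W-sep ck (not-W c∉F) λ (A , B , s) →
      orient ck s λ where
        (inj₁ sm₁) → finish s sm₁
        (inj₂ sm₁) → finish (flip s) sm₁
      where
      finish : ∀ {A B} → Sep c A B → Small k A B → ⊥
      finish {A} {B} s sm₁ = case ≤-or-> (r A) 3 of λ where
        (inj₁ g) → K (A , B , s , g , sm₁)
        (inj₂ g) → no-solid (r A) c∉F ck s sm₁ ≤-refl g

    -- A plane at `y` and a plane at a second point found by `escape` clash in `no-two-planes`.
    -- Hence the contracted flat lies in `F`, which bounds its rank by that of `F`.
    exhausted : ∀ y k → y ∈ Con k → y ∈ F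
    exhausted y k yk = case y ∈? F of λ where
      (inj₁ h) → h
      (inj₂ y∉F) → ⊥-elim $
        plane-of yk y∉F λ (P′ , H , s , plane , sm₁) →
        escape s y∉F λ (z , z∈P , z∉H , z∉F) →
        extend yk s sm₁ z∈P z∉H λ (k₂ , _ , zk , _) →
        plane-of zk z∉F λ (P″ , H′ , s′ , plane′ , sm₂) →
        no-two-planes s plane yk sm₁ y∉F z∈P z∉H z∉F s′ plane′ zk sm₂

-- Free families of points and filaments

module FreeFamilies {P : Set} ⦃ _ : DecEq P ⦄ (M : Ranked P)
  (simple : ∀ {y z} → z ∉ ⟨ y ⟩ → 2 ≤ Ranked.r M (⟨ y ⟩ ∪ ⟨ z ⟩))
  (loopless : ∀ z → 1 ≤ Ranked.r M ⟨ z ⟩)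
  (vc3 : ∀ A B → 𝕌 ⊆ A ∪ B → Ranked.r M A < Ranked.r M 𝕌 → Ranked.r M B < Ranked.r M 𝕌 →
         2 + Ranked.r M 𝕌 ≤ Ranked.r M A + Ranked.r M B)
  (tangles : Separations.Tangles M simple vc3) where
  open Ranked M
  open Closure M
  open Separations M simple vc3
  open Crossings tangles
  open Tangles tangles
  open TwoLines M simple vc3 tangles
  open Filaments M simple vc3 tangles
  open Planes M simple vc3 tangles
  open Sep
  open Star
  open Filament
  open Alpha

  r-setOf : ∀ I → r (setOf I) ≤ length I
  r-setOf [] = r-∅
  r-setOf (z ∷ zs) = (linear 4 (λ a b c d → (a ≼ b) ⇒ (c ≼ num 1) ⇒ (d ≼ c ⊕ a) ⇒ ⊩ (d ≼ ↑ b)) (r (setOf zs)) (length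
    zs) (r ⟨ z ⟩) (r (⟨ z ⟩ ∪ setOf zs)) (r-setOf zs) (r-point z) (add ⟨ z ⟩ (setOf zs)))

  ⋃ : List (Sub P) → Sub P
  ⋃ []       = ∅
  ⋃ (l ∷ ls) = l ∪ ⋃ ls

  r-⋃ : ∀ {ls} → All Filament ls → r (⋃ ls) ≤ length ls + length ls
  r-⋃ [] = r-∅
  r-⋃ {l ∷ ls} (f ∷ fs) = (linear 4 (λ a b c d → (a ≼ b ⊕ b) ⇒ (c ≼ num 2) ⇒ (d ≼ c ⊕ a) ⇒ ⊩ (d ≼ ↑ b ⊕ ↑ b)) (r (⋃
    ls)) (length ls) (r l) (r (l ∪ ⋃ ls)) (r-⋃ fs) (l≤2 f) (add l (⋃ ls)))

  off-⋃ : ∀ {ls z} → All Filament ls → z ∈ ⋃ ls → ¬ W z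
  off-⋃ {[]} {z} [] h Wz = (nonempty (sets 1 (λ a → (a ⊑ 𝟘) ⇛ ⊢ (a ⊑ 𝟘)) ⟨ z ⟩ h))
  off-⋃ {l ∷ ls} {z} (f ∷ fs) h Wz = case z ∈? l of λ where
    (inj₁ g) → off-W f z g Wz
    (inj₂ g) → off-⋃ fs (sets 3 (λ a b c → (a ⊑ b ⊔ c) ⇛ (a ⊑ ∼ b) ⇛ ⊢ (a ⊑ c)) ⟨ z ⟩ l (⋃ ls) h g) Wz

  thick : ∀ {l} → Filament l → ∀ z → 2 ≤ r (l ∩ ∁ ⟨ z ⟩)
  thick {l} f z = case e₁ f ∈? ⟨ z ⟩ ,′ e₂ f ∈? ⟨ z ⟩ of λ where
      (inj₂ a , inj₂ b) → two (e₁ f) (e₂ f) (e₁∈ f) (e₂∈ f) a b (e₁≠e₂ f)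
      (inj₁ a , _) → two (e₂ f) (e₃ f) (e₂∈ f) (e₃∈ f)
        (avoid (e₁ f) (e₂ f) a (e₁≠e₂ f)) (avoid (e₁ f) (e₃ f) a (e₁≠e₃ f)) (e₂≠e₃ f)
      (inj₂ a , inj₁ b) → two (e₁ f) (e₃ f) (e₁∈ f) (e₃∈ f)
        a (avoid (e₂ f) (e₃ f) b (e₂≠e₃ f)) (e₁≠e₃ f)
    where
    two : ∀ a b → a ∈ l → b ∈ l → a ∉ ⟨ z ⟩ → b ∉ ⟨ z ⟩ → a ∉ ⟨ b ⟩ → 2 ≤ r (l ∩ ∁ ⟨ z ⟩)
    two a b al bl az bz ab =
      let p = simple {b} {a} ab
          m = mono {⟨ b ⟩ ∪ ⟨ a ⟩} {l ∩ ∁ ⟨ z ⟩} (sets 4 (λ a b c d → (a ⊑ b) ⇛ (c ⊑ b) ⇛ (a ⊑ ∼ d) ⇛ (c ⊑ ∼ d) ⇛ ⊢ (c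
            ⊔ a ⊑ b ⊓ ∼ d)) ⟨ a ⟩ l ⟨ b ⟩ ⟨ z ⟩ al bl az bz)
      in (linear 2 (λ a b → (num 2 ≼ a) ⇒ (a ≼ b) ⇒ ⊩ (num 2 ≼ b)) (r (⟨ b ⟩ ∪ ⟨ a ⟩)) (r (l ∩ ∁ ⟨ z ⟩)) p m)
    avoid : ∀ a b → a ∈ ⟨ z ⟩ → a ∉ ⟨ b ⟩ → b ∉ ⟨ z ⟩
    avoid a b a∈ a∉b = case same a∈ of λ where
      refl → case b ∈? ⟨ z ⟩ of λ where
        (inj₂ g) → g
        (inj₁ g) → ⊥-elim (nonempty (sets 2 (λ a b → (a ⊑ ∼ b) ⇛ (b ⊑ a) ⇛ ⊢ (b ⊑ 𝟘)) ⟨ a ⟩ ⟨ b ⟩ a∉b g))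

  -- A point has rank at most 1 and a filament at most 2, so `indep` forces the rank of the union to
  -- be the sum of the ranks: freeness in numerical form.
  record Family : Set where
    field
      I     : List P
      ls    : List (Sub P)
      I-W   : ∀ w → w ∈ setOf I → W w
      ls-F  : All Filament ls
      indep : length I + (length ls + length ls) ≤ r (setOf I ∪ ⋃ ls)
    span : Sub P
    span = cl (setOf I ∪ ⋃ ls)
    span-flat : Flat span
    span-flat = cl-flat _
    I⊆ : setOf I ⊆ span
    I⊆ = let p = ⊆cl (setOf I ∪ ⋃ ls) ; q : setOf I ⊆ cl (setOf I ∪ ⋃ ls) ; q = (sets 3 (λ a b c → (a ⊔ b ⊑ c) ⇛ ⊢ (a
               ⊑ c)) (setOf I) (⋃ ls) (cl (setOf I ∪ ⋃ ls)) p) in q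
    ls⊆ : ⋃ ls ⊆ span
    ls⊆ = let p = ⊆cl (setOf I ∪ ⋃ ls) ; q : ⋃ ls ⊆ cl (setOf I ∪ ⋃ ls) ; q = (sets 3 (λ a b c → (a ⊔ b ⊑ c) ⇛ ⊢ (b ⊑
                c)) (setOf I) (⋃ ls) (cl (setOf I ∪ ⋃ ls)) p) in q
    r-span : r span ≤ length I + (length ls + length ls)
    r-span = ≤-trans (r-cl (setOf I ∪ ⋃ ls)) (linear 5 (λ a b c d e → (a ≼ b ⊕ b) ⇒ (c ≼ d) ⇒ (e ≼ c ⊕ a) ⇒ ⊩ (e ≼ d ⊕
      (b ⊕ b))) (r (⋃ ls)) (length ls) (r (setOf I)) (length I) (r (setOf I ∪ ⋃ ls)) (r-⋃ ls-F) (r-setOf I) (add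
      (setOf I) (⋃ ls)))
    span-r : length I + (length ls + length ls) ≤ r span
    span-r = ≤-trans indep (mono (⊆cl (setOf I ∪ ⋃ ls)))
    size : ℕ
    size = length I + length ls
  open Family

  remove : ∀ I {x} → x ∈ setOf I → ∃ λ I′ → length I ≡ suc (length I′) ×
           setOf I ⊆ setOf I′ ∪ ⟨ x ⟩ × setOf I′ ⊆ setOf I
  remove [] {x} h = ⊥-elim (nonempty (sets 1 (λ a → (a ⊑ 𝟘) ⇛ ⊢ (a ⊑ 𝟘)) ⟨ x ⟩ h))
  remove (z ∷ zs) {x} h = case x ∈? ⟨ z ⟩ of λ where
    (inj₁ g) → case same g of λ where
      refl → zs , refl , (sets 2 (λ a b → ⊢ (a ⊔ b ⊑ b ⊔ a)) ⟨ z ⟩ (setOf zs)) , (sets 2 (λ a b → ⊢ (a ⊑ b ⊔ a))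
        (setOf zs) ⟨ z ⟩)
    (inj₂ g) → let I′ , e , p , q = remove zs {x} (sets 3 (λ a b c → (a ⊑ b ⊔ c) ⇛ (a ⊑ ∼ b) ⇛ ⊢ (a ⊑ c)) ⟨ x ⟩ ⟨ z ⟩
                     (setOf zs) h g) in
      z ∷ I′ , cong suc e , (sets 4 (λ a b c d → (a ⊑ b ⊔ c) ⇛ ⊢ (d ⊔ a ⊑ (d ⊔ b) ⊔ c)) (setOf zs) (setOf I′) ⟨ x ⟩ ⟨
        z ⟩ p) , (sets 3 (λ a b c → (a ⊑ b) ⇛ ⊢ (c ⊔ a ⊑ c ⊔ b)) (setOf I′) (setOf zs) ⟨ z ⟩ q)

  add-point : (f : Family) → ∀ w → W w → w ∉ span f →
              ∃ λ f′ → suc (r (span f)) ≤ r (span f′)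
  add-point f w Ww w∉ = f′ , ≤-trans (s≤s (r-span f)) (span-r f′)
    where
    o : suc (r (setOf (I f) ∪ ⋃ (ls f))) ≤ r ((setOf (I f) ∪ ⋃ (ls f)) ∪ ⟨ w ⟩)
    o = out (span-flat f) (⊆cl _) w∉
    f′ : Family
    f′ = record
      { I = w ∷ I f ; ls = ls f
      ; I-W = λ v h → case v ∈? ⟨ w ⟩ of λ where
          (inj₁ g) → case same g of λ where refl → Ww
          (inj₂ g) → I-W f v (sets 3 (λ a b c → (a ⊑ b ⊔ c) ⇛ (a ⊑ ∼ b) ⇛ ⊢ (a ⊑ c)) ⟨ v ⟩ ⟨ w ⟩ (setOf (I f)) h g)
      ; ls-F = ls-F f
      ; indep =
          let m = mono {(setOf (I f) ∪ ⋃ (ls f)) ∪ ⟨ w ⟩} {setOf (w ∷ I f) ∪ ⋃ (ls f)} (sets 4 (λ a b c d → (a ⊑ ∼ b)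
                ⇛ ⊢ ((c ⊔ d) ⊔ a ⊑ (a ⊔ c) ⊔ d)) ⟨ w ⟩ (span f) (setOf (I f)) (⋃ (ls f)) w∉)
          in (linear 5 (λ a b c d e → (↑ a ≼ b) ⇒ (d ⊕ (c ⊕ c) ≼ a) ⇒ (b ≼ e) ⇒ ⊩ (↑ d ⊕ (c ⊕ c) ≼ e)) (r (setOf (I f)
            ∪ ⋃ (ls f))) (r ((setOf (I f) ∪ ⋃ (ls f)) ∪ ⟨ w ⟩)) (length (ls f)) (length (I f)) (r ((⟨ w ⟩ ∪ setOf (I
            f)) ∪ ⋃ (ls f))) o (indep f) m) }

  -- Filaments of the family, and contractible points other than the tip `x`, lie in the hyperplane
  -- of the star at `y`. The span contains `x`, which the hyperplane misses, so `x` must be among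
  -- the chosen points. Replacing it by `l` takes away one and adds two.
  swap : (f : Family) → (∀ w → W w → w ∈ span f) →
         ∀ {l y} → Filament l → y ∈ l → y ∉ span f →
         ¬¬ (∃ λ f′ → suc (r (span f)) ≤ r (span f′))
  swap f W⊆ {l} {y} fl y∈l y∉ K = star fl y y∈l λ st →
      case x st ∈? setOf (I f) of λ where
        (inj₁ g) → with-x st g
        (inj₂ g) → without-x st g
    where
    module _ (st : Star l y) where
      -- A point of another filament outside the hyperplane is not the tip, so it is on `l`. Two
      -- such points would bring `l` into the span; hence all points but one, and so the whole
      -- filament, lie in the hyperplane.
      members : ∀ {ls} → All Filament ls → ⋃ ls ⊆ span f → ⋃ ls ⊆ H st
      members {[]} [] _ = (sets 1 (λ a → ⊢ (𝟘 ⊑ a)) (H st))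
      members {l′ ∷ ls} (f′ ∷ fs) sub′ =
        let rest = members fs (sets 3 (λ a b c → (a ⊔ b ⊑ c) ⇛ ⊢ (b ⊑ c)) l′ (⋃ ls) (span f) sub′)
            here′ : l′ ⊆ H st
            here′ = ⊆-intro λ z z∈ z∉ →
              case z ∈? ⟨ x st ⟩ of λ where
                (inj₁ g) → case same g of λ where refl → off-W f′ z z∈ (Wx st)
                (inj₂ z≠x) →
                  let z∈l : z ∈ l
                      z∈l = (sets 5 (λ a b c d e → (∼ a ⊑ b ⊓ ∼ c ⊔ d) ⇛ (e ⊑ ∼ a) ⇛ (e ⊑ ∼ d) ⇛ ⊢ (e ⊑ b)) (H st) l ⟨
                        y ⟩ ⟨ x st ⟩ ⟨ z ⟩ (C⊆ st) z∉ z≠x)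
                      inner : l′ ∩ ∁ ⟨ z ⟩ ⊆ H st
                      inner = ⊆-intro λ p p∈ p∉ →
                        case p ∈? ⟨ x st ⟩ of λ where
                          (inj₁ g) → case same g of λ where refl → off-W f′ p (sets 3 (λ a b c → (a ⊑ b ⊓ ∼ c) ⇛ ⊢ (a
                                                              ⊑ b)) ⟨ x st ⟩ l′ ⟨ z ⟩ p∈) (Wx st)
                          (inj₂ p≠x) →
                            let pz = simple {z} {p} (sets 3 (λ a b c → (a ⊑ b ⊓ ∼ c) ⇛ ⊢ (a ⊑ ∼ c)) ⟨ p ⟩ l′ ⟨ z ⟩ p∈)
                                t = spanned {span f} {⟨ z ⟩ ∪ ⟨ p ⟩} {l} (span-flat f) (sets 5 (λ a b c d e → (a ⊔ b ⊑
                                  c) ⇛ (d ⊑ a) ⇛ (e ⊑ a ⊓ ∼ d) ⇛ ⊢ (d ⊔ e ⊑ c)) l′ (⋃ ls) (span f) ⟨ z ⟩ ⟨ p ⟩ sub′ z∈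
                                  p∈)
                                      (sets 6 (λ a b c d e f → (∼ a ⊑ b ⊓ ∼ c ⊔ d) ⇛ (e ⊑ ∼ a) ⇛ (e ⊑ ∼ d) ⇛ (f ⊑ ∼ a)
                                        ⇛ (f ⊑ ∼ d) ⇛ ⊢ (e ⊔ f ⊑ b)) (H st) l ⟨ y ⟩ ⟨ x st ⟩ ⟨ z ⟩ ⟨ p ⟩ (C⊆ st) z∉
                                        z≠x p∉ p≠x) (linear 2 (λ a b → (a ≼ num 2) ⇒ (num 2 ≼ b) ⇒ ⊩ (a ≼ b)) (r l) (r
                                        (⟨ z ⟩ ∪ ⟨ p ⟩)) (l≤2 fl) pz)
                            in (nonempty (sets 3 (λ a b c → (a ⊑ b) ⇛ (a ⊑ ∼ c) ⇛ (b ⊑ c) ⇛ ⊢ (a ⊑ 𝟘)) ⟨ y ⟩ l (span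
                              f) y∈l y∉ t))
                      t = spanned {H st} {l′ ∩ ∁ ⟨ z ⟩} {l′} (H-flat st) inner (sets 2 (λ a b → ⊢ (a ⊓ ∼ b ⊑ a)) l′ ⟨
                        z ⟩) (linear 2 (λ a b → (a ≼ num 2) ⇒ (num 2 ≼ b) ⇒ ⊩ (a ≼ b)) (r l′) (r (l′ ∩ ∁ ⟨ z ⟩)) (l≤2
                        f′) (thick f′ z))
                  in (nonempty (sets 3 (λ a b c → (a ⊑ b) ⇛ (a ⊑ ∼ c) ⇛ (b ⊑ c) ⇛ ⊢ (a ⊑ 𝟘)) ⟨ z ⟩ l′ (H st) z∈ z∉ t))
        in (sets 3 (λ a b c → (a ⊑ b) ⇛ (c ⊑ b) ⇛ ⊢ (c ⊔ a ⊑ b)) (⋃ ls) (H st) l′ rest here′)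
      Λ⊆H : ⋃ (ls f) ⊆ H st
      Λ⊆H = members (ls-F f) (ls⊆ f)
      W⊆H : ∀ w → W w → w ∉ ⟨ x st ⟩ → w ∈ H st
      W⊆H w Ww w≠x = case w ∈? H st of λ where
        (inj₁ g) → g
        (inj₂ g) → ⊥-elim (off-W fl w (sets 5 (λ a b c d e → (∼ a ⊑ b ⊓ ∼ c ⊔ d) ⇛ (e ⊑ ∼ d) ⇛ (e ⊑ ∼ a) ⇛ ⊢ (e ⊑ b))
          (H st) l ⟨ y ⟩ ⟨ x st ⟩ ⟨ w ⟩ (C⊆ st) w≠x g) Ww)
      without-x : x st ∉ setOf (I f) → ⊥
      without-x x∉I =
        let I⊆H : setOf (I f) ⊆ H st
            I⊆H = ⊆-intro λ w w∈ w∉ → let h = W⊆H w (I-W f w w∈) (sets 3 (λ a b c → (a ⊑ ∼ b) ⇛ (c ⊑ b) ⇛ ⊢ (c ⊑ ∼ a))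
                                            ⟨ x st ⟩ (setOf (I f)) ⟨ w ⟩ x∉I w∈) in (nonempty (sets 2 (λ a b → (a ⊑ ∼
                                            b) ⇛ (a ⊑ b) ⇛ ⊢ (a ⊑ 𝟘)) ⟨ w ⟩ (H st) w∉ h))
            t = spanned {H st} {setOf (I f) ∪ ⋃ (ls f)} {span f} (H-flat st) (sets 3 (λ a b c → (a ⊑ b) ⇛ (c ⊑ b) ⇛ ⊢
              (a ⊔ c ⊑ b)) (setOf (I f)) (H st) (⋃ (ls f)) I⊆H Λ⊆H) (⊆cl _) (r-cl _)
            x∈s = W⊆ (x st) (Wx st)
            x∉ = x∉H st
        in nonempty {z = x st} (sets 3 (λ a b c → (a ⊑ b) ⇛ (c ⊑ a) ⇛ (c ⊑ ∼ b) ⇛ ⊢ (c ⊑ 𝟘)) (span f) (H st) ⟨ x st ⟩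
          t x∈s x∉)
      with-x : x st ∈ setOf (I f) → ⊥
      with-x x∈I with remove (I f) x∈I
      ... | I′ , e , p , q = K (f′ , grown)
        where
        S′ = setOf I′ ∪ ⋃ (ls f)
        x∉I′ : x st ∉ setOf I′
        x∉I′ = case x st ∈? setOf I′ of λ where
          (inj₂ g) → g
          (inj₁ g) → ⊥-elim
            (let m = mono {setOf (I f) ∪ ⋃ (ls f)} {setOf I′ ∪ ⋃ (ls f)} (sets 4 (λ a b c d → (a ⊑ b ⊔ c) ⇛ (c ⊑ b) ⇛
                   ⊢ (a ⊔ d ⊑ b ⊔ d)) (setOf (I f)) (setOf I′) ⟨ x st ⟩ (⋃ (ls f)) p g) in (linear 7 (λ a b c d e f g
                   → (a ≼ b ⊕ b) ⇒ (c ≼ d) ⇒ (e ≼ c ⊕ a) ⇒ (f ⊕ (b ⊕ b) ≼ g) ⇒ (↑ d ≼ f) ⇒ (g ≼ e) ⇒ ⊩⊥) (r (⋃ (ls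
                   f))) (length (ls f)) (r (setOf I′)) (length I′) (r (setOf I′ ∪ ⋃ (ls f))) (length (I f)) (r (setOf
                   (I f) ∪ ⋃ (ls f))) (r-⋃ (ls-F f)) (r-setOf I′) (add (setOf I′) (⋃ (ls f))) (indep f) (≤-reflexive
                   (sym e)) m))
        I′⊆H : setOf I′ ⊆ H st
        I′⊆H = ⊆-intro λ w w∈ w∉ → let h = W⊆H w (I-W f w (sets 3 (λ a b c → (a ⊑ b) ⇛ (c ⊑ a) ⇛ ⊢ (c ⊑ b)) (setOf I′)
                                         (setOf (I f)) ⟨ w ⟩ q w∈)) (sets 3 (λ a b c → (a ⊑ b) ⇛ (c ⊑ ∼ b) ⇛ ⊢ (a ⊑ ∼
                                         c)) ⟨ w ⟩ (setOf I′) ⟨ x st ⟩ w∈ x∉I′) in (nonempty (sets 2 (λ a b → (a ⊑ ∼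
                                         b) ⇛ (a ⊑ b) ⇛ ⊢ (a ⊑ 𝟘)) ⟨ w ⟩ (H st) w∉ h))
        -- `y` is outside the span; a further point `v` of `l` is outside the hyperplane, which
        -- contains all the rest and `y`.
        grow : 2 + r (setOf I′ ∪ ⋃ (ls f)) ≤ r (setOf I′ ∪ (l ∪ ⋃ (ls f)))
        grow = ≤-by-contra λ lt →
          ⊈-witness (λ h → let m = mono {l ∩ ∁ ⟨ y ⟩} {∅} h in (linear 2 (λ a b → (a ≼ num 0) ⇒ (num 2 ≼ b) ⇒ (b ≼ a)
                                 ⇒ ⊩⊥) (r ∅) (r (l ∩ ∁ ⟨ y ⟩)) r-∅ (thick fl y) m)) λ (v , v∈ , _) →
          let o₁ = out {span f} {setOf I′ ∪ ⋃ (ls f)} {y} (span-flat f) (sets 4 (λ a b c d → (a ⊑ b) ⇛ (c ⊑ b) ⇛ (d ⊑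
                c) ⇛ ⊢ (d ⊔ a ⊑ b)) (⋃ (ls f)) (span f) (setOf (I f)) (setOf I′) (ls⊆ f) (I⊆ f) q) y∉
              o₂ = out {H st} {(setOf I′ ∪ ⋃ (ls f)) ∪ ⟨ y ⟩} {v} (H-flat st) (sets 4 (λ a b c d → (a ⊑ b) ⇛ (c ⊑ b) ⇛
                (d ⊑ b) ⇛ ⊢ ((d ⊔ c) ⊔ a ⊑ b)) ⟨ y ⟩ (H st) (⋃ (ls f)) (setOf I′) (z∈H st) Λ⊆H I′⊆H) (sets 4 (λ a b c
                d → (a ⊓ ∼ b ⊑ ∼ c) ⇛ (d ⊑ a ⊓ ∼ b) ⇛ ⊢ (d ⊑ ∼ c)) l ⟨ y ⟩ (H st) ⟨ v ⟩ (⊆C st) v∈)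
              m = mono {((setOf I′ ∪ ⋃ (ls f)) ∪ ⟨ y ⟩) ∪ ⟨ v ⟩} {setOf I′ ∪ (l ∪ ⋃ (ls f))} (sets 5 (λ a b c d e → (a
                ⊑ b) ⇛ (c ⊑ b ⊓ ∼ a) ⇛ ⊢ (((d ⊔ e) ⊔ a) ⊔ c ⊑ d ⊔ b ⊔ e)) ⟨ y ⟩ l ⟨ v ⟩ (setOf I′) (⋃ (ls f)) y∈l v∈)
          in (linear 4 (λ a b c d → (↑ a ≼ num 2 ⊕ b) ⇒ (↑ b ≼ c) ⇒ (↑ c ≼ d) ⇒ (d ≼ a) ⇒ ⊩⊥) (r (setOf I′ ∪ l ∪ ⋃ (ls
            f))) (r (setOf I′ ∪ ⋃ (ls f))) (r ((setOf I′ ∪ ⋃ (ls f)) ∪ ⟨ y ⟩)) (r (((setOf I′ ∪ ⋃ (ls f)) ∪ ⟨ y ⟩) ∪ ⟨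
            v ⟩)) lt o₁ o₂ m)
        drop : r (setOf (I f) ∪ ⋃ (ls f)) ≤ suc (r (setOf I′ ∪ ⋃ (ls f)))
        drop = let m = mono {setOf (I f) ∪ ⋃ (ls f)} {(setOf I′ ∪ ⋃ (ls f)) ∪ ⟨ x st ⟩} (sets 4 (λ a b c d → (a ⊑ b ⊔
                     c) ⇛ ⊢ (a ⊔ d ⊑ (b ⊔ d) ⊔ c)) (setOf (I f)) (setOf I′) ⟨ x st ⟩ (⋃ (ls f)) p)
               in (linear 3 (λ a b c → (a ≼ ↑ b) ⇒ (c ≼ a) ⇒ ⊩ (c ≼ ↑ b)) (r ((setOf I′ ∪ ⋃ (ls f)) ∪ ⟨ x st ⟩)) (r
                 (setOf I′ ∪ ⋃ (ls f))) (r (setOf (I f) ∪ ⋃ (ls f))) (step (setOf I′ ∪ ⋃ (ls f)) (x st)) m)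
        f′ : Family
        f′ = record
          { I = I′ ; ls = l ∷ ls f
          ; I-W = λ w h → I-W f w (sets 3 (λ a b c → (a ⊑ b) ⇛ (c ⊑ a) ⇛ ⊢ (c ⊑ b)) (setOf I′) (setOf (I f)) ⟨ w ⟩ q
            h)
          ; ls-F = fl ∷ ls-F f
          ; indep = (linear 6 (λ a b c d e f → (↑ a ≼ b) ⇒ (b ⊕ (c ⊕ c) ≼ d) ⇒ (d ≼ ↑ e) ⇒ (num 2 ⊕ e ≼ f) ⇒ ⊩ (a ⊕ (↑
            c ⊕ ↑ c) ≼ f)) (length I′) (length (I f)) (length (ls f)) (r (setOf (I f) ∪ ⋃ (ls f))) (r (setOf I′ ∪ ⋃
            (ls f))) (r (setOf I′ ∪ l ∪ ⋃ (ls f))) (≤-reflexive (sym e)) (indep f) drop grow) }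
        grown : suc (r (span f)) ≤ r (span f′)
        grown = ≤-trans g (span-r f′)
          where
          g : suc (r (span f)) ≤ length I′ + (suc (length (ls f)) + suc (length (ls f)))
          g = (linear 4 (λ a b c d → (a ≼ c ⊕ (b ⊕ b)) ⇒ (c ≼ ↑ d) ⇒ ⊩ (↑ a ≼ d ⊕ (↑ b ⊕ ↑ b))) (r (span f)) (length
            (ls f)) (length (I f)) (length I′) (r-span f) (≤-reflexive e))

  Saturated : Family → Set
  Saturated f = (∀ w → W w → w ∈ span f) × (∀ l → Filament l → l ⊆ span f)

  -- `n` bounds the corank of the span, and each addition or exchange raises the rank of the span.
  saturate : ∀ n (f : Family) → ρ ≤ n + r (span f) → ¬¬ (∃ Saturated)
  saturate n f h K =
    em (∃ λ w → W w × w ∉ span f) λ where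
      (inj₁ (w , Ww , w∉)) → let f′ , lt = add-point f w Ww w∉ in next n h w∉ f′ lt
      (inj₂ none) →
        let W⊆ : ∀ w → W w → w ∈ span f
            W⊆ w Ww = case w ∈? span f of λ where
              (inj₁ g) → g
              (inj₂ g) → ⊥-elim (none (w , Ww , g))
        in em (∃₂ λ l y → Filament l × y ∈ l × y ∉ span f) λ where
          (inj₁ (l , y , fl , y∈ , y∉)) → swap f W⊆ fl y∈ y∉ λ (f′ , lt) → next n h y∉ f′ lt
          (inj₂ none′) → K (f , W⊆ , λ l fl → ⊆-intro λ y y∈ y∉ → none′ (l , y , fl , y∈ , y∉))
    where
    next : ∀ n → ρ ≤ n + r (span f) → ∀ {z} → z ∉ span f →
           ∀ f′ → suc (r (span f)) ≤ r (span f′) → ⊥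
    next zero h {z} z∉ f′ lt =
      let o = out {span f} {span f} {z} (span-flat f) (sets 2 (λ a b → (a ⊑ ∼ b) ⇛ ⊢ (b ⊑ b)) ⟨ z ⟩ (span f) z∉) z∉
          m = mono {span f ∪ ⟨ z ⟩} {𝕌} (sets 2 (λ a b → (a ⊑ ∼ b) ⇛ ⊢ (b ⊔ a ⊑ 𝟙)) ⟨ z ⟩ (span f) z∉)
      in (linear 3 (λ a b c → (a ≼ num 0 ⊕ b) ⇒ (↑ b ≼ c) ⇒ (c ≼ a) ⇒ ⊩⊥) ρ (r (span f)) (r (span f ∪ ⟨ z ⟩)) h o m)
    next (suc n) h z∉ f′ lt = saturate n f′ (linear 4 (λ a b c d → (a ≼ ↑ c ⊕ b) ⇒ (↑ b ≼ d) ⇒ ⊩ (a ≼ c ⊕ d)) ρ (r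
      (span f)) n (r (span f′)) h lt) K

-- Chains of Alpha points outside the span

module AlphaChains {P : Set} ⦃ _ : DecEq P ⦄ (M : Ranked P)
  (simple : ∀ {y z} → z ∉ ⟨ y ⟩ → 2 ≤ Ranked.r M (⟨ y ⟩ ∪ ⟨ z ⟩))
  (loopless : ∀ z → 1 ≤ Ranked.r M ⟨ z ⟩)
  (vc3 : ∀ A B → 𝕌 ⊆ A ∪ B → Ranked.r M A < Ranked.r M 𝕌 → Ranked.r M B < Ranked.r M 𝕌 →
         2 + Ranked.r M 𝕌 ≤ Ranked.r M A + Ranked.r M B)
  (tangles : Separations.Tangles M simple vc3) where
  open Ranked M
  open Closure M
  open Separations M simple vc3
  open Crossings tangles
  open Tangles tangles
  open TwoLines M simple vc3 tangles
  open Filaments M simple vc3 tangles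
  open Planes M simple vc3 tangles
  open FreeFamilies M simple loopless vc3 tangles
  open Sep
  open Star
  open Filament
  open Alpha
  open Family

  -- A shared point costs one in submodularity, and the independence count has no slack.
  ⋃-disjoint : ∀ {l ls} → All Filament (l ∷ ls) →
               length (l ∷ ls) + length (l ∷ ls) ≤ r (⋃ (l ∷ ls)) → ⋃ ls ⊆ ∁ l
  ⋃-disjoint {l} {ls} (f ∷ fs) h = ⊆-intro λ z z∈ z∉ →
    let s = sm {l ∪ ⋃ ls} {⟨ z ⟩} l (⋃ ls) (sets 2 (λ a b → ⊢ (a ⊔ b ⊑ a ⊔ b)) l (⋃ ls)) (sets 3 (λ a b c → (a ⊑ b) ⇛
          (a ⊑ ∼ (∼ c)) ⇛ ⊢ (a ⊑ c ⊓ b)) ⟨ z ⟩ (⋃ ls) l z∈ z∉)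
    in (linear 5 (λ a b c d e → (a ≼ num 2) ⇒ (b ≼ c ⊕ c) ⇒ (num 1 ≼ d) ⇒ (↑ c ⊕ ↑ c ≼ e) ⇒ (e ⊕ d ≼ a ⊕ b) ⇒ ⊩⊥) (r
      l) (r (⋃ ls)) (length ls) (r ⟨ z ⟩) (r ((l ∪ ⋃ ls))) (l≤2 f) (r-⋃ fs) (loopless z) h s)

  -- Independence over the complement of `S`: the hyperplanes of the stars at `e₁` and `e₂` contain
  -- `∁ S` and the later filaments, since the tips are contractible and thus in `S`. Each contains
  -- its own point and misses the other, so both points raise the rank.
  ∁-grows : ∀ S → (∀ w → W w → w ∈ S) → ∀ ls → All Filament ls →
            length ls + length ls ≤ r (⋃ ls) → ⋃ ls ⊆ S →
            r (∁ S) + (length ls + length ls) ≤ r (∁ S ∪ ⋃ ls)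
  ∁-grows S W⊆S [] [] h sub′ = (linear 2 (λ a b → (a ≼ b) ⇒ ⊩ (a ⊕ (num 0 ⊕ num 0) ≼ b)) (r (∁ S)) (r (∁ S ∪ ∅)) (mono
    {∁ S} {∁ S ∪ ∅} (sets 1 (λ a → ⊢ (a ⊑ a ⊔ 𝟘)) (∁ S))))
  ∁-grows S W⊆S (l ∷ ls) (f ∷ fs) h sub′ = ≤-by-contra λ lt →
      star f (e₁ f) (e₁∈ f) λ s₁ →
      star f (e₂ f) (e₂∈ f) λ s₂ →
      let e₁∉H₂ : e₁ f ∉ H s₂
          e₁∉H₂ = (sets 4 (λ a b c d → (a ⊑ ∼ b) ⇛ (c ⊓ ∼ b ⊑ ∼ d) ⇛ (a ⊑ c) ⇛ ⊢ (a ⊑ ∼ d)) ⟨ e₁ f ⟩ ⟨ e₂ f ⟩ l (H s₂)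
            (e₁≠e₂ f) (⊆C s₂) (e₁∈ f))
          e₂∉H₁ : e₂ f ∉ H s₁
          e₂∉H₁ = (sets 4 (λ a b c d → (a ⊑ ∼ b) ⇛ (b ⊑ c) ⇛ (c ⊓ ∼ a ⊑ ∼ d) ⇛ ⊢ (b ⊑ ∼ d)) ⟨ e₁ f ⟩ ⟨ e₂ f ⟩ l (H s₁)
            (e₁≠e₂ f) (e₂∈ f) (⊆C s₁))
          h₁ = avoids s₁
          h₂ = avoids s₂
          o₁ = out {H s₂} {∁ S ∪ ⋃ ls} {e₁ f} (H-flat s₂) h₂ e₁∉H₂
          o₂ = out {H s₁} {(∁ S ∪ ⋃ ls) ∪ ⟨ e₁ f ⟩} {e₂ f} (H-flat s₁) (sets 4 (λ a b c d → (a ⊑ b) ⇛ (∼ c ⊔ d ⊑ b) ⇛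
            ⊢ ((∼ c ⊔ d) ⊔ a ⊑ b)) ⟨ e₁ f ⟩ (H s₁) S (⋃ ls) (z∈H s₁) h₁) e₂∉H₁
          m = mono {((∁ S ∪ ⋃ ls) ∪ ⟨ e₁ f ⟩) ∪ ⟨ e₂ f ⟩} {∁ S ∪ (l ∪ ⋃ ls)} (sets 5 (λ a b c d e → (a ⊑ b) ⇛ (c ⊑ b)
            ⇛ ⊢ (((∼ d ⊔ e) ⊔ a) ⊔ c ⊑ ∼ d ⊔ b ⊔ e)) ⟨ e₁ f ⟩ l ⟨ e₂ f ⟩ S (⋃ ls) (e₁∈ f) (e₂∈ f))
          IH = ∁-grows S W⊆S ls fs tail (sets 3 (λ a b c → (a ⊔ b ⊑ c) ⇛ ⊢ (b ⊑ c)) l (⋃ ls) S sub′)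
      in (linear 6 (λ a b c d e f → (↑ a ≼ c ⊕ (↑ b ⊕ ↑ b)) ⇒ (↑ d ≼ e) ⇒ (↑ e ≼ f) ⇒ (f ≼ a) ⇒ (c ⊕ (b ⊕ b) ≼ d) ⇒
        ⊩⊥) (r (∁ S ∪ (l ∪ ⋃ ls))) (length ls) (r (∁ S)) (r (∁ S ∪ ⋃ ls)) (r ((∁ S ∪ ⋃ ls) ∪ ⟨ e₁ f ⟩)) (r (((∁ S ∪ ⋃
        ls) ∪ ⟨ e₁ f ⟩) ∪ ⟨ e₂ f ⟩)) lt o₁ o₂ m IH)
    where
    tail : length ls + length ls ≤ r (⋃ ls)
    tail = (linear 4 (λ a b c d → (a ≼ num 2) ⇒ (b ≼ a ⊕ c) ⇒ (↑ d ⊕ ↑ d ≼ b) ⇒ ⊩ (d ⊕ d ≼ c)) (r l) (r (l ∪ ⋃ ls)) (r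
      (⋃ ls)) (length ls) (l≤2 f) (add l (⋃ ls)) h)
    disj : ⋃ ls ⊆ ∁ l
    disj = ⋃-disjoint (f ∷ fs) h
    avoids : ∀ {z} (s : Star l z) → ∁ S ∪ ⋃ ls ⊆ H s
    avoids {z} s = ⊆-intro λ v v∈ v∉ →
      case v ∈? ⟨ x s ⟩ of λ where
        (inj₁ g) → case same g of λ where
          refl → let xS = W⊆S (x s) (Wx s) in off-⋃ fs (sets 3 (λ a b c → (a ⊑ ∼ b ⊔ c) ⇛ (a ⊑ b) ⇛ ⊢ (a ⊑ c)) ⟨ x s ⟩
                       S (⋃ ls) v∈ xS) (Wx s)
        (inj₂ g) → (nonempty (sets 7 (λ a b c d e f g → (a ⊔ b ⊑ c) ⇛ (∼ d ⊑ a ⊓ ∼ e ⊔ f) ⇛ (g ⊑ ∼ c ⊔ b) ⇛ (g ⊑ ∼ d)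
          ⇛ (g ⊑ ∼ f) ⇛ (b ⊑ ∼ a) ⇛ ⊢ (g ⊑ 𝟘)) l (⋃ ls) S (H s) ⟨ z ⟩ ⟨ x s ⟩ ⟨ v ⟩ sub′ (C⊆ s) v∈ v∉ g disj))

  -- `F` is the span enlarged by `τ` Alpha points, and `B` is what remains of the complement of the
  -- span when their lines are removed. `B≤` is the dual count: each filament and each Alpha line
  -- costs the complement two. `big` is the relation between `τ` and the number of chosen points on
  -- which the final count rests.
  record Chain (f : Family) (τ : ℕ) : Set where
    field
      F B    : Sub P
      F-flat : Flat F
      span⊆F : span f ⊆ F
      F≤     : r F ≤ (length (I f) + (length (ls f) + length (ls f))) + τ
      cov    : 𝕌 ⊆ F ∪ B
      B⊆     : B ⊆ ∁ (span f)
      B≤     : r B + ((length (ls f) + length (ls f)) + (τ + τ)) ≤ ρ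
      big    : τ ≡ 0 ⊎ 2 + τ ≤ length (I f)
  open Chain

  start : ∀ f → Saturated f → Chain f 0
  start f (W⊆ , _) = record
    { F = span f ; B = ∁ (span f) ; F-flat = span-flat f ; span⊆F = (sets 1 (λ a → ⊢ (a ⊑ a)) (span f))
    ; F≤ = (linear 3 (λ a b c → (a ≼ c ⊕ (b ⊕ b)) ⇒ ⊩ (a ≼ c ⊕ (b ⊕ b) ⊕ num 0)) (r (span f)) (length (ls f)) (length
      (I f)) (r-span f))
    ; cov = (sets 1 (λ a → ⊢ (𝟙 ⊑ a ⊔ ∼ a)) (span f)) ; B⊆ = (sets 1 (λ a → ⊢ (∼ a ⊑ ∼ a)) (span f))
    ; B≤ = (linear 4 (λ a b c d → (a ≼ b) ⇒ (d ⊕ (c ⊕ c) ≼ a) ⇒ ⊩ (d ⊕ (c ⊕ c ⊕ (num 0 ⊕ num 0)) ≼ b)) (r (∁ (span f)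
      ∪ ⋃ (ls f))) ρ (length (ls f)) (r (∁ (span f))) m g)
    ; big = inj₁ refl }
    where
    g = ∁-grows (span f) W⊆ (ls f) (ls-F f)
      (linear 5 (λ a b c d e → (a ≼ b) ⇒ (c ≼ a ⊕ d) ⇒ (b ⊕ (e ⊕ e) ≼ c) ⇒ ⊩ (e ⊕ e ≼ d)) (r (setOf (I f))) (length (I
        f)) (r (setOf (I f) ∪ ⋃ (ls f))) (r (⋃ (ls f))) (length (ls f)) (r-setOf (I f)) (add (setOf (I f)) (⋃ (ls f)))
        (indep f)) (ls⊆ f)
    m = mono {∁ (span f) ∪ ⋃ (ls f)} {𝕌} (sets 1 (λ a → ⊢ (a ⊑ 𝟙)) _)

  -- `w`, `u₁` and `u₂` are contractible, hence in the span. So what is left of `B` off the line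
  -- lies in `H₁` and `H₂`; `y` escapes `H₂`, and then `c′` escapes `H₁`, a loss of two. On the
  -- other side `y` and `w` bring the whole line into the new `F`, which keeps the cover.
  lengthen : ∀ {f τ} → Saturated f → (ch : Chain f τ) → ∀ {y} → Alpha y → y ∉ F ch →
             ∃ λ (ch′ : Chain f (suc τ)) → suc (r (F ch)) ≤ r (F ch′)
  lengthen {f} {τ} (W⊆ , _) ch {y} α y∉F = ch′ , ≤-trans o (mono (⊆cl (F ch ∪ ⟨ y ⟩)))
    where
    w∈ = W⊆ (w α) (Ww α)
    u₁∈ = W⊆ (u₁ α) (Wu₁ α)
    u₂∈ = W⊆ (u₂ α) (Wu₂ α)
    w∈F : w α ∈ F ch
    w∈F = (sets 4 (λ a b c d → (𝟙 ⊑ a ⊔ b) ⇛ (b ⊑ ∼ c) ⇛ (d ⊑ c) ⇛ ⊢ (d ⊑ a)) (F ch) (B ch) (span f) ⟨ w α ⟩ (cov ch)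
      (B⊆ ch) w∈)
    o : suc (r (F ch)) ≤ r (F ch ∪ ⟨ y ⟩)
    o = out {F ch} {F ch} {y} (F-flat ch) (sets 1 (λ a → ⊢ (a ⊑ a)) (F ch)) y∉F
    wy = simple {w α} {y} (sets 3 (λ a b c → (a ⊑ b) ⇛ (c ⊑ ∼ b) ⇛ ⊢ (c ⊑ ∼ a)) ⟨ w α ⟩ (F ch) ⟨ y ⟩ w∈F y∉F)
    wc = simple {w α} {c′ α} (w≠c α)
    c∉F : c′ α ∉ F ch
    c∉F = case c′ α ∈? F ch of λ where
      (inj₂ g) → g
      (inj₁ g) → ⊥-elim
        (let t = spanned {F ch} {⟨ w α ⟩ ∪ ⟨ c′ α ⟩} {l α} (F-flat ch) (sets 3 (λ a b c → (a ⊑ b) ⇛ (c ⊑ b) ⇛ ⊢ (c ⊔ a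
               ⊑ b)) ⟨ c′ α ⟩ (F ch) ⟨ w α ⟩ g w∈F) (sets 3 (λ a b c → (a ⊑ b) ⇛ (c ⊑ b) ⇛ ⊢ (c ⊔ a ⊑ b)) ⟨ c′ α ⟩ (l
               α) ⟨ w α ⟩ (c∈l α) (w∈l α)) (linear 2 (λ a b → (num 2 ≼ a) ⇒ (b ≼ num 2) ⇒ ⊩ (b ≼ a)) (r (⟨ w α ⟩ ∪ ⟨
               c′ α ⟩)) (r (l α)) wc (l≤2 α))
         in (nonempty (sets 3 (λ a b c → (a ⊑ b) ⇛ (a ⊑ ∼ c) ⇛ (b ⊑ c) ⇛ ⊢ (a ⊑ 𝟘)) ⟨ y ⟩ (l α) (F ch) (y∈l α) y∉F
           t)))
    B′ = B ch ∩ ∁ (l α)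
    B₁⊆ : B ch ∩ ∁ (l α) ⊆ H₁ α
    B₁⊆ = (sets 5 (λ a b c d e → (a ⊑ ∼ b) ⇛ (c ⊑ b) ⇛ (∼ d ⊑ e ⊔ c) ⇛ ⊢ (a ⊓ ∼ e ⊑ d)) (B ch) (span f) ⟨ u₁ α ⟩ (H₁
      α) (l α) (B⊆ ch) u₁∈ (C₁⊆ α))
    B₂⊆ : B ch ∩ ∁ (l α) ⊆ H₂ α
    B₂⊆ = (sets 5 (λ a b c d e → (a ⊑ ∼ b) ⇛ (c ⊑ b) ⇛ (∼ d ⊑ e ⊔ c) ⇛ ⊢ (a ⊓ ∼ e ⊑ d)) (B ch) (span f) ⟨ u₂ α ⟩ (H₂
      α) (l α) (B⊆ ch) u₂∈ (C₂⊆ α))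
    shrinks : 2 + r (B ch ∩ ∁ (l α)) ≤ r (B ch)
    shrinks =
      let o₁ = out {H₂ α} {B ch ∩ ∁ (l α)} {y} (H₂-flat α) B₂⊆ (y∉H₂ α)
          o₂ = out {H₁ α} {(B ch ∩ ∁ (l α)) ∪ ⟨ y ⟩} {c′ α} (H₁-flat α) (sets 4 (λ a b c d → (a ⊓ ∼ b ⊑ c) ⇛ (d ⊑ c) ⇛
            ⊢ (a ⊓ ∼ b ⊔ d ⊑ c)) (B ch) (l α) (H₁ α) ⟨ y ⟩ B₁⊆ (y∈H₁ α)) (c∉H₁ α)
          m = mono {((B ch ∩ ∁ (l α)) ∪ ⟨ y ⟩) ∪ ⟨ c′ α ⟩} {B ch} (sets 5 (λ a b c d e → (a ⊑ ∼ b) ⇛ (𝟙 ⊑ b ⊔ c) ⇛ (d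
            ⊑ ∼ b) ⇛ ⊢ ((c ⊓ ∼ e ⊔ d) ⊔ a ⊑ c)) ⟨ c′ α ⟩ (F ch) (B ch) ⟨ y ⟩ (l α) c∉F (cov ch) y∉F)
      in (linear 4 (λ a b c d → (↑ a ≼ b) ⇒ (↑ b ≼ c) ⇒ (c ≼ d) ⇒ ⊩ (num 2 ⊕ a ≼ d)) (r (B ch ∩ ∁ (l α))) (r (B ch ∩ ∁
        (l α) ∪ ⟨ y ⟩)) (r ((B ch ∩ ∁ (l α) ∪ ⟨ y ⟩) ∪ ⟨ c′ α ⟩)) (r (B ch)) o₁ o₂ m)
    l⊆F′ : l α ⊆ cl (F ch ∪ ⟨ y ⟩)
    l⊆F′ = spanned {cl (F ch ∪ ⟨ y ⟩)} {⟨ w α ⟩ ∪ ⟨ y ⟩} {l α} (cl-flat _) (sets 4 (λ a b c d → (a ⊑ b) ⇛ (b ⊔ c ⊑ d)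
      ⇛ ⊢ (a ⊔ c ⊑ d)) ⟨ w α ⟩ (F ch) ⟨ y ⟩ (cl (F ch ∪ ⟨ y ⟩)) w∈F (⊆cl (F ch ∪ ⟨ y ⟩))) (sets 3 (λ a b c → (a ⊑ b) ⇛
      (c ⊑ b) ⇛ ⊢ (c ⊔ a ⊑ b)) ⟨ y ⟩ (l α) ⟨ w α ⟩ (y∈l α) (w∈l α)) (linear 2 (λ a b → (num 2 ≼ a) ⇒ (b ≼ num 2) ⇒ ⊩
      (b ≼ a)) (r (⟨ w α ⟩ ∪ ⟨ y ⟩)) (r (l α)) wy (l≤2 α))
    -- `F` and `l ∪ (B − l)` cover and share `w`; contractibility asks for rank sum `3 + ρ`, and the
    -- upper bounds leave just `3 + τ` chosen points. Without filaments and for `τ = 0` the second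
    -- side might span, but then `w`, `u₁`, `u₂` are three independent points in the span of the
    -- chosen points.
    big′ : 3 + τ ≤ length (I f)
    big′ = case ≤-or-> (length (ls f) + τ) 0 of λ where
      (inj₁ le) →
        let m = mono {(⟨ w α ⟩ ∪ ⟨ u₁ α ⟩) ∪ ⟨ u₂ α ⟩} {span f} (sets 4 (λ a b c d → (a ⊑ b) ⇛ (c ⊑ b) ⇛ (d ⊑ b) ⇛ ⊢
              ((a ⊔ c) ⊔ d ⊑ b)) ⟨ w α ⟩ (span f) ⟨ u₁ α ⟩ ⟨ u₂ α ⟩ w∈ u₁∈ u₂∈)
        in (linear 5 (λ a b c d e → (a ≼ c ⊕ (b ⊕ b)) ⇒ (num 3 ≼ d) ⇒ (b ⊕ e ≼ num 0) ⇒ (b ⊕ e ≼ num 0) ⇒ (d ≼ a) ⇒ ⊩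
          (num 3 ⊕ e ≼ c)) (r (span f)) (length (ls f)) (length (I f)) (r ((⟨ w α ⟩ ∪ ⟨ u₁ α ⟩) ∪ ⟨ u₂ α ⟩)) τ (r-span
          f) (wuu α) le le m)
      (inj₂ gt) →
        let nF = mono {F ch ∪ ⟨ y ⟩} {𝕌} (sets 2 (λ a b → ⊢ (a ⊔ b ⊑ 𝟙)) (F ch) ⟨ y ⟩)
            c = proj₁ (Ww α) (l α ∪ (B ch ∩ ∁ (l α))) (F ch) (sets 3 (λ a b c → (𝟙 ⊑ a ⊔ b) ⇛ ⊢ (𝟙 ⊑ (c ⊔ b ⊓ ∼ c) ⊔
              a)) (F ch) (B ch) (l α) (cov ch)) (sets 3 (λ a b c → (a ⊑ b) ⇛ ⊢ (a ⊑ b ⊔ c ⊓ ∼ b)) ⟨ w α ⟩ (l α) (B ch)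
              (w∈l α)) w∈F
                  (linear 7 (λ a b c d e f g → (c ⊕ (b ⊕ b ⊕ (a ⊕ a)) ≼ d) ⇒ (num 2 ⊕ e ≼ c) ⇒ (f ≼ num 2) ⇒ (g ≼ f ⊕
                    e) ⇒ (num 1 ≼ b ⊕ a) ⇒ ⊩ (↑ g ≼ d)) τ (length (ls f)) (r (B ch)) ρ (r (B ch ∩ ∁ (l α))) (r (l α))
                    (r (l α ∪ B ch ∩ ∁ (l α))) (B≤ ch) shrinks (l≤2 α) (add (l α) (B ch ∩ ∁ (l α))) gt) (linear 3 (λ a
                    b c → (↑ a ≼ b) ⇒ (b ≼ c) ⇒ ⊩ (↑ a ≼ c)) (r (F ch)) (r (F ch ∪ ⟨ y ⟩)) ρ o nF)
        in (linear 9 (λ a b c d e f g h i → (num 3 ⊕ a ≼ c ⊕ b) ⇒ (b ≼ f ⊕ (e ⊕ e) ⊕ d) ⇒ (g ⊕ (e ⊕ e ⊕ (d ⊕ d)) ≼ a)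
          ⇒ (num 2 ⊕ h ≼ g) ⇒ (i ≼ num 2) ⇒ (c ≼ i ⊕ h) ⇒ ⊩ (num 3 ⊕ d ≼ f)) ρ (r (F ch)) (r (l α ∪ B ch ∩ ∁ (l α))) τ
          (length (ls f)) (length (I f)) (r (B ch)) (r (B ch ∩ ∁ (l α))) (r (l α)) c (F≤ ch) (B≤ ch) shrinks (l≤2 α)
          (add (l α) (B ch ∩ ∁ (l α))))
    ch′ : Chain f (suc τ)
    ch′ = record
      { F = cl (F ch ∪ ⟨ y ⟩) ; B = B ch ∩ ∁ (l α) ; F-flat = cl-flat _
      ; span⊆F = (sets 4 (λ a b c d → (a ⊔ b ⊑ c) ⇛ (d ⊑ a) ⇛ ⊢ (d ⊑ c)) (F ch) ⟨ y ⟩ (cl (F ch ∪ ⟨ y ⟩)) (span f)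
        (⊆cl (F ch ∪ ⟨ y ⟩)) (span⊆F ch))
      ; F≤ = (linear 6 (λ a b c d e f → (a ≼ d ⊕ (c ⊕ c) ⊕ b) ⇒ (e ≼ ↑ a) ⇒ (f ≼ e) ⇒ ⊩ (f ≼ d ⊕ (c ⊕ c) ⊕ ↑ b)) (r (F
        ch)) τ (length (ls f)) (length (I f)) (r (F ch ∪ ⟨ y ⟩)) (r (cl (F ch ∪ ⟨ y ⟩))) (F≤ ch) (step (F ch) y) (r-cl
        (F ch ∪ ⟨ y ⟩)))
      ; cov = (sets 5 (λ a b c d e → (a ⊔ b ⊑ c) ⇛ (d ⊑ c) ⇛ (𝟙 ⊑ a ⊔ e) ⇛ ⊢ (𝟙 ⊑ c ⊔ e ⊓ ∼ d)) (F ch) ⟨ y ⟩ (cl (F ch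
        ∪ ⟨ y ⟩)) (l α) (B ch) (⊆cl (F ch ∪ ⟨ y ⟩)) l⊆F′ (cov ch))
      ; B⊆ = (sets 3 (λ a b c → (a ⊑ ∼ b) ⇛ ⊢ (a ⊓ ∼ c ⊑ ∼ b)) (B ch) (span f) (l α) (B⊆ ch))
      ; B≤ = (linear 5 (λ a b c d e → (c ⊕ (b ⊕ b ⊕ (a ⊕ a)) ≼ d) ⇒ (num 2 ⊕ e ≼ c) ⇒ ⊩ (e ⊕ (b ⊕ b ⊕ (↑ a ⊕ ↑ a)) ≼
        d)) τ (length (ls f)) (r (B ch)) ρ (r (B ch ∩ ∁ (l α))) (B≤ ch) shrinks)
      ; big = inj₂ big′ }

-- From chains to a large family

module Counting {P : Set} ⦃ _ : DecEq P ⦄ (M : Ranked P)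
  (simple : ∀ {y z} → z ∉ ⟨ y ⟩ → 2 ≤ Ranked.r M (⟨ y ⟩ ∪ ⟨ z ⟩))
  (loopless : ∀ z → 1 ≤ Ranked.r M ⟨ z ⟩)
  (vc3 : ∀ A B → 𝕌 ⊆ A ∪ B → Ranked.r M A < Ranked.r M 𝕌 → Ranked.r M B < Ranked.r M 𝕌 →
         2 + Ranked.r M 𝕌 ≤ Ranked.r M A + Ranked.r M B)
  (tangles : Separations.Tangles M simple vc3) where
  open Ranked M
  open Closure M
  open Separations M simple vc3
  open Crossings tangles
  open Tangles tangles
  open TwoLines M simple vc3 tangles
  open Filaments M simple vc3 tangles
  open Planes M simple vc3 tangles
  open FreeFamilies M simple loopless vc3 tangles
  open AlphaChains M simple loopless vc3 tangles
  open Sep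
  open Star
  open Filament
  open Alpha
  open Family

  open Chain

  complete : ∀ n {f τ} → Saturated f → (ch : Chain f τ) → ρ ≤ n + r (F ch) →
             ¬¬ (∃ λ τ′ → Σ (Chain f τ′) λ ch′ → ∀ y → Alpha y → y ∈ F ch′)
  complete n {f} {τ} sat ch h K =
    em (∃ λ y → Alpha y × y ∉ F ch) λ where
      (inj₂ none) → K (τ , ch , λ y α → case y ∈? F ch of λ where
        (inj₁ g) → g
        (inj₂ g) → ⊥-elim (none (y , α , g)))
      (inj₁ (y , α , y∉)) → let ch′ , lt = lengthen sat ch α y∉ in next n h y∉ ch′ lt
    where
    next : ∀ n → ρ ≤ n + r (F ch) → ∀ {y} → y ∉ F ch → ∀ ch′ → suc (r (F ch)) ≤ r (F ch′) → ⊥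
    next zero h {y} y∉ ch′ lt =
      let o = out {F ch} {F ch} {y} (F-flat ch) (sets 1 (λ a → ⊢ (a ⊑ a)) (F ch)) y∉
          m = mono {F ch ∪ ⟨ y ⟩} {𝕌} (sets 2 (λ a b → ⊢ (a ⊔ b ⊑ 𝟙)) (F ch) ⟨ y ⟩)
      in (linear 3 (λ a b c → (a ≼ num 0 ⊕ b) ⇒ (↑ b ≼ c) ⇒ (c ≼ a) ⇒ ⊩⊥) ρ (r (F ch)) (r (F ch ∪ ⟨ y ⟩)) h o m)
    next (suc n) h y∉ ch′ lt = complete n sat ch′ (linear 4 (λ a b c d → (a ≼ ↑ c ⊕ b) ⇒ (↑ b ≼ d) ⇒ ⊩ (a ≼ c ⊕ d)) ρ
      (r (F ch)) n (r (F ch′)) h lt) K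

  -- A point of a filament has a separation, and two ranks below `ρ` with sum at least `ρ + 2` force
  -- `ρ` to be at least 4.
  4≤ρ : ∀ {l} → Filament l → 4 ≤ ρ
  4≤ρ {l} f = ≤-by-contra λ lt →
    non-W-sep {e₁ f} {copy f} (sets 3 (λ a b c → (a ⊑ b) ⇛ (c ⊑ a) ⇛ ⊢ (c ⊑ b)) l (Con (copy f)) ⟨ e₁ f ⟩ (l⊆Con f)
      (e₁∈ f)) (off-W f _ (e₁∈ f)) λ (A , B , s) → (linear 3 (λ a b c → (↑ a ≼ num 4) ⇒ (↑ b ≼ a) ⇒ (↑ c ≼ a) ⇒ (num 2
      ⊕ a ≼ b ⊕ c) ⇒ ⊩⊥) ρ (r A) (r B) lt (ltA s) (ltB s) (low s))

  -- With a common tip `x` the complement of `l ∪ x` would lie in both hyperplanes. These differ at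
  -- `a`, so its rank is at most `ρ − 2`, too little next to the rank at most 3 of `l ∪ x`.
  tips-distinct : ∀ {l a b} → Filament l → a ∈ l → b ∈ l → a ∉ ⟨ b ⟩ →
                  (s : Star l a) (t : Star l b) → ¬ (x s ≡ x t)
  tips-distinct {l} {a} {b} f a∈ b∈ a≠b s t e =
    let y₁ = subst (λ v → ∁ (H s) ⊆ (l ∩ ∁ ⟨ a ⟩) ∪ ⟨ v ⟩) e (C⊆ s)
        o = out {H t} {∁ (l ∪ ⟨ x t ⟩)} {a} (H-flat t) (sets 4 (λ a b c d → (∼ a ⊑ b ⊓ ∼ c ⊔ d) ⇛ ⊢ (∼ (b ⊔ d) ⊑ a))
          (H t) l ⟨ b ⟩ ⟨ x t ⟩ (C⊆ t)) (sets 4 (λ a b c d → (a ⊑ b) ⇛ (a ⊑ ∼ c) ⇛ (b ⊓ ∼ c ⊑ ∼ d) ⇛ ⊢ (a ⊑ ∼ d)) ⟨ a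
          ⟩ l ⟨ b ⟩ (H t) a∈ a≠b (⊆C t))
        m = mono {∁ (l ∪ ⟨ x t ⟩) ∪ ⟨ a ⟩} {H s} (sets 4 (λ a b c d → (a ⊑ b) ⇛ (∼ b ⊑ c ⊓ ∼ a ⊔ d) ⇛ ⊢ (∼ (c ⊔ d) ⊔ a
          ⊑ b)) ⟨ a ⟩ (H s) l ⟨ x t ⟩ (z∈H s) y₁)
        v = vc3 (l ∪ ⟨ x t ⟩) (∁ (l ∪ ⟨ x t ⟩)) (sets 2 (λ a b → ⊢ (𝟙 ⊑ (a ⊔ b) ⊔ ∼ (a ⊔ b))) l ⟨ x t ⟩) (linear 3 (λ
          a b c → (num 4 ≼ a) ⇒ (b ≼ num 2) ⇒ (c ≼ ↑ b) ⇒ ⊩ (↑ c ≼ a)) ρ (r l) (r (l ∪ ⟨ x t ⟩)) (4≤ρ f) (l≤2 f) (step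
          l (x t))) (linear 4 (λ a b c d → (↑ a ≼ b) ⇒ (↑ c ≼ d) ⇒ (d ≼ a) ⇒ ⊩ (↑ c ≼ b)) (r (H s)) ρ (r (∁ (l ∪ ⟨ x t
          ⟩))) (r (∁ (l ∪ ⟨ x t ⟩) ∪ ⟨ a ⟩)) (ltH s) o m)
    in (linear 6 (λ a b c d e f → (a ≼ num 2) ⇒ (b ≼ ↑ a) ⇒ (↑ c ≼ d) ⇒ (↑ e ≼ f) ⇒ (f ≼ c) ⇒ (num 2 ⊕ d ≼ b ⊕ e) ⇒
      ⊩⊥) (r l) (r (l ∪ ⟨ x t ⟩)) (r (H s)) ρ (r (∁ (l ∪ ⟨ x t ⟩))) (r (∁ (l ∪ ⟨ x t ⟩) ∪ ⟨ a ⟩)) (l≤2 f) (step l (x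
      t)) (ltH s) o m v)

  -- Each tip avoids its own hyperplane, which contains the other tips and the remaining filaments,
  -- so the three tips are independent over the rest. One member of the family becomes three.
  replace-filament : ∀ {l ls} → All Filament (l ∷ ls) →
    length (l ∷ ls) + length (l ∷ ls) ≤ r (⋃ (l ∷ ls)) →
    ¬¬ (∃ λ f → size f ≡ 3 + length ls)
  replace-filament {l} {ls} (f ∷ fs) h K =
    star f (e₁ f) (e₁∈ f) λ s₁ →
    star f (e₂ f) (e₂∈ f) λ s₂ →
    star f (e₃ f) (e₃∈ f) λ s₃ →
    let d₁₂ = apart (tips-distinct f (e₁∈ f) (e₂∈ f) (e₁≠e₂ f) s₁ s₂)
        d₁₃ = apart (tips-distinct f (e₁∈ f) (e₃∈ f) (e₁≠e₃ f) s₁ s₃)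
        d₂₃ = apart (tips-distinct f (e₂∈ f) (e₃∈ f) (e₂≠e₃ f) s₂ s₃)
        x₂∈H₁ : x s₂ ∈ H s₁
        x₂∈H₁ = tip s₁ s₂ d₁₂
        x₃∈H₁ : x s₃ ∈ H s₁
        x₃∈H₁ = tip s₁ s₃ d₁₃
        x₃∈H₂ : x s₃ ∈ H s₂
        x₃∈H₂ = tip s₂ s₃ d₂₃
        o₃ = out {H s₃} {⋃ ls} {x s₃} (H-flat s₃) (avoids s₃) (x∉H s₃)
        o₂ = out {H s₂} {⋃ ls ∪ ⟨ x s₃ ⟩} {x s₂} (H-flat s₂) (sets 3 (λ a b c → (a ⊑ b) ⇛ (c ⊑ b) ⇛ ⊢ (a ⊔ c ⊑ b)) (⋃
          ls) (H s₂) ⟨ x s₃ ⟩ (avoids s₂) x₃∈H₂) (x∉H s₂)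
        o₁ = out {H s₁} {(⋃ ls ∪ ⟨ x s₃ ⟩) ∪ ⟨ x s₂ ⟩} {x s₁} (H-flat s₁) (sets 4 (λ a b c d → (a ⊑ b) ⇛ (c ⊑ b) ⇛ (d
          ⊑ b) ⇛ ⊢ ((a ⊔ d) ⊔ c ⊑ b)) (⋃ ls) (H s₁) ⟨ x s₂ ⟩ ⟨ x s₃ ⟩ (avoids s₁) x₂∈H₁ x₃∈H₁) (x∉H s₁)
        m = mono {((⋃ ls ∪ ⟨ x s₃ ⟩) ∪ ⟨ x s₂ ⟩) ∪ ⟨ x s₁ ⟩} {(⟨ x s₁ ⟩ ∪ (⟨ x s₂ ⟩ ∪ (⟨ x s₃ ⟩ ∪ ∅))) ∪ ⋃ ls} (sets 4
          (λ a b c d → ⊢ (((a ⊔ b) ⊔ c) ⊔ d ⊑ (d ⊔ c ⊔ b ⊔ 𝟘) ⊔ a)) (⋃ ls) ⟨ x s₃ ⟩ ⟨ x s₂ ⟩ ⟨ x s₁ ⟩)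
        n = ⋃-size
        fin : 3 + (length ls + length ls) ≤ r ((⟨ x s₁ ⟩ ∪ (⟨ x s₂ ⟩ ∪ (⟨ x s₃ ⟩ ∪ ∅))) ∪ ⋃ ls)
        fin = (linear 6 (λ a b c d e f → (↑ a ≼ b) ⇒ (↑ b ≼ c) ⇒ (↑ c ≼ d) ⇒ (d ≼ e) ⇒ (f ⊕ f ≼ a) ⇒ ⊩ (num 3 ⊕ (f ⊕
          f) ≼ e)) (r (⋃ ls)) (r (⋃ ls ∪ ⟨ x s₃ ⟩)) (r ((⋃ ls ∪ ⟨ x s₃ ⟩) ∪ ⟨ x s₂ ⟩)) (r (((⋃ ls ∪ ⟨ x s₃ ⟩) ∪ ⟨ x s₂
          ⟩) ∪ ⟨ x s₁ ⟩)) (r ((⟨ x s₁ ⟩ ∪ ⟨ x s₂ ⟩ ∪ ⟨ x s₃ ⟩ ∪ ∅) ∪ ⋃ ls)) (length ls) o₃ o₂ o₁ m n)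
    in K (record
      { I = x s₁ ∷ x s₂ ∷ x s₃ ∷ [] ; ls = ls
      ; I-W = λ w w∈ → pick w s₁ s₂ s₃ w∈
      ; ls-F = fs
      ; indep = fin } , refl)
    where
    ⋃-size : length ls + length ls ≤ r (⋃ ls)
    ⋃-size = (linear 4 (λ a b c d → (a ≼ num 2) ⇒ (b ≼ a ⊕ c) ⇒ (↑ d ⊕ ↑ d ≼ b) ⇒ ⊩ (d ⊕ d ≼ c)) (r l) (r (l ∪ ⋃ ls))
      (r (⋃ ls)) (length ls) (l≤2 f) (add l (⋃ ls)) h)
    disj : ⋃ ls ⊆ ∁ l
    disj = ⋃-disjoint (f ∷ fs) h
    avoids : ∀ {z} (s : Star l z) → ⋃ ls ⊆ H s
    avoids {z} s = ⊆-intro λ v v∈ v∉ →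
      case v ∈? ⟨ x s ⟩ of λ where
        (inj₁ g) → case same g of λ where
          refl → off-⋃ fs v∈ (Wx s)
        (inj₂ g) → (nonempty (sets 6 (λ a b c d e f → (∼ a ⊑ b ⊓ ∼ c ⊔ d) ⇛ (e ⊑ f) ⇛ (e ⊑ ∼ a) ⇛ (e ⊑ ∼ d) ⇛ (f ⊑ ∼
          b) ⇛ ⊢ (e ⊑ 𝟘)) (H s) l ⟨ z ⟩ ⟨ x s ⟩ ⟨ v ⟩ (⋃ ls) (C⊆ s) v∈ v∉ g disj))
    tip : ∀ {a b} (s : Star l a) (t : Star l b) → x s ∉ ⟨ x t ⟩ → x t ∈ H s
    tip {a} {b} s t d = case x t ∈? H s of λ where
      (inj₁ g) → g
      (inj₂ g) → ⊥-elim (off-W f (x t) (sets 5 (λ a b c d e → (∼ a ⊑ b ⊓ ∼ c ⊔ d) ⇛ (d ⊑ ∼ e) ⇛ (e ⊑ ∼ a) ⇛ ⊢ (e ⊑ b))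
        (H s) l ⟨ a ⟩ ⟨ x s ⟩ ⟨ x t ⟩ (C⊆ s) d g) (Wx t))
    pick : ∀ w {a b c} (s₁ : Star l a) (s₂ : Star l b) (s₃ : Star l c) →
           w ∈ ⟨ x s₁ ⟩ ∪ (⟨ x s₂ ⟩ ∪ (⟨ x s₃ ⟩ ∪ ∅)) → W w
    pick w s₁ s₂ s₃ w∈ = case w ∈? ⟨ x s₁ ⟩ of λ where
      (inj₁ g) → case same g of λ where refl → Wx s₁
      (inj₂ n₁) → case w ∈? ⟨ x s₂ ⟩ of λ where
        (inj₁ g) → case same g of λ where refl → Wx s₂
        (inj₂ n₂) → case w ∈? ⟨ x s₃ ⟩ of λ where
          (inj₁ g) → case same g of λ where refl → Wx s₃
          (inj₂ n₃) → ⊥-elim (nonempty (sets 4 (λ a b c d → (a ⊑ b ⊔ c ⊔ d ⊔ 𝟘) ⇛ (a ⊑ ∼ b) ⇛ (a ⊑ ∼ c) ⇛ (a ⊑ ∼ d) ⇛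
            ⊢ (a ⊑ 𝟘)) ⟨ w ⟩ ⟨ x s₁ ⟩ ⟨ x s₂ ⟩ ⟨ x s₃ ⟩ w∈ n₁ n₂ n₃))

  -- Contracting `l` costs both sides and the whole two in rank, hence the constant 4. Two of three
  -- tips lie on one side; cutting the other side by their hyperplanes keeps the cover and loses two
  -- in rank, and `vc3` applies to what is left.
  line-contractible : ∀ {l} → Filament l → ∀ A B → 𝕌 ⊆ A ∪ B → l ⊆ A → l ⊆ B →
                      r A < ρ → r B < ρ → 4 + ρ ≤ r A + r B
  line-contractible {l} f A B c lA lB ltA′ ltB′ = ≤-by-contra λ small →
      star f (e₁ f) (e₁∈ f) λ s₁ →
      star f (e₂ f) (e₂∈ f) λ s₂ →
      star f (e₃ f) (e₃∈ f) λ s₃ →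
      let side : ∀ z → z ∈ A ⊎ z ∈ B
          side z = case z ∈? A of λ where
            (inj₁ h) → inj₁ h
            (inj₂ h) → inj₂ (sets 3 (λ a b c → (𝟙 ⊑ a ⊔ b) ⇛ (c ⊑ ∼ a) ⇛ ⊢ (c ⊑ b)) A B ⟨ z ⟩ c h)
          c′ : 𝕌 ⊆ B ∪ A
          c′ = (sets 2 (λ a b → (𝟙 ⊑ a ⊔ b) ⇛ ⊢ (𝟙 ⊑ b ⊔ a)) A B c)
          small′ : suc (r B + r A) ≤ 4 + ρ
          small′ = (linear 3 (λ a b c → (↑ (b ⊕ a) ≼ num 4 ⊕ c) ⇒ ⊩ (↑ (a ⊕ b) ≼ num 4 ⊕ c)) (r B) (r A) ρ small)
          two = λ {a b} → two′ {A} {B} {a} {b} c lA lB ltA′ ltB′ small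
          two₂ = λ {a b} → two′ {B} {A} {a} {b} c′ lB lA ltB′ ltA′ small′
      in case side (x s₁) , side (x s₂) , side (x s₃) of λ where
        (inj₁ p , inj₁ q , _) → two s₁ s₂ (e₁∈ f) (e₂∈ f) (e₁≠e₂ f) p q
        (inj₂ p , inj₂ q , _) → two₂ s₁ s₂ (e₁∈ f) (e₂∈ f) (e₁≠e₂ f) p q
        (inj₁ p , inj₂ _ , inj₁ q) → two s₁ s₃ (e₁∈ f) (e₃∈ f) (e₁≠e₃ f) p q
        (inj₂ p , inj₁ _ , inj₂ q) → two₂ s₁ s₃ (e₁∈ f) (e₃∈ f) (e₁≠e₃ f) p q
        (inj₁ _ , inj₂ p , inj₂ q) → two₂ s₂ s₃ (e₂∈ f) (e₃∈ f) (e₂≠e₃ f) p q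
        (inj₂ _ , inj₁ p , inj₁ q) → two s₂ s₃ (e₂∈ f) (e₃∈ f) (e₂≠e₃ f) p q
    where
    two′ : ∀ {A B a b} → 𝕌 ⊆ A ∪ B → l ⊆ A → l ⊆ B → r A < ρ → r B < ρ →
           suc (r A + r B) ≤ 4 + ρ →
           (s : Star l a) (t : Star l b) → a ∈ l → b ∈ l → a ∉ ⟨ b ⟩ → x s ∈ A → x t ∈ A → ⊥
    two′ {A} {B} {a} {b} c lA lB ltA′ ltB′ small s t a∈ b∈ a≠b sA tA =
      let D = mono {B ∩ H s ∩ H t} {B} (sets 3 (λ a b c → ⊢ (a ⊓ b ⊓ c ⊑ a)) B (H s) (H t))
          o₁ = out {H t} {B ∩ H s ∩ H t} {a} (H-flat t) (sets 3 (λ a b c → ⊢ (a ⊓ b ⊓ c ⊑ c)) B (H s) (H t)) (sets 4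
            (λ a b c d → (a ⊓ ∼ b ⊑ ∼ c) ⇛ (d ⊑ a) ⇛ (d ⊑ ∼ b) ⇛ ⊢ (d ⊑ ∼ c)) l ⟨ b ⟩ (H t) ⟨ a ⟩ (⊆C t) a∈ a≠b)
          o₂ = out {H s} {(B ∩ H s ∩ H t) ∪ ⟨ a ⟩} {b} (H-flat s) (sets 4 (λ a b c d → (a ⊑ b) ⇛ ⊢ (c ⊓ b ⊓ d ⊔ a ⊑
            b)) ⟨ a ⟩ (H s) B (H t) (z∈H s)) (sets 4 (λ a b c d → (a ⊓ ∼ b ⊑ ∼ c) ⇛ (d ⊑ a) ⇛ (b ⊑ ∼ d) ⇛ ⊢ (d ⊑ ∼ c))
            l ⟨ a ⟩ (H s) ⟨ b ⟩ (⊆C s) b∈ a≠b)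
          m = mono {((B ∩ H s ∩ H t) ∪ ⟨ a ⟩) ∪ ⟨ b ⟩} {B} (sets 6 (λ a b c d e f → (a ⊑ b) ⇛ (c ⊑ a) ⇛ (d ⊑ a) ⇛ ⊢
            ((b ⊓ e ⊓ f ⊔ c) ⊔ d ⊑ b)) l B ⟨ a ⟩ ⟨ b ⟩ (H s) (H t) lB a∈ b∈)
          v = vc3 A (B ∩ H s ∩ H t) (sets 9 (λ a b c d e f g h i → (𝟙 ⊑ a ⊔ b) ⇛ (c ⊑ a) ⇛ (∼ d ⊑ c ⊓ ∼ e ⊔ f) ⇛ (∼ g
            ⊑ c ⊓ ∼ h ⊔ i) ⇛ (f ⊑ a) ⇛ (i ⊑ a) ⇛ ⊢ (𝟙 ⊑ a ⊔ b ⊓ d ⊓ g)) A B l (H s) ⟨ a ⟩ ⟨ x s ⟩ (H t) ⟨ b ⟩ ⟨ x t ⟩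
            c lA (C⊆ s) (C⊆ t) sA tA) ltA′ (linear 3 (λ a b c → (↑ a ≼ b) ⇒ (c ≼ a) ⇒ ⊩ (↑ c ≼ b)) (r B) ρ (r (B ∩ H s
            ∩ H t)) ltB′ D)
      in (linear 6 (λ a b c d e f → (↑ (b ⊕ a) ≼ num 4 ⊕ c) ⇒ (↑ d ≼ e) ⇒ (↑ e ≼ f) ⇒ (f ≼ a) ⇒ (num 2 ⊕ c ≼ b ⊕ d) ⇒
        ⊩⊥) (r B) (r A) ρ (r (B ∩ H s ∩ H t)) (r (B ∩ H s ∩ H t ∪ ⟨ a ⟩)) (r ((B ∩ H s ∩ H t ∪ ⟨ a ⟩) ∪ ⟨ b ⟩)) small
        o₁ o₂ m v)

  empty : Family
  empty = record
    { I = [] ; ls = [] ; I-W = λ w w∈ → ⊥-elim (nonempty (sets 1 (λ a → (a ⊑ 𝟘) ⇛ ⊢ (a ⊑ 𝟘)) ⟨ w ⟩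
      w∈)) ; ls-F = [] ; indep = z≤n }

  large-family : ∀ k K → K ≤ r (Con k) → 2 ≤ K → ¬¬ (∃ λ f → 2 + K ≤ size f + size f)
  large-family k K K≤ 2≤K Q =
    saturate ρ empty (m≤m+n ρ _) λ (f , sat) →
    complete ρ sat (start f sat) (m≤m+n ρ _) λ (τ , ch , α⊆) →
    let Con⊆ : Con k ⊆ F ch
        Con⊆ = ⊆-intro λ y y∈ y∉ →
          let y∈F = Exhaust₂.exhausted (F ch) (F-flat ch) (λ w Ww → W⊆F f sat ch w Ww)
                      (λ l fl → l⊆F f sat ch l fl) α⊆ y k y∈
          in (nonempty (sets 2 (λ a b → (a ⊑ ∼ b) ⇛ (a ⊑ b) ⇛ ⊢ (a ⊑ 𝟘)) ⟨ y ⟩ (F ch) y∉ y∈F))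
        bound : K ≤ (length (I f) + (length (ls f) + length (ls f))) + τ
        bound = (linear 6 (λ a b c d e f → (a ≼ d ⊕ (c ⊕ c) ⊕ b) ⇒ (e ≼ a) ⇒ (f ≼ e) ⇒ ⊩ (f ≼ d ⊕ (c ⊕ c) ⊕ b)) (r (F
          ch)) τ (length (ls f)) (length (I f)) (r (Con k)) K (F≤ ch) (mono Con⊆) K≤)
    in case big ch of λ where
        (inj₂ b) →
          let g : 2 + K ≤ (length (I f) + length (ls f)) + (length (I f) + length (ls f))
              g = (linear 4 (λ a b c d → (num 2 ⊕ a ≼ b) ⇒ (c ≼ b ⊕ (d ⊕ d) ⊕ a) ⇒ ⊩ (num 2 ⊕ c ≼ b ⊕ d ⊕ (b ⊕ d))) τ
                (length (I f)) K (length (ls f)) b bound)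
          in Q (f , g)
        (inj₁ refl) → short f bound
    where
    W⊆F : ∀ f {τ} → Saturated f → (ch : Chain f τ) → ∀ w → W w → w ∈ F ch
    W⊆F f (sat , _) ch w Ww = let h = sat w Ww in (sets 4 (λ a b c d → (𝟙 ⊑ a ⊔ b) ⇛ (b ⊑ ∼ c) ⇛ (d ⊑ c) ⇛ ⊢ (d ⊑ a))
                                    (F ch) (B ch) (span f) ⟨ w ⟩ (cov ch) (B⊆ ch) h)
    l⊆F : ∀ f {τ} → Saturated f → (ch : Chain f τ) → ∀ l → Filament l → l ⊆ F ch
    l⊆F f (_ , sat) ch l fl = let h = sat l fl in (sets 3 (λ a b c → (a ⊑ b) ⇛ (c ⊑ a) ⇛ ⊢ (c ⊑ b)) (span f) (F ch) l
                                    (span⊆F ch) h)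
    replace : ∀ ls → All Filament ls → length ls + length ls ≤ r (⋃ ls) → 1 ≤ length ls →
              ¬¬ (∃ λ f → size f ≡ 2 + length ls)
    replace (l ∷ ls) fs h _ = replace-filament fs h
    -- No Alpha points. Without filaments `2 ≤ K` suffices, and with two chosen points the bound on
    -- `K` is enough. Otherwise `K ≤ 2q + 1` for `q` filaments, and trading one for three tips gives
    -- `q + 2` members.
    short : ∀ f → K ≤ (length (I f) + (length (ls f) + length (ls f))) + 0 → ⊥
    short f bound = case ≤-or-> (length (ls f)) 0 ,′ ≤-or-> 2 (length (I f)) of λ where
      (inj₁ q≤0 , _) →
        let g : 2 + K ≤ (length (I f) + length (ls f)) + (length (I f) + length (ls f))
            g = (linear 3 (λ a b c → (num 2 ≼ a) ⇒ (a ≼ c ⊕ (b ⊕ b) ⊕ num 0) ⇒ (a ≼ c ⊕ (b ⊕ b) ⊕ num 0) ⇒ (b ≼ num 0)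
              ⇒ (b ≼ num 0) ⇒ ⊩ (num 2 ⊕ a ≼ c ⊕ b ⊕ (c ⊕ b))) K (length (ls f)) (length (I f)) 2≤K bound bound q≤0
              q≤0)
        in Q (f , g)
      (inj₂ q≥1 , inj₁ a≥2) →
        let g : 2 + K ≤ (length (I f) + length (ls f)) + (length (I f) + length (ls f))
            g = (linear 3 (λ a b c → (a ≼ c ⊕ (b ⊕ b) ⊕ num 0) ⇒ (num 2 ≼ c) ⇒ ⊩ (num 2 ⊕ a ≼ c ⊕ b ⊕ (c ⊕ b))) K
              (length (ls f)) (length (I f)) bound a≥2)
        in Q (f , g)
      (inj₂ q≥1 , inj₂ a≤1) →
        let g : 2 + K ≤ (2 + length (ls f)) + (2 + length (ls f))
            g = (linear 3 (λ a b c → (a ≼ c ⊕ (b ⊕ b) ⊕ num 0) ⇒ (↑ c ≼ num 2) ⇒ ⊩ (num 2 ⊕ a ≼ num 2 ⊕ b ⊕ (num 2 ⊕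
              b))) K (length (ls f)) (length (I f)) bound a≤1)
        in replace (ls f) (ls-F f) (linear 5 (λ a b c d e → (a ≼ b) ⇒ (c ≼ a ⊕ d) ⇒ (b ⊕ (e ⊕ e) ≼ c) ⇒ ⊩ (e ⊕ e ≼ d))
          (r (setOf (I f))) (length (I f)) (r (setOf (I f) ∪ ⋃ (ls f))) (r (⋃ (ls f))) (length (ls f)) (r-setOf (I f))
          (add (setOf (I f)) (⋃ (ls f))) (indep f)) q≥1 λ (f′ , e) →
        Q (f′ , subst (λ n → 2 + K ≤ n + n) (sym e) g)

-- Copies of N

module Image {P Q : Set} ⦃ _ : DecEq P ⦄ ⦃ _ : DecEq Q ⦄ (N : Ranked Q) (φ : Q → P) where

  pre : Sub P → Sub Q
  mem (pre A) e = mem A (φ e)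

  -- A union of singletons along the list of elements: it is a Boolean set without any decision
  -- about the range of `φ`.
  imgOn : Sub Q → List Q → Sub P
  imgOn Y []       = ∅
  imgOn Y (e ∷ es) = (if mem Y e then ⟨ φ e ⟩ else ∅) ∪ imgOn Y es

  img : Sub Q → Sub P
  img Y = imgOn Y (Ranked.points N)

  ∈-pre : ∀ {e A} → φ e ∈ A → e ∈ pre A
  ∈-pre {A = A} h = ∈-intro {X = pre A} (∈-elim h)

  pre-∈ : ∀ {e A} → e ∈ pre A → φ e ∈ A
  pre-∈ {A = A} h = ∈-intro {X = A} (∈-elim h)

  img-⊆ : ∀ {Y A} → (∀ e → e ∈ Y → φ e ∈ A) → img Y ⊆ A
  img-⊆ {Y} {A} h = go (Ranked.points N)
    where
    union : ∀ {X Z} → X ⊆ A → Z ⊆ A → X ∪ Z ⊆ A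
    union {X} {Z} p q = (sets 3 (λ a b c → (a ⊑ b) ⇛ (c ⊑ b) ⇛ ⊢ (a ⊔ c ⊑ b)) X A Z p q)
    first : ∀ b e → (T b → φ e ∈ A) → (if b then ⟨ φ e ⟩ else ∅) ⊆ A
    first true  e f = f tt
    first false e f = sets 1 (λ a → ⊢ (𝟘 ⊑ a)) A
    go : ∀ es → imgOn Y es ⊆ A
    go []       = sets 1 (λ a → ⊢ (𝟘 ⊑ a)) A
    go (e ∷ es) = union (first (mem Y e) e (λ t → h e (∈-intro t))) (go es)

  ∈-img : ∀ {Y e} → e ∈ Y → φ e ∈ img Y
  ∈-img {Y} {e} h = go (Ranked.points N) (Ranked.listed N e)
    where
    left : ∀ {z : P} {X Z} → z ∈ X → z ∈ X ∪ Z
    left {z} {X} {Z} p = (sets 3 (λ a b c → (a ⊑ b) ⇛ ⊢ (a ⊑ b ⊔ c)) ⟨ z ⟩ X Z p)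
    right : ∀ {z : P} {X Z} → z ∈ Z → z ∈ X ∪ Z
    right {z} {X} {Z} p = (sets 3 (λ a b c → (a ⊑ b) ⇛ ⊢ (a ⊑ c ⊔ b)) ⟨ z ⟩ Z X p)
    first : ∀ b x → T b → φ x ∈ (if b then ⟨ φ x ⟩ else ∅)
    first true x _ = sets 1 (λ a → ⊢ (a ⊑ a)) ⟨ φ x ⟩
    go : ∀ es → e ∈ₗ es → φ e ∈ imgOn Y es
    go (x ∷ es) (here refl) = left (first (mem Y x) x (∈-elim h))
    go (x ∷ es) (there i)   = right (go es i)

  img-mono : ∀ {Y Z} → Y ⊆ Z → img Y ⊆ img Z
  img-mono {Y} {Z} h = img-⊆ λ e e∈ → ∈-img (sets 3 (λ a b c → (a ⊑ b) ⇛ (c ⊑ a) ⇛ ⊢ (c ⊑ b)) Y Z ⟨ e ⟩ h e∈)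

module Copies {P Q : Set} ⦃ _ : DecEq P ⦄ ⦃ _ : DecEq Q ⦄ (M : Ranked P) (N : Ranked Q)
  (simple : ∀ {y z} → z ∉ ⟨ y ⟩ → 2 ≤ Ranked.r M (⟨ y ⟩ ∪ ⟨ z ⟩))
  (loopless : ∀ z → 1 ≤ Ranked.r M ⟨ z ⟩)
  (vc3 : ∀ A B → 𝕌 ⊆ A ∪ B → Ranked.r M A < Ranked.r M 𝕌 → Ranked.r M B < Ranked.r M 𝕌 →
         2 + Ranked.r M 𝕌 ≤ Ranked.r M A + Ranked.r M B)
  where
  open Ranked M
  open Closure M
  open Separations M simple vc3
  open Sep
  open Ranked N using () renaming (r to rN)
  open Image {P} {Q} N

  -- N is the image of φ in M / C.
  record CopyOf : Set where
    field
      φ      : Q → P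
      C      : Sub P
      C-flat : Flat C
      rank-φ : ∀ Y → rN Y + r C ≡ r (img φ Y ∪ C)
  open CopyOf

  -- Passing to the closure changes neither of the two ranks that involve `D`, so the contracted set
  -- may be taken to be a flat.
  mkCopy : (φ : Q → P) (D : Sub P) → (∀ Y → rN Y + r D ≡ r (img φ Y ∪ D)) → CopyOf
  mkCopy φ D e = record
    { φ = φ ; C = cl D ; C-flat = cl-flat D
    ; rank-φ = λ Y →
        let s = sm {img φ Y ∪ cl D} {D} (cl D) (img φ Y ∪ D) (sets 3 (λ a b c → (a ⊑ b) ⇛ ⊢ (c ⊔ b ⊑ b ⊔ c ⊔ a)) D (cl
              D) (Image.img N φ Y) (⊆cl D)) (sets 3 (λ a b c → (a ⊑ b) ⇛ ⊢ (a ⊑ b ⊓ (c ⊔ a))) D (cl D) (Image.img N φ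
              Y) (⊆cl D))
            m = mono {img φ Y ∪ D} {img φ Y ∪ cl D} (sets 3 (λ a b c → (a ⊑ b) ⇛ ⊢ (c ⊔ a ⊑ c ⊔ b)) D (cl D)
              (Image.img N φ Y) (⊆cl D))
            m′ = mono (⊆cl D)
        in (≤-antisym (linear 5 (λ a b c d e → (a ≼ b) ⇒ (c ⊕ b ≼ d) ⇒ (d ≼ e) ⇒ ⊩ (c ⊕ a ≼ e)) (r (cl D)) (r D) (rN
          Y) (r (img φ Y ∪ D)) (r (img φ Y ∪ cl D)) (r-cl D) (≤-reflexive (e Y)) m) (linear 5 (λ a b c d e → (a ≼ c ⊕
          b) ⇒ (d ⊕ b ≼ e ⊕ a) ⇒ ⊩ (d ≼ c ⊕ e)) (r (img φ Y ∪ D)) (r D) (rN Y) (r (img φ Y ∪ cl D)) (r (cl D))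
          (≤-reflexive (sym (e Y))) s)) }

  AtMostOne : Sub Q → Set
  AtMostOne Y = ∀ e e′ → e ∈ Y → e′ ∈ Y → e ≡ e′

  SmallIn : CopyOf → Sub P → Sub P → Set
  SmallIn k A B = ∀ e e′ → φ k e ∈ A → φ k e ∉ B → φ k e′ ∈ A → φ k e′ ∉ B → e ≡ e′

  module _
    (3-conn : ∀ Y → rN Y + rN (∁ Y) ≤ suc (rN 𝕌) → AtMostOne Y ⊎ AtMostOne (∁ Y)) where

    -- Contracting a flat through the guts point `y` lowers the connectivity of the two sides by
    -- one. What the copy sees is a separation of `N` with rank sum at most `r(N) + 1`, so one side
    -- has at most one element.
    orient′ : ∀ {k} {y : P} {A B} → y ∈ C k → Sep y A B → SmallIn k A B ⊎ SmallIn k B A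
    orient′ {k} {y} {A} {B} y∈ s = case 3-conn NB sum of λ where
        (inj₁ one) → inj₂ λ e e′ eB _ e′B _ → one e e′ (∈-pre (φ k) {A = B} eB) (∈-pre (φ k) {A = B} e′B)
        (inj₂ one) → inj₁ λ e e′ _ eB _ e′B → one e e′ (out-pre eB) (out-pre e′B)
      where
      NB = pre (φ k) B
      out-pre : ∀ {e} → φ k e ∉ B → e ∉ NB
      out-pre {e} h = ∈-intro {X = ∁ NB} (∈-elim h)
      X : Sub P
      X = img (φ k) (∁ NB)
      Y : Sub P
      Y = img (φ k) NB
      I : Sub P
      I = img (φ k) 𝕌
      sum : rN NB + rN (∁ NB) ≤ suc (rN 𝕌)
      sum = go X Y I
        (img-⊆ (φ k) λ e e∈ → X⊆A e (∈-intro {X = ∁ B} (∈-elim e∈)))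
        (img-⊆ (φ k) λ e e∈ → pre-∈ (φ k) {A = B} e∈)
        (img-mono (φ k) (sets 1 (λ a → ⊢ (a ⊑ 𝟙)) _)) (img-mono (φ k) (sets 1 (λ a → ⊢ (a ⊑ 𝟙)) _))
        (img-⊆ (φ k) λ e _ → both e)
        (rank-φ k (∁ NB)) (rank-φ k NB) (rank-φ k 𝕌)
        where
        X⊆A : ∀ e → φ k e ∉ B → φ k e ∈ A
        X⊆A e h = (sets 3 (λ a b c → (𝟙 ⊑ a ⊔ b) ⇛ (c ⊑ ∼ b) ⇛ ⊢ (c ⊑ a)) A B ⟨ φ k e ⟩ (cover s) h)
        both : ∀ e → (φ k) e ∈ X ∪ Y
        both e = case e ∈? NB of λ where
          (inj₁ h) → let g = ∈-img (φ k) h in sets 3 (λ a b c → (a ⊑ c) ⇛ ⊢ (a ⊑ b ⊔ c)) ⟨ (φ k) e ⟩ X Y g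
          (inj₂ h) → let g = ∈-img (φ k) {∁ NB} h in sets 3 (λ a b c → (a ⊑ b) ⇛ ⊢ (a ⊑ b ⊔ c)) ⟨ (φ k) e ⟩ X Y g
        -- `f₁`, `f₂`, `f₃` bound the rank sum of `A ∪ C` and `B ∪ C`, where the common point `y`
        -- saves one. `f₄` and `f₅` then pass to the parts occupied by the copy: connectivity does
        -- not grow under restriction.
        go : ∀ X Y I → X ⊆ A → Y ⊆ B → X ⊆ I → Y ⊆ I → I ⊆ X ∪ Y → ∀ {a b c} →
             a + r (C k) ≡ r (X ∪ C k) → b + r (C k) ≡ r (Y ∪ C k) → c + r (C k) ≡ r (I ∪ C k) →
             b + a ≤ suc c
        go X Y I XA YB XI YI IXY {a} {b} {c} ea eb ec =
          let f₁ = submod A (C k)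
              f₂ = submod B (C k)
              f₃ = sm {C k} {⟨ y ⟩} (A ∩ C k) (B ∩ C k) (sets 3 (λ a b c → (𝟙 ⊑ a ⊔ b) ⇛ ⊢ (c ⊑ a ⊓ c ⊔ b ⊓ c)) A B (C
                k) (cover s)) (sets 4 (λ a b c d → (a ⊑ b) ⇛ (a ⊑ c) ⇛ (a ⊑ d) ⇛ ⊢ (a ⊑ (c ⊓ d) ⊓ b ⊓ d)) ⟨ y ⟩ B A (C
                k) (inB s) (inA s) y∈)
              f₄ = sm {(A ∪ C k) ∪ Y} {X ∪ C k} (A ∪ C k) (I ∪ C k) (sets 4 (λ a b c d → (a ⊑ b) ⇛ ⊢ ((c ⊔ d) ⊔ a ⊑ (c
                ⊔ d) ⊔ b ⊔ d)) Y I A (C k) YI) (sets 4 (λ a b c d → (a ⊑ b) ⇛ (a ⊑ c) ⇛ ⊢ (a ⊔ d ⊑ (b ⊔ d) ⊓ (c ⊔ d)))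
                X A I (C k) XA XI)
              f₅ = sm {𝕌} {Y ∪ C k} (B ∪ C k) ((A ∪ C k) ∪ Y) (sets 4 (λ a b c d → (𝟙 ⊑ a ⊔ b) ⇛ ⊢ (𝟙 ⊑ (b ⊔ c) ⊔ (a ⊔
                c) ⊔ d)) A B (C k) Y (cover s)) (sets 4 (λ a b c d → (a ⊑ b) ⇛ ⊢ (a ⊔ c ⊑ (b ⊔ c) ⊓ ((d ⊔ c) ⊔ a))) Y
                B (C k) A YB)
          in (linear 16 (λ a b c d e f g h i j k l m n o p → (num 1 ≼ a) ⇒ (c ⊕ b ≼ num 2 ⊕ d) ⇒ (f ⊕ e ≼ g) ⇒ (h ⊕ e
            ≼ i) ⇒ (j ≼ k ⊕ e) ⇒ (m ⊕ l ≼ c ⊕ e) ⇒ (o ⊕ n ≼ b ⊕ e) ⇒ (e ⊕ a ≼ l ⊕ n) ⇒ (p ⊕ g ≼ m ⊕ j) ⇒ (d ⊕ i ≼ o ⊕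
            p) ⇒ ⊩ (h ⊕ f ≼ ↑ k)) (r ⟨ y ⟩) (r B) (r A) ρ (r (C k)) a (r (X ∪ C k)) b (r (Y ∪ C k)) (r (I ∪ C k)) c (r
            (A ∩ C k)) (r (A ∪ C k)) (r (B ∩ C k)) (r (B ∪ C k)) (r ((A ∪ C k) ∪ Y)) (loopless y) (tight s)
            (≤-reflexive ea) (≤-reflexive eb) (≤-reflexive (sym ec)) f₁ f₂ f₃ f₄ f₅)

    module _ (conn : ∀ Y → rN Y + rN (∁ Y) ≤ rN 𝕌 → Y ⊆ ∅ ⊎ ∁ Y ⊆ ∅)
             (N-loopless : ∀ e → 1 ≤ rN ⟨ e ⟩)
             (second : ∀ (e : Q) → ∃ λ e′ → e′ ∉ ⟨ e ⟩) where

      -- For X inside one side A of a 2-separation (A , B) at y, the number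
      -- r X + r B − r (X ∪ B) − 1 tells whether X spans the virtual
      -- element of the corresponding 2-sum.

      module _ {y A B} (s : Sep y A B) where

        Misses Hits : Sub P → Set
        Misses X = r X + r B ≤ 1 + r (X ∪ B)
        Hits   X = 2 + r (X ∪ B) ≤ r X + r B

        misses-or-hits : ∀ X → Misses X ⊎ Hits X
        misses-or-hits X = ≤-or-> (r X + r B) (1 + r (X ∪ B))

        -- Seen from `B`, a set that misses behaves like the point `y` alone, just as one that hits
        -- behaves like all of `A`.
        when-misses : ∀ {X Z} → Misses X → y ∈ X → y ∈ Z → Z ⊆ B →
                      suc (r (Z ∪ X)) ≡ r Z + r X
        when-misses {X} {Z} h yX yZ Z⊆B =
          let s₁ = sm {Z ∪ X} {⟨ y ⟩} Z X (sets 2 (λ a b → ⊢ (a ⊔ b ⊑ a ⊔ b)) Z X) (sets 3 (λ a b c → (a ⊑ b) ⇛ (a ⊑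
                c) ⇛ ⊢ (a ⊑ c ⊓ b)) ⟨ y ⟩ X Z yX yZ)
              s₂ = sm {X ∪ B} {Z} B (Z ∪ X) (sets 3 (λ a b c → ⊢ (a ⊔ b ⊑ b ⊔ c ⊔ a)) X B Z) (sets 3 (λ a b c → (a ⊑
                b) ⇛ ⊢ (a ⊑ b ⊓ (a ⊔ c))) Z B X Z⊆B)
          in (≤-antisym (linear 4 (λ a b c d → (num 1 ≼ a) ⇒ (b ⊕ a ≼ d ⊕ c) ⇒ ⊩ (↑ b ≼ d ⊕ c)) (r ⟨ y ⟩) (r (Z ∪ X))
            (r X) (r Z) (loopless y) s₁) (linear 5 (λ a b c d e → (b ⊕ a ≼ num 1 ⊕ c) ⇒ (c ⊕ d ≼ a ⊕ e) ⇒ ⊩ (d ⊕ b ≼ ↑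
            e)) (r B) (r X) (r (X ∪ B)) (r Z) (r (Z ∪ X)) h s₂))

        when-hits : ∀ {X Z} → Hits X → X ⊆ A → Z ⊆ B → r (Z ∪ X) + r A ≡ r (Z ∪ A) + r X
        when-hits {X} {Z} h X⊆A Z⊆B =
          let s₁ = sm {𝕌} {Z ∪ X} (Z ∪ A) (X ∪ B) (sets 4 (λ a b c d → (𝟙 ⊑ a ⊔ b) ⇛ ⊢ (𝟙 ⊑ (c ⊔ a) ⊔ d ⊔ b)) A B Z X
                (cover s)) (sets 4 (λ a b c d → (a ⊑ b) ⇛ (c ⊑ d) ⇛ ⊢ (c ⊔ a ⊑ (c ⊔ b) ⊓ (a ⊔ d))) X A Z B X⊆A Z⊆B)
              s₂ = sm {Z ∪ A} {X} A (Z ∪ X) (sets 3 (λ a b c → ⊢ (a ⊔ b ⊑ b ⊔ a ⊔ c)) Z A X) (sets 3 (λ a b c → (a ⊑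
                b) ⇛ ⊢ (a ⊑ b ⊓ (c ⊔ a))) X A Z X⊆A)
          in (≤-antisym (linear 7 (λ a b c d e f g → (b ⊕ a ≼ num 2 ⊕ c) ⇒ (num 2 ⊕ d ≼ e ⊕ a) ⇒ (c ⊕ f ≼ g ⊕ d) ⇒ ⊩
            (f ⊕ b ≼ g ⊕ e)) (r B) (r A) ρ (r (X ∪ B)) (r X) (r (Z ∪ X)) (r (Z ∪ A)) (tight s) h s₁) (linear 4 (λ a b
            c d → (b ⊕ a ≼ d ⊕ c) ⇒ ⊩ (b ⊕ a ≼ c ⊕ d)) (r X) (r (Z ∪ A)) (r (Z ∪ X)) (r A) s₂))

        hits-A : Hits A
        hits-A = let m = mono {A ∪ B} {𝕌} (sets 2 (λ a b → ⊢ (a ⊔ b ⊑ 𝟙)) A B) in (linear 4 (λ a b c d → (num 2 ⊕ a ≼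
                       c ⊕ b) ⇒ (d ≼ a) ⇒ ⊩ (num 2 ⊕ d ≼ c ⊕ b)) ρ (r B) (r A) (r (A ∪ B)) (low s) m)

        hits-resp : ∀ {X X′} → X ⊆ X′ → X′ ⊆ X → Hits X → Hits X′
        hits-resp {X} {X′} p q h =
          let m = mono p ; m′ = mono {X′ ∪ B} {X ∪ B} (sets 3 (λ a b c → (a ⊑ b) ⇛ ⊢ (a ⊔ c ⊑ b ⊔ c)) X′ X B q) in
                (linear 5 (λ a b c d e → (num 2 ⊕ a ≼ c ⊕ b) ⇒ (c ≼ d) ⇒ (e ≼ a) ⇒ ⊩ (num 2 ⊕ e ≼ d ⊕ b)) (r (X ∪ B))
                (r B) (r X) (r X′) (r (X′ ∪ B)) h m m′)

        -- Points of `A` are added while the set still misses. Since everything together hits, some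
        -- point is the first to change the state.
        threshold : ∀ zs X → Misses X → X ⊆ A → Hits (X ∪ (A ∩ setOf zs)) →
          ∃₂ λ X′ a → Misses X′ × X ⊆ X′ × X′ ⊆ A × a ∈ A × Hits (X′ ∪ ⟨ a ⟩)
        threshold [] X m X⊆A h = ⊥-elim
          (let h′ = hits-resp {X ∪ (A ∩ ∅)} {X} (sets 2 (λ a b → ⊢ (a ⊔ b ⊓ 𝟘 ⊑ a)) X A) (sets 2 (λ a b → ⊢ (a ⊑ a ⊔ b
                 ⊓ 𝟘)) X A) h in (linear 3 (λ a b c → (b ⊕ a ≼ num 1 ⊕ c) ⇒ (num 2 ⊕ c ≼ b ⊕ a) ⇒ ⊩⊥) (r B) (r X) (r
                 (X ∪ B)) m h′))
        threshold (v ∷ vs) X m X⊆A h = case v ∈? A of λ where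
            (inj₂ v∉) → threshold vs X m X⊆A
              (hits-resp {X ∪ (A ∩ (⟨ v ⟩ ∪ setOf vs))} {X ∪ (A ∩ setOf vs)} (sets 4 (λ a b c d → (a ⊑ ∼ b) ⇛ ⊢ (c ⊔ b
                ⊓ (a ⊔ d) ⊑ c ⊔ b ⊓ d)) ⟨ v ⟩ A X (setOf vs) v∉) (sets 4 (λ a b c d → ⊢ (a ⊔ b ⊓ c ⊑ a ⊔ b ⊓ (d ⊔ c)))
                X A (setOf vs) ⟨ v ⟩) h)
            (inj₁ v∈) → case misses-or-hits (X ∪ ⟨ v ⟩) of λ where
              (inj₂ h′) → X , v , m , (sets 1 (λ a → ⊢ (a ⊑ a)) X) , X⊆A , v∈ , h′
              (inj₁ m′) →
                let X′ , a , p , q , rest = threshold vs (X ∪ ⟨ v ⟩) m′ (sets 3 (λ a b c → (a ⊑ b) ⇛ (c ⊑ b) ⇛ ⊢ (a ⊔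
                      c ⊑ b)) X A ⟨ v ⟩ X⊆A v∈)
                      (hits-resp {X ∪ (A ∩ (⟨ v ⟩ ∪ setOf vs))} {(X ∪ ⟨ v ⟩) ∪ (A ∩ setOf vs)} (sets 4 (λ a b c d → ⊢
                        (a ⊔ b ⊓ (c ⊔ d) ⊑ (a ⊔ c) ⊔ b ⊓ d)) X A ⟨ v ⟩ (setOf vs)) (sets 4 (λ a b c d → (a ⊑ b) ⇛ ⊢
                        ((c ⊔ a) ⊔ b ⊓ d ⊑ c ⊔ b ⊓ (a ⊔ d))) ⟨ v ⟩ A X (setOf vs) v∈) h)
                in X′ , a , p , (sets 3 (λ a b c → (a ⊔ b ⊑ c) ⇛ ⊢ (a ⊑ c)) X ⟨ v ⟩ X′ q) , rest

      -- The part of the contracted flat in `A` is exchanged for a set in `A` that contains `y` and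
      -- `z` and looks the same from `B`. If one element of the copy sits outside `B`, it is moved
      -- to a point that plays the same part over the new set.
      extend′ : ∀ {k} {y z : P} {A B} → y ∈ C k → Sep y A B → SmallIn k A B → z ∈ A → z ∉ B →
                ¬¬ (∃ λ k′ → y ∈ C k′ × z ∈ C k′ × SmallIn k′ A B)
      extend′ {k} {y} {z} {A} {B} y∈ s small z∈ z∉ K =
          em (∃ λ e → φ k e ∉ B) λ where
            (inj₂ none) → inside (λ e → case φ k e ∈? B of λ where
              (inj₁ h) → h
              (inj₂ h) → ⊥-elim (none (e , h)))
            (inj₁ (e₀ , e₀∉)) → crossing e₀ e₀∉
        where
        CA : Sub P
        CA = C k ∩ A
        CB : Sub P
        CB = C k ∩ B
        yz : Sub P
        yz = ⟨ y ⟩ ∪ ⟨ z ⟩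
        y∈CA : y ∈ CA
        y∈CA = sets 3 (λ a b c → (a ⊑ b) ⇛ (a ⊑ c) ⇛ ⊢ (a ⊑ b ⊓ c)) ⟨ y ⟩ (C k) A y∈ (inA s)
        y∈CB : y ∈ CB
        y∈CB = sets 3 (λ a b c → (a ⊑ b) ⇛ (a ⊑ c) ⇛ ⊢ (a ⊑ b ⊓ c)) ⟨ y ⟩ (C k) B y∈ (inB s)
        CA⊆A : CA ⊆ A
        CA⊆A = sets 2 (λ a b → ⊢ (a ⊓ b ⊑ b)) (C k) A
        CB⊆B : CB ⊆ B
        CB⊆B = sets 2 (λ a b → ⊢ (a ⊓ b ⊑ b)) (C k) B
        split : C k ⊆ CB ∪ CA
        split = sets 3 (λ a b c → (𝟙 ⊑ b ⊔ c) ⇛ ⊢ (a ⊑ a ⊓ c ⊔ a ⊓ b)) (C k) A B (cover s)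
        joined : CB ∪ CA ⊆ C k
        joined = sets 3 (λ a b c → ⊢ (a ⊓ c ⊔ a ⊓ b ⊑ a)) (C k) A B
        y∈yz : y ∈ yz
        y∈yz = sets 2 (λ a b → ⊢ (a ⊑ a ⊔ b)) ⟨ y ⟩ ⟨ z ⟩
        z∈yz : z ∈ yz
        z∈yz = sets 2 (λ a b → ⊢ (b ⊑ a ⊔ b)) ⟨ y ⟩ ⟨ z ⟩
        yz⊆A : yz ⊆ A
        yz⊆A = sets 3 (λ a b c → (a ⊑ c) ⇛ (b ⊑ c) ⇛ ⊢ (a ⊔ b ⊑ c)) ⟨ y ⟩ ⟨ z ⟩ A (inA s) z∈
        misses-yz : Misses s yz
        misses-yz =
          let o = out {B} {B} {z} (flB s) (sets 1 (λ a → ⊢ (a ⊑ a)) B) z∉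
              m = mono {B ∪ ⟨ z ⟩} {yz ∪ B} (sets 3 (λ a b c → (a ⊑ b) ⇛ ⊢ (c ⊔ a ⊑ b ⊔ c)) ⟨ z ⟩ yz B z∈yz)
              t : r yz ≤ 2
              t = ≤-trans (add ⟨ y ⟩ ⟨ z ⟩) (+-mono-≤ (r-point y) (r-point z))
          in (linear 4 (λ a b c d → (↑ a ≼ b) ⇒ (b ≼ c) ⇒ (d ≼ num 2) ⇒ ⊩ (d ⊕ a ≼ num 1 ⊕ c)) (r B) (r (B ∪ ⟨ z ⟩))
            (r (yz ∪ B)) (r yz) o m t)

        -- The copy changes only inside A, so small (C k) ranks are compared
        -- through the split C k = CB ∪ CA.
        old : ∀ I {a} → a + r (C k) ≡ r (I ∪ C k) →
              a + r (CB ∪ CA) ≡ r ((I ∪ CB) ∪ CA)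
        old I {a} e =
          let m₁ = mono split
              m₂ = mono joined
              m₃ = mono {I ∪ C k} {(I ∪ CB) ∪ CA} (sets 4 (λ a b c d → (a ⊑ b ⊔ c) ⇛ ⊢ (d ⊔ a ⊑ (d ⊔ b) ⊔ c)) (C k) CB
                CA I split)
              m₄ = mono {(I ∪ CB) ∪ CA} {I ∪ C k} (sets 4 (λ a b c d → (a ⊔ b ⊑ c) ⇛ ⊢ ((d ⊔ a) ⊔ b ⊑ d ⊔ c)) CB CA (C
                k) I joined)
          in (≤-antisym (linear 5 (λ a b c d e → (b ⊕ a ≼ c) ⇒ (d ≼ a) ⇒ (c ≼ e) ⇒ ⊩ (b ⊕ d ≼ e)) (r (C k)) a (r (I ∪
            C k)) (r (CB ∪ CA)) (r ((I ∪ CB) ∪ CA)) (≤-reflexive e) m₂ m₃) (linear 5 (λ a b c d e → (a ≼ c ⊕ b) ⇒ (b ≼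
            d) ⇒ (e ≼ a) ⇒ ⊩ (e ≼ c ⊕ d)) (r (I ∪ C k)) (r (C k)) a (r (CB ∪ CA)) (r ((I ∪ CB) ∪ CA)) (≤-reflexive
            (sym e)) m₁ m₄))

        ⊆cl∈ : ∀ {v D} → v ∈ D → v ∈ cl D
        ⊆cl∈ {v} {D} h = (sets 3 (λ a b c → (a ⊑ b) ⇛ (c ⊑ a) ⇛ ⊢ (c ⊑ b)) D (cl D) ⟨ v ⟩ (⊆cl D) h)

        assoc : ∀ X I {a} → a + r (CB ∪ X) ≡ r ((I ∪ CB) ∪ X) → a + r (CB ∪ X) ≡ r (I ∪ (CB ∪ X))
        assoc X I {a} e =
          let m₁ = mono {(I ∪ CB) ∪ X} {I ∪ (CB ∪ X)} (sets 3 (λ a b c → ⊢ ((a ⊔ b) ⊔ c ⊑ a ⊔ b ⊔ c)) I CB X)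
              m₂ = mono {I ∪ (CB ∪ X)} {(I ∪ CB) ∪ X} (sets 3 (λ a b c → ⊢ (a ⊔ b ⊔ c ⊑ (a ⊔ b) ⊔ c)) I CB X)
          in (≤-antisym (linear 4 (λ a b c d → (b ⊕ a ≼ c) ⇒ (c ≼ d) ⇒ ⊩ (b ⊕ a ≼ d)) (r (CB ∪ X)) a (r ((I ∪ CB) ∪
            X)) (r (I ∪ CB ∪ X)) (≤-reflexive e) m₁) (linear 4 (λ a b c d → (a ≼ c ⊕ b) ⇒ (d ≼ a) ⇒ ⊩ (d ≼ c ⊕ b)) (r
            ((I ∪ CB) ∪ X)) (r (CB ∪ X)) a (r (I ∪ CB ∪ X)) (≤-reflexive (sym e)) m₂))

        -- With no element outside `B` only the view from `B` matters: a part that misses becomes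
        -- just `y` and `z`, a part that hits becomes all of `A`.
        inside : (∀ e → φ k e ∈ B) → ⊥
        inside all = case misses-or-hits s CA of λ where
            (inj₁ m) → K (with-X yz y∈yz yz⊆A z∈yz
              (λ I I⊆ {a} e →
                let Z⊆ : I ∪ CB ⊆ B
                    Z⊆ = (sets 3 (λ a b c → (a ⊑ b) ⇛ (c ⊑ b) ⇛ ⊢ (c ⊔ a ⊑ b)) CB B I CB⊆B I⊆)
                    yI : y ∈ I ∪ CB
                    yI = (sets 3 (λ a b c → (a ⊑ b) ⇛ ⊢ (a ⊑ c ⊔ b)) ⟨ y ⟩ CB I y∈CB)
                    e₁ = when-misses s m y∈CA yI Z⊆
                    e₂ = when-misses s m y∈CA y∈CB CB⊆B
                    e₃ = when-misses s misses-yz y∈yz yI Z⊆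
                    e₄ = when-misses s misses-yz y∈yz y∈CB CB⊆B
                in (≤-antisym (linear 9 (λ a b c d e f g h i → (b ⊕ a ≼ c) ⇒ (↑ c ≼ e ⊕ d) ⇒ (f ⊕ d ≼ ↑ a) ⇒ (e ⊕ g ≼
                  ↑ h) ⇒ (↑ i ≼ f ⊕ g) ⇒ ⊩ (b ⊕ i ≼ h)) (r (CB ∪ CA)) a (r ((I ∪ CB) ∪ CA)) (r CA) (r (I ∪ CB)) (r CB)
                  (r yz) (r ((I ∪ CB) ∪ yz)) (r (CB ∪ yz)) (≤-reflexive e) (≤-reflexive e₁) (≤-reflexive (sym e₂))
                  (≤-reflexive (sym e₃)) (≤-reflexive e₄)) (linear 9 (λ a b c d e f g h i → (a ≼ c ⊕ b) ⇒ (e ⊕ d ≼ ↑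
                  a) ⇒ (↑ b ≼ f ⊕ d) ⇒ (↑ g ≼ e ⊕ h) ⇒ (f ⊕ h ≼ ↑ i) ⇒ ⊩ (g ≼ c ⊕ i)) (r ((I ∪ CB) ∪ CA)) (r (CB ∪
                  CA)) a (r CA) (r (I ∪ CB)) (r CB) (r ((I ∪ CB) ∪ yz)) (r yz) (r (CB ∪ yz)) (≤-reflexive (sym e))
                  (≤-reflexive (sym e₁)) (≤-reflexive e₂) (≤-reflexive e₃) (≤-reflexive (sym e₄))))))
            (inj₂ h) → K (with-X A (inA s) (sets 1 (λ a → ⊢ (a ⊑ a)) A) z∈
              (λ I I⊆ {a} e →
                let Z⊆ : I ∪ CB ⊆ B
                    Z⊆ = (sets 3 (λ a b c → (a ⊑ b) ⇛ (c ⊑ b) ⇛ ⊢ (c ⊔ a ⊑ b)) CB B I CB⊆B I⊆)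
                    e₁ = when-hits s h CA⊆A Z⊆
                    e₂ = when-hits s h CA⊆A CB⊆B
                in (≤-antisym (linear 7 (λ a b c d e f g → (b ⊕ a ≼ c) ⇒ (c ⊕ d ≼ f ⊕ e) ⇒ (g ⊕ e ≼ a ⊕ d) ⇒ ⊩ (b ⊕ g
                  ≼ f)) (r (CB ∪ CA)) a (r ((I ∪ CB) ∪ CA)) (r A) (r CA) (r ((I ∪ CB) ∪ A)) (r (CB ∪ A)) (≤-reflexive
                  e) (≤-reflexive e₁) (≤-reflexive (sym e₂))) (linear 7 (λ a b c d e f g → (a ≼ c ⊕ b) ⇒ (e ⊕ d ≼ a ⊕
                  f) ⇒ (b ⊕ f ≼ g ⊕ d) ⇒ ⊩ (e ≼ c ⊕ g)) (r ((I ∪ CB) ∪ CA)) (r (CB ∪ CA)) a (r CA) (r ((I ∪ CB) ∪ A))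
                  (r A) (r (CB ∪ A)) (≤-reflexive (sym e)) (≤-reflexive (sym e₁)) (≤-reflexive e₂)))))
          where
          with-X : ∀ X → y ∈ X → X ⊆ A → z ∈ X →
            (∀ I → I ⊆ B → ∀ {a} → a + r (CB ∪ CA) ≡ r ((I ∪ CB) ∪ CA) → a + r (CB ∪ X) ≡ r ((I ∪ CB) ∪ X)) →
            ∃ λ k′ → y ∈ C k′ × z ∈ C k′ × SmallIn k′ A B
          with-X X yX X⊆A zX eq =
              mkCopy (φ k) (CB ∪ X) (λ Y → assoc X (img (φ k) Y) (eq (img (φ k) Y) (img-⊆ (φ k) λ e _ → all e) (old _ (rank-φ k Y))))
            , ⊆cl∈ (sets 3 (λ a b c → (a ⊑ b) ⇛ ⊢ (a ⊑ b ⊔ c)) ⟨ y ⟩ CB X y∈CB) , ⊆cl∈ (sets 3 (λ a b c → (a ⊑ b) ⇛ ⊢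
              (a ⊑ c ⊔ b)) ⟨ z ⟩ X CB zX)
            , small

        -- If the image of `e₀` did not change the state of `CA`, then `e₀` would be a separator of
        -- `N`, against connectivity. So `CA` misses and `U` hits; `threshold` provides a set and a
        -- point in the same relation.
        crossing : ∀ e₀ → φ k e₀ ∉ B → ⊥
        crossing e₀ e₀∉ = case misses-or-hits s CA ,′ misses-or-hits s U of λ where
            (inj₁ m , inj₁ m′) → separates
              (λ Z Z⊆B yZ →
                let e₁ = when-misses s {CA} {Z} m y∈CA yZ Z⊆B
                    e₂ = when-misses s {U} {Z} m′ y∈U yZ Z⊆B
                in (≤-antisym (linear 5 (λ a b c d e → (b ⊕ a ≼ ↑ c) ⇒ (↑ d ≼ b ⊕ e) ⇒ ⊩ (d ⊕ a ≼ c ⊕ e)) (r CA) (r Z)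
                  (r (Z ∪ CA)) (r (Z ∪ U)) (r U) (≤-reflexive (sym e₁)) (≤-reflexive e₂)) (linear 5 (λ a b c d e → (↑
                  a ≼ c ⊕ b) ⇒ (c ⊕ d ≼ ↑ e) ⇒ ⊩ (a ⊕ d ≼ e ⊕ b)) (r (Z ∪ CA)) (r CA) (r Z) (r U) (r (Z ∪ U))
                  (≤-reflexive e₁) (≤-reflexive (sym e₂)))))
            (inj₂ h , _) → separates
              (λ Z Z⊆B yZ →
                let q = sm {U ∪ B} {CA} (CA ∪ B) U (sets 3 (λ a b c → ⊢ (a ⊔ b ⊑ (c ⊔ b) ⊔ a)) U B CA) (sets 3 (λ a b
                      c → (a ⊑ b) ⇛ ⊢ (a ⊑ (a ⊔ c) ⊓ b)) CA U B CA⊆U)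
                    hU : Hits s U
                    hU = (linear 5 (λ a b c d e → (num 2 ⊕ a ≼ c ⊕ b) ⇒ (d ⊕ c ≼ a ⊕ e) ⇒ ⊩ (num 2 ⊕ d ≼ e ⊕ b)) (r
                      (CA ∪ B)) (r B) (r CA) (r (U ∪ B)) (r U) h q)
                    e₁ = when-hits s {CA} {Z} h CA⊆A Z⊆B
                    e₂ = when-hits s {U} {Z} hU U⊆A Z⊆B
                in (≤-antisym (linear 6 (λ a b c d e f → (b ⊕ a ≼ d ⊕ c) ⇒ (e ⊕ c ≼ b ⊕ f) ⇒ ⊩ (e ⊕ a ≼ d ⊕ f)) (r CA)
                  (r (Z ∪ A)) (r A) (r (Z ∪ CA)) (r (Z ∪ U)) (r U) (≤-reflexive (sym e₁)) (≤-reflexive e₂)) (linear 6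
                  (λ a b c d e f → (b ⊕ a ≼ d ⊕ c) ⇒ (d ⊕ e ≼ f ⊕ a) ⇒ ⊩ (b ⊕ e ≼ f ⊕ c)) (r A) (r (Z ∪ CA)) (r CA) (r
                  (Z ∪ A)) (r U) (r (Z ∪ U)) (≤-reflexive e₁) (≤-reflexive (sym e₂)))))
            (inj₁ m , inj₂ h) →
              let X , a′ , mX , yz⊆X , X⊆A , a′∈A , hX = threshold s points yz misses-yz yz⊆A
                    (hits-resp s all⊆ (sets 3 (λ a b c → (a ⊑ b) ⇛ ⊢ (a ⊔ b ⊓ c ⊑ b)) yz A (setOf points)
                      yz⊆A) (hits-A s))
              in K (swapped m h X a′ mX yz⊆X X⊆A a′∈A hX)
          where
          a : P
          a = φ k e₀
          a∉B : a ∉ B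
          a∉B = e₀∉
          a∈A : a ∈ A
          a∈A = (sets 3 (λ a b c → (𝟙 ⊑ a ⊔ b) ⇛ (c ⊑ ∼ b) ⇛ ⊢ (c ⊑ a)) A B ⟨ a ⟩ (cover s) a∉B)
          U : Sub P
          U = CA ∪ ⟨ a ⟩
          U⊆ : U ⊆ CA ∪ ⟨ a ⟩
          U⊆ = sets 1 (λ a → ⊢ (a ⊑ a)) _
          ⊆U : CA ∪ ⟨ a ⟩ ⊆ U
          ⊆U = sets 1 (λ a → ⊢ (a ⊑ a)) _
          rU : r U ≤ suc (r CA)
          rU = step CA a
          U⊆A : U ⊆ A
          U⊆A = (sets 4 (λ a b c d → (a ⊑ b) ⇛ (c ⊑ b) ⇛ (d ⊑ a ⊔ c) ⇛ ⊢ (d ⊑ b)) CA A ⟨ a ⟩ U CA⊆A a∈A U⊆)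
          CA⊆U : CA ⊆ U
          CA⊆U = sets 2 (λ a b → ⊢ (a ⊑ a ⊔ b)) CA ⟨ a ⟩
          y∈U : y ∈ U
          y∈U = (sets 3 (λ a b c → (a ⊑ b) ⇛ (c ⊑ a) ⇛ ⊢ (c ⊑ b)) CA U ⟨ y ⟩ CA⊆U y∈CA)
          all⊆ : A ⊆ yz ∪ (A ∩ setOf points)
          all⊆ = ⊆-intro λ v v∈ v∉ → let h = ∈-setOf (listed v) in (nonempty (sets 4 (λ a b c d → (a ⊑ b) ⇛ (a ⊑ ∼ (c
                                           ⊔ b ⊓ d)) ⇛ (a ⊑ d) ⇛ ⊢ (a ⊑ 𝟘)) ⟨ v ⟩ A yz (setOf points) v∈ v∉ h))
          others : ∀ e → e ∉ ⟨ e₀ ⟩ → φ k e ∈ B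
          others e e≠ = case φ k e ∈? B of λ where
            (inj₁ h) → h
            (inj₂ h) → case small e e₀ (sets 3 (λ a b c → (𝟙 ⊑ a ⊔ b) ⇛ (c ⊑ ∼ b) ⇛ ⊢ (c ⊑ a)) A B ⟨ φ k e ⟩ (cover s)
              h) h a∈A e₀∉ of λ where
              refl → ⊥-elim (nonempty {z = e₀} (sets 1 (λ a → (a ⊑ ∼ a) ⇛ ⊢ (a ⊑ 𝟘)) ⟨ e ⟩ e≠))
          Jn : Sub Q → Sub P
          Jn Y = img (φ k) (Y ∩ ∁ ⟨ e₀ ⟩)
          Jn⊆B : ∀ Y → Jn Y ⊆ B
          Jn⊆B Y = img-⊆ (φ k) λ e e∈ → others e (sets 3 (λ a b c → (a ⊑ b ⊓ ∼ c) ⇛ ⊢ (a ⊑ ∼ c)) ⟨ e ⟩ Y ⟨ e₀ ⟩ e∈)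
          img⊆Jn : ∀ Y → img (φ k) Y ⊆ Jn Y ∪ ⟨ a ⟩
          img⊆Jn Y = img-⊆ (φ k) λ e e∈ → case e ∈? ⟨ e₀ ⟩ of λ where
            (inj₁ h) → case same h of λ where
              refl → sets 2 (λ a b → ⊢ (b ⊑ a ⊔ b)) (Jn Y) ⟨ a ⟩
            (inj₂ h) → let g = ∈-img (φ k) {Y ∩ ∁ ⟨ e₀ ⟩} {e} (sets 3 (λ a b c → (a ⊑ b) ⇛ (a ⊑ ∼ c) ⇛ ⊢ (a ⊑ b ⊓ ∼
                             c)) ⟨ e ⟩ Y ⟨ e₀ ⟩ e∈ h)
                       in sets 3 (λ a b c → (c ⊑ a) ⇛ ⊢ (c ⊑ a ⊔ b)) (Jn Y) ⟨ a ⟩ ⟨ φ k e ⟩ g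
          Jn⊆img : ∀ Y → Jn Y ⊆ img (φ k) Y
          Jn⊆img Y = img-mono (φ k) (sets 2 (λ a b → ⊢ (a ⊓ ∼ b ⊑ a)) Y ⟨ e₀ ⟩)

          separates : (∀ Z → Z ⊆ B → y ∈ Z → r (Z ∪ U) + r CA ≡ r (Z ∪ CA) + r U) → ⊥
          separates const′ = case conn ⟨ e₀ ⟩ sum of λ where
              (inj₁ h) → nonempty {z = e₀} h
              (inj₂ h) → let e , e≠ = second e₀ in nonempty {z = e} (sets 2 (λ a b → (∼ a ⊑ 𝟘) ⇛ (b ⊑ ∼ a) ⇛ ⊢ (b ⊑
                               𝟘)) ⟨ e₀ ⟩ ⟨ e ⟩ h e≠)
            where
            I : Sub P
            I = img (φ k) (∁ ⟨ e₀ ⟩)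
            I⊆B : I ⊆ B
            I⊆B = img-⊆ (φ k) λ e e∈ → others e e∈
            sum : rN ⟨ e₀ ⟩ + rN (∁ ⟨ e₀ ⟩) ≤ rN 𝕌
            sum =
              let c₁ = const′ (I ∪ CB) (sets 3 (λ a b c → (a ⊑ b) ⇛ (c ⊑ b) ⇛ ⊢ (c ⊔ a ⊑ b)) CB B I CB⊆B I⊆B) (sets 3
                    (λ a b c → (a ⊑ b) ⇛ ⊢ (a ⊑ c ⊔ b)) ⟨ y ⟩ CB I y∈CB)
                  c₂ = const′ CB CB⊆B y∈CB
                  o₁ = old I (rank-φ k (∁ ⟨ e₀ ⟩))
                  t₁ = rank-φ k ⟨ e₀ ⟩
                  t₂ = rank-φ k 𝕌
                  i₀ : img (φ k) ⟨ e₀ ⟩ ⊆ ⟨ a ⟩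
                  i₀ = img-⊆ (φ k) λ e e∈ → case same e∈ of λ where
                    refl → sets 1 (λ a → ⊢ (a ⊑ a)) ⟨ a ⟩
                  i₁ : ⟨ a ⟩ ⊆ img (φ k) 𝕌
                  i₁ = ∈-img (φ k) {𝕌} {e₀} (sets 1 (λ a → ⊢ (a ⊑ 𝟙)) ⟨ e₀ ⟩)
                  i₂ : I ⊆ img (φ k) 𝕌
                  i₂ = img-mono (φ k) {∁ ⟨ e₀ ⟩} {𝕌} (sets 1 (λ a → ⊢ (∼ a ⊑ 𝟙)) ⟨ e₀ ⟩)
                  m₁ = mono {img (φ k) ⟨ e₀ ⟩ ∪ C k} {CB ∪ U} (sets 6 (λ a b c d e f → (a ⊑ b) ⇛ (c ⊑ d ⊔ e) ⇛ (e ⊔ b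
                    ⊑ f) ⇛ ⊢ (a ⊔ c ⊑ d ⊔ f)) (img (φ k) ⟨ e₀ ⟩) ⟨ a ⟩ (C k) CB CA U i₀ split ⊆U)
                  m₂ = mono {(I ∪ CB) ∪ U} {img (φ k) 𝕌 ∪ C k} (sets 7 (λ a b c d e f g → (a ⊑ b) ⇛ (c ⊑ b) ⇛ (d ⊔ e ⊑
                    f) ⇛ (g ⊑ e ⊔ a) ⇛ ⊢ ((c ⊔ d) ⊔ g ⊑ b ⊔ f)) ⟨ a ⟩ (img (φ k) 𝕌) I CB CA (C k) U i₁ i₂ joined U⊆)
                  m₃ = mono split
                  m₄ = mono joined
              in (linear 12 (λ a b c d e f g h i j k l → (b ⊕ a ≼ d ⊕ c) ⇒ (e ⊕ c ≼ f ⊕ a) ⇒ (g ⊕ f ≼ b) ⇒ (i ⊕ h ≼ j)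
                ⇒ (k ≼ l ⊕ h) ⇒ (j ≼ e) ⇒ (d ≼ k) ⇒ ⊩ (i ⊕ g ≼ l)) (r U) (r ((I ∪ CB) ∪ CA)) (r CA) (r ((I ∪ CB) ∪ U))
                (r (CB ∪ U)) (r (CB ∪ CA)) (rN (∁ ⟨ e₀ ⟩)) (r (C k)) (rN ⟨ e₀ ⟩) (r (img (φ k) ⟨ e₀ ⟩ ∪ (C k))) (r
                (img (φ k) 𝕌 ∪ (C k))) (rN 𝕌) (≤-reflexive (sym c₁)) (≤-reflexive c₂) (≤-reflexive o₁) (≤-reflexive
                t₁) (≤-reflexive (sym t₂)) m₁ m₂)

          swapped : Misses s CA → Hits s U → ∀ X a′ → Misses s X → yz ⊆ X → X ⊆ A → a′ ∈ A →
                    Hits s (X ∪ ⟨ a′ ⟩) → ∃ λ k′ → y ∈ C k′ × z ∈ C k′ × SmallIn k′ A B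
          swapped m h X a′ mX yz⊆X X⊆A a′∈A hX =
              mkCopy φ′ (CB ∪ X) (λ Y → assoc X (img φ′ Y) (rank-φ′ Y))
            , ⊆cl∈ (sets 3 (λ a b c → (a ⊑ b) ⇛ ⊢ (a ⊑ b ⊔ c)) ⟨ y ⟩ CB X y∈CB) , ⊆cl∈ (sets 4 (λ a b c d → (a ⊑ b) ⇛
              (b ⊑ c) ⇛ ⊢ (a ⊑ d ⊔ c)) ⟨ z ⟩ yz X CB z∈yz yz⊆X)
            , λ e e′ _ e∉ _ e′∉ → trans (sym (only e e∉)) (only e′ e′∉)
            where
            φ′ : Q → P
            φ′ e = [ (λ _ → a′) , (λ _ → φ k e) ]′ (e ∈? ⟨ e₀ ⟩)
            φ′-other : ∀ e → e ∉ ⟨ e₀ ⟩ → φ′ e ≡ φ k e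
            φ′-other e e≠ with e ∈? ⟨ e₀ ⟩
            ... | inj₂ _ = refl
            ... | inj₁ g = ⊥-elim (nonempty {z = e} (sets 2 (λ a b → (a ⊑ b) ⇛ (a ⊑ ∼ b) ⇛ ⊢ (a ⊑ 𝟘)) ⟨ e ⟩ ⟨ e₀ ⟩ g
              e≠))
            φ′-e₀ : φ′ e₀ ≡ a′
            φ′-e₀ with e₀ ∈? ⟨ e₀ ⟩
            ... | inj₁ _ = refl
            ... | inj₂ g = ⊥-elim (nonempty {z = e₀} (sets 1 (λ a → (a ⊑ ∼ a) ⇛ ⊢ (a ⊑ 𝟘)) ⟨ e₀ ⟩ g))
            only : ∀ e → φ′ e ∉ B → e₀ ≡ e
            only e e∉ = case e ∈? ⟨ e₀ ⟩ of λ where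
              (inj₁ g) → same g
              (inj₂ g) → let h = others e g
                             h′ : φ k e ∉ B
                             h′ = subst (_∉ B) (φ′-other e g) e∉
                         in ⊥-elim (nonempty (sets 2 (λ a b → (a ⊑ b) ⇛ (a ⊑ ∼ b) ⇛ ⊢ (a ⊑ 𝟘)) ⟨ φ k e ⟩ B h h′))
            Jn⊆img′ : ∀ Y → Jn Y ⊆ img φ′ Y
            Jn⊆img′ Y = img-⊆ (φ k) λ e e∈ →
              subst (_∈ img φ′ Y) (φ′-other e (sets 3 (λ a b c → (a ⊑ b ⊓ ∼ c) ⇛ ⊢ (a ⊑ ∼ c)) ⟨ e ⟩ Y ⟨ e₀ ⟩
                e∈)) (∈-img φ′ (sets 3 (λ a b c → (a ⊑ b ⊓ ∼ c) ⇛ ⊢ (a ⊑ b)) ⟨ e ⟩ Y ⟨ e₀ ⟩ e∈))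
            img′⊆ : ∀ Y Z → Jn Y ⊆ Z → (e₀ ∈ Y → a′ ∈ Z) → img φ′ Y ⊆ Z
            img′⊆ Y Z Jn⊆ a′∈ = img-⊆ φ′ λ e e∈ → case e ∈? ⟨ e₀ ⟩ of λ where
              (inj₁ g) → case same g of λ where refl → subst (_∈ Z) (sym φ′-e₀) (a′∈ e∈)
              (inj₂ g) → subst (_∈ Z) (sym (φ′-other e g))
                (let q : φ k e ∈ Jn Y
                     q = ∈-img (φ k) {Y ∩ ∁ ⟨ e₀ ⟩} {e} (sets 3 (λ a b c → (a ⊑ b) ⇛ (a ⊑ ∼ c) ⇛ ⊢ (a ⊑ b ⊓ ∼ c)) ⟨ e
                       ⟩ Y ⟨ e₀ ⟩ e∈ g) in (sets 3 (λ a b c → (a ⊑ b) ⇛ (c ⊑ a) ⇛ ⊢ (c ⊑ b)) (Jn Y) Z ⟨ φ k e ⟩ Jn⊆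
                       q))
            rank-φ′ : ∀ Y → rN Y + r (CB ∪ X) ≡ r ((img φ′ Y ∪ CB) ∪ X)
            rank-φ′ Y = case e₀ ∈? Y of λ where
                (inj₂ e₀∉Y) → without e₀∉Y
                (inj₁ e₀∈Y) → with-e₀ e₀∈Y
              where
              Z⊆ : Jn Y ∪ CB ⊆ B
              Z⊆ = (sets 3 (λ a b c → (a ⊑ b) ⇛ (c ⊑ b) ⇛ ⊢ (c ⊔ a ⊑ b)) CB B (Jn Y) CB⊆B (Jn⊆B Y))
              yZ : y ∈ Jn Y ∪ CB
              yZ = (sets 3 (λ a b c → (a ⊑ b) ⇛ ⊢ (a ⊑ c ⊔ b)) ⟨ y ⟩ CB (Jn Y) y∈CB)
              e₁ = when-misses s {CA} {CB} m y∈CA y∈CB CB⊆B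
              y∈X : y ∈ X
              y∈X = (sets 3 (λ a b c → (a ⊑ b) ⇛ (b ⊑ c) ⇛ ⊢ (a ⊑ c)) ⟨ y ⟩ yz X y∈yz yz⊆X)
              e₂ = when-misses s {X} {CB} mX y∈X y∈CB CB⊆B
              without : e₀ ∉ Y → rN Y + r (CB ∪ X) ≡ r ((img φ′ Y ∪ CB) ∪ X)
              without e₀∉Y =
                let o = old (img (φ k) Y) (rank-φ k Y)
                    j₁ = Jn⊆img Y
                    j₂ : img (φ k) Y ⊆ Jn Y
                    j₂ = img-mono (φ k) (sets 2 (λ a b → (a ⊑ ∼ b) ⇛ ⊢ (b ⊑ b ⊓ ∼ a)) ⟨ e₀ ⟩ Y e₀∉Y)
                    j₃ = Jn⊆img′ Y
                    j₄ = img′⊆ Y (Jn Y) (sets 1 (λ a → ⊢ (a ⊑ a)) (Jn Y)) (λ e∈ → ⊥-elim (nonempty {z = e₀} (sets 2 (λ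
                      a b → (a ⊑ ∼ b) ⇛ (a ⊑ b) ⇛ ⊢ (a ⊑ 𝟘)) ⟨ e₀ ⟩ Y e₀∉Y e∈)))
                    m₁ = mono {(img (φ k) Y ∪ CB) ∪ CA} {(Jn Y ∪ CB) ∪ CA} (sets 4 (λ a b c d → (a ⊑ b) ⇛ ⊢ ((a ⊔ c) ⊔
                      d ⊑ (b ⊔ c) ⊔ d)) (img (φ k) Y) (Jn Y) CB CA j₂)
                    m₂ = mono {(Jn Y ∪ CB) ∪ CA} {(img (φ k) Y ∪ CB) ∪ CA} (sets 4 (λ a b c d → (a ⊑ b) ⇛ ⊢ ((a ⊔ c) ⊔
                      d ⊑ (b ⊔ c) ⊔ d)) (Jn Y) (img (φ k) Y) CB CA j₁)
                    m₃ = mono {(img φ′ Y ∪ CB) ∪ X} {(Jn Y ∪ CB) ∪ X} (sets 4 (λ a b c d → (a ⊑ b) ⇛ ⊢ ((a ⊔ c) ⊔ d ⊑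
                      (b ⊔ c) ⊔ d)) (img φ′ Y) (Jn Y) CB X j₄)
                    m₄ = mono {(Jn Y ∪ CB) ∪ X} {(img φ′ Y ∪ CB) ∪ X} (sets 4 (λ a b c d → (a ⊑ b) ⇛ ⊢ ((a ⊔ c) ⊔ d ⊑
                      (b ⊔ c) ⊔ d)) (Jn Y) (img φ′ Y) CB X j₃)
                    e₃ = when-misses s {CA} {Jn Y ∪ CB} m y∈CA yZ Z⊆
                    e₄ = when-misses s {X} {Jn Y ∪ CB} mX y∈X yZ Z⊆
                in (≤-antisym (linear 11 (λ a b c d e f g h i j k → (b ⊕ a ≼ c) ⇒ (c ≼ d) ⇒ (e ≼ f) ⇒ (↑ d ≼ h ⊕ g) ⇒
                  (h ⊕ i ≼ ↑ e) ⇒ (j ⊕ g ≼ ↑ a) ⇒ (↑ k ≼ j ⊕ i) ⇒ ⊩ (b ⊕ k ≼ f)) (r (CB ∪ CA)) (rN Y) (r ((img (φ k) Y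
                  ∪ CB) ∪ CA)) (r ((Jn Y ∪ CB) ∪ CA)) (r ((Jn Y ∪ CB) ∪ X)) (r ((img φ′ Y ∪ CB) ∪ X)) (r CA) (r (Jn Y
                  ∪ CB)) (r X) (r CB) (r (CB ∪ X)) (≤-reflexive o) m₁ m₄ (≤-reflexive e₃) (≤-reflexive (sym e₄))
                  (≤-reflexive (sym e₁)) (≤-reflexive e₂)) (linear 11 (λ a b c d e f g h i j k → (a ≼ c ⊕ b) ⇒ (d ≼ a)
                  ⇒ (e ≼ f) ⇒ (h ⊕ g ≼ ↑ d) ⇒ (↑ f ≼ h ⊕ i) ⇒ (↑ b ≼ j ⊕ g) ⇒ (j ⊕ i ≼ ↑ k) ⇒ ⊩ (e ≼ c ⊕ k)) (r ((img
                  (φ k) Y ∪ CB) ∪ CA)) (r (CB ∪ CA)) (rN Y) (r ((Jn Y ∪ CB) ∪ CA)) (r ((img φ′ Y ∪ CB) ∪ X)) (r ((Jn Y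
                  ∪ CB) ∪ X)) (r CA) (r (Jn Y ∪ CB)) (r X) (r CB) (r (CB ∪ X)) (≤-reflexive (sym o)) m₂ m₃
                  (≤-reflexive (sym e₃)) (≤-reflexive e₄) (≤-reflexive e₁) (≤-reflexive (sym e₂))))
              with-e₀ : e₀ ∈ Y → rN Y + r (CB ∪ X) ≡ r ((img φ′ Y ∪ CB) ∪ X)
              with-e₀ e₀∈Y =
                let o = rank-φ k Y
                    j₁ = Jn⊆img Y
                    j₂ = img⊆Jn Y
                    j₃ = Jn⊆img′ Y
                    j₄ = img′⊆ Y (Jn Y ∪ ⟨ a′ ⟩) (sets 2 (λ a b → ⊢ (a ⊑ a ⊔ b)) (Jn Y) ⟨ a′ ⟩)
                           (λ _ → sets 2 (λ a b → ⊢ (b ⊑ a ⊔ b)) (Jn Y) ⟨ a′ ⟩)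
                    j₅ : a ∈ img (φ k) Y
                    j₅ = ∈-img (φ k) e₀∈Y
                    j₆ : a′ ∈ img φ′ Y
                    j₆ = subst (_∈ img φ′ Y) φ′-e₀ (∈-img φ′ e₀∈Y)
                    m₁ = mono {img (φ k) Y ∪ C k} {(Jn Y ∪ CB) ∪ U} (sets 7 (λ a b c d e f g → (a ⊑ b ⊔ c) ⇛ (d ⊑ e ⊔
                      f) ⇛ (f ⊔ c ⊑ g) ⇛ ⊢ (a ⊔ d ⊑ (b ⊔ e) ⊔ g)) (img (φ k) Y) (Jn Y) ⟨ a ⟩ (C k) CB CA U j₂ split
                      ⊆U)
                    m₂ = mono {(Jn Y ∪ CB) ∪ U} {img (φ k) Y ∪ C k} (sets 7 (λ a b c d e f g → (a ⊑ b) ⇛ (c ⊑ b) ⇛ (d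
                      ⊔ e ⊑ f) ⇛ (g ⊑ e ⊔ c) ⇛ ⊢ ((a ⊔ d) ⊔ g ⊑ b ⊔ f)) (Jn Y) (img (φ k) Y) ⟨ a ⟩ CB CA (C k) U j₁ j₅
                      joined U⊆)
                    m₃ = mono {(img φ′ Y ∪ CB) ∪ X} {(Jn Y ∪ CB) ∪ (X ∪ ⟨ a′ ⟩)} (sets 5 (λ a b c d e → (a ⊑ b ⊔ c) ⇛
                      ⊢ ((a ⊔ d) ⊔ e ⊑ (b ⊔ d) ⊔ e ⊔ c)) (img φ′ Y) (Jn Y) ⟨ a′ ⟩ CB X j₄)
                    m₄ = mono {(Jn Y ∪ CB) ∪ (X ∪ ⟨ a′ ⟩)} {(img φ′ Y ∪ CB) ∪ X} (sets 5 (λ a b c d e → (a ⊑ b) ⇛ (c ⊑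
                      b) ⇛ ⊢ ((a ⊔ d) ⊔ e ⊔ c ⊑ (b ⊔ d) ⊔ e)) (Jn Y) (img φ′ Y) ⟨ a′ ⟩ CB X j₃ j₆)
                    m₅ = mono split
                    m₆ = mono joined
                    m₇ = mono {CA ∪ B} {U ∪ B} (sets 3 (λ a b c → (a ⊑ b) ⇛ ⊢ (a ⊔ c ⊑ b ⊔ c)) CA U B CA⊆U)
                    m₈ = mono {X ∪ B} {(X ∪ ⟨ a′ ⟩) ∪ B} (sets 3 (λ a b c → ⊢ (a ⊔ b ⊑ (a ⊔ c) ⊔ b)) X B ⟨ a′ ⟩)
                    e₃ = when-hits s {U} {Jn Y ∪ CB} h U⊆A Z⊆
                    e₄ = when-hits s {X ∪ ⟨ a′ ⟩} {Jn Y ∪ CB} hX (sets 3 (λ a b c → (a ⊑ b) ⇛ (c ⊑ b) ⇛ ⊢ (a ⊔ c ⊑ b))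
                      X A ⟨ a′ ⟩ X⊆A a′∈A) Z⊆
                in (≤-antisym (linear 18 (λ a b c d e f g h i j k l m n o p q r → (b ⊕ a ≼ num 1 ⊕ c) ⇒ (num 2 ⊕ d ≼ e
                  ⊕ a) ⇒ (g ⊕ f ≼ h) ⇒ (h ≼ i) ⇒ (j ≼ k) ⇒ (l ≼ f) ⇒ (c ≼ d) ⇒ (i ⊕ m ≼ o ⊕ n) ⇒ (o ⊕ e ≼ j ⊕ m) ⇒ (q
                  ⊕ p ≼ ↑ l) ⇒ (↑ r ≼ q ⊕ b) ⇒ (n ≼ ↑ p) ⇒ ⊩ (g ⊕ r ≼ k)) (r B) (r X) (r (X ∪ B)) (r ((X ∪ ⟨ a′ ⟩) ∪
                  B)) (r (X ∪ ⟨ a′ ⟩)) (r (C k)) (rN Y) (r (img (φ k) Y ∪ (C k))) (r ((Jn Y ∪ CB) ∪ U)) (r ((Jn Y ∪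
                  CB) ∪ X ∪ ⟨ a′ ⟩)) (r ((img φ′ Y ∪ CB) ∪ X)) (r (CB ∪ CA)) (r A) (r U) (r ((Jn Y ∪ CB) ∪ A)) (r CA)
                  (r CB) (r (CB ∪ X)) mX hX (≤-reflexive o) m₁ m₄ m₆ m₈ (≤-reflexive e₃) (≤-reflexive (sym e₄))
                  (≤-reflexive (sym e₁)) (≤-reflexive e₂) rU) (linear 18 (λ a b c d e f g h i j k l m n o p q r → (a ≼
                  ↑ b) ⇒ (d ⊕ c ≼ num 1 ⊕ e) ⇒ (num 2 ⊕ f ≼ g ⊕ c) ⇒ (h ≼ j ⊕ i) ⇒ (k ≼ h) ⇒ (l ≼ m) ⇒ (i ≼ n) ⇒ (e ≼
                  f) ⇒ (o ⊕ g ≼ k ⊕ p) ⇒ (m ⊕ p ≼ o ⊕ a) ⇒ (↑ n ≼ q ⊕ d) ⇒ (q ⊕ b ≼ ↑ r) ⇒ ⊩ (l ≼ j ⊕ r)) (r (X ∪ ⟨ a′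
                  ⟩)) (r X) (r B) (r CA) (r (CA ∪ B)) (r (U ∪ B)) (r U) (r (img (φ k) Y ∪ (C k))) (r (C k)) (rN Y) (r
                  ((Jn Y ∪ CB) ∪ U)) (r ((img φ′ Y ∪ CB) ∪ X)) (r ((Jn Y ∪ CB) ∪ X ∪ ⟨ a′ ⟩)) (r (CB ∪ CA)) (r ((Jn Y
                  ∪ CB) ∪ A)) (r A) (r CB) (r (CB ∪ X)) (step X a′) m h (≤-reflexive (sym o)) m₂ m₃ m₅ m₇ (≤-reflexive
                  (sym e₃)) (≤-reflexive e₄) (≤-reflexive e₁) (≤-reflexive (sym e₂))))

      module _ (N-simple : ∀ {e e′} → e′ ∉ ⟨ e ⟩ → 2 ≤ rN (⟨ e ⟩ ∪ ⟨ e′ ⟩))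
               (q₁ q₂ q₃ q₄ : Q) (d₁₂ : ¬ q₁ ≡ q₂) (d₁₃ : ¬ q₁ ≡ q₃) (d₁₄ : ¬ q₁ ≡ q₄)
               (d₂₃ : ¬ q₂ ≡ q₃) (d₂₄ : ¬ q₂ ≡ q₄) (d₃₄ : ¬ q₃ ≡ q₄) where

        Two Three : (Q → Set) → Set
        Two   S = ∃₂ λ e e′ → ¬ e ≡ e′ × S e × S e′
        Three S = ∃₂ λ e e′ → ∃ λ e″ → ¬ e ≡ e′ × ¬ e ≡ e″ × ¬ e′ ≡ e″ × S e × S e′ × S e″

        three : (S : Q → Set) → (∀ e → S e ⊎ ¬ S e) →
                (∀ e e′ → ¬ S e → ¬ S e′ → e ≡ e′) → Three S
        three S S? one with S? q₁ | S? q₂ | S? q₃ | S? q₄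
        ... | inj₁ a | inj₁ b | inj₁ c | _      = q₁ , q₂ , q₃ , d₁₂ , d₁₃ , d₂₃ , a , b , c
        ... | inj₁ a | inj₁ b | inj₂ _ | inj₁ c = q₁ , q₂ , q₄ , d₁₂ , d₁₄ , d₂₄ , a , b , c
        ... | inj₁ a | inj₂ _ | inj₁ b | inj₁ c = q₁ , q₃ , q₄ , d₁₃ , d₁₄ , d₃₄ , a , b , c
        ... | inj₂ _ | inj₁ a | inj₁ b | inj₁ c = q₂ , q₃ , q₄ , d₂₃ , d₂₄ , d₃₄ , a , b , c
        ... | inj₂ a | inj₂ b | _      | _      = ⊥-elim (d₁₂ (one _ _ a b))
        ... | inj₂ a | inj₁ _ | inj₂ b | _      = ⊥-elim (d₁₃ (one _ _ a b))
        ... | inj₂ a | inj₁ _ | inj₁ _ | inj₂ b = ⊥-elim (d₁₄ (one _ _ a b))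
        ... | inj₁ _ | inj₂ a | inj₂ b | _      = ⊥-elim (d₂₃ (one _ _ a b))
        ... | inj₁ _ | inj₂ a | inj₁ _ | inj₂ b = ⊥-elim (d₂₄ (one _ _ a b))
        ... | inj₁ _ | inj₁ _ | inj₂ a | inj₂ b = ⊥-elim (d₃₄ (one _ _ a b))

        two : (S S′ : Q → Set) → (∀ e → S′ e ⊎ ¬ S′ e) → Three S →
              (∀ e e′ → ¬ S′ e → ¬ S′ e′ → e ≡ e′) → Two (λ e → S e × S′ e)
        two S S′ S′? (e₁ , e₂ , e₃ , n₁₂ , n₁₃ , n₂₃ , a , b , c) one with S′? e₁ | S′? e₂ | S′? e₃
        ... | inj₁ p | inj₁ q | _      = e₁ , e₂ , n₁₂ , (a , p) , (b , q)
        ... | inj₁ p | inj₂ _ | inj₁ q = e₁ , e₃ , n₁₃ , (a , p) , (c , q)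
        ... | inj₂ _ | inj₁ p | inj₁ q = e₂ , e₃ , n₂₃ , (b , p) , (c , q)
        ... | inj₂ p | inj₂ q | _      = ⊥-elim (n₁₂ (one _ _ p q))
        ... | inj₂ p | inj₁ _ | inj₂ q = ⊥-elim (n₁₃ (one _ _ p q))
        ... | inj₁ _ | inj₂ p | inj₂ q = ⊥-elim (n₂₃ (one _ _ p q))

        -- Each of the two sides holds at most one of four elements, so two elements lie in
        -- `B ∩ B′`. They have rank 2 over the contracted flat, impossible for a set of rank 1, or
        -- of rank 2 that meets this flat.
        opposite′ : ∀ {k A B A′ B′} → SmallIn k A B → SmallIn k A′ B′ →
                    𝕌 ⊆ A ∪ B → 𝕌 ⊆ A′ ∪ B′ →
                    r (B ∩ B′) ≤ 1 ⊎ (r (B ∩ B′) ≤ 2 × ∃ λ z → z ∈ B ∩ B′ × z ∈ C k) → ⊥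
        opposite′ {k} {A} {B} {A′} {B′} sm₁ sm₂ c₁ c₂ thin =
          let e , e′ , e≠e′ , (eB , eB′) , (e′B , e′B′) =
                two (λ e → φ k e ∈ B) (λ e → φ k e ∈ B′) (λ e → in? e B′)
                  (three (λ e → φ k e ∈ B) (λ e → in? e B) (λ e e′ n n′ →
                    let p = off n ; p′ = off n′ in sm₁ e e′ (sets 3 (λ a b c → (𝟙 ⊑ a ⊔ b) ⇛ (c ⊑ ∼ b) ⇛ ⊢ (c ⊑ a)) A
                          B ⟨ φ k e ⟩ c₁ p) p (sets 3 (λ a b c → (𝟙 ⊑ a ⊔ b) ⇛ (c ⊑ ∼ b) ⇛ ⊢ (c ⊑ a)) A B ⟨ φ k e′ ⟩
                          c₁ p′) p′))
                  (λ e e′ n n′ → let p = off n ; p′ = off n′ in sm₂ e e′ (sets 3 (λ a b c → (𝟙 ⊑ a ⊔ b) ⇛ (c ⊑ ∼ b) ⇛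
                                       ⊢ (c ⊑ a)) A′ B′ ⟨ φ k e ⟩ c₂ p) p (sets 3 (λ a b c → (𝟙 ⊑ a ⊔ b) ⇛ (c ⊑ ∼ b) ⇛
                                       ⊢ (c ⊑ a)) A′ B′ ⟨ φ k e′ ⟩ c₂ p′) p′)
              s = N-simple {e} {e′} (apart (λ q → e≠e′ (sym q)))
              i : img (φ k) (⟨ e ⟩ ∪ ⟨ e′ ⟩) ⊆ ⟨ φ k e ⟩ ∪ ⟨ φ k e′ ⟩
              i = img-⊆ (φ k) λ v v∈ → case v ∈? ⟨ e ⟩ of λ where
                (inj₁ g) → case same g of λ where refl → sets 2 (λ a b → ⊢ (a ⊑ a ⊔ b)) _ _
                (inj₂ g) → case same {z = v} {e′} (sets 3 (λ a b c → (a ⊑ b ⊔ c) ⇛ (a ⊑ ∼ b) ⇛ ⊢ (a ⊑ c)) ⟨ v ⟩ ⟨ e ⟩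
                  ⟨ e′ ⟩ v∈ g) of λ where
                  refl → sets 2 (λ a b → ⊢ (b ⊑ a ⊔ b)) _ _
              ρφ = rank-φ k (⟨ e ⟩ ∪ ⟨ e′ ⟩)
              m = mono {img (φ k) (⟨ e ⟩ ∪ ⟨ e′ ⟩) ∪ C k} {(B ∩ B′) ∪ C k} (sets 6 (λ a b c d e f → (a ⊑ b) ⇛ (a ⊑ c)
                ⇛ (d ⊑ b) ⇛ (d ⊑ c) ⇛ (e ⊑ a ⊔ d) ⇛ ⊢ (e ⊔ f ⊑ b ⊓ c ⊔ f)) ⟨ φ k e ⟩ B B′ ⟨ φ k e′ ⟩ (img (φ k) (⟨ e ⟩
                ∪ ⟨ e′ ⟩)) (C k) eB eB′ e′B e′B′ i)
          in case thin of λ where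
            (inj₁ h) → (linear 5 (λ a b c d e → (a ≼ c ⊕ b) ⇒ (c ≼ num 1) ⇒ (num 2 ≼ d) ⇒ (d ⊕ b ≼ e) ⇒ (e ≼ a) ⇒ ⊩⊥)
              (r (B ∩ B′ ∪ C k)) (r (C k)) (r (B ∩ B′)) (rN (⟨ e ⟩ ∪ ⟨ e′ ⟩)) (r (img (φ k) (⟨ e ⟩ ∪ ⟨ e′ ⟩) ∪ (C k)))
              (add (B ∩ B′) (C k)) h s (≤-reflexive ρφ) m)
            (inj₂ (h , z , z∈ , zC)) →
              let t = sm {(B ∩ B′) ∪ C k} {⟨ z ⟩} (B ∩ B′) (C k) (sets 3 (λ a b c → ⊢ (a ⊓ b ⊔ c ⊑ a ⊓ b ⊔ c)) B B′ (C
                    k)) (sets 4 (λ a b c d → (a ⊑ b ⊓ c) ⇛ (a ⊑ d) ⇛ ⊢ (a ⊑ (b ⊓ c) ⊓ d)) ⟨ z ⟩ B B′ (C k) z∈ zC)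
              in (linear 6 (λ a b c d e f → (num 1 ≼ a) ⇒ (b ≼ num 2) ⇒ (num 2 ≼ c) ⇒ (c ⊕ d ≼ e) ⇒ (e ≼ f) ⇒ (f ⊕ a ≼
                b ⊕ d) ⇒ ⊩⊥) (r ⟨ z ⟩) (r (B ∩ B′)) (rN (⟨ e ⟩ ∪ ⟨ e′ ⟩)) (r (C k)) (r (img (φ k) (⟨ e ⟩ ∪ ⟨ e′ ⟩) ∪
                (C k))) (r (B ∩ B′ ∪ C k)) (loopless z) h s (≤-reflexive ρφ) m t)
          where
          in? : ∀ e X → φ k e ∈ X ⊎ ¬ φ k e ∈ X
          in? e X = case φ k e ∈? X of λ where
            (inj₁ h) → inj₁ h
            (inj₂ h) → inj₂ λ g → (nonempty (sets 2 (λ a b → (a ⊑ ∼ b) ⇛ (a ⊑ b) ⇛ ⊢ (a ⊑ 𝟘)) ⟨ φ k e ⟩ X h g))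
          off : ∀ {e X} → ¬ φ k e ∈ X → φ k e ∉ X
          off {e} {X} n = case φ k e ∈? X of λ where
            (inj₁ h) → ⊥-elim (n h)
            (inj₂ h) → h

        tangles : Tangles
        tangles = record
          { Copy = CopyOf ; Con = C ; Small = SmallIn ; Con-flat = C-flat
          ; orient = λ {k} {y} {A} {B} y∈ s K → K (orient′ {k} {y} {A} {B} y∈ s)
          ; extend = λ {k} {y} {z} {A} {B} → extend′ {k} {y} {z} {A} {B}
          ; shrink = λ {k} {A} {B} {A′} {B′} sm₁ h e e′ p q p′ q′ →
              sm₁ e e′ (proj₁ (both k h p q)) (proj₂ (both k h p q))
                (proj₁ (both k h p′ q′)) (proj₂ (both k h p′ q′))
          ; opposite = λ {k} {A} {B} {A′} {B′} s₁ s₂ c₁ c₂ t →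
              ⊥-elim (opposite′ {k} {A} {B} {A′} {B′} s₁ s₂ c₁ c₂ t) }
          where
          both : ∀ k {A B A′ B′ e} → A′ ∩ ∁ B′ ⊆ A ∩ ∁ B → φ k e ∈ A′ → φ k e ∉ B′ → φ k e ∈ A × φ k e ∉ B
          both k {A} {B} {A′} {B′} {e} h p q = (sets 5 (λ a b c d e → (a ⊓ ∼ b ⊑ c ⊓ ∼ d) ⇛ (e ⊑ a) ⇛ (e ⊑ ∼ b) ⇛ ⊢ (e
            ⊑ c)) A′ B′ A B ⟨ φ k e ⟩ h p q) , (sets 5 (λ a b c d e → (a ⊓ ∼ b ⊑ c ⊓ ∼ d) ⇛ (e ⊑ a) ⇛ (e ⊑ ∼ b) ⇛ ⊢ (e
            ⊑ ∼ d)) A′ B′ A B ⟨ φ k e ⟩ h p q)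

open import Defs using (Matroid; rank; Element; _∖_; _/_; _*; _≅_; ⋃ᶠ; PairwiseDisjoint; HasMinor;
  Independent; Circuit; Cocircuit; Loop; Parallel; Simple; circuit?; Representative; representative?; si;
  Separation; ThreeConnected; VerticallyContractible; filament; IsFilament; Free)

-- Matroids as rank functions on their elements

private
  variable
    m n : ℕ

─-∉ : ∀ {x : Fin n} (p q : Subset n) → x S.∈ p ─ q → ¬ (x S.∈ q)
─-∉ {x = Fin.suc x} (_ Vec.∷ p) (false Vec.∷ q) (Vec.there h) (Vec.there h′) = ─-∉ p q h h′
─-∉ {x = Fin.suc x} (_ Vec.∷ p) (true Vec.∷ q) (Vec.there h) (Vec.there h′) = ─-∉ p q h h′

1≤∣∣ : ∀ {x : Fin n} {p} → x S.∈ p → 1 ≤ ∣ p ∣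
1≤∣∣ {x = x} {p} h = ≤-trans (≤-reflexive (sym (S.∣⁅x⁆∣≡1 x)))
  (S.p⊆q⇒∣p∣≤∣q∣ λ {y} y∈ → subst (S._∈ p) (sym (S.x∈⁅y⁆⇒x≡y x y∈)) h)

2≤∣∣ : ∀ {x y : Fin n} {p} → x S.∈ p → y S.∈ p → ¬ x ≡ y → 2 ≤ ∣ p ∣
2≤∣∣ {x = x} {y} {p} x∈ y∈ n =
  ≤-trans (s≤s (1≤∣∣ {x = y} (S.x∈p∧x≢y⇒x∈p-y y∈ (n ∘ sym)))) (S.x∈p⇒∣p-x∣<∣p∣ x∈)

member : ∀ {p : Subset n} → 1 ≤ ∣ p ∣ → ∃ (S._∈ p)
member {n} {p} h with S.nonempty? p
... | yes q = q
... | no q  = ⊥-elim (1+n≰n (≤-trans h (≤-reflexive (trans (cong ∣_∣ (S.Empty-unique q)) (S.∣⊥∣≡0 n)))))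

two-members : ∀ {p : Subset n} → 2 ≤ ∣ p ∣ → ∃₂ λ x y → x S.∈ p × y S.∈ p × ¬ x ≡ y
two-members {p = p} h with member (≤-trans (s≤s z≤n) h)
... | x , x∈ with Fin.any? (λ y → (y S.∈? p) ×-dec ¬? (x Fin.≟ y))
  where open import Relation.Nullary.Decidable using (_×-dec_; ¬?)
... | yes (y , y∈ , n) = x , y , x∈ , y∈ , n
... | no none = ⊥-elim (1+n≰n (≤-trans h (≤-trans
        (S.p⊆q⇒∣p∣≤∣q∣ {q = ⁅ x ⁆} λ {y} y∈ → case x Fin.≟ y of λ where
          (yes refl) → S.x∈⁅x⁆ x
          (no q) → ⊥-elim (none (y , y∈ , q)))
        (≤-reflexive (S.∣⁅x⁆∣≡1 x)))))

instance
  decElement : ∀ {m} {p : Subset m} → DecEq (∃ (S._∈ p))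
  decElement = deceq λ (i , i∈) (j , j∈) → case i Fin.≟ j of λ where
    (yes refl) → yes (cong (i ,_) ([]=-irrelevant i∈ j∈))
    (no q)     → no λ e → q (cong proj₁ e)

module Elements {m : ℕ} (G : Subset m) where

  Pt : Set
  Pt = ∃ (S._∈ G)

  bit : Sub Pt → Fin m → Bool
  bit X i = case i S.∈? G of λ where
    (yes p) → mem X (i , p)
    (no _)  → false

  toSub : Sub Pt → Subset m
  toSub X = tabulate (bit X)

  fromSub : Subset m → Sub Pt
  mem (fromSub Y) (i , _) = lookup Y i

  T-≡ : ∀ {b} → T b → b ≡ true
  T-≡ {true} _ = refl

  ≡-T : ∀ {b} → b ≡ true → T b
  ≡-T refl = tt

  fromSub⁺ : ∀ {Y i p} → i S.∈ Y → (i , p) ∈ fromSub Y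
  fromSub⁺ h = ∈-intro (≡-T ([]=⇒lookup h))

  fromSub⁻ : ∀ {Y i p} → (i , p) ∈ fromSub Y → i S.∈ Y
  fromSub⁻ {Y} {i} h = lookup⇒[]= i Y (T-≡ (∈-elim h))

  toSub⁺ : ∀ {X} (z : Pt) → z ∈ X → proj₁ z S.∈ toSub X
  toSub⁺ {X} (i , p) h = lookup⇒[]= i (toSub X) (trans (lookup∘tabulate (bit X) i) eq)
    where
    eq : bit X i ≡ true
    eq with i S.∈? G
    ... | yes q = trans (cong (λ q → mem X (i , q)) ([]=-irrelevant q p)) (T-≡ (∈-elim h))
    ... | no q  = ⊥-elim (q p)

  toSub⁻ : ∀ {X i} → i S.∈ toSub X → Σ (i S.∈ G) λ p → (i , p) ∈ X
  toSub⁻ {X} {i} h = go (trans (sym (lookup∘tabulate (bit X) i)) ([]=⇒lookup h))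
    where
    go : bit X i ≡ true → Σ (i S.∈ G) λ p → (i , p) ∈ X
    go e with i S.∈? G
    ... | yes q = q , ∈-intro (≡-T e)
    ... | no q  = case e of λ ()

  toSub-⊆ : ∀ {X} → toSub X S.⊆ G
  toSub-⊆ h = proj₁ (toSub⁻ h)

  toSub-mono : ∀ {X Y} → X ⊆ Y → toSub X S.⊆ toSub Y
  toSub-mono {X} {Y} h {i} i∈ = let p , q = toSub⁻ i∈ in
    toSub⁺ (i , p) (⊆-trans q h)
    where
    ⊆-trans : ∀ {A B C : Sub Pt} → A ⊆ B → B ⊆ C → A ⊆ C
    ⊆-trans {A} {B} {C} p q = sets 3 (λ a b c → (a ⊑ b) ⇛ (b ⊑ c) ⇛ ⊢ (a ⊑ c)) A B C p q

  fromSub-mono : ∀ {X Y} → X S.⊆ Y → fromSub X ⊆ fromSub Y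
  fromSub-mono {X} {Y} h = ⊆-intro λ (i , p) a b →
    let c = fromSub⁺ {Y} {i} {p} (h (fromSub⁻ {X} {i} {p} a)) in clash (i , p) c b

  to-from : ∀ {Y} → Y S.⊆ G → toSub (fromSub Y) ≡ Y
  to-from {Y} h = S.⊆-antisym
    (λ {i} i∈ → let p , q = toSub⁻ i∈ in fromSub⁻ {Y} {i} {p} q)
    (λ {i} i∈ → toSub⁺ (i , h i∈) (fromSub⁺ i∈))

  from-to⊆ : ∀ X → fromSub (toSub X) ⊆ X
  from-to⊆ X = ⊆-intro λ (i , p) a b → let p′ , q = toSub⁻ {X} (fromSub⁻ {toSub X} {i} {p} a) in
    clash (i , p) (subst (λ p → (i , p) ∈ X) ([]=-irrelevant p′ p) q) b

  ⊆from-to : ∀ X → X ⊆ fromSub (toSub X)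
  ⊆from-to X = ⊆-intro λ z a b → clash z (fromSub⁺ {toSub X} (toSub⁺ z a)) b

  pointsFrom : List (Fin m) → List Pt
  pointsFrom [] = []
  pointsFrom (i ∷ is) = case i S.∈? G of λ where
    (yes p) → (i , p) ∷ pointsFrom is
    (no _)  → pointsFrom is

  listed-from : ∀ {i is} (p : i S.∈ G) → i ∈ₗ is → (i , p) ∈ₗ pointsFrom is
  listed-from {i} {j ∷ is} p (here refl) with i S.∈? G
  ... | yes q = here (cong (i ,_) ([]=-irrelevant p q))
  ... | no q  = ⊥-elim (q p)
  listed-from {i} {j ∷ is} p (there h) with j S.∈? G
  ... | yes q = there (listed-from p h)
  ... | no q  = listed-from p h

-- With the elements of `M` as points, the rank function is only evaluated inside the ground set,
-- where its values have meaning.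
module Hat {m : ℕ} (M : Matroid m) where
  open Matroid M using () renaming (E to E₀; r to r₀; rank to rank₀; r-bounded to bd; r-monotone to mo; r-submodular to su)
  open Elements E₀ public

  hat : Ranked (Element M)
  hat = record
    { r = r₀ ∘ toSub
    ; mono = λ h → mo (toSub-mono h) toSub-⊆
    ; submod = λ X Y → ≤-trans
        (+-mono-≤
          (mo (λ {i} i∈ → let p , q = toSub⁻ i∈ in S.x∈p∪q⁺ (case (i , p) ∈? X of λ where
                (inj₁ h) → inj₁ (toSub⁺ (i , p) h)
                (inj₂ h) → inj₂ (toSub⁺ (i , p) (right X Y (i , p) q h))))
              (λ {i} i∈ → [ toSub-⊆ , toSub-⊆ ]′ (S.x∈p∪q⁻ _ _ i∈)))
          (mo (λ {i} i∈ → let p , q = toSub⁻ i∈ in S.x∈p∩q⁺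
                (toSub⁺ (i , p) (fst∩ X Y (i , p) q) , toSub⁺ (i , p) (snd∩ X Y (i , p) q)))
              (λ i∈ → toSub-⊆ (proj₁ (S.x∈p∩q⁻ _ _ i∈)))))
        (su toSub-⊆ toSub-⊆)
    ; r-∅ = ≤-trans (bd toSub-⊆) (≤-trans
        (S.p⊆q⇒∣p∣≤∣q∣ {q = S.⊥} (λ {i} i∈ → let p , q = toSub⁻ {∅} {i} i∈ in ⊥-elim (nonempty {z = (i , p)} q)))
        (≤-reflexive (S.∣⊥∣≡0 m)))
    ; r-point = λ (i , p) → ≤-trans (bd toSub-⊆) (≤-trans
        (S.p⊆q⇒∣p∣≤∣q∣ {q = ⁅ i ⁆} (λ {j} j∈ → let q , h = toSub⁻ {⟨ i , p ⟩} {j} j∈ in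
          subst (S._∈ ⁅ i ⁆) (cong proj₁ (same h)) (S.x∈⁅x⁆ i)))
        (≤-reflexive (S.∣⁅x⁆∣≡1 i)))
    ; points = pointsFrom (List.allFin m)
    ; listed = λ (i , p) → listed-from p (∈-allFin i) }
    where
    right : ∀ (X Y : Sub (Element M)) z → z ∈ X ∪ Y → z ∉ X → z ∈ Y
    right X Y z a b = (sets 3 (λ a b c → (a ⊑ b ⊔ c) ⇛ (a ⊑ ∼ b) ⇛ ⊢ (a ⊑ c)) ⟨ z ⟩ X Y a b)
    fst∩ : ∀ (X Y : Sub (Element M)) z → z ∈ X ∩ Y → z ∈ X
    fst∩ X Y z a = (sets 3 (λ a b c → (a ⊑ b ⊓ c) ⇛ ⊢ (a ⊑ b)) ⟨ z ⟩ X Y a)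
    snd∩ : ∀ (X Y : Sub (Element M)) z → z ∈ X ∩ Y → z ∈ Y
    snd∩ X Y z a = (sets 3 (λ a b c → (a ⊑ b ⊓ c) ⇛ ⊢ (a ⊑ c)) ⟨ z ⟩ X Y a)

  open Ranked hat public
  open Closure hat public

  r-sub : ∀ {Y} → Y S.⊆ E₀ → r₀ Y ≡ r (fromSub Y)
  r-sub h = cong r₀ (sym (to-from h))

  r-card : ∀ X → r X ≤ ∣ toSub X ∣
  r-card X = bd toSub-⊆

  toSub-∁ : ∀ X → toSub (∁ X) ≡ E₀ ─ toSub X
  toSub-∁ X = S.⊆-antisym
    (λ {i} i∈ → let p , q = toSub⁻ i∈ in S.x∈p∧x∉q⇒x∈p─q p
      (λ h → let p′ , q′ = toSub⁻ {X} h in clash (i , p) (subst (λ p → (i , p) ∈ X) ([]=-irrelevant p′ p) q′) q))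
    (λ {i} i∈ → let p = S.p─q⊆p E₀ (toSub X) i∈ in toSub⁺ (i , p)
      (case (i , p) ∈? X of λ where
        (inj₁ h) → ⊥-elim (─-∉ E₀ (toSub X) i∈ (toSub⁺ (i , p) h))
        (inj₂ h) → h))

  rank-hat : rank₀ ≡ ρ
  rank-hat = cong r₀ (S.⊆-antisym (λ {i} i∈ → toSub⁺ {𝕌} (i , i∈) (sets 1 (λ a → ⊢ (a ⊑ 𝟙)) _)) toSub-⊆)

  module _ (tc : ThreeConnected M) where

    no-separation : ∀ k X → 1 ≤ k → k < 3 → k ≤ ∣ toSub X ∣ → k ≤ ∣ toSub (∁ X) ∣ →
                    r X + r (∁ X) < ρ + k → ⊥
    no-separation k X 1≤k k<3 a b c = tc k 1≤k k<3
      ( toSub X , toSub-⊆ , a , subst (λ Y → k ≤ ∣ Y ∣) (toSub-∁ X) b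
      , subst₂ _<_ (cong (λ Y → r X + r₀ Y) (toSub-∁ X)) (cong (_+ k) (sym rank-hat)) c)

    whole : ∀ X → ρ ≤ r X + r (∁ X)
    whole X = ≤-trans (mono {𝕌} {X ∪ ∁ X} (sets 1 (λ a → ⊢ (𝟙 ⊑ a ⊔ ∼ a)) X)) (add X (∁ X))

    -- The definition of 3-connectivity counts elements, this one ranks. Since neither side spans,
    -- the part of rank that one side lacks must be supplied by the other, which bounds the sizes
    -- from below.
    vc3 : ∀ A B → 𝕌 ⊆ A ∪ B → r A < ρ → r B < ρ → 2 + ρ ≤ r A + r B
    vc3 A B c lA lB = ≤-by-contra λ lt →
      let m = mono {∁ A} {B} (sets 2 (λ a b → (𝟙 ⊑ a ⊔ b) ⇛ ⊢ (∼ a ⊑ b)) A B c) in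
      case ≤-or-> (r A + r (∁ A)) ρ of λ where
        (inj₁ le) → no-separation 1 A ≤-refl (s≤s (s≤s z≤n))
          (≤-trans (linear 4 (λ a b c d → (a ≼ c ⊕ b) ⇒ (↑ d ≼ a) ⇒ (b ≼ d) ⇒ ⊩ (num 1 ≼ c)) ρ (r (∁ A)) (r A) (r B)
            (whole A) lB m) (r-card A)) (≤-trans (linear 3 (λ a b c → (a ≼ c ⊕ b) ⇒ (↑ c ≼ a) ⇒ ⊩ (num 1 ≼ b)) ρ (r (∁
            A)) (r A) (whole A) lA) (r-card (∁ A))) (linear 3 (λ a b c → (b ⊕ a ≼ c) ⇒ ⊩ (↑ (b ⊕ a) ≼ c ⊕ num 1)) (r
            (∁ A)) (r A) ρ le)
        (inj₂ gt) → no-separation 2 A (s≤s z≤n) ≤-refl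
          (≤-trans (linear 4 (λ a b c d → (↑ a ≼ b) ⇒ (↑ b ≼ d ⊕ c) ⇒ (c ≼ a) ⇒ ⊩ (num 2 ≼ d)) (r B) ρ (r (∁ A)) (r A)
            lB gt m) (r-card A)) (≤-trans (linear 3 (λ a b c → (↑ a ≼ b) ⇒ (↑ b ≼ a ⊕ c) ⇒ ⊩ (num 2 ≼ c)) (r A) ρ (r
            (∁ A)) lA gt) (r-card (∁ A))) (linear 4 (λ a b c d → (↑ (b ⊕ a) ≼ num 2 ⊕ c) ⇒ (d ≼ a) ⇒ ⊩ (↑ (b ⊕ d) ≼ c
            ⊕ num 2)) (r B) (r A) ρ (r (∁ A)) lt m)

    module _ (2≤ρ : 2 ≤ ρ) where

      loopless : ∀ z → 1 ≤ r ⟨ z ⟩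
      loopless z = ≤-by-contra λ lt → no-separation 1 ⟨ z ⟩ ≤-refl (s≤s (s≤s z≤n))
        (1≤∣∣ (toSub⁺ z (sets 1 (λ a → ⊢ (a ⊑ a)) ⟨ z ⟩)))
        (≤-trans (linear 3 (λ a b c → (a ≼ c ⊕ b) ⇒ (num 2 ≼ a) ⇒ (↑ c ≼ num 1) ⇒ ⊩ (num 1 ≼ b)) ρ (r (∁ ⟨ z ⟩)) (r ⟨
          z ⟩) (whole ⟨ z ⟩) 2≤ρ lt) (r-card (∁ ⟨ z ⟩))) (linear 3 (λ a b c → (a ≼ b) ⇒ (↑ c ≼ num 1) ⇒ ⊩ (↑ (c ⊕ a) ≼
          b ⊕ num 1)) (r (∁ ⟨ z ⟩)) ρ (r ⟨ z ⟩) (mono {∁ ⟨ z ⟩} {𝕌} (sets 1 (λ a → ⊢ (a ⊑ 𝟙)) _)) lt)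

      -- Two points of rank at most 1 would be one side of a separation of order two, or of order
      -- one if the rest has rank at most 1.
      simple : ∀ {y z} → z ∉ ⟨ y ⟩ → 2 ≤ r (⟨ y ⟩ ∪ ⟨ z ⟩)
      simple {y} {z} z≠y = ≤-by-contra λ lt →
          let X = ⟨ y ⟩ ∪ ⟨ z ⟩
              w = whole (⟨ y ⟩ ∪ ⟨ z ⟩)
              m = mono {∁ (⟨ y ⟩ ∪ ⟨ z ⟩)} {𝕌} (sets 1 (λ a → ⊢ (a ⊑ 𝟙)) _)
          in case ≤-or-> 2 (r (∁ (⟨ y ⟩ ∪ ⟨ z ⟩))) of λ where
            (inj₁ ge) → no-separation 2 (⟨ y ⟩ ∪ ⟨ z ⟩) (s≤s z≤n) ≤-refl two
              (≤-trans ge (r-card (∁ (⟨ y ⟩ ∪ ⟨ z ⟩)))) (linear 3 (λ a b c → (↑ a ≼ num 2) ⇒ (b ≼ c) ⇒ ⊩ (↑ (a ⊕ b) ≼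
                c ⊕ num 2)) (r (⟨ y ⟩ ∪ ⟨ z ⟩)) (r (∁ (⟨ y ⟩ ∪ ⟨ z ⟩))) ρ lt m)
            (inj₂ le) → no-separation 1 (⟨ y ⟩ ∪ ⟨ z ⟩) ≤-refl (s≤s (s≤s z≤n)) (≤-trans (s≤s z≤n) two)
              (≤-trans (linear 3 (λ a b c → (num 2 ≼ a) ⇒ (↑ b ≼ num 2) ⇒ (a ≼ b ⊕ c) ⇒ ⊩ (num 1 ≼ c)) ρ (r (⟨ y ⟩ ∪ ⟨
                z ⟩)) (r (∁ (⟨ y ⟩ ∪ ⟨ z ⟩))) 2≤ρ lt w) (r-card (∁ (⟨ y ⟩ ∪ ⟨ z ⟩)))) (linear 3 (λ a b c → (num 2 ≼ a)
                ⇒ (↑ b ≼ num 2) ⇒ (↑ c ≼ num 2) ⇒ ⊩ (↑ (b ⊕ c) ≼ a ⊕ num 1)) ρ (r (⟨ y ⟩ ∪ ⟨ z ⟩)) (r (∁ (⟨ y ⟩ ∪ ⟨ z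
                ⟩))) 2≤ρ lt le)
        where
        y≢z : ¬ proj₁ y ≡ proj₁ z
        y≢z e = case at z≠y z (self z) of λ t → nope y z e t
          where
          nope : ∀ (y z : Element M) → proj₁ y ≡ proj₁ z → T (mem (∁ ⟨ y ⟩) z) → ⊥
          nope (i , p) (i , q) refl t with []=-irrelevant p q
          ... | refl = not-T t (self (i , p))
        two : 2 ≤ ∣ toSub (⟨ y ⟩ ∪ ⟨ z ⟩) ∣
        two = 2≤∣∣ (toSub⁺ y (sets 2 (λ a b → (a ⊑ ∼ b) ⇛ ⊢ (b ⊑ b ⊔ a)) ⟨ z ⟩ ⟨ y ⟩ z≠y)) (toSub⁺ z (sets 2 (λ a b →
          (a ⊑ ∼ b) ⇛ ⊢ (a ⊑ b ⊔ a)) ⟨ z ⟩ ⟨ y ⟩ z≠y)) y≢z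

    AtMostOne : Sub (Element M) → Set
    AtMostOne Y = ∀ e e′ → e ∈ Y → e′ ∈ Y → e ≡ e′

    few : ∀ Y → ∣ toSub Y ∣ ≤ 1 → AtMostOne Y
    few Y h (i , p) (j , q) a b = case i Fin.≟ j of λ where
      (yes refl) → cong (i ,_) ([]=-irrelevant p q)
      (no n) → ⊥-elim (1+n≰n (≤-trans (2≤∣∣ (toSub⁺ (i , p) a) (toSub⁺ (j , q) b) n) h))

    3-conn : ∀ Y → r Y + r (∁ Y) ≤ suc ρ → AtMostOne Y ⊎ AtMostOne (∁ Y)
    3-conn Y h = case ≤-or-> (∣ toSub Y ∣) 1 ,′ ≤-or-> (∣ toSub (∁ Y) ∣) 1 of λ where
      (inj₁ a , _) → inj₁ (few Y a)
      (inj₂ _ , inj₁ b) → inj₂ (few (∁ Y) b)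
      (inj₂ a , inj₂ b) → ⊥-elim (no-separation 2 Y (s≤s z≤n) ≤-refl a b (linear 3 (λ a b c → (b ⊕ a ≼ ↑ c) ⇒ ⊩ (↑ (b
        ⊕ a) ≼ c ⊕ num 2)) (r (∁ Y)) (r Y) ρ h))

    conn : ∀ Y → r Y + r (∁ Y) ≤ ρ → Y ⊆ ∅ ⊎ ∁ Y ⊆ ∅
    conn Y h = case ≤-or-> (∣ toSub Y ∣) 0 ,′ ≤-or-> (∣ toSub (∁ Y) ∣) 0 of λ where
        (inj₁ a , _) → inj₁ (none Y a)
        (inj₂ _ , inj₁ b) → inj₂ (none (∁ Y) b)
        (inj₂ a , inj₂ b) → ⊥-elim (no-separation 1 Y ≤-refl (s≤s (s≤s z≤n)) a b (linear 3 (λ a b c → (b ⊕ a ≼ c) ⇒ ⊩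
          (↑ (b ⊕ a) ≼ c ⊕ num 1)) (r (∁ Y)) (r Y) ρ h))
      where
      none : ∀ Y → ∣ toSub Y ∣ ≤ 0 → Y ⊆ ∅
      none Y a = ⊆-intro λ z z∈ _ → 1+n≰n (≤-trans (1≤∣∣ (toSub⁺ z z∈)) a)

-- Simplification, contraction and minors

module Simplification {m : ℕ} (K : Matroid m) where
  open Matroid K using () renaming (E to E₀; r to r₀; rank to rank₀; r-bounded to bd; r-monotone to mo)
  open Hat K

  sub₁ : ∀ i (p : i S.∈ E₀) → toSub ⟨ i , p ⟩ ≡ ⁅ i ⁆
  sub₁ i p = S.⊆-antisym
    (λ {j} j∈ → let q , h = toSub⁻ {⟨ i , p ⟩} {j} j∈ in subst (S._∈ ⁅ i ⁆) (cong proj₁ (same h)) (S.x∈⁅x⁆ i))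
    (λ {j} j∈ → subst (S._∈ toSub ⟨ i , p ⟩) (sym (S.x∈⁅y⁆⇒x≡y i j∈))
      (toSub⁺ (i , p) (sets 1 (λ a → ⊢ (a ⊑ a)) _)))

  sub₂ : ∀ i j (p : i S.∈ E₀) (q : j S.∈ E₀) → toSub (⟨ i , p ⟩ ∪ ⟨ j , q ⟩) ≡ ⁅ i ⁆ S.∪ ⁅ j ⁆
  sub₂ i j p q = S.⊆-antisym
    (λ {k} k∈ → let s , h = toSub⁻ {⟨ i , p ⟩ ∪ ⟨ j , q ⟩} {k} k∈ in
      S.x∈p∪q⁺ (case (k , s) ∈? ⟨ i , p ⟩ of λ where
        (inj₁ g) → inj₁ (subst (S._∈ ⁅ i ⁆) (cong proj₁ (same g)) (S.x∈⁅x⁆ i))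
        (inj₂ g) → inj₂ (subst (S._∈ ⁅ j ⁆) (cong proj₁ (same (snd (k , s) (i , p) (j , q) h g))) (S.x∈⁅x⁆ j))))
    (λ {k} k∈ → case S.x∈p∪q⁻ ⁅ i ⁆ ⁅ j ⁆ k∈ of λ where
      (inj₁ g) → subst (S._∈ toSub (⟨ i , p ⟩ ∪ ⟨ j , q ⟩)) (sym (S.x∈⁅y⁆⇒x≡y i g))
        (toSub⁺ (i , p) (sets 2 (λ a b → ⊢ (a ⊑ a ⊔ b)) _ _))
      (inj₂ g) → subst (S._∈ toSub (⟨ i , p ⟩ ∪ ⟨ j , q ⟩)) (sym (S.x∈⁅y⁆⇒x≡y j g))
        (toSub⁺ (j , q) (sets 2 (λ a b → ⊢ (b ⊑ a ⊔ b)) _ _)))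
    where
    snd : ∀ z x y → z ∈ ⟨ x ⟩ ∪ ⟨ y ⟩ → z ∉ ⟨ x ⟩ → z ∈ ⟨ y ⟩
    snd z x y a b = (sets 3 (λ a b c → (a ⊑ b ⊔ c) ⇛ (a ⊑ ∼ b) ⇛ ⊢ (a ⊑ c)) ⟨ z ⟩ ⟨ x ⟩ ⟨ y ⟩ a b)

  ∅-independent : ∀ D → ∣ D ∣ ≤ 0 → D S.⊆ E₀ → Independent K D
  ∅-independent D h s = s , ≤-antisym (bd s) (≤-trans h z≤n)

  nonloop : ∀ {e} → e S.∈ E₀ → ¬ Loop K e → 1 ≤ r₀ ⁅ e ⁆
  nonloop {e} e∈ n = ≤-by-contra λ lt → n
    ( ((λ h → subst (S._∈ E₀) (sym (S.x∈⁅y⁆⇒x≡y e h)) e∈)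
      , ≤-trans lt (≤-reflexive (sym (S.∣⁅x⁆∣≡1 e))))
    , λ D D⊂ → ∅-independent D
        (≤-pred (≤-trans (S.p⊂q⇒∣p∣<∣q∣ D⊂) (≤-reflexive (S.∣⁅x⁆∣≡1 e))))
        (λ h → subst (S._∈ E₀) (sym (S.x∈⁅y⁆⇒x≡y e (proj₁ D⊂ h))) e∈) )

  nonloop⁻ : ∀ {e} → 1 ≤ r₀ ⁅ e ⁆ → ¬ Loop K e
  nonloop⁻ {e} h ((_ , lt) , _) = 1+n≰n (≤-trans (s≤s h) (≤-trans lt (≤-reflexive (S.∣⁅x⁆∣≡1 e))))

  nonparallel : ∀ {e f} → e S.∈ E₀ → f S.∈ E₀ → 1 ≤ r₀ ⁅ e ⁆ → 1 ≤ r₀ ⁅ f ⁆ → ¬ e ≡ f →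
                ¬ Parallel K e f → 2 ≤ r₀ (⁅ e ⁆ S.∪ ⁅ f ⁆)
  nonparallel {e} {f} e∈ f∈ re rf e≢f n = ≤-by-contra λ lt → n (e≢f ,
      ( (ef⊆ , ≤-trans lt (2≤∣∣ (S.x∈p∪q⁺ (inj₁ (S.x∈⁅x⁆ e))) (S.x∈p∪q⁺ (inj₂ (S.x∈⁅x⁆ f))) e≢f))
      , λ D D⊂ → (ef⊆ ∘ proj₁ D⊂) , ≤-antisym (bd (ef⊆ ∘ proj₁ D⊂)) (full D D⊂)))
    where
    ef⊆ : ⁅ e ⁆ S.∪ ⁅ f ⁆ S.⊆ E₀
    ef⊆ h = case S.x∈p∪q⁻ ⁅ e ⁆ ⁅ f ⁆ h of λ where
      (inj₁ g) → subst (S._∈ E₀) (sym (S.x∈⁅y⁆⇒x≡y e g)) e∈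
      (inj₂ g) → subst (S._∈ E₀) (sym (S.x∈⁅y⁆⇒x≡y f g)) f∈
    which : ∀ {x} → x S.∈ ⁅ e ⁆ S.∪ ⁅ f ⁆ → x ≡ e ⊎ x ≡ f
    which h = case S.x∈p∪q⁻ ⁅ e ⁆ ⁅ f ⁆ h of λ where
      (inj₁ g) → inj₁ (S.x∈⁅y⁆⇒x≡y e g)
      (inj₂ g) → inj₂ (S.x∈⁅y⁆⇒x≡y f g)
    full : ∀ D → D S.⊂ ⁅ e ⁆ S.∪ ⁅ f ⁆ → ∣ D ∣ ≤ r₀ D
    three-of-two : ∀ {D} x y z → x S.∈ D → y S.∈ D → ¬ z S.∈ D → ¬ x ≡ y →
            x ≡ e ⊎ x ≡ f → y ≡ e ⊎ y ≡ f → z ≡ e ⊎ z ≡ f → ⊥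
    three-of-two x y z x∈ y∈ z∉ x≢y (inj₁ refl) (inj₁ refl) _           = x≢y refl
    three-of-two x y z x∈ y∈ z∉ x≢y (inj₂ refl) (inj₂ refl) _           = x≢y refl
    three-of-two x y z x∈ y∈ z∉ x≢y (inj₁ refl) (inj₂ refl) (inj₁ refl) = z∉ x∈
    three-of-two x y z x∈ y∈ z∉ x≢y (inj₁ refl) (inj₂ refl) (inj₂ refl) = z∉ y∈
    three-of-two x y z x∈ y∈ z∉ x≢y (inj₂ refl) (inj₁ refl) (inj₁ refl) = z∉ y∈
    three-of-two x y z x∈ y∈ z∉ x≢y (inj₂ refl) (inj₁ refl) (inj₂ refl) = z∉ x∈
    rank-of : ∀ x → x ≡ e ⊎ x ≡ f → 1 ≤ r₀ ⁅ x ⁆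
    rank-of x (inj₁ refl) = re
    rank-of x (inj₂ refl) = rf
    full D (D⊆ , z , z∈ , z∉) = case ≤-or-> ∣ D ∣ 1 of λ where
      (inj₂ h) → let x , y , x∈ , y∈ , x≢y = two-members h in
        ⊥-elim (three-of-two x y z x∈ y∈ z∉ x≢y (which (D⊆ x∈)) (which (D⊆ y∈)) (which z∈))
      (inj₁ h) → case ≤-or-> ∣ D ∣ 0 of λ where
        (inj₁ h′) → ≤-trans h′ z≤n
        (inj₂ h′) → let x , x∈ = member h′ in ≤-trans h (≤-trans
          (rank-of x (which (D⊆ x∈)))
          (mo (λ {y} y∈ → subst (S._∈ D) (sym (S.x∈⁅y⁆⇒x≡y x y∈)) x∈) (ef⊆ ∘ D⊆)))

  parallel⁻ : ∀ {e f} → Parallel K e f → (e S.∈ E₀ × f S.∈ E₀) × r₀ (⁅ e ⁆ S.∪ ⁅ f ⁆) ≤ 1 × 1 ≤ r₀ ⁅ e ⁆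
  parallel⁻ {e} {f} (e≢f , ((sub′ , lt) , minimal)) =
      (sub′ (S.x∈p∪q⁺ (inj₁ (S.x∈⁅x⁆ e))) , sub′ (S.x∈p∪q⁺ (inj₂ (S.x∈⁅x⁆ f))))
    , ≤-pred (≤-trans lt ∣ef∣≤2) , ≤-reflexive (sym re)
    where
    re : r₀ ⁅ e ⁆ ≡ 1
    re = trans (proj₂ (minimal ⁅ e ⁆ ((λ h → S.x∈p∪q⁺ (inj₁ h)) ,
      f , S.x∈p∪q⁺ (inj₂ (S.x∈⁅x⁆ f)) , λ h → e≢f (sym (S.x∈⁅y⁆⇒x≡y e h))))) (S.∣⁅x⁆∣≡1 e)
    ∣ef∣≤2 : ∣ ⁅ e ⁆ S.∪ ⁅ f ⁆ ∣ ≤ 2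
    ∣ef∣≤2 = ≤-by-contra λ h → 1+n≰n (≤-trans (≤-trans h
      (≤-reflexive refl)) (union e f))
      where
      union : ∀ {n} (e f : Fin n) → ∣ ⁅ e ⁆ S.∪ ⁅ f ⁆ ∣ ≤ 2
      union {suc n} Fin.zero    Fin.zero    = s≤s (≤-trans (≤-reflexive (trans (cong ∣_∣ (S.∪-identityˡ (S.⊥ {n = n}))) (S.∣⊥∣≡0 n))) z≤n)
      union {suc n} Fin.zero    (Fin.suc f) = s≤s (≤-reflexive (trans (cong ∣_∣ (S.∪-identityˡ ⁅ f ⁆)) (S.∣⁅x⁆∣≡1 f)))
      union {suc n} (Fin.suc e) Fin.zero    = s≤s (≤-reflexive (trans (cong ∣_∣ (S.∪-identityʳ ⁅ e ⁆)) (S.∣⁅x⁆∣≡1 e)))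
      union {suc n} (Fin.suc e) (Fin.suc f) = union e f

  R : Subset m
  R = tabulate (λ e → does (representative? K e))

  R⁺ : ∀ {e} → Representative K e → e S.∈ R
  R⁺ {e} h = lookup⇒[]= e R
    (trans (lookup∘tabulate (λ e → does (representative? K e)) e) (dec-true (representative? K e) h))

  R⁻ : ∀ {e} → e S.∈ R → Representative K e
  R⁻ {e} h = from-does (representative? K e)
    (trans (sym (lookup∘tabulate (λ e → does (representative? K e)) e)) ([]=⇒lookup h))
    where
    from-does : ∀ {A : Set} (d : Dec A) → does d ≡ true → A
    from-does (yes a) _ = a

  r₁ : ∀ {z : Element K} → r ⟨ z ⟩ ≡ r₀ ⁅ proj₁ z ⁆
  r₁ {i , p} = cong r₀ (sub₁ i p)

  r₂ : ∀ {z w : Element K} → r (⟨ z ⟩ ∪ ⟨ w ⟩) ≡ r₀ (⁅ proj₁ z ⁆ S.∪ ⁅ proj₁ w ⁆)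
  r₂ {i , p} {j , q} = cong r₀ (sub₂ i j p q)

  -- A non-loop that is not a representative is parallel to an element of smaller index; the
  -- descent, bounded by `n`, ends at a representative.
  rep-from : ∀ n (z : Element K) → Fin.toℕ (proj₁ z) < n → 1 ≤ r ⟨ z ⟩ →
             ∃ λ (e : Element K) → Representative K (proj₁ e) × r (⟨ e ⟩ ∪ ⟨ z ⟩) ≤ 1
  rep-from (suc n) (i , i∈) lt h = case representative? K i of λ where
      (yes rp) → (i , i∈) , rp , ≤-trans (mono (sets 1 (λ a → ⊢ (a ⊔ a ⊑ a)) _)) (r-point _)
      (no nrp) → case Fin.any? (λ f → (f Fin.<? i) ×-dec (¬? (f Fin.≟ i) ×-dec circuit? K (⁅ f ⁆ S.∪ ⁅ i ⁆))) of λ where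
        (no none) → ⊥-elim (nrp (i∈ , nonloop⁻ (≤-trans h (≤-reflexive r₁)) , none))
        (yes (f , f<i , par)) →
          let (f∈ , _) , r≤1 , rf = parallel⁻ par
              e , rp , le = rep-from n (f , f∈) (≤-trans f<i (≤-pred lt)) (≤-trans rf (≤-reflexive (sym r₁)))
          in e , rp , join e (f , f∈) (i , i∈) le (≤-trans (≤-reflexive r₂) r≤1) (≤-trans rf (≤-reflexive (sym r₁)))
    where
    join : ∀ e f i → r (⟨ e ⟩ ∪ ⟨ f ⟩) ≤ 1 → r (⟨ f ⟩ ∪ ⟨ i ⟩) ≤ 1 → 1 ≤ r ⟨ f ⟩ → r (⟨ e ⟩ ∪ ⟨ i ⟩) ≤ 1
    join e f i p q h =
      let s = sm {⟨ e ⟩ ∪ ⟨ i ⟩} {⟨ f ⟩} (⟨ e ⟩ ∪ ⟨ f ⟩) (⟨ f ⟩ ∪ ⟨ i ⟩) (sets 3 (λ a b c → ⊢ (a ⊔ b ⊑ (a ⊔ c) ⊔ c ⊔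
            b)) ⟨ e ⟩ ⟨ i ⟩ ⟨ f ⟩) (sets 3 (λ a b c → ⊢ (a ⊑ (b ⊔ a) ⊓ (a ⊔ c))) ⟨ f ⟩ ⟨ e ⟩ ⟨ i ⟩) in (linear 4 (λ a
            b c d → (a ≼ num 1) ⇒ (b ≼ num 1) ⇒ (num 1 ≼ c) ⇒ (d ⊕ c ≼ a ⊕ b) ⇒ ⊩ (d ≼ num 1)) (r (⟨ e ⟩ ∪ ⟨ f ⟩)) (r
            (⟨ f ⟩ ∪ ⟨ i ⟩)) (r ⟨ f ⟩) (r (⟨ e ⟩ ∪ ⟨ i ⟩)) p q h s)

  rep : ∀ (z : Element K) → 1 ≤ r ⟨ z ⟩ →
        ∃ λ (e : Element K) → Representative K (proj₁ e) × r (⟨ e ⟩ ∪ ⟨ z ⟩) ≤ 1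
  rep z = rep-from m z (Fin.toℕ<n (proj₁ z))

  -- The sides of a separation of order one or two are closed up in `K`, where they cover since
  -- every element is a loop or parallel to a representative. Representatives are independent in
  -- pairs, so a side of size at least `k` has rank at least `k`; hence neither closure spans and
  -- `vc` applies.
  vc3⇒si-3-connected :
    (∀ A B → 𝕌 ⊆ A ∪ B → r A < ρ → r B < ρ → 2 + ρ ≤ r A + r B) → ThreeConnected (si K)
  vc3⇒si-3-connected vc k 1≤k k<3 (Y , Y⊆ , kY , kZ , lt) = (linear 7 (λ a b c d e f g → (a ≼ b) ⇒ (c ≼ d) ⇒ (num 2 ⊕
    e ≼ c ⊕ a) ⇒ (↑ f ≼ num 3) ⇒ (↑ (d ⊕ b) ≼ g ⊕ f) ⇒ (g ≼ e) ⇒ ⊩⊥) (r (cl Ẑ)) (r Ẑ) (r (cl Ŷ)) (r Ŷ) ρ k (r (fromSub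
    E₁)) (r-cl Ẑ) (r-cl Ŷ) v k<3 sum top)
    where
    E₁ : Subset m
    E₁ = E₀ S.∩ R
    Z : Subset m
    Z = E₁ ─ Y
    in-E : ∀ {i} → i S.∈ E₁ → i S.∈ E₀
    in-E h = proj₁ (S.x∈p∩q⁻ E₀ R h)
    in-R : ∀ {i} → i S.∈ E₁ → Representative K i
    in-R h = R⁻ (proj₂ (S.x∈p∩q⁻ E₀ R h))
    Z⊆ : Z S.⊆ E₁
    Z⊆ = S.p─q⊆p E₁ Y
    Ŷ Ẑ : Sub (Element K)
    Ŷ = fromSub Y
    Ẑ = fromSub Z
    sum : r Ŷ + r Ẑ < r (fromSub E₁) + k
    sum = subst₂ _<_ (cong₂ _+_ (r-sub (in-E ∘ Y⊆)) (r-sub (in-E ∘ Z⊆))) (cong (_+ k) (r-sub in-E)) lt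
    absorbed : ∀ {X z} → 1 ≤ r ⟨ z ⟩ → (e : Element K) → e ∈ X → r (⟨ e ⟩ ∪ ⟨ z ⟩) ≤ 1 → 1 ≤ r ⟨ e ⟩ → z ∈ cl X
    absorbed {X} {z} h e e∈ le re = ∈-cl
      (let s = sm {X ∪ ⟨ z ⟩} {⟨ e ⟩} X (⟨ e ⟩ ∪ ⟨ z ⟩) (sets 3 (λ a b c → (a ⊑ b) ⇛ ⊢ (b ⊔ c ⊑ b ⊔ a ⊔ c)) ⟨ e ⟩ X ⟨
             z ⟩ e∈) (sets 3 (λ a b c → (a ⊑ b) ⇛ ⊢ (a ⊑ b ⊓ (a ⊔ c))) ⟨ e ⟩ X ⟨ z ⟩ e∈) in (linear 4 (λ a b c d → (a
             ≼ num 1) ⇒ (num 1 ≼ b) ⇒ (c ⊕ b ≼ d ⊕ a) ⇒ ⊩ (c ≼ d)) (r (⟨ e ⟩ ∪ ⟨ z ⟩)) (r ⟨ e ⟩) (r (X ∪ ⟨ z ⟩)) (r X)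
             le re s))
    rank-rep : ∀ {e : Element K} → Representative K (proj₁ e) → 1 ≤ r ⟨ e ⟩
    rank-rep {e} (e∈ , nl , _) = ≤-trans (nonloop e∈ nl) (≤-reflexive (sym r₁))
    loop-in : ∀ X z → r ⟨ z ⟩ ≤ 0 → z ∈ cl X
    loop-in X z le = ∈-cl (let s = add X ⟨ z ⟩ in (linear 3 (λ a b c → (a ≼ num 0) ⇒ (b ≼ c ⊕ a) ⇒ ⊩ (b ≼ c)) (r ⟨ z
                                 ⟩) (r (X ∪ ⟨ z ⟩)) (r X) le s))
    covered : ∀ z → z ∈ cl Ŷ ⊎ z ∈ cl Ẑ
    covered z = case ≤-or-> (r ⟨ z ⟩) 0 of λ where
      (inj₁ le) → inj₁ (loop-in Ŷ z le)
      (inj₂ ge) →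
        let e , rp , le = rep z ge
            e∈E₁ = S.x∈p∩q⁺ (proj₂ e , R⁺ rp)
        in case proj₁ e S.∈? Y of λ where
          (yes h) → inj₁ (absorbed ge e (fromSub⁺ h) le (rank-rep rp))
          (no h)  → inj₂ (absorbed ge e (fromSub⁺ (S.x∈p∧x∉q⇒x∈p─q e∈E₁ h)) le (rank-rep rp))
    cov : 𝕌 ⊆ cl Ŷ ∪ cl Ẑ
    cov = ⊆-intro λ z _ z∉ → case covered z of λ where
      (inj₁ h) → (nonempty (sets 3 (λ a b c → (a ⊑ ∼ (b ⊔ c)) ⇛ (a ⊑ b) ⇛ ⊢ (a ⊑ 𝟘)) ⟨ z ⟩ (cl Ŷ) (cl Ẑ) z∉ h))
      (inj₂ h) → (nonempty (sets 3 (λ a b c → (a ⊑ ∼ (b ⊔ c)) ⇛ (a ⊑ c) ⇛ ⊢ (a ⊑ 𝟘)) ⟨ z ⟩ (cl Ŷ) (cl Ẑ) z∉ h))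
    big : ∀ j X → X S.⊆ E₁ → 1 ≤ j → j < 3 → j ≤ ∣ X ∣ → j ≤ r (fromSub X)
    big zero X X⊆ () _ h
    big (suc zero) X X⊆ _ _ h =
      let x , x∈ = member h
          z : Element K
          z = x , in-E (X⊆ x∈)
      in ≤-trans (rank-rep {z} (in-R (X⊆ x∈))) (mono (fromSub⁺ {X} {x} {proj₂ z} x∈))
    big (suc (suc zero)) X X⊆ _ _ h =
      let x , y , x∈ , y∈ , x≢y = two-members h
          px = in-E (X⊆ x∈)
          py = in-E (X⊆ y∈)
          rx = in-R (X⊆ x∈)
          ry = in-R (X⊆ y∈)
      in ≤-trans
        (nonparallel px py (nonloop px (proj₁ (proj₂ rx))) (nonloop py (proj₁ (proj₂ ry))) x≢y
          (λ par → order x y rx ry x≢y par))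
        (≤-trans (≤-reflexive (sym (r₂ {x , px} {y , py})))
          (mono (join (x , px) (y , py) (fromSub⁺ {X} {x} {px} x∈) (fromSub⁺ {X} {y} {py} y∈))))
      where
      join : ∀ {W} a b → a ∈ W → b ∈ W → ⟨ a ⟩ ∪ ⟨ b ⟩ ⊆ W
      join {W} a b p q = (sets 3 (λ a b c → (a ⊑ b) ⇛ (c ⊑ b) ⇛ ⊢ (a ⊔ c ⊑ b)) ⟨ a ⟩ W ⟨ b ⟩ p q)
      order : ∀ x y → Representative K x → Representative K y → ¬ x ≡ y → ¬ Parallel K x y
      order x y rx ry x≢y (n , c) = case Fin.<-cmp x y of λ where
        (tri< l _ _) → proj₂ (proj₂ ry) (x , l , n , c)
        (tri≈ _ q _) → x≢y q
        (tri> _ _ g) → proj₂ (proj₂ rx) (y , g , (n ∘ sym) , subst (Circuit K) (S.∪-comm ⁅ x ⁆ ⁅ y ⁆) c)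
    big (suc (suc (suc _))) X X⊆ _ (s≤s (s≤s (s≤s ()))) h
    bY : k ≤ r Ŷ
    bY = big k Y Y⊆ 1≤k k<3 kY
    bZ : k ≤ r Ẑ
    bZ = big k Z Z⊆ 1≤k k<3 kZ
    top : r (fromSub E₁) ≤ ρ
    top = mono (sets 1 (λ a → ⊢ (a ⊑ 𝟙)) _)
    v : 2 + ρ ≤ r (cl Ŷ) + r (cl Ẑ)
    v = vc (cl Ŷ) (cl Ẑ) cov (let c = r-cl Ŷ in (linear 6 (λ a b c d e f → (a ≼ b) ⇒ (↑ (b ⊕ c) ≼ e ⊕ d) ⇒ (d ≼ c) ⇒
                                    (e ≼ f) ⇒ ⊩ (↑ a ≼ f)) (r (cl Ŷ)) (r Ŷ) (r Ẑ) k (r (fromSub E₁)) ρ c sum bZ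
                                    top)) (let c = r-cl Ẑ in (linear 6 (λ a b c d e f → (a ≼ b) ⇒ (↑ (c ⊕ b) ≼ e ⊕ d)
                                                 ⇒ (d ≼ c) ⇒ (e ≼ f) ⇒ ⊩ (↑ a ≼ f)) (r (cl Ẑ)) (r Ẑ) (r Ŷ) k (r
                                                 (fromSub E₁)) ρ c sum bY top))

module _ {P Q : Set} ⦃ _ : DecEq P ⦄ ⦃ _ : DecEq Q ⦄ (N : Ranked Q) (φ : Q → P) where
  open Image {P} {Q} N

  img⁻ : ∀ {Y z} → z ∈ img φ Y → ∃ λ e → e ∈ Y × φ e ≡ z
  img⁻ {Y} {z} = go (Ranked.points N)
    where
    rest : ∀ {X X′ : Sub P} → z ∈ X ∪ X′ → z ∉ X → z ∈ X′
    rest {X} {X′} p q = (sets 3 (λ a b c → (a ⊑ b ⊔ c) ⇛ (a ⊑ ∼ b) ⇛ ⊢ (a ⊑ c)) ⟨ z ⟩ X X′ p q)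
    first : ∀ b e → z ∈ (if b then ⟨ φ e ⟩ else ∅) → T b × z ∈ ⟨ φ e ⟩
    first true  e h = tt , h
    first false e h = ⊥-elim (nonempty h)
    go : ∀ es → z ∈ imgOn φ Y es → ∃ λ e → e ∈ Y × φ e ≡ z
    go []       h = ⊥-elim (nonempty h)
    go (e ∷ es) h = case z ∈? (if mem Y e then ⟨ φ e ⟩ else ∅) of λ where
      (inj₁ g) → let t , g′ = first (mem Y e) e g in e , ∈-intro t , same g′
      (inj₂ g) → go es (rest h g)

Element-≡ : ∀ {k} {G : Subset k} {a b : ∃ (S._∈ G)} → proj₁ a ≡ proj₁ b → a ≡ b
Element-≡ {a = i , p} {.i , q} refl = cong (i ,_) ([]=-irrelevant p q)

module _ {m : ℕ} (G : Subset m) where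
  open Elements G

  toSub-∪ : ∀ A B → toSub (A ∪ B) ≡ toSub A S.∪ toSub B
  toSub-∪ A B = S.⊆-antisym
    (λ {i} i∈ → let p , q = toSub⁻ i∈ in S.x∈p∪q⁺ (case (i , p) ∈? A of λ where
      (inj₁ h) → inj₁ (toSub⁺ (i , p) h)
      (inj₂ h) → inj₂ (toSub⁺ (i , p) (rest (i , p) q h))))
    (λ {i} i∈ → case S.x∈p∪q⁻ (toSub A) (toSub B) i∈ of λ where
      (inj₁ h) → toSub-mono {A} {A ∪ B} (sets 2 (λ a b → ⊢ (a ⊑ a ⊔ b)) A B) h
      (inj₂ h) → toSub-mono {B} {A ∪ B} (sets 2 (λ a b → ⊢ (b ⊑ a ⊔ b)) A B) h)
    where
    rest : ∀ z → z ∈ A ∪ B → z ∉ A → z ∈ B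
    rest z p q = (sets 3 (λ a b c → (a ⊑ b ⊔ c) ⇛ (a ⊑ ∼ b) ⇛ ⊢ (a ⊑ c)) ⟨ z ⟩ A B p q)

module _ {m n : ℕ} (M : Matroid m) (N : Matroid n) where
  open Hat M
  private module HN = Hat N
  open Image {Element M} {Element N} HN.hat

  Embeds : (Element N → Element M) → Sub (Element M) → Set
  Embeds φ C = ∀ Y → HN.r Y + r C ≡ r (img φ Y ∪ C)

  module _ (C D : Subset m) (C⊆ : C S.⊆ Matroid.E M) (iso : (M / C ∖ D) ≅ N) where
    private
      E′ : Subset m
      E′ = Matroid.E (M / C ∖ D)
      ι = proj₁ iso
      E′⊆ : ∀ {i} → i S.∈ E′ → i S.∈ Matroid.E M
      E′⊆ h = S.p─q⊆p (Matroid.E M) C (proj₁ (S.x∈p∩q⁻ _ _ h))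

    φ-of : Element N → Element M
    φ-of e = let i , p = Inverse.from ι e in i , E′⊆ p

    -- Contraction subtracts the rank of `C`; monotonicity of the rank rules out truncation, so
    -- adding that rank back gives the identity.
    minor-embeds : Embeds φ-of (fromSub C)
    minor-embeds Ŷ = begin
      HN.r Ŷ + r (fromSub C)                       ≡⟨ cong₂ _+_ (sym (proj₂ iso X Y X⊆ HN.toSub-⊆ corr)) (cong (Matroid.r M) (to-from C⊆)) ⟩
      (Matroid.r M (X S.∪ EC) ∸ Matroid.r M EC) + Matroid.r M C  ≡⟨ cong (λ G → (Matroid.r M (X S.∪ G) ∸ Matroid.r M G) + Matroid.r M C) EC≡ ⟩
      (Matroid.r M (X S.∪ C) ∸ Matroid.r M C) + Matroid.r M C    ≡⟨ m∸n+n≡m (Matroid.r-monotone M (S.q⊆p∪q X C) XC⊆) ⟩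
      Matroid.r M (X S.∪ C)                         ≡⟨ cong (λ G → Matroid.r M (X S.∪ G)) (to-from C⊆) ⟨
      Matroid.r M (X S.∪ toSub (fromSub C))         ≡⟨ cong (Matroid.r M) (toSub-∪ (Matroid.E M) (img φ-of Ŷ) (fromSub C)) ⟨
      r (img φ-of Ŷ ∪ fromSub C) ∎
      where
      open ≡-Reasoning
      X : Subset m
      X = toSub (img φ-of Ŷ)
      Y : Subset n
      Y = HN.toSub Ŷ
      EC : Subset m
      EC = Matroid.E M S.∩ C
      EC≡ : EC ≡ C
      EC≡ = S.⊆-antisym (S.p∩q⊆q _ C) (λ h → S.x∈p∩q⁺ (C⊆ h , h))
      XC⊆ : X S.∪ C S.⊆ Matroid.E M
      XC⊆ h = [ toSub-⊆ , C⊆ ]′ (S.x∈p∪q⁻ X C h)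
      found : ∀ {i} → i S.∈ X → ∃ λ e → e ∈ Ŷ × proj₁ (Inverse.from ι e) ≡ i
      found {i} h = let p , q = toSub⁻ {img φ-of Ŷ} h
                        e , e∈ , eq = img⁻ HN.hat φ-of q
                    in e , e∈ , cong proj₁ eq
      X⊆ : X S.⊆ E′
      X⊆ h = let e , _ , eq = found h in subst (S._∈ E′) eq (proj₂ (Inverse.from ι e))
      corr : ∀ e → proj₁ e S.∈ X ⇔ proj₁ (Inverse.to ι e) S.∈ Y
      corr (i , p) = mk⇔
        (λ h → let e , e∈ , eq = found h in
          subst (λ v → proj₁ v S.∈ Y)
            (trans (sym (Inverse.strictlyInverseˡ ι e)) (cong (Inverse.to ι) (Element-≡ eq)))
            (HN.toSub⁺ e e∈))
        (λ h → let q , e∈ = HN.toSub⁻ {Ŷ} h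
                   e∈′ : Inverse.to ι (i , p) ∈ Ŷ
                   e∈′ = subst (_∈ Ŷ) (Element-≡ refl) e∈
               in subst (S._∈ X) (cong proj₁ (Inverse.strictlyInverseʳ ι (i , p)))
                 (toSub⁺ (φ-of (Inverse.to ι (i , p))) (∈-img φ-of e∈′)))

  -- A point outside the span of the copy and `D` raises every rank in the identity by one, so it
  -- can be contracted too. In the end the copy and `D′` span, and the rank of `D′` is at least the
  -- difference of the two ranks.
  grow : ∀ k φ D → ρ ≤ k + r D → Embeds φ D →
         ¬¬ (∃ λ D′ → Embeds φ D′ × ρ ≤ r (img φ 𝕌 ∪ D′))
  grow k φ D h emb K = case ≤-or-> ρ (r (img φ 𝕌 ∪ D)) of λ where
      (inj₁ le) → K (D , emb , le)
      (inj₂ gt) → ⊈-witness (λ s → let m = mono {𝕌} {cl (img φ 𝕌 ∪ D)} s in (linear 3 (λ a b c → (a ≼ b) ⇒ (↑ b ≼ c) ⇒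
                                         (c ≼ a) ⇒ ⊩⊥) (r (cl (img φ 𝕌 ∪ D))) (r (img φ 𝕌 ∪ D)) ρ (r-cl (img φ 𝕌 ∪ D))
                                         gt m))
        λ (z , _ , z∉) → next k h z z∉
    where
    F : Sub (Element M)
    F = cl (img φ 𝕌 ∪ D)
    I⊆F : img φ 𝕌 ∪ D ⊆ F
    I⊆F = ⊆cl (img φ 𝕌 ∪ D)
    emb′ : ∀ z → z ∉ F → Embeds φ (D ∪ ⟨ z ⟩)
    emb′ z z∉ Y =
      let i = img-mono φ {Y} {𝕌} (sets 1 (λ a → ⊢ (a ⊑ 𝟙)) Y)
          o₁ = out {F} {D} {z} (cl-flat _) (sets 3 (λ a b c → (a ⊔ b ⊑ c) ⇛ ⊢ (b ⊑ c)) (img φ 𝕌) D F I⊆F) z∉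
          o₂ = out {F} {img φ Y ∪ D} {z} (cl-flat _) (sets 4 (λ a b c f → (a ⊔ b ⊑ f) ⇛ (c ⊑ a) ⇛ ⊢ (c ⊔ b ⊑ f)) (img
            φ 𝕌) D (img φ Y) F I⊆F i) z∉
          m₁ = mono {(img φ Y ∪ D) ∪ ⟨ z ⟩} {img φ Y ∪ (D ∪ ⟨ z ⟩)} (sets 3 (λ a b c → ⊢ ((a ⊔ b) ⊔ c ⊑ a ⊔ b ⊔ c))
            (img φ Y) D ⟨ z ⟩)
          m₂ = mono {img φ Y ∪ (D ∪ ⟨ z ⟩)} {(img φ Y ∪ D) ∪ ⟨ z ⟩} (sets 3 (λ a b c → ⊢ (a ⊔ b ⊔ c ⊑ (a ⊔ b) ⊔ c))
            (img φ Y) D ⟨ z ⟩)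
          e = emb Y
      in (≤-antisym (linear 6 (λ a b c d e f → (a ≼ ↑ b) ⇒ (↑ c ≼ d) ⇒ (d ≼ e) ⇒ (f ⊕ b ≼ c) ⇒ ⊩ (f ⊕ a ≼ e)) (r (D ∪
        ⟨ z ⟩)) (r D) (r (img φ Y ∪ D)) (r ((img φ Y ∪ D) ∪ ⟨ z ⟩)) (r (img φ Y ∪ D ∪ ⟨ z ⟩)) (HN.r Y) (step D z) o₂
        m₁ (≤-reflexive e)) (linear 6 (λ a b c d e f → (a ≼ ↑ b) ⇒ (↑ c ≼ d) ⇒ (e ≼ a) ⇒ (b ≼ f ⊕ c) ⇒ ⊩ (e ≼ f ⊕ d))
        (r ((img φ Y ∪ D) ∪ ⟨ z ⟩)) (r (img φ Y ∪ D)) (r D) (r (D ∪ ⟨ z ⟩)) (r (img φ Y ∪ D ∪ ⟨ z ⟩)) (HN.r Y) (step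
        (img φ Y ∪ D) z) o₁ m₂ (≤-reflexive (sym e))))
    next : ∀ k → ρ ≤ k + r D → ∀ z → z ∉ F → ⊥
    next zero h z z∉ =
      let o₁ = out {F} {D} {z} (cl-flat _) (sets 3 (λ a b c → (a ⊔ b ⊑ c) ⇛ ⊢ (b ⊑ c)) (img φ 𝕌) D F I⊆F) z∉
          m = mono {D ∪ ⟨ z ⟩} {𝕌} (sets 1 (λ a → ⊢ (a ⊑ 𝟙)) _)
      in (linear 3 (λ a b c → (a ≼ num 0 ⊕ b) ⇒ (↑ b ≼ c) ⇒ (c ≼ a) ⇒ ⊩⊥) ρ (r D) (r (D ∪ ⟨ z ⟩)) h o₁ m)
    next (suc k) h z z∉ =
      let o₁ = out {F} {D} {z} (cl-flat _) (sets 3 (λ a b c → (a ⊔ b ⊑ c) ⇛ ⊢ (b ⊑ c)) (img φ 𝕌) D F I⊆F) z∉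
      in grow k φ (D ∪ ⟨ z ⟩) (linear 4 (λ a b c d → (a ≼ ↑ c ⊕ b) ⇒ (↑ b ≼ d) ⇒ ⊩ (a ≼ c ⊕ d)) ρ (r D) k (r (D ∪ ⟨ z
        ⟩)) h o₁) (emb′ z z∉) K

module Contraction {m : ℕ} (M : Matroid m) (X : Subset m) (X⊆ : X S.⊆ Matroid.E M) where
  open Hat M
  E₀ : Subset m
  E₀ = Matroid.E M
  r₀ = Matroid.r M
  private
    module K = Hat (M / X)
    module SK = Simplification (M / X)

  X̂ : Sub (Element M)
  X̂ = fromSub X

  EX≡ : E₀ S.∩ X ≡ X
  EX≡ = S.⊆-antisym (S.p∩q⊆q E₀ X) (λ h → S.x∈p∩q⁺ (X⊆ h , h))

  r-/ : ∀ {Y} → Y S.⊆ E₀ → Matroid.r (M / X) Y + r X̂ ≡ r (fromSub Y ∪ X̂)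
  r-/ {Y} Y⊆ = begin
    Matroid.r (M / X) Y + r X̂             ≡⟨ cong (λ T → (r₀ (Y S.∪ T) ∸ r₀ T) + r X̂) EX≡ ⟩
    (r₀ (Y S.∪ X) ∸ r₀ X) + r X̂           ≡⟨ cong (λ T → (r₀ (Y S.∪ X) ∸ r₀ X) + r₀ T) (to-from X⊆) ⟩
    (r₀ (Y S.∪ X) ∸ r₀ X) + r₀ X          ≡⟨ m∸n+n≡m (Matroid.r-monotone M (S.q⊆p∪q Y X) (λ h → [ Y⊆ , X⊆ ]′ (S.x∈p∪q⁻ Y X h))) ⟩
    r₀ (Y S.∪ X)                          ≡⟨ cong r₀ (cong₂ S._∪_ (to-from Y⊆) (to-from X⊆)) ⟨
    r₀ (toSub (fromSub Y) S.∪ toSub X̂)    ≡⟨ cong r₀ (toSub-∪ E₀ (fromSub Y) X̂) ⟨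
    r (fromSub Y ∪ X̂)                     ∎
    where open ≡-Reasoning

  lower : ∀ {i} → i S.∈ E₀ ─ X → i S.∈ E₀
  lower = S.p─q⊆p E₀ X

  lift : Sub (Element (M / X)) → Sub (Element M)
  lift W = fromSub (K.toSub W)

  r-lift : ∀ W → K.r W + r X̂ ≡ r (lift W ∪ X̂)
  r-lift W = r-/ (lower ∘ K.toSub-⊆)

  private
    ∪-∈ˡ : ∀ {z} {A B : Sub (Element M)} → z ∈ A → z ∈ A ∪ B
    ∪-∈ˡ {z} {A} {B} h = (sets 3 (λ a b c → (a ⊑ b) ⇛ ⊢ (a ⊑ b ⊔ c)) ⟨ z ⟩ A B h)

    ∪-∈ʳ : ∀ {z} {A B : Sub (Element M)} → z ∈ B → z ∈ A ∪ B
    ∪-∈ʳ {z} {A} {B} h = (sets 3 (λ a b c → (a ⊑ b) ⇛ ⊢ (a ⊑ c ⊔ b)) ⟨ z ⟩ B A h)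

  cover-lift : ∀ {A B} → 𝕌 ⊆ A ∪ B → 𝕌 ⊆ (lift A ∪ X̂) ∪ (lift B ∪ X̂)
  cover-lift {A} {B} h = ⊆-intro λ z _ z∉ → cov z z∉
    where
    rest : ∀ {z} → z ∉ A → z ∈ B
    rest {z} q = (sets 3 (λ a b c → (𝟙 ⊑ a ⊔ b) ⇛ (c ⊑ ∼ a) ⇛ ⊢ (c ⊑ b)) A B ⟨ z ⟩ h q)
    cov : ∀ z → z ∉ (lift A ∪ X̂) ∪ (lift B ∪ X̂) → ⊥
    cov (i , p) z∉ = case i S.∈? X of λ where
      (yes q) → clash {X = (lift A ∪ X̂) ∪ (lift B ∪ X̂)} (i , p) (∪-∈ˡ {B = lift B ∪ X̂} (∪-∈ʳ {A = lift A} (fromSub⁺ q))) z∉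
      (no q)  → case (i , S.x∈p∧x∉q⇒x∈p─q p q) ∈? A of λ where
        (inj₁ a) → clash {X = (lift A ∪ X̂) ∪ (lift B ∪ X̂)} (i , p) (∪-∈ˡ {B = lift B ∪ X̂} (∪-∈ˡ {B = X̂} (fromSub⁺ (K.toSub⁺ _ a)))) z∉
        (inj₂ b) → clash {X = (lift A ∪ X̂) ∪ (lift B ∪ X̂)} (i , p) (∪-∈ʳ {A = lift A ∪ X̂} (∪-∈ˡ {B = X̂} (fromSub⁺ (K.toSub⁺ _ (rest b))))) z∉

  rank-lift : K.ρ + r X̂ ≡ ρ
  rank-lift = trans (r-lift 𝕌) (≤-antisym
    (mono {lift 𝕌 ∪ X̂} {𝕌} (sets 2 (λ a b → ⊢ (a ⊔ b ⊑ 𝟙)) (lift 𝕌) X̂))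
    (mono {𝕌} {lift 𝕌 ∪ X̂} (let c = cover-lift {𝕌} {𝕌} (sets 1 (λ a → ⊢ (𝟙 ⊑ 𝟙 ⊔ a)) 𝕌) in (sets 2 (λ a b → (𝟙 ⊑ (a ⊔
                                   b) ⊔ a ⊔ b) ⇛ ⊢ (𝟙 ⊑ a ⊔ b)) (lift 𝕌) X̂ c))))

  -- The bound is vertical 3-connectivity of `M / X` with `r X̂` put back three times: into each
  -- side and into the whole.
  contraction-3-connected :
    (∀ A B → 𝕌 ⊆ A ∪ B → X̂ ⊆ A → X̂ ⊆ B → r A < ρ → r B < ρ → 2 + r X̂ + ρ ≤ r A + r B) →
    ThreeConnected (si (M / X))
  contraction-3-connected vc = SK.vc3⇒si-3-connected λ A B c lA lB →
    let v = vc (lift A ∪ X̂) (lift B ∪ X̂) (cover-lift c)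
              (sets 2 (λ a b → ⊢ (b ⊑ a ⊔ b)) (lift A) X̂) (sets 2 (λ a b → ⊢ (b ⊑ a ⊔ b)) (lift B) X̂)
              (short A lA) (short B lB)
        a = r-lift A
        b = r-lift B
        e = rank-lift
    in fin {K.r A} {K.r B} {K.ρ} a b e v
    where
    short : ∀ A → K.r A < K.ρ → r (lift A ∪ X̂) < ρ
    short A l = go {K.r A} {K.ρ} (r-lift A) rank-lift l
      where
      go : ∀ {a t} → a + r X̂ ≡ r (lift A ∪ X̂) → t + r X̂ ≡ ρ → a < t → r (lift A ∪ X̂) < ρ
      go {a} {t} e f l = (linear 5 (λ a b c d e → (a ≼ c ⊕ b) ⇒ (d ⊕ b ≼ e) ⇒ (↑ c ≼ d) ⇒ ⊩ (↑ a ≼ e)) (r (lift A ∪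
        X̂)) (r X̂) a t ρ (≤-reflexive (sym e)) (≤-reflexive f) l)
    fin : ∀ {a b t x y} → a + r X̂ ≡ x → b + r X̂ ≡ y → t + r X̂ ≡ ρ → 2 + r X̂ + ρ ≤ x + y → 2 + t ≤ a + b
    fin {a} {b} {t} {x} {y} p q s v = (linear 7 (λ a b c d e f g → (a ≼ c ⊕ b) ⇒ (d ≼ e ⊕ b) ⇒ (f ⊕ b ≼ g) ⇒ (num 2 ⊕
      b ⊕ g ≼ a ⊕ d) ⇒ ⊩ (num 2 ⊕ f ≼ c ⊕ e)) x (r X̂) a y b t ρ (≤-reflexive (sym p)) (≤-reflexive (sym q))
      (≤-reflexive s) v)

  E₁ : Subset m
  E₁ = Matroid.E (si (M / X))

  E₁⊆ : ∀ {i} → i S.∈ E₁ → i S.∈ E₀ ─ X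
  E₁⊆ h = proj₁ (S.x∈p∩q⁻ (E₀ ─ X) SK.R h)

  -- The two rank conditions say that, after contracting `X`, the element `e` is a non-loop parallel
  -- or equal to `z`.
  representative : ∀ z → z ∉ cl X̂ → ∃ λ (e : Element M) → proj₁ e S.∈ E₁ ×
    r (⟨ e ⟩ ∪ (⟨ z ⟩ ∪ X̂)) ≤ 1 + r X̂ × 1 + r X̂ ≤ r (⟨ e ⟩ ∪ X̂)
  representative (i , p) z∉ = case i S.∈? X of λ where
      (yes q) → ⊥-elim (clash (i , p) (spans (i , p) (⊆cl X̂) (fromSub⁺ q)) z∉)
      (no q)  → outX q
    where
    spans : ∀ z {A B} → A ⊆ B → z ∈ A → z ∈ B
    spans z {A} {B} p q = (sets 3 (λ a b c → (a ⊑ b) ⇛ (c ⊑ a) ⇛ ⊢ (c ⊑ b)) A B ⟨ z ⟩ p q)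
    outX : ¬ (i S.∈ X) → ∃ λ (e : Element M) → proj₁ e S.∈ E₁ ×
      r (⟨ e ⟩ ∪ (⟨ i , p ⟩ ∪ X̂)) ≤ 1 + r X̂ × 1 + r X̂ ≤ r (⟨ e ⟩ ∪ X̂)
    outX q = unpack (S.x∈p∧x∉q⇒x∈p─q p q) (SK.rep (i , S.x∈p∧x∉q⇒x∈p─q p q) (nonloop (i , S.x∈p∧x∉q⇒x∈p─q p q) refl))
      where
      pair : ∀ j j∈₀ j∈ i∈ → K.r (⟨ j , j∈ ⟩ ∪ ⟨ i , i∈ ⟩) ≤ 1 → r (⟨ j , j∈₀ ⟩ ∪ (⟨ i , p ⟩ ∪ X̂)) ≤ 1 + r X̂
      pair j j∈₀ j∈ i∈ le = ≤-trans (mono (inc (j , j∈₀) (i , p) (fromSub⁺ (K.toSub⁺ (j , j∈) (sets 2 (λ a b → ⊢ (a ⊑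
        a ⊔ b)) _ _))) (fromSub⁺ (K.toSub⁺ (i , i∈) (sets 2 (λ a b → ⊢ (b ⊑ a ⊔ b)) _ _)))))
        (go (r-lift (⟨ j , j∈ ⟩ ∪ ⟨ i , i∈ ⟩)) le)
        where
        inc : ∀ {W} u v → u ∈ W → v ∈ W → ⟨ u ⟩ ∪ (⟨ v ⟩ ∪ X̂) ⊆ W ∪ X̂
        inc {W} u v a b = (sets 4 (λ a b c d → (a ⊑ b) ⇛ (c ⊑ b) ⇛ ⊢ (a ⊔ c ⊔ d ⊑ b ⊔ d)) ⟨ u ⟩ W ⟨ v ⟩ X̂ a b)
        go : ∀ {a x} → a + r X̂ ≡ x → a ≤ 1 → x ≤ 1 + r X̂
        go {a} {x} e l = (linear 3 (λ a b c → (a ≼ c ⊕ b) ⇒ (c ≼ num 1) ⇒ ⊩ (a ≼ num 1 ⊕ b)) x (r X̂) a (≤-reflexive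
          (sym e)) l)
      single : ∀ j j∈₀ → 1 ≤ Matroid.r (M / X) ⁅ j ⁆ → 1 + r X̂ ≤ r (⟨ j , j∈₀ ⟩ ∪ X̂)
      single j j∈₀ le = go (r-/ {⁅ j ⁆} j⊆) le
          (mono (inc fromSub⊆))
        where
        j⊆ : ⁅ j ⁆ S.⊆ E₀
        j⊆ h = subst (S._∈ E₀) (sym (S.x∈⁅y⁆⇒x≡y j h)) j∈₀
        fromSub⊆ : fromSub ⁅ j ⁆ ⊆ ⟨ j , j∈₀ ⟩
        fromSub⊆ = ⊆-intro λ (k , k∈) a b → nope (k , k∈) (S.x∈⁅y⁆⇒x≡y j (fromSub⁻ {⁅ j ⁆} {k} {k∈} a)) b
          where
          nope : ∀ z → proj₁ z ≡ j → z ∉ ⟨ j , j∈₀ ⟩ → ⊥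
          nope z e b = self∉ z (subst (λ w → z ∉ ⟨ w ⟩) (Element-≡ {b = z} (sym e)) b)
            where
            self∉ : ∀ z → z ∉ ⟨ z ⟩ → ⊥
            self∉ z b = (nonempty (sets 1 (λ a → (a ⊑ ∼ a) ⇛ ⊢ (a ⊑ 𝟘)) ⟨ z ⟩ b))
        inc : ∀ {W V} → W ⊆ V → W ∪ X̂ ⊆ V ∪ X̂
        inc {W} {V} a = (sets 3 (λ a b c → (a ⊑ b) ⇛ ⊢ (a ⊔ c ⊑ b ⊔ c)) W V X̂ a)
        go : ∀ {a x y} → a + r X̂ ≡ x → 1 ≤ a → x ≤ y → 1 + r X̂ ≤ y
        go {a} {x} {y} e l u = (linear 4 (λ a b c d → (b ⊕ a ≼ c) ⇒ (num 1 ≼ b) ⇒ (c ≼ d) ⇒ ⊩ (num 1 ⊕ a ≼ d)) (r X̂)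
          a x y (≤-reflexive e) l u)
      nonloop : ∀ (z′ : Element (M / X)) → proj₁ z′ ≡ i → 1 ≤ K.r ⟨ z′ ⟩
      nonloop z′ refl = ≤-by-contra λ lt → (λ h → clash (i , p) h z∉) (∈-cl (≤-trans (mono (inc (i , p) (fromSub⁺ (K.toSub⁺ z′ (sets 1 (λ a → ⊢ (a ⊑ a)) _)))))
            (go (r-lift ⟨ z′ ⟩) lt)))
        where
        inc : ∀ {W} v → v ∈ W → X̂ ∪ ⟨ v ⟩ ⊆ W ∪ X̂
        inc {W} v b = (sets 3 (λ a b c → (a ⊑ b) ⇛ ⊢ (c ⊔ a ⊑ b ⊔ c)) ⟨ v ⟩ W X̂ b)
        go : ∀ {a x} → a + r X̂ ≡ x → suc a ≤ 1 → x ≤ r X̂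
        go {a} {x} e l = (linear 3 (λ a b c → (a ≼ c ⊕ b) ⇒ (↑ c ≼ num 1) ⇒ ⊩ (a ≼ b)) x (r X̂) a (≤-reflexive (sym
          e)) l)
      unpack : (i∈ : i S.∈ E₀ ─ X) →
        (∃ λ (e : Element (M / X)) → Representative (M / X) (proj₁ e) × K.r (⟨ e ⟩ ∪ ⟨ i , i∈ ⟩) ≤ 1) →
        ∃ λ (e : Element M) → proj₁ e S.∈ E₁ ×
          r (⟨ e ⟩ ∪ (⟨ i , p ⟩ ∪ X̂)) ≤ 1 + r X̂ × 1 + r X̂ ≤ r (⟨ e ⟩ ∪ X̂)
      unpack i∈ ((j , j∈) , rp , le) = (j , lower j∈) , S.x∈p∩q⁺ (j∈ , SK.R⁺ rp) ,
        pair j (lower j∈) j∈ i∈ le , single j (lower j∈) (SK.nonloop j∈ (proj₁ (proj₂ rp)))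

module _ {m n : ℕ} (M : Matroid m) (N : Matroid n) (X : Subset m) (X⊆ : X S.⊆ Matroid.E M) where
  open Hat M
  open Contraction M X X⊆
  private module HN₂ = Hat N
  open Image {Element M} {Element N} HN₂.hat

  private
    r-≡ : ∀ {A B} → A ⊆ cl B → B ⊆ cl A → r A ≡ r B
    r-≡ {A} {B} p q = ≤-antisym (≤-trans (mono p) (r-cl B)) (≤-trans (mono q) (r-cl A))

    same-span : ∀ v z → r (⟨ v ⟩ ∪ (⟨ z ⟩ ∪ X̂)) ≤ 1 + r X̂ → 1 + r X̂ ≤ r (⟨ v ⟩ ∪ X̂) →
                ∀ W → X̂ ⊆ W → v ∈ W → z ∈ cl W
    same-span v z a b W X⊆W v∈ = ∈-cl
      (let s = sm {W ∪ ⟨ z ⟩} {⟨ v ⟩ ∪ X̂} W (⟨ v ⟩ ∪ (⟨ z ⟩ ∪ X̂)) (sets 4 (λ a b c d → ⊢ (a ⊔ b ⊑ a ⊔ c ⊔ b ⊔ d)) W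
             ⟨ z ⟩ ⟨ v ⟩ X̂) (sets 4 (λ a b c d → (a ⊑ b) ⇛ (c ⊑ b) ⇛ ⊢ (c ⊔ a ⊑ b ⊓ (c ⊔ d ⊔ a))) X̂ W ⟨ v ⟩ ⟨ z ⟩
             X⊆W v∈) in (linear 5 (λ a b c d e → (a ≼ num 1 ⊕ b) ⇒ (num 1 ⊕ b ≼ c) ⇒ (d ⊕ c ≼ e ⊕ a) ⇒ ⊩ (d ≼ e)) (r
             (⟨ v ⟩ ∪ ⟨ z ⟩ ∪ X̂)) (r X̂) (r (⟨ v ⟩ ∪ X̂)) (r (W ∪ ⟨ z ⟩)) (r W) a b s))

    not-in-X : ∀ z → z ∉ cl X̂ → 1 + r X̂ ≤ r (⟨ z ⟩ ∪ X̂)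
    not-in-X z h = let o = out {cl X̂} {X̂} {z} (cl-flat X̂) (⊆cl X̂) h
                       m = mono {X̂ ∪ ⟨ z ⟩} {⟨ z ⟩ ∪ X̂} (sets 3 (λ a b c → (a ⊑ ∼ b) ⇛ ⊢ (c ⊔ a ⊑ a ⊔ c)) ⟨ z ⟩ (cl
                         X̂) X̂ h)
                   in (linear 3 (λ a b c → (↑ a ≼ b) ⇒ (b ≼ c) ⇒ ⊩ (num 1 ⊕ a ≼ c)) (r X̂) (r (X̂ ∪ ⟨ z ⟩)) (r (⟨ z ⟩
                     ∪ X̂)) o m)

    flip-span : ∀ v z → r (⟨ v ⟩ ∪ (⟨ z ⟩ ∪ X̂)) ≤ 1 + r X̂ → r (⟨ z ⟩ ∪ (⟨ v ⟩ ∪ X̂)) ≤ 1 + r X̂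
    flip-span v z h = ≤-trans (mono (sets 3 (λ a b c → ⊢ (a ⊔ b ⊔ c ⊑ b ⊔ a ⊔ c)) ⟨ z ⟩ ⟨ v ⟩ X̂)) h

    in-flat : ∀ {F z} → Flat F → z ∈ cl F → z ∈ F
    in-flat {F} {z} f h = let s = spanned {F} {F} {cl F} f (sets 3 (λ a b c → (a ⊑ b) ⇛ ⊢ (c ⊑ c)) ⟨ z ⟩ (cl F) F
                                h) (⊆cl F) (r-cl F) in (sets 3 (λ a b c → (a ⊑ b) ⇛ (b ⊑ c) ⇛ ⊢ (a ⊑ c)) ⟨ z ⟩ (cl F)
                                F h s)

  -- A copy over a flat containing `X̂` is moved into `si (M / X)`: its elements go to
  -- representatives, the flat to the representatives it contains, and the remaining elements are
  -- deleted. Closures over `X̂` do not change, so ranks agree.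
  module Transfer
    (N-loopless : ∀ e → 1 ≤ HN₂.r ⟨ e ⟩) (N-simple : ∀ {e e′} → e′ ∉ ⟨ e ⟩ → 2 ≤ HN₂.r (⟨ e ⟩ ∪ ⟨ e′ ⟩))
    (φ : Element N → Element M) (C : Sub (Element M)) (C-flat : Flat C) (X̂⊆C : X̂ ⊆ C) (emb : Embeds M N φ C)
    where

    φ∉C : ∀ e → φ e ∉ C
    φ∉C e = case φ e ∈? C of λ where
      (inj₂ h) → h
      (inj₁ h) → ⊥-elim
        (let i = img-⊆ φ {⟨ e ⟩} {C} (λ e′ e∈ → subst (λ v → φ v ∈ C) (same e∈) h)
             l = N-loopless e
             m = mono {img φ ⟨ e ⟩ ∪ C} {C} (sets 2 (λ a b → (a ⊑ b) ⇛ ⊢ (a ⊔ b ⊑ b)) (img φ ⟨ e ⟩) C i)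
             g = emb ⟨ e ⟩
         in (linear 3 (λ a b c → (num 1 ≼ a) ⇒ (b ≼ c) ⇒ (a ⊕ c ≼ b) ⇒ ⊩⊥) (HN₂.r ⟨ e ⟩) (r (img φ ⟨ e ⟩ ∪ C)) (r C) l
           m (≤-reflexive g)))

    φ∉cl : ∀ e → φ e ∉ cl X̂
    φ∉cl e = let h = φ∉C e
                 s = spanned {C} {X̂} {cl X̂} C-flat X̂⊆C (⊆cl X̂) (r-cl X̂)
             in (sets 3 (λ a b c → (a ⊑ ∼ b) ⇛ (c ⊑ b) ⇛ ⊢ (a ⊑ ∼ c)) ⟨ φ e ⟩ C (cl X̂) h s)

    module _
      (ψ : Element N → Element M) (ψ∈E₁ : ∀ e → proj₁ (ψ e) S.∈ E₁)
      (ψ-near : ∀ e → r (⟨ ψ e ⟩ ∪ (⟨ φ e ⟩ ∪ X̂)) ≤ 1 + r X̂)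
      (ψ-far : ∀ e → 1 + r X̂ ≤ r (⟨ ψ e ⟩ ∪ X̂)) where

      φ∈ψ : ∀ e W → X̂ ⊆ W → ψ e ∈ W → φ e ∈ cl W
      φ∈ψ e = same-span (ψ e) (φ e) (ψ-near e) (ψ-far e)

      ψ∈φ : ∀ e W → X̂ ⊆ W → φ e ∈ W → ψ e ∈ cl W
      ψ∈φ e = same-span (φ e) (ψ e) (flip-span (ψ e) (φ e) (ψ-near e)) (not-in-X (φ e) (φ∉cl e))

      ψ∉C : ∀ e → ψ e ∉ C
      ψ∉C e = case ψ e ∈? C of λ where
          (inj₂ h) → h
          (inj₁ h) → ⊥-elim (clash (φ e) (in-flat C-flat (φ∈ψ e C X̂⊆C h)) (φ∉C e))

      C′ Ψ D′ : Subset m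
      C′ = E₁ S.∩ toSub C
      Ψ  = toSub (img ψ 𝕌)
      D′ = E₁ ─ C′ ─ Ψ

      E₁⊆₀ : ∀ {i} → i S.∈ E₁ → i S.∈ Matroid.E M
      E₁⊆₀ = lower ∘ E₁⊆

      C′⊆ : C′ S.⊆ Matroid.E M
      C′⊆ = E₁⊆₀ ∘ proj₁ ∘ S.x∈p∩q⁻ E₁ _

      Ĉ : Sub (Element M)
      Ĉ = fromSub C′

      disjoint : S.Empty (C′ S.∩ D′)
      disjoint (i , h) = let a , b = S.x∈p∩q⁻ C′ D′ h in
        ─-∉ E₁ C′ (S.p─q⊆p (E₁ ─ C′) Ψ b) a

      E₂ : Subset m
      E₂ = Matroid.E (si (M / X) / C′ ∖ D′)

      E₂⁻ : ∀ {i} → i S.∈ E₂ → i S.∈ E₁ × ¬ (i S.∈ C′) × i S.∈ Ψ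
      E₂⁻ {i} h = let a , b = S.x∈p∩q⁻ (E₁ ─ C′) (E₁ ─ C′ ─ D′) h in
        S.p─q⊆p E₁ C′ a , ─-∉ E₁ C′ a ,
        (case i S.∈? Ψ of λ where
          (yes q) → q
          (no q)  → ⊥-elim (─-∉ (E₁ ─ C′) D′ b (S.x∈p∧x∉q⇒x∈p─q a q)))

      E₂⁺ : ∀ {i} → i S.∈ E₁ → ¬ (i S.∈ C′) → i S.∈ Ψ → i S.∈ E₂
      E₂⁺ a b c = let d = S.x∈p∧x∉q⇒x∈p─q a b in
        S.x∈p∩q⁺ (d , S.x∈p∧x∉q⇒x∈p─q d λ h → ─-∉ (E₁ ─ C′) Ψ h c)

      all : ∀ {P : Set} ⦃ _ : DecEq P ⦄ (z : P) → z ∈ 𝕌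
      all z = sets 1 (λ a → ⊢ (a ⊑ 𝟙)) ⟨ z ⟩

      ψ∈E₂ : ∀ e → proj₁ (ψ e) S.∈ E₂
      ψ∈E₂ e = E₂⁺ (ψ∈E₁ e)
        (λ h → let p , q = toSub⁻ {C} (proj₂ (S.x∈p∩q⁻ E₁ (toSub C) h)) in
          clash (ψ e) (subst (_∈ C) (Element-≡ refl) q) (ψ∉C e))
        (toSub⁺ (ψ e) (∈-img ψ (all e)))

      from : Element N → Element (si (M / X) / C′ ∖ D′)
      from e = proj₁ (ψ e) , ψ∈E₂ e

      to-full : ∀ {i} → i S.∈ E₂ → ∃ λ e → proj₁ (ψ e) ≡ i
      to-full h = let p , q = toSub⁻ {img ψ 𝕌} (proj₂ (proj₂ (E₂⁻ h)))
                      e , _ , eq = img⁻ HN₂.hat ψ q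
                  in e , cong proj₁ eq

      to : Element (si (M / X) / C′ ∖ D′) → Element N
      to (i , h) = proj₁ (to-full h)

      from-to : ∀ z → from (to z) ≡ z
      from-to (i , h) = Element-≡ (proj₂ (to-full h))

      -- Elements with a common representative would have joint rank at most 1 over `C`, whereas `N`
      -- is simple.
      ψ-injective : ∀ e e′ → ψ e ≡ ψ e′ → e ≡ e′
      ψ-injective e e′ eq = case e′ ∈? ⟨ e ⟩ of λ where
          (inj₁ h) → same h
          (inj₂ h) → ⊥-elim
            (let s = N-simple h
                 g = emb (⟨ e ⟩ ∪ ⟨ e′ ⟩)
                 t = step C (ψ e)
                 u = ≤-trans (mono {img φ (⟨ e ⟩ ∪ ⟨ e′ ⟩) ∪ C} {cl (C ∪ ⟨ ψ e ⟩)} inside) (r-cl (C ∪ ⟨ ψ e ⟩))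
             in (linear 4 (λ a b c d → (num 2 ≼ a) ⇒ (a ⊕ b ≼ c) ⇒ (d ≼ ↑ b) ⇒ (c ≼ d) ⇒ ⊩⊥) (HN₂.r (⟨ e ⟩ ∪ ⟨ e′ ⟩))
               (r C) (r (img φ (⟨ e ⟩ ∪ ⟨ e′ ⟩) ∪ C)) (r (C ∪ ⟨ ψ e ⟩)) s (≤-reflexive g) t u))
        where
        e∈ : φ e ∈ cl (C ∪ ⟨ ψ e ⟩)
        e∈ = φ∈ψ e (C ∪ ⟨ ψ e ⟩) (sets 3 (λ a b c → (a ⊑ b) ⇛ ⊢ (a ⊑ b ⊔ c)) X̂ C ⟨ ψ e ⟩ X̂⊆C) (sets 3 (λ a b c → (a
          ⊑ b) ⇛ ⊢ (c ⊑ b ⊔ c)) X̂ C ⟨ ψ e ⟩ X̂⊆C)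
        e′∈ : φ e′ ∈ cl (C ∪ ⟨ ψ e ⟩)
        e′∈ = φ∈ψ e′ (C ∪ ⟨ ψ e ⟩) (sets 3 (λ a b c → (a ⊑ b) ⇛ ⊢ (a ⊑ b ⊔ c)) X̂ C ⟨ ψ e ⟩
          X̂⊆C) (subst (λ v → v ∈ C ∪ ⟨ ψ e ⟩) eq (sets 2 (λ a b → ⊢ (a ⊑ b ⊔ a)) ⟨ ψ e ⟩ C))
        pick : ∀ w → w ∈ ⟨ e ⟩ ∪ ⟨ e′ ⟩ → φ w ∈ cl (C ∪ ⟨ ψ e ⟩)
        pick w w∈ = case w ∈? ⟨ e ⟩ of λ where
            (inj₁ h) → subst (λ v → φ v ∈ cl (C ∪ ⟨ ψ e ⟩)) (same h) e∈
            (inj₂ h) → subst (λ v → φ v ∈ cl (C ∪ ⟨ ψ e ⟩)) (same (rest w w∈ h)) e′∈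
          where
          rest : ∀ w → w ∈ ⟨ e ⟩ ∪ ⟨ e′ ⟩ → w ∉ ⟨ e ⟩ → w ∈ ⟨ e′ ⟩
          rest w a b = (sets 3 (λ a b c → (a ⊑ b ⊔ c) ⇛ (a ⊑ ∼ b) ⇛ ⊢ (a ⊑ c)) ⟨ w ⟩ ⟨ e ⟩ ⟨ e′ ⟩ a b)
        inside : img φ (⟨ e ⟩ ∪ ⟨ e′ ⟩) ∪ C ⊆ cl (C ∪ ⟨ ψ e ⟩)
        inside = let a = img-⊆ φ {⟨ e ⟩ ∪ ⟨ e′ ⟩} {cl (C ∪ ⟨ ψ e ⟩)} pick
                     b = ⊆cl (C ∪ ⟨ ψ e ⟩)
                 in (sets 4 (λ a b c d → (a ⊑ b) ⇛ (c ⊔ d ⊑ b) ⇛ ⊢ (a ⊔ c ⊑ b)) (img φ (⟨ e ⟩ ∪ ⟨ e′ ⟩)) (cl (C ∪ ⟨ ψ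
                   e ⟩)) C ⟨ ψ e ⟩ a b)

      to-from′ : ∀ e → to (from e) ≡ e
      to-from′ e = ψ-injective _ e (Element-≡ (proj₂ (to-full (ψ∈E₂ e))))

      -- A point of `C` outside the closure of `X̂` is parallel over `X̂` to its representative, and
      -- the flat `C` contains that as well.
      C⊆ : C ⊆ cl (Ĉ ∪ X̂)
      C⊆ = ⊆-intro λ z z∈ z∉ → case z ∈? cl X̂ of λ where
          (inj₁ h) → inner z h z∉
          (inj₂ h) → outer z z∈ z∉ h
        where
        inner : ∀ z → z ∈ cl X̂ → z ∉ cl (Ĉ ∪ X̂) → ⊥
        inner z h z∉ =
          let s = spanned {cl (Ĉ ∪ X̂)} {X̂} {cl X̂} (cl-flat (Ĉ ∪ X̂)) (let b = ⊆cl (Ĉ ∪ X̂) in (sets 3 (λ a b c → (a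
                                                                               ⊔ b ⊑ c) ⇛ ⊢ (b ⊑ c)) Ĉ X̂ (cl (Ĉ ∪
                                                                               X̂)) b)) (⊆cl X̂) (r-cl X̂)
          in (nonempty (sets 3 (λ a b c → (a ⊑ b) ⇛ (a ⊑ ∼ c) ⇛ (b ⊑ c) ⇛ ⊢ (a ⊑ 𝟘)) ⟨ z ⟩ (cl X̂) (cl (Ĉ ∪ X̂)) h z∉
            s))
        outer : ∀ z → z ∈ C → z ∉ cl (Ĉ ∪ X̂) → z ∉ cl X̂ → ⊥
        outer z z∈ z∉ h =
          let v , v∈ , a , b = representative z h
              v∈C = in-flat C-flat (same-span z v (flip-span v z a) (not-in-X z h) C X̂⊆C z∈)
              g = same-span v z a b (Ĉ ∪ X̂) (sets 2 (λ a b → ⊢ (a ⊑ b ⊔ a)) X̂ Ĉ)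
                    (inˡ v (fromSub⁺ (S.x∈p∩q⁺ (v∈ , toSub⁺ v v∈C))))
          in (nonempty (sets 2 (λ a b → (a ⊑ ∼ b) ⇛ (a ⊑ b) ⇛ ⊢ (a ⊑ 𝟘)) ⟨ z ⟩ (cl (Ĉ ∪ X̂)) z∉ g))
          where
          inˡ : ∀ v → v ∈ Ĉ → v ∈ Ĉ ∪ X̂
          inˡ v h = (sets 3 (λ a b c → (a ⊑ b) ⇛ ⊢ (a ⊑ b ⊔ c)) ⟨ v ⟩ Ĉ X̂ h)

      Ĉ⊆C : Ĉ ⊆ C
      Ĉ⊆C = ⊆-intro λ (i , p) a b →
        let q , c = toSub⁻ {C} (proj₂ (S.x∈p∩q⁻ E₁ (toSub C) (fromSub⁻ {C′} {i} {p} a))) in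
        clash (i , p) (subst (_∈ C) (Element-≡ refl) c) b

      rank-C : r (Ĉ ∪ X̂) ≡ r C
      rank-C = r-≡ (let a = Ĉ⊆C
                        b = ⊆cl C in (sets 4 (λ a b c d → (a ⊑ b) ⇛ (c ⊑ a) ⇛ (d ⊑ a) ⇛ ⊢ (c ⊔ d ⊑ b)) C (cl C) Ĉ X̂ b
                          a X̂⊆C)) C⊆

      rank-ψ : ∀ Y → r (img ψ Y ∪ (Ĉ ∪ X̂)) ≡ r (img φ Y ∪ C)
      rank-ψ Y = r-≡
        (let a = img-⊆ ψ {Y} {cl (img φ Y ∪ C)} λ e e∈ →
                   let i = ∈-img φ e∈ in ψ∈φ e (img φ Y ∪ C) (sets 3 (λ a b c → (a ⊑ b) ⇛ ⊢ (a ⊑ c ⊔ b)) X̂ C (img φ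
                         Y) X̂⊆C) (inˡ i)
             b = ⊆cl (img φ Y ∪ C)
             c = Ĉ⊆C
         in (sets 6 (λ a b c d e f → (a ⊑ b) ⇛ (c ⊑ b) ⇛ (d ⊔ b ⊑ e) ⇛ (f ⊑ e) ⇛ ⊢ (f ⊔ c ⊔ a ⊑ e)) X̂ C Ĉ (img φ Y)
           (cl (img φ Y ∪ C)) (img ψ Y) X̂⊆C c b a))
        (let a = img-⊆ φ {Y} {cl (img ψ Y ∪ (Ĉ ∪ X̂))} λ e e∈ →
                   let i = ∈-img ψ e∈ in φ∈ψ e (img ψ Y ∪ (Ĉ ∪ X̂)) (sets 3 (λ a b c → ⊢ (a ⊑ b ⊔ c ⊔ a)) X̂ (img ψ Y)
                         Ĉ) (inˡ i)
             b = spanned {cl (img ψ Y ∪ (Ĉ ∪ X̂))} {Ĉ ∪ X̂} {cl (Ĉ ∪ X̂)} (cl-flat _)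
                   (let d = ⊆cl (img ψ Y ∪ (Ĉ ∪ X̂)) in (sets 4 (λ a b c d → (a ⊔ b ⊔ c ⊑ d) ⇛ ⊢ (b ⊔ c ⊑ d)) (img ψ
                          Y) Ĉ X̂ (cl (img ψ Y ∪ Ĉ ∪ X̂)) d)) (⊆cl (Ĉ ∪ X̂)) (r-cl (Ĉ ∪ X̂))
             c = C⊆
         in (sets 4 (λ a b c d → (a ⊑ b) ⇛ (c ⊑ b) ⇛ (d ⊑ c) ⇛ ⊢ (a ⊔ d ⊑ b)) (img φ Y) (cl (img ψ Y ∪ Ĉ ∪ X̂)) (cl (Ĉ
           ∪ X̂)) C a b C⊆))
        where
        inˡ : ∀ {z} {A B : Sub (Element M)} → z ∈ A → z ∈ A ∪ B
        inˡ {z} {A} {B} h = (sets 3 (λ a b c → (a ⊑ b) ⇛ ⊢ (a ⊑ b ⊔ c)) ⟨ z ⟩ A B h)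

      ranks : ∀ X₁ Y → X₁ S.⊆ E₂ → Y S.⊆ Matroid.E N →
              (∀ (z : Element (si (M / X) / C′ ∖ D′)) → proj₁ z S.∈ X₁ ⇔ proj₁ (to z) S.∈ Y) →
              Matroid.r (si (M / X) / C′ ∖ D′) X₁ ≡ Matroid.r N Y
      ranks X₁ Y X₁⊆ Y⊆ corr = begin
          rK (X₁ S.∪ (E₁ S.∩ C′)) ∸ rK (E₁ S.∩ C′)  ≡⟨ cong (λ G → rK (X₁ S.∪ G) ∸ rK G) EC ⟩
          rK (X₁ S.∪ C′) ∸ rK C′                    ≡⟨ cong (_∸ rK C′) sum ⟩
          (HN₂.r Ŷ + rK C′) ∸ rK C′                  ≡⟨ m+n∸n≡m (HN₂.r Ŷ) (rK C′) ⟩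
          HN₂.r Ŷ                                    ≡⟨ cong (Matroid.r N) (HN₂.to-from Y⊆) ⟩
          Matroid.r N Y                             ∎
        where
        open ≡-Reasoning
        rK = Matroid.r (M / X)
        Ŷ : Sub (Element N)
        Ŷ = HN₂.fromSub Y
        EC : E₁ S.∩ C′ ≡ C′
        EC = S.⊆-antisym (S.p∩q⊆q E₁ C′) (λ h → S.x∈p∩q⁺ (proj₁ (S.x∈p∩q⁻ E₁ _ h) , h))
        X₁⊆₀ : X₁ S.⊆ Matroid.E M
        X₁⊆₀ h = E₁⊆₀ (proj₁ (E₂⁻ (X₁⊆ h)))
        W : Sub (Element M)
        W = fromSub (X₁ S.∪ C′)
        inˡ : ∀ {z} {A B : Sub (Element M)} → z ∈ A → z ∈ A ∪ B
        inˡ {z} {A} {B} h = (sets 3 (λ a b c → (a ⊑ b) ⇛ ⊢ (a ⊑ b ⊔ c)) ⟨ z ⟩ A B h)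
        inʳ : ∀ {z} {A B : Sub (Element M)} → z ∈ B → z ∈ A ∪ B
        inʳ {z} {A} {B} h = (sets 3 (λ a b c → (a ⊑ b) ⇛ ⊢ (a ⊑ c ⊔ b)) ⟨ z ⟩ B A h)
        W⊆ : W ⊆ img ψ Ŷ ∪ Ĉ
        W⊆ = ⊆-intro λ (i , p) a b → clash (i , p) (case S.x∈p∪q⁻ X₁ C′ (fromSub⁻ {X₁ S.∪ C′} {i} {p} a) of λ where
            (inj₁ h) → inˡ {B = Ĉ} (subst (_∈ img ψ Ŷ) (Element-≡ (proj₂ (to-full (X₁⊆ h))))
              (∈-img ψ (HN₂.fromSub⁺ (Equivalence.to (corr (i , X₁⊆ h)) h))))
            (inj₂ h) → inʳ {A = img ψ Ŷ} (fromSub⁺ h)) b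
        ψ⊆W : img ψ Ŷ ⊆ W
        ψ⊆W = img-⊆ ψ λ (j , q) e∈ → fromSub⁺ (S.x∈p∪q⁺ (inj₁
          (Equivalence.from (corr (from (j , q)))
            (subst (λ v → proj₁ v S.∈ Y) (sym (to-from′ (j , q))) (HN₂.fromSub⁻ {Y} {j} {q} e∈)))))
        Ĉ⊆W : Ĉ ⊆ W
        Ĉ⊆W = fromSub-mono λ h → S.x∈p∪q⁺ (inj₂ h)
        sum : rK (X₁ S.∪ C′) ≡ HN₂.r Ŷ + rK C′
        sum = go (r-/ {X₁ S.∪ C′} (λ h → [ X₁⊆₀ , C′⊆ ]′ (S.x∈p∪q⁻ X₁ C′ h))) (r-/ {C′} C′⊆)
                 rank-C (rank-ψ Ŷ) (emb Ŷ)
          where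
          up : r (W ∪ X̂) ≤ r (img ψ Ŷ ∪ (Ĉ ∪ X̂))
          up = mono (let a = W⊆ in (sets 4 (λ a b c d → (a ⊑ b ⊔ c) ⇛ ⊢ (a ⊔ d ⊑ b ⊔ c ⊔ d)) W (img ψ Ŷ) Ĉ X̂ W⊆))
          down : r (img ψ Ŷ ∪ (Ĉ ∪ X̂)) ≤ r (W ∪ X̂)
          down = mono (let a = ψ⊆W
                           b = Ĉ⊆W in (sets 4 (λ a b c d → (a ⊑ b) ⇛ (c ⊑ b) ⇛ ⊢ (a ⊔ c ⊔ d ⊑ b ⊔ d)) (img ψ Ŷ) W Ĉ X̂
                             ψ⊆W Ĉ⊆W))
          go : ∀ {a c x y z} → a + r X̂ ≡ r (W ∪ X̂) → c + r X̂ ≡ x → x ≡ y → r (img ψ Ŷ ∪ (Ĉ ∪ X̂)) ≡ z →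
               HN₂.r Ŷ + y ≡ z → a ≡ HN₂.r Ŷ + c
          go {a} {c} {x} {y} {z} p q s t u = let v = up
                                                 w = down in (≤-antisym (linear 9 (λ a b c d e f g h i → (b ⊕ a ≼ c) ⇒
                                                   (d ≼ e ⊕ a) ⇒ (f ≼ d) ⇒ (g ≼ h) ⇒ (h ≼ i ⊕ f) ⇒ (c ≼ g) ⇒ ⊩ (b ≼ i
                                                   ⊕ e)) (r X̂) a (r (W ∪ X̂)) x c y (r (img ψ Ŷ ∪ Ĉ ∪ X̂)) z (HN₂.r
                                                   Ŷ) (≤-reflexive p) (≤-reflexive (sym q)) (≤-reflexive (sym s))
                                                   (≤-reflexive t) (≤-reflexive (sym u)) v)
                                                              (linear 9 (λ a b c d e f g h i → (a ≼ c ⊕ b) ⇒ (d ⊕ b ≼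
                                                                e) ⇒ (e ≼ f) ⇒ (g ≼ h) ⇒ (i ⊕ f ≼ g) ⇒ (h ≼ a) ⇒ ⊩ (i
                                                                ⊕ d ≼ c)) (r (W ∪ X̂)) (r X̂) a c x y z (r (img ψ Ŷ ∪
                                                                Ĉ ∪ X̂)) (HN₂.r Ŷ) (≤-reflexive (sym p)) (≤-reflexive
                                                                q) (≤-reflexive s) (≤-reflexive (sym t)) (≤-reflexive
                                                                u) w))

      transferred : HasMinor (si (M / X)) N
      transferred = C′ , D′ , proj₁ ∘ S.x∈p∩q⁻ E₁ _ , (λ h → S.p─q⊆p E₁ C′ (S.p─q⊆p (E₁ ─ C′) Ψ h)) , disjoint ,
        mk↔ₛ′ to from to-from′ from-to , ranks

  embedding⇒minor :
    (∀ e → 1 ≤ HN₂.r ⟨ e ⟩) → (∀ {e e′} → e′ ∉ ⟨ e ⟩ → 2 ≤ HN₂.r (⟨ e ⟩ ∪ ⟨ e′ ⟩)) →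
    ∀ φ C → Flat C → X̂ ⊆ C → Embeds M N φ C → HasMinor (si (M / X)) N
  embedding⇒minor N-loopless N-simple φ C C-flat X̂⊆C emb = go λ e → representative (φ e) (φ∉cl e)
    where
    open Transfer N-loopless N-simple φ C C-flat X̂⊆C emb
    go : (∀ e → ∃ λ (v : Element M) → proj₁ v S.∈ E₁ ×
      r (⟨ v ⟩ ∪ (⟨ φ e ⟩ ∪ X̂)) ≤ 1 + r X̂ × 1 + r X̂ ≤ r (⟨ v ⟩ ∪ X̂)) → HasMinor (si (M / X)) N
    go f = transferred (λ e → proj₁ (f e)) (λ e → proj₁ (proj₂ (f e)))
      (λ e → proj₁ (proj₂ (proj₂ (f e)))) (λ e → proj₂ (proj₂ (proj₂ (f e))))

-- The case of at most three elements in N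

module Extension {P : Set} ⦃ _ : DecEq P ⦄ (M : Ranked P) where
  open Ranked M
  open Closure M

  maximal : (Good : Sub P → Set) → ∀ k D → ρ ≤ k + r D → Good D →
            ¬¬ (∃ λ D′ → Good D′ × (∀ z → r D′ < r (D′ ∪ ⟨ z ⟩) → ¬ Good (D′ ∪ ⟨ z ⟩)))
  maximal Good k D h g K = K (D , g , λ z o g′ → next k h z o g′)
    where
    next : ∀ k → ρ ≤ k + r D → ∀ z → r D < r (D ∪ ⟨ z ⟩) → Good (D ∪ ⟨ z ⟩) → ⊥
    next zero h z o g′ = let m = mono {D ∪ ⟨ z ⟩} {𝕌} (sets 2 (λ a b → ⊢ (a ⊔ b ⊑ 𝟙)) D ⟨ z ⟩) in (linear 3 (λ a b c →
                               (a ≼ num 0 ⊕ b) ⇒ (↑ b ≼ c) ⇒ (c ≼ a) ⇒ ⊩⊥) ρ (r D) (r (D ∪ ⟨ z ⟩)) h o m)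
    next (suc k) h z o g′ = maximal Good k (D ∪ ⟨ z ⟩) (linear 4 (λ a b c d → (a ≼ ↑ c ⊕ b) ⇒ (↑ b ≼ d) ⇒ ⊩ (a ≼ c ⊕
      d)) ρ (r D) k (r (D ∪ ⟨ z ⟩)) h o) g′ K

  module _ {X : Sub P} (vc : ∀ A B → 𝕌 ⊆ A ∪ B → X ⊆ A → X ⊆ B → r A < ρ → r B < ρ → 2 + r X + ρ ≤ r A + r B) where

    -- Extend `X` as long as `b` stays independent of it. In corank two or more, a point outside the
    -- span of `D` and `b` could still be added.
    hyperplane-avoiding : ∀ b → b ∉ cl X → ¬¬ (∃ λ D → X ⊆ D × suc (r D) ≤ r (D ∪ ⟨ b ⟩) × ρ ≤ suc (r D))
    hyperplane-avoiding b b∉ K =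
      maximal (λ D → X ⊆ D × suc (r D) ≤ r (D ∪ ⟨ b ⟩)) ρ X (linear 2 (λ a b → ⊩ (a ≼ a ⊕ b)) ρ (r X))
        ((sets 3 (λ a b c → (a ⊑ ∼ b) ⇛ ⊢ (c ⊑ c)) ⟨ b ⟩ (cl X) X
          b∉) , out {cl X} {X} {b} (cl-flat X) (⊆cl X) b∉) λ (D , (X⊆D , s) , mx) →
      K (D , X⊆D , s , ≤-by-contra λ lt → go D X⊆D s mx lt)
      where
      go : ∀ D → X ⊆ D → suc (r D) ≤ r (D ∪ ⟨ b ⟩) →
           (∀ z → r D < r (D ∪ ⟨ z ⟩) → ¬ (X ⊆ D ∪ ⟨ z ⟩ × suc (r (D ∪ ⟨ z ⟩)) ≤ r ((D ∪ ⟨ z ⟩) ∪ ⟨ b ⟩))) →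
           suc (suc (r D)) ≤ ρ → ⊥
      go D X⊆D s mx lt = ⊈-witness (λ full → let m = mono {𝕌} {cl (D ∪ ⟨ b ⟩)} full
                                                 c = r-cl (D ∪ ⟨ b ⟩)
                                                 t = step D b
                                             in (linear 4 (λ a b c d → (↑ ↑ a ≼ b) ⇒ (b ≼ c) ⇒ (c ≼ d) ⇒ (d ≼ ↑ a) ⇒
                                               ⊩⊥) (r D) ρ (r (cl (D ∪ ⟨ b ⟩))) (r (D ∪ ⟨ b ⟩)) lt m c t))
        λ (z , _ , z∉) →
          let o = out {cl (D ∪ ⟨ b ⟩)} {D ∪ ⟨ b ⟩} {z} (cl-flat _) (⊆cl _) z∉
              i = ⊆cl (D ∪ ⟨ b ⟩)
              o′ = out {cl (D ∪ ⟨ b ⟩)} {D} {z} (cl-flat _) (sets 3 (λ a b c → (a ⊔ b ⊑ c) ⇛ ⊢ (a ⊑ c)) D ⟨ b ⟩ (cl (D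
                ∪ ⟨ b ⟩)) i) z∉
              m = mono {(D ∪ ⟨ b ⟩) ∪ ⟨ z ⟩} {(D ∪ ⟨ z ⟩) ∪ ⟨ b ⟩} (sets 3 (λ a b c → ⊢ ((a ⊔ b) ⊔ c ⊑ (a ⊔ c) ⊔ b)) D
                ⟨ b ⟩ ⟨ z ⟩)
              t = step D z
          in mx z o′ ((sets 3 (λ a b c → (a ⊑ b) ⇛ ⊢ (a ⊑ b ⊔ c)) X D ⟨ z ⟩ X⊆D) , (linear 5 (λ a b c d e → (↑ a ≼ b)
            ⇒ (↑ b ≼ c) ⇒ (c ≼ d) ⇒ (e ≼ ↑ a) ⇒ ⊩ (↑ e ≼ d)) (r D) (r (D ∪ ⟨ b ⟩)) (r ((D ∪ ⟨ b ⟩) ∪ ⟨ z ⟩)) (r ((D ∪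
            ⟨ z ⟩) ∪ ⟨ b ⟩)) (r (D ∪ ⟨ z ⟩)) s o m t))

    -- Over `F` the points `b`, `e`, `h` form a three-point line, the least 3-connected simple
    -- matroid of rank 2. Both `b` and `e` are off a hyperplane; `F` is maximal in that hyperplane
    -- with `b`, `e` independent over it, and `h` is a point of the hyperplane outside `F`.
    triangle : 2 + r X ≤ ρ → ¬¬ (∃ λ F → X ⊆ F × ρ ≤ 2 + r F × ∃ λ b → ∃₂ λ e h →
      2 + r F ≤ r (F ∪ (⟨ b ⟩ ∪ ⟨ e ⟩)) × 2 + r F ≤ r (F ∪ (⟨ h ⟩ ∪ ⟨ b ⟩)) × 2 + r F ≤ r (F ∪ (⟨ h ⟩ ∪ ⟨ e ⟩)))
    triangle room K =
      ⊈-witness (λ full → let m = mono {𝕌} {cl X} full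
                              c = r-cl X in (linear 3 (λ a b c → (num 2 ⊕ a ≼ b) ⇒ (b ≼ c) ⇒ (c ≼ a) ⇒ ⊩⊥) (r X) ρ (r
                                (cl X)) room m c)) λ (b , _ , b∉) →
      hyperplane-avoiding b b∉ λ (D , X⊆D , s , big) →
      -- The two closures contain `X` and have rank sum at most `ρ + r X`, so `vc` keeps them from
      -- covering; this provides `e`.
      ⊈-witness {Y = cl D ∪ cl (X ∪ ⟨ b ⟩)} (λ cov → crossing D X⊆D (mono {D ∪ ⟨ b ⟩} {𝕌} (sets 2 (λ a b → ⊢ (a ⊔ b ⊑
        𝟙)) D ⟨ b ⟩)) s b cov) λ (e , _ , e∉) →
      let i = ⊆cl D
          j = ⊆cl (X ∪ ⟨ b ⟩)
          e∉D : e ∉ cl D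
          e∉D = (sets 3 (λ a b c → (a ⊑ ∼ (b ⊔ c)) ⇛ ⊢ (a ⊑ ∼ b)) ⟨ e ⟩ (cl D) (cl (X ∪ ⟨ b ⟩)) e∉)
          o₁ = out {cl X} {X} {b} (cl-flat X) (⊆cl X) b∉
          o₂ = out {cl (X ∪ ⟨ b ⟩)} {X ∪ ⟨ b ⟩} {e} (cl-flat _) (⊆cl _) (sets 3 (λ a b c → (a ⊑ ∼ (b ⊔ c)) ⇛ ⊢ (a ⊑ ∼
            c)) ⟨ e ⟩ (cl D) (cl (X ∪ ⟨ b ⟩)) e∉)
          m = mono {(X ∪ ⟨ b ⟩) ∪ ⟨ e ⟩} {X ∪ (⟨ b ⟩ ∪ ⟨ e ⟩)} (sets 3 (λ a b c → ⊢ ((a ⊔ b) ⊔ c ⊑ a ⊔ b ⊔ c)) X ⟨ b ⟩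
            ⟨ e ⟩)
      in maximal (λ F → X ⊆ F × F ⊆ cl D × 2 + r F ≤ r (F ∪ (⟨ b ⟩ ∪ ⟨ e ⟩))) ρ X (linear 2 (λ a b → ⊩ (a ≼ a ⊕ b)) ρ
        (r X))
          ((sets 1 (λ a → ⊢ (a ⊑ a)) X) , (sets 3 (λ a b c → (a ⊑ b) ⇛ (b ⊑ c) ⇛ ⊢ (a ⊑ c)) X D (cl D) X⊆D i) ,
            (linear 4 (λ a b c d → (↑ a ≼ b) ⇒ (↑ b ≼ c) ⇒ (c ≼ d) ⇒ ⊩ (num 2 ⊕ a ≼ d)) (r X) (r (X ∪ ⟨ b ⟩)) (r ((X ∪
            ⟨ b ⟩) ∪ ⟨ e ⟩)) (r (X ∪ ⟨ b ⟩ ∪ ⟨ e ⟩)) o₁ o₂ m)) λ (F , (X⊆F , F⊆ , t) , mx) →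
         finish D b e F X⊆F F⊆ s big e∉D t mx
      where
      crossing : ∀ D → X ⊆ D → ∀ {x} → x ≤ ρ → suc (r D) ≤ x → ∀ b → 𝕌 ⊆ cl D ∪ cl (X ∪ ⟨ b ⟩) → ⊥
      crossing D X⊆D {x} le s b cov =
        let i = ⊆cl D
            j = ⊆cl (X ∪ ⟨ b ⟩)
            c = r-cl D
            d = r-cl (X ∪ ⟨ b ⟩)
            t = step X b
            v = vc (cl D) (cl (X ∪ ⟨ b ⟩)) cov (sets 3 (λ a b c → (a ⊑ b) ⇛ (c ⊑ a) ⇛ ⊢ (c ⊑ b)) D (cl D) X i X⊆D)
              (sets 3 (λ a b c → (a ⊔ b ⊑ c) ⇛ ⊢ (a ⊑ c)) X ⟨ b ⟩ (cl (X ∪ ⟨ b ⟩)) j) (linear 4 (λ a b c d → (a ≼ b) ⇒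
              (↑ c ≼ a) ⇒ (d ≼ c) ⇒ ⊩ (↑ d ≼ b)) x ρ (r D) (r (cl D)) le s c) (linear 4 (λ a b c d → (num 2 ⊕ a ≼ b) ⇒
              (c ≼ d) ⇒ (d ≼ ↑ a) ⇒ ⊩ (↑ c ≼ b)) (r X) ρ (r (cl (X ∪ ⟨ b ⟩))) (r (X ∪ ⟨ b ⟩)) room d t)
        in (linear 7 (λ a b c d e f g → (a ≼ b) ⇒ (↑ c ≼ a) ⇒ (d ≼ c) ⇒ (e ≼ f) ⇒ (f ≼ ↑ g) ⇒ (num 2 ⊕ g ⊕ b ≼ d ⊕ e)
          ⇒ ⊩⊥) x ρ (r D) (r (cl D)) (r (cl (X ∪ ⟨ b ⟩))) (r (X ∪ ⟨ b ⟩)) (r X) le s c d t v)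
      finish : ∀ D b e F → X ⊆ F → F ⊆ cl D → suc (r D) ≤ r (D ∪ ⟨ b ⟩) → ρ ≤ suc (r D) → e ∉ cl D →
               2 + r F ≤ r (F ∪ (⟨ b ⟩ ∪ ⟨ e ⟩)) →
               (∀ z → r F < r (F ∪ ⟨ z ⟩) → ¬ (X ⊆ F ∪ ⟨ z ⟩ × F ∪ ⟨ z ⟩ ⊆ cl D ×
                  2 + r (F ∪ ⟨ z ⟩) ≤ r ((F ∪ ⟨ z ⟩) ∪ (⟨ b ⟩ ∪ ⟨ e ⟩)))) → ⊥
      finish D b e F X⊆F F⊆ s big e∉ t mx =
          ⊈-witness (λ D⊆ → let m = mono {D} {cl F} D⊆
                                c = r-cl F
                                l = mono {F ∪ (⟨ b ⟩ ∪ ⟨ e ⟩)} {𝕌} (sets 3 (λ a b c → ⊢ (a ⊔ b ⊔ c ⊑ 𝟙)) F ⟨ b ⟩ ⟨ e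
                                  ⟩)
                            in (linear 5 (λ a b c d e → (a ≼ ↑ b) ⇒ (num 2 ⊕ c ≼ d) ⇒ (b ≼ e) ⇒ (e ≼ c) ⇒ (d ≼ a) ⇒
                              ⊩⊥) ρ (r D) (r F) (r (F ∪ ⟨ b ⟩ ∪ ⟨ e ⟩)) (r (cl F)) big t m c l)) λ (h , h∈ , h∉) →
          K (F , X⊆F , large , b , e , h , t , pair h h∈ h∉ b b∉ , pair h h∈ h∉ e e∉)
        where
        i = ⊆cl D
        b∉ : b ∉ cl D
        b∉ = case b ∈? cl D of λ where
          (inj₂ q) → q
          (inj₁ q) → let g = cl-∈ q in ⊥-elim (linear 2 (λ a b → (↑ a ≼ b) ⇒ (b ≼ a) ⇒ ⊩⊥) (r D) (r (D ∪ ⟨ b ⟩)) s g)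
        large : ρ ≤ 2 + r F
        large = ≤-by-contra λ lt →
          ⊈-witness {X = D} {Y = cl (F ∪ (⟨ b ⟩ ∪ ⟨ e ⟩))}
            (λ D⊆ →         let k = ⊆cl (F ∪ (⟨ b ⟩ ∪ ⟨ e ⟩))
                                m = mono {D ∪ ⟨ b ⟩} {cl (F ∪ (⟨ b ⟩ ∪ ⟨ e ⟩))} (sets 5 (λ a b c d e → (a ⊑ b) ⇛ (c ⊔
                                  d ⊔ e ⊑ b) ⇛ ⊢ (a ⊔ d ⊑ b)) D (cl (F ∪ ⟨ b ⟩ ∪ ⟨ e ⟩)) F ⟨ b ⟩ ⟨ e ⟩ D⊆ k)
                                c = r-cl (F ∪ (⟨ b ⟩ ∪ ⟨ e ⟩))
                                a₁ = add F (⟨ b ⟩ ∪ ⟨ e ⟩)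
                                a₂ = add ⟨ b ⟩ ⟨ e ⟩
                                p₁ = r-point b
                                p₂ = r-point e
                            in (linear 9 (λ a b c d e f g h i → (↑ a ≼ b) ⇒ (c ≼ ↑ a) ⇒ (↑ (num 2 ⊕ d) ≼ c) ⇒ (b ≼ e)
                              ⇒ (e ≼ f) ⇒ (f ≼ d ⊕ g) ⇒ (g ≼ i ⊕ h) ⇒ (i ≼ num 1) ⇒ (h ≼ num 1) ⇒ ⊩⊥) (r D) (r (D ∪ ⟨
                              b ⟩)) ρ (r F) (r (cl (F ∪ ⟨ b ⟩ ∪ ⟨ e ⟩))) (r (F ∪ ⟨ b ⟩ ∪ ⟨ e ⟩)) (r (⟨ b ⟩ ∪ ⟨ e ⟩))
                              (r ⟨ e ⟩) (r ⟨ b ⟩) s big lt m c a₁ a₂ p₁ p₂)) λ (z , z∈ , z∉) →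
          let k = ⊆cl (F ∪ (⟨ b ⟩ ∪ ⟨ e ⟩))
              o = out {cl (F ∪ (⟨ b ⟩ ∪ ⟨ e ⟩))} {F ∪ (⟨ b ⟩ ∪ ⟨ e ⟩)} {z} (cl-flat _) k z∉
              o′ = out {cl (F ∪ (⟨ b ⟩ ∪ ⟨ e ⟩))} {F} {z} (cl-flat _) (sets 4 (λ a b c d → (a ⊔ b ⊔ c ⊑ d) ⇛ ⊢ (a ⊑
                d)) F ⟨ b ⟩ ⟨ e ⟩ (cl (F ∪ ⟨ b ⟩ ∪ ⟨ e ⟩)) k) z∉
              m = mono {(F ∪ (⟨ b ⟩ ∪ ⟨ e ⟩)) ∪ ⟨ z ⟩} {(F ∪ ⟨ z ⟩) ∪ (⟨ b ⟩ ∪ ⟨ e ⟩)} (sets 4 (λ a b c d → ⊢ ((a ⊔ b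
                ⊔ c) ⊔ d ⊑ (a ⊔ d) ⊔ b ⊔ c)) F ⟨ b ⟩ ⟨ e ⟩ ⟨ z ⟩)
              u = step F z
          in mx z o′ ((sets 3 (λ a b c → (a ⊑ b) ⇛ ⊢ (a ⊑ b ⊔ c)) X F ⟨ z ⟩ X⊆F) , (sets 4 (λ a b c d → (a ⊑ b) ⇛ (b ⊑
            c) ⇛ (d ⊑ c) ⇛ ⊢ (d ⊔ a ⊑ c)) ⟨ z ⟩ D (cl D) F z∈ i F⊆) , (linear 5 (λ a b c d e → (num 2 ⊕ a ≼ b) ⇒ (↑ b
            ≼ c) ⇒ (c ≼ d) ⇒ (e ≼ ↑ a) ⇒ ⊩ (num 2 ⊕ e ≼ d)) (r F) (r (F ∪ ⟨ b ⟩ ∪ ⟨ e ⟩)) (r ((F ∪ ⟨ b ⟩ ∪ ⟨ e ⟩) ∪ ⟨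
            z ⟩)) (r ((F ∪ ⟨ z ⟩) ∪ ⟨ b ⟩ ∪ ⟨ e ⟩)) (r (F ∪ ⟨ z ⟩)) t o m u))
        pair : ∀ h → h ∈ D → h ∉ cl F → ∀ v → v ∉ cl D → 2 + r F ≤ r (F ∪ (⟨ h ⟩ ∪ ⟨ v ⟩))
        pair h h∈ h∉ v v∉ =
          let o = out {cl F} {F} {h} (cl-flat F) (⊆cl F) h∉
              o′ = out {cl D} {F ∪ ⟨ h ⟩} {v} (cl-flat D) (sets 4 (λ a b c d → (a ⊑ b) ⇛ (b ⊑ c) ⇛ (d ⊑ c) ⇛ ⊢ (d ⊔ a
                ⊑ c)) ⟨ h ⟩ D (cl D) F h∈ i F⊆) v∉
              m = mono {(F ∪ ⟨ h ⟩) ∪ ⟨ v ⟩} {F ∪ (⟨ h ⟩ ∪ ⟨ v ⟩)} (sets 3 (λ a b c → ⊢ ((a ⊔ b) ⊔ c ⊑ a ⊔ b ⊔ c)) F ⟨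
                h ⟩ ⟨ v ⟩)
          in (linear 4 (λ a b c d → (↑ a ≼ b) ⇒ (↑ b ≼ c) ⇒ (c ≼ d) ⇒ ⊩ (num 2 ⊕ a ≼ d)) (r F) (r (F ∪ ⟨ h ⟩)) (r ((F
            ∪ ⟨ h ⟩) ∪ ⟨ v ⟩)) (r (F ∪ ⟨ h ⟩ ∪ ⟨ v ⟩)) o o′ m)

module SmallMinor {P Q : Set} ⦃ _ : DecEq P ⦄ ⦃ _ : DecEq Q ⦄ (M : Ranked P) (N : Ranked Q)
  (N-loopless : ∀ e → 1 ≤ Ranked.r N ⟨ e ⟩)
  (N-simple : ∀ {e e′} → e′ ∉ ⟨ e ⟩ → 2 ≤ Ranked.r N (⟨ e ⟩ ∪ ⟨ e′ ⟩)) where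
  open Ranked M
  open Closure M
  open Extension M
  open Ranked N using () renaming (r to rN; mono to monoN; r-point to pointN; r-∅ to r-∅N)
  open Image {P} {Q} N

  -- By simplicity, sets with no, one or several elements have ranks 0, 1 and 2, so the identity
  -- need only be checked on points and pairs, with `top` as the upper bound.
  small-embeds : ∀ φ C → rN 𝕌 ≤ 2 → (∀ e → 1 + r C ≤ r (C ∪ ⟨ φ e ⟩)) →
    (∀ e e′ → e′ ∉ ⟨ e ⟩ → 2 + r C ≤ r (C ∪ (⟨ φ e ⟩ ∪ ⟨ φ e′ ⟩))) →
    r (img φ 𝕌 ∪ C) ≤ rN 𝕌 + r C →
    ∀ Y → rN Y + r C ≡ r (img φ Y ∪ C)
  small-embeds φ C le₂ one two top Y = ≤-antisym (≤-by-contra λ lt → cases (λ eq → ⊥-elim (linear 3 (λ a b c → (↑ a ≼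
    c ⊕ b) ⇒ (c ⊕ b ≼ a) ⇒ ⊩⊥) (r (img φ Y ∪ C)) (r C) (rN Y) lt (≤-reflexive
    eq)))) (≤-by-contra λ lt → cases (λ eq → ⊥-elim (linear 3 (λ a b c → (↑ (b ⊕ a) ≼ c) ⇒ (c ≼ b ⊕ a) ⇒ ⊩⊥) (r C) (rN
    Y) (r (img φ Y ∪ C)) lt (≤-reflexive (sym eq)))))
    where
    cases : ¬¬ (rN Y + r C ≡ r (img φ Y ∪ C))
    cases K = em (∃₂ λ e e′ → e ∈ Y × e′ ∈ Y × e′ ∉ ⟨ e ⟩) λ where
        (inj₁ (e , e′ , e∈ , e′∈ , d)) → K (many e e′ e∈ e′∈ d)
        (inj₂ none) → em (∃ λ e → e ∈ Y) λ where
          (inj₁ (e , e∈)) → K (single e e∈ (⊆-intro λ z z∈ z∉ → none (e , z , e∈ , z∈ , z∉)))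
          (inj₂ empty) → K (zeros (⊆-intro λ z z∈ _ → empty (z , z∈)))
      where
      trans-⊆ : ∀ e {X Z : Sub Q} → e ∈ X → X ⊆ Z → e ∈ Z
      trans-⊆ e {X} {Z} p q = (sets 3 (λ a b c → (a ⊑ b) ⇛ (b ⊑ c) ⇛ ⊢ (a ⊑ c)) ⟨ e ⟩ X Z p q)
      many : ∀ e e′ → e ∈ Y → e′ ∈ Y → e′ ∉ ⟨ e ⟩ → rN Y + r C ≡ r (img φ Y ∪ C)
      many e e′ e∈ e′∈ d =
        let i = ∈-img φ e∈
            i′ = ∈-img φ e′∈
            a = two e e′ d
            b = mono {C ∪ (⟨ φ e ⟩ ∪ ⟨ φ e′ ⟩)} {img φ Y ∪ C} (sets 4 (λ a b c d → (a ⊑ b) ⇛ (c ⊑ b) ⇛ ⊢ (d ⊔ a ⊔ c ⊑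
              b ⊔ d)) ⟨ φ e ⟩ (img φ Y) ⟨ φ e′ ⟩ C i i′)
            c = N-simple d
            d = monoN {⟨ e ⟩ ∪ ⟨ e′ ⟩} {Y} (sets 3 (λ a b c → (a ⊑ b) ⇛ (c ⊑ b) ⇛ ⊢ (c ⊔ a ⊑ b)) ⟨ e′ ⟩ Y ⟨ e ⟩ e′∈
              e∈)
            f = monoN {Y} {𝕌} (sets 1 (λ a → ⊢ (a ⊑ 𝟙)) Y)
            j = img-mono φ {Y} {𝕌} (sets 1 (λ a → ⊢ (a ⊑ 𝟙)) Y)
            g = mono {img φ Y ∪ C} {img φ 𝕌 ∪ C} (sets 3 (λ a b c → (a ⊑ b) ⇛ ⊢ (a ⊔ c ⊑ b ⊔ c)) (img φ Y) (img φ 𝕌) C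
              j)
        in (≤-antisym (linear 5 (λ a b c d e → (a ≼ num 2) ⇒ (num 2 ⊕ b ≼ c) ⇒ (c ≼ d) ⇒ (e ≼ a) ⇒ ⊩ (e ⊕ b ≼ d)) (rN
          𝕌) (r C) (r (C ∪ ⟨ φ e ⟩ ∪ ⟨ φ e′ ⟩)) (r (img φ Y ∪ C)) (rN Y) le₂ a b f) (linear 6 (λ a b c d e f → (a ≼
          num 2) ⇒ (b ≼ a ⊕ c) ⇒ (num 2 ≼ d) ⇒ (d ≼ e) ⇒ (f ≼ b) ⇒ ⊩ (f ≼ e ⊕ c)) (rN 𝕌) (r (img φ 𝕌 ∪ C)) (r C) (rN
          (⟨ e ⟩ ∪ ⟨ e′ ⟩)) (rN Y) (r (img φ Y ∪ C)) le₂ top c d g))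
      single : ∀ e → e ∈ Y → Y ⊆ ⟨ e ⟩ → rN Y + r C ≡ r (img φ Y ∪ C)
      single e e∈ Y⊆ =
        let i = ∈-img φ e∈
            a = one e
            b = mono {C ∪ ⟨ φ e ⟩} {img φ Y ∪ C} (sets 3 (λ a b c → (a ⊑ b) ⇛ ⊢ (c ⊔ a ⊑ b ⊔ c)) ⟨ φ e ⟩ (img φ Y) C
              i)
            j = img-⊆ φ {Y} {⟨ φ e ⟩} λ e₁ e₁∈ → subst (λ v → φ v ∈ ⟨ φ e ⟩) (same (trans-⊆ e₁ e₁∈ Y⊆)) (sets 1 (λ a →
              ⊢ (a ⊑ a)) _)
            c = mono {img φ Y ∪ C} {C ∪ ⟨ φ e ⟩} (sets 3 (λ a b c → (a ⊑ b) ⇛ ⊢ (a ⊔ c ⊑ c ⊔ b)) (img φ Y) ⟨ φ e ⟩ C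
              j)
            s = step C (φ e)
            l = N-loopless e
            p = pointN e
            m = monoN {⟨ e ⟩} {Y} e∈
            u = monoN {Y} {⟨ e ⟩} Y⊆
        in (≤-antisym (linear 5 (λ a b c d e → (num 1 ⊕ a ≼ b) ⇒ (b ≼ c) ⇒ (d ≼ num 1) ⇒ (e ≼ d) ⇒ ⊩ (e ⊕ a ≼ c)) (r
          C) (r (C ∪ ⟨ φ e ⟩)) (r (img φ Y ∪ C)) (rN ⟨ e ⟩) (rN Y) a b p u) (linear 5 (λ a b c d e → (a ≼ b) ⇒ (b ≼ ↑
          c) ⇒ (num 1 ≼ d) ⇒ (d ≼ e) ⇒ ⊩ (a ≼ e ⊕ c)) (r (img φ Y ∪ C)) (r (C ∪ ⟨ φ e ⟩)) (r C) (rN ⟨ e ⟩) (rN Y) c s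
          l m))
      zeros : Y ⊆ ∅ → rN Y + r C ≡ r (img φ Y ∪ C)
      zeros Y⊆ =
        let j = img-⊆ φ {Y} {∅} λ e e∈ → ⊥-elim (nonempty {z = e} (trans-⊆ e e∈ Y⊆))
            a = mono {img φ Y ∪ C} {C} (sets 2 (λ a b → (a ⊑ 𝟘) ⇛ ⊢ (a ⊔ b ⊑ b)) (img φ Y) C j)
            b = mono {C} {img φ Y ∪ C} (sets 2 (λ a b → ⊢ (a ⊑ b ⊔ a)) C (img φ Y))
            c = monoN {Y} {∅} Y⊆
            d = r-∅N
        in (≤-antisym (linear 4 (λ a b c d → (a ≼ b) ⇒ (c ≼ d) ⇒ (d ≼ num 0) ⇒ ⊩ (c ⊕ a ≼ b)) (r C) (r (img φ Y ∪ C))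
          (rN Y) (rN ∅) b c d) (linear 3 (λ a b c → (a ≼ b) ⇒ ⊩ (a ≼ c ⊕ b)) (r (img φ Y ∪ C)) (r C) (rN Y) a))

  Four : Set
  Four = ∃₂ λ (q₁ q₂ : Q) → ∃₂ λ q₃ q₄ → (¬ q₁ ≡ q₂ × ¬ q₁ ≡ q₃ × ¬ q₁ ≡ q₄) × (¬ q₂ ≡ q₃ × ¬ q₂ ≡ q₄) × ¬ q₃ ≡ q₄

  differ : ∀ {q q′ : Q} → q′ ∉ ⟨ q ⟩ → ¬ q ≡ q′
  differ {q} {q′} h eq = go (subst (λ v → v ∉ ⟨ q ⟩) (sym eq) h)
    where
    go : q ∉ ⟨ q ⟩ → ⊥
    go h = (nonempty (sets 1 (λ a → (a ⊑ ∼ a) ⇛ ⊢ (a ⊑ 𝟘)) ⟨ q ⟩ h))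

  module _ (few : ¬ Four) where

    -- Three elements of rank 3 would be independent, and the first would be separated from the
    -- other two.
    few⇒rank≤2 : (∀ Y → rN Y + rN (∁ Y) ≤ rN 𝕌 → Y ⊆ ∅ ⊎ ∁ Y ⊆ ∅) → rN 𝕌 ≤ 2
    few⇒rank≤2 conn = ≤-by-contra λ lt →
      ⊈-witness {X = 𝕌} {Y = ∅} (λ h → let m = monoN {𝕌} {∅} h
                                           z = r-∅N in (linear 2 (λ a b → (num 3 ≼ a) ⇒ (a ≼ b) ⇒ (b ≼ num 0) ⇒ ⊩⊥)
                                             (rN 𝕌) (rN ∅) lt m z)) λ (q₁ , _ , _) →
      ⊈-witness {X = 𝕌} {Y = ⟨ q₁ ⟩} (λ h → let m = monoN {𝕌} {⟨ q₁ ⟩} h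
                                                z = pointN q₁ in (linear 2 (λ a b → (num 3 ≼ a) ⇒ (a ≼ b) ⇒ (b ≼ num
                                                  1) ⇒ ⊩⊥) (rN 𝕌) (rN ⟨ q₁ ⟩) lt m z)) λ (q₂ , _ , q₂∉) →
      go lt q₁ q₂ q₂∉
      where
      module CN = Closure N
      go : 3 ≤ rN 𝕌 → ∀ q₁ q₂ → q₂ ∉ ⟨ q₁ ⟩ → ⊥
      go lt q₁ q₂ q₂∉ =
        ⊈-witness {X = 𝕌} {Y = ⟨ q₁ ⟩ ∪ ⟨ q₂ ⟩}
          (λ h → let m = monoN {𝕌} {⟨ q₁ ⟩ ∪ ⟨ q₂ ⟩} h
                     a = CN.add ⟨ q₁ ⟩ ⟨ q₂ ⟩
                     z₁ = pointN q₁
                     z₂ = pointN q₂ in (linear 4 (λ a b c d → (num 3 ≼ a) ⇒ (a ≼ b) ⇒ (b ≼ d ⊕ c) ⇒ (d ≼ num 1) ⇒ (c ≼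
                       num 1) ⇒ ⊩⊥) (rN 𝕌) (rN (⟨ q₁ ⟩ ∪ ⟨ q₂ ⟩)) (rN ⟨ q₂ ⟩) (rN ⟨ q₁ ⟩) lt m a z₁
                       z₂)) λ (q₃ , _ , q₃∉) →
        let a = CN.add ⟨ q₂ ⟩ ⟨ q₃ ⟩
            z₁ = pointN q₁
            z₂ = pointN q₂
            z₃ = pointN q₃
            c = ⊆-intro {X = 𝕌} {Y = ⟨ q₁ ⟩ ∪ (⟨ q₂ ⟩ ∪ ⟨ q₃ ⟩)} λ z _ z∉ → few
              (q₁ , q₂ , q₃ , z , (differ q₂∉ , differ {q₁} {q₃} (sets 3 (λ a b c → (a ⊑ ∼ (b ⊔ c)) ⇛ ⊢ (a ⊑ ∼ b)) ⟨
                q₃ ⟩ ⟨ q₁ ⟩ ⟨ q₂ ⟩ q₃∉) , differ {q₁} {z} (sets 4 (λ a b c d → (a ⊑ ∼ (b ⊔ c ⊔ d)) ⇛ ⊢ (a ⊑ ∼ b)) ⟨ z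
                ⟩ ⟨ q₁ ⟩ ⟨ q₂ ⟩ ⟨ q₃ ⟩ z∉)) ,
               (differ {q₂} {q₃} (sets 3 (λ a b c → (a ⊑ ∼ (b ⊔ c)) ⇛ ⊢ (a ⊑ ∼ c)) ⟨ q₃ ⟩ ⟨ q₁ ⟩ ⟨ q₂ ⟩
                 q₃∉) , differ {q₂} {z} (sets 4 (λ a b c d → (a ⊑ ∼ (b ⊔ c ⊔ d)) ⇛ ⊢ (a ⊑ ∼ c)) ⟨ z ⟩ ⟨ q₁ ⟩ ⟨ q₂ ⟩ ⟨
                 q₃ ⟩ z∉)) , differ {q₃} {z} (sets 4 (λ a b c d → (a ⊑ ∼ (b ⊔ c ⊔ d)) ⇛ ⊢ (a ⊑ ∼ d)) ⟨ z ⟩ ⟨ q₁ ⟩ ⟨ q₂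
                 ⟩ ⟨ q₃ ⟩ z∉))
            m = monoN {∁ ⟨ q₁ ⟩} {⟨ q₂ ⟩ ∪ ⟨ q₃ ⟩} (sets 3 (λ a b c → (𝟙 ⊑ a ⊔ b ⊔ c) ⇛ ⊢ (∼ a ⊑ b ⊔ c)) ⟨ q₁ ⟩ ⟨ q₂ ⟩
              ⟨ q₃ ⟩ c)
        in case conn ⟨ q₁ ⟩ (linear 6 (λ a b c d e f → (num 3 ≼ a) ⇒ (b ≼ d ⊕ c) ⇒ (e ≼ num 1) ⇒ (d ≼ num 1) ⇒ (c ≼
          num 1) ⇒ (f ≼ b) ⇒ ⊩ (e ⊕ f ≼ a)) (rN 𝕌) (rN (⟨ q₂ ⟩ ∪ ⟨ q₃ ⟩)) (rN ⟨ q₃ ⟩) (rN ⟨ q₂ ⟩) (rN ⟨ q₁ ⟩) (rN (∁ ⟨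
          q₁ ⟩)) lt a z₁ z₂ z₃ m) of λ where
          (inj₁ h) → nonempty {z = q₁} h
          (inj₂ h) → nonempty {z = q₂} (sets 2 (λ a b → (∼ a ⊑ 𝟘) ⇛ (b ⊑ ∼ a) ⇛ ⊢ (b ⊑ 𝟘)) ⟨ q₁ ⟩ ⟨ q₂ ⟩ h q₂∉)

    module _ {X : Sub P} (vc : ∀ A B → 𝕌 ⊆ A ∪ B → X ⊆ A → X ⊆ B → r A < ρ → r B < ρ → 2 + r X + ρ ≤ r A + r B) where

      Copied : Set
      Copied = ∃₂ λ φ C → X ⊆ C × (∀ Y → rN Y + r C ≡ r (img φ Y ∪ C))

      -- In rank 0 there is nothing to place, in rank 1 a single point outside the closure of `X`
      -- suffices, and in rank 2 the three-point line from `triangle` carries the copy.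
      small-copy : rN 𝕌 ≤ 2 → rN 𝕌 + r X ≤ ρ → ¬¬ Copied
      small-copy le₂ room K = case ≤-or-> (rN 𝕌) 0 ,′ ≤-or-> (rN 𝕌) 1 of λ where
          (inj₁ h , _) → K (zero-case h)
          (inj₂ g , inj₁ h) → ⊈-witness {X = 𝕌} {Y = cl X} (full g) λ (b , _ , b∉) → K (one-case h b b∉)
          (inj₂ _ , inj₂ g) →
            ⊈-witness {X = 𝕌} {Y = ∅} (λ h → let m = monoN {𝕌} {∅} h
                                                 z = r-∅N in (linear 2 (λ a b → (num 2 ≼ a) ⇒ (a ≼ b) ⇒ (b ≼ num 0) ⇒
                                                   ⊩⊥) (rN 𝕌) (rN ∅) g m z)) λ (q₁ , _ , _) →
            ⊈-witness {X = 𝕌} {Y = ⟨ q₁ ⟩} (λ h → let m = monoN {𝕌} {⟨ q₁ ⟩} h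
                                                      z = pointN q₁ in (linear 2 (λ a b → (num 2 ≼ a) ⇒ (a ≼ b) ⇒ (b ≼
                                                        num 1) ⇒ ⊩⊥) (rN 𝕌) (rN ⟨ q₁ ⟩) g m z)) λ (q₂ , _ , q₂∉) →
            triangle vc (linear 3 (λ a b c → (b ⊕ a ≼ c) ⇒ (num 2 ≼ b) ⇒ ⊩ (num 2 ⊕ a ≼ c)) (r X) (rN 𝕌) ρ room
              g) λ (F , X⊆F , big , b , e , h , t₁ , t₂ , t₃) →
            K (two-case g q₁ q₂ q₂∉ F X⊆F big b e h t₁ t₂ t₃)
        where
        full : 1 ≤ rN 𝕌 → ¬ (𝕌 ⊆ cl X)
        full g h = let m = mono {𝕌} {cl X} h
                       c = r-cl X in (linear 4 (λ a b c d → (b ⊕ a ≼ c) ⇒ (num 1 ≼ b) ⇒ (c ≼ d) ⇒ (d ≼ a) ⇒ ⊩⊥) (r X)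
                         (rN 𝕌) ρ (r (cl X)) room g m c)

        zero-case : rN 𝕌 ≤ 0 → Copied
        zero-case h = (λ e → ⊥-elim (none e)) , X , (sets 1 (λ a → ⊢ (a ⊑ a)) X) ,
            small-embeds _ X le₂ (λ e → ⊥-elim (none e)) (λ e → ⊥-elim (none e)) (top _)
          where
          none : Q → ⊥
          none e = let l = N-loopless e
                       m = monoN {⟨ e ⟩} {𝕌} (sets 1 (λ a → ⊢ (a ⊑ 𝟙)) ⟨ e ⟩) in (linear 2 (λ a b → (a ≼ num 0) ⇒ (num
                         1 ≼ b) ⇒ (b ≼ a) ⇒ ⊩⊥) (rN 𝕌) (rN ⟨ e ⟩) h l m)
          top : ∀ φ → r (img φ 𝕌 ∪ X) ≤ rN 𝕌 + r X
          top φ = ≤-trans (mono (let i = img-⊆ φ {𝕌} {X} λ e → ⊥-elim (none e) in (sets 2 (λ a b → (a ⊑ b) ⇛ ⊢ (a ⊔ b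
                                       ⊑ b)) (img φ 𝕌) X i))) (m≤n+m (r X) (rN 𝕌))

        one-case : rN 𝕌 ≤ 1 → ∀ b → b ∉ cl X → Copied
        one-case h b b∉ = (λ _ → b) , X , (sets 3 (λ a b c → (a ⊑ ∼ b) ⇛ ⊢ (c ⊑ c)) ⟨ b ⟩ (cl X) X b∉) ,
            small-embeds (λ _ → b) X le₂ (λ _ → out {cl X} {X} {b} (cl-flat X) (⊆cl X) b∉) (λ e e′ d → ⊥-elim (few₂ e e′ d)) top
          where
          few₂ : ∀ e e′ → e′ ∉ ⟨ e ⟩ → ⊥
          few₂ e e′ d = let s = N-simple d
                            m = monoN {⟨ e ⟩ ∪ ⟨ e′ ⟩} {𝕌} (sets 2 (λ a b → ⊢ (a ⊔ b ⊑ 𝟙)) ⟨ e ⟩ ⟨ e′ ⟩) in (linear 2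
                              (λ a b → (a ≼ num 1) ⇒ (num 2 ≼ b) ⇒ (b ≼ a) ⇒ ⊩⊥) (rN 𝕌) (rN (⟨ e ⟩ ∪ ⟨ e′ ⟩)) h s m)
          top : r (img (λ _ → b) 𝕌 ∪ X) ≤ rN 𝕌 + r X
          top = ≤-by-contra λ lt → em Q λ where
            (inj₁ q) → let l = N-loopless q
                           m = monoN {⟨ q ⟩} {𝕌} (sets 1 (λ a → ⊢ (a ⊑ 𝟙)) ⟨ q ⟩)
                           i = img-⊆ (λ _ → b) {𝕌} {⟨ b ⟩} λ _ _ → (sets 2 (λ a b → (a ⊑ ∼ b) ⇛ ⊢ (a ⊑ a)) ⟨ b ⟩ (cl
                             X) b∉)
                           n = mono {img (λ _ → b) 𝕌 ∪ X} {X ∪ ⟨ b ⟩} (sets 3 (λ a b c → (a ⊑ b) ⇛ ⊢ (a ⊔ c ⊑ c ⊔ b))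
                             (img (λ _ → b) 𝕌) ⟨ b ⟩ X i)
                           s = step X b in (linear 5 (λ a b c d e → (↑ (b ⊕ a) ≼ c) ⇒ (num 1 ≼ d) ⇒ (d ≼ b) ⇒ (c ≼ e)
                             ⇒ (e ≼ ↑ a) ⇒ ⊩⊥) (r X) (rN 𝕌) (r (img (λ _ → b) 𝕌 ∪ X)) (rN ⟨ q ⟩) (r (X ∪ ⟨ b ⟩)) lt l
                             m n s)
            (inj₂ n) → let i = img-⊆ (λ _ → b) {𝕌} {X} λ e _ → ⊥-elim (n e)
                           n = mono {img (λ _ → b) 𝕌 ∪ X} {X} (sets 2 (λ a b → (a ⊑ b) ⇛ ⊢ (a ⊔ b ⊑ b)) (img (λ _ → b)
                             𝕌) X i) in (linear 3 (λ a b c → (↑ (b ⊕ a) ≼ c) ⇒ (c ≼ a) ⇒ ⊩⊥) (r X) (rN 𝕌) (r (img (λ _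
                             → b) 𝕌 ∪ X)) lt n)

        two-case : 2 ≤ rN 𝕌 → ∀ q₁ q₂ → q₂ ∉ ⟨ q₁ ⟩ → ∀ F → X ⊆ F → ρ ≤ 2 + r F → ∀ b e h →
          2 + r F ≤ r (F ∪ (⟨ b ⟩ ∪ ⟨ e ⟩)) → 2 + r F ≤ r (F ∪ (⟨ h ⟩ ∪ ⟨ b ⟩)) → 2 + r F ≤ r (F ∪ (⟨ h ⟩ ∪ ⟨ e ⟩)) → Copied
        two-case g q₁ q₂ q₂∉ F X⊆F big b e h be hb he =
            φ , F , X⊆F , small-embeds φ F le₂ one two top
          where
          -- At most one element of `N` differs from `q₁` and `q₂`; it goes to `h`.
          pick : Bool → Bool → P
          pick true  _     = b
          pick false true  = e
          pick false false = h
          φ : Q → P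
          φ q = pick (mem ⟨ q₁ ⟩ q) (mem ⟨ q₂ ⟩ q)
          data Kind (q : Q) : Set where
            k₁ : q ∈ ⟨ q₁ ⟩ → φ q ≡ b → Kind q
            k₂ : q ∈ ⟨ q₂ ⟩ → φ q ≡ e → Kind q
            k₃ : q ∉ ⟨ q₁ ⟩ → q ∉ ⟨ q₂ ⟩ → φ q ≡ h → Kind q
          kind : ∀ q → Kind q
          kind q = go (mem ⟨ q₁ ⟩ q) (mem ⟨ q₂ ⟩ q) refl refl
            where
            go : ∀ β γ → mem ⟨ q₁ ⟩ q ≡ β → mem ⟨ q₂ ⟩ q ≡ γ → Kind q
            go true  γ     x y = k₁ (∈-intro (subst T (sym x) tt)) (cong₂ pick x y)
            go false true  x y = k₂ (∈-intro (subst T (sym y) tt)) (cong₂ pick x y)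
            go false false x y = k₃ (∈-intro (subst (λ v → T (not v)) (sym x) tt)) (∈-intro (subst (λ v → T (not v)) (sym y) tt)) (cong₂ pick x y)
          Skew : P → P → Set
          Skew u v = 2 + r F ≤ r (F ∪ (⟨ u ⟩ ∪ ⟨ v ⟩))
          swap-skew : ∀ {u v} → Skew u v → Skew v u
          swap-skew {u} {v} s = ≤-trans s (mono (sets 3 (λ a b c → ⊢ (a ⊔ b ⊔ c ⊑ a ⊔ c ⊔ b)) F ⟨ u ⟩ ⟨ v ⟩))
          off : ∀ {u v} → 2 + r F ≤ r (F ∪ (⟨ u ⟩ ∪ ⟨ v ⟩)) → 1 + r F ≤ r (F ∪ ⟨ u ⟩)
          off {u} {v} s = let t = step (F ∪ ⟨ u ⟩) v
                              m = mono {F ∪ (⟨ u ⟩ ∪ ⟨ v ⟩)} {(F ∪ ⟨ u ⟩) ∪ ⟨ v ⟩} (sets 3 (λ a b c → ⊢ (a ⊔ b ⊔ c ⊑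
                                (a ⊔ b) ⊔ c)) F ⟨ u ⟩ ⟨ v ⟩) in (linear 4 (λ a b c d → (num 2 ⊕ a ≼ b) ⇒ (c ≼ ↑ d) ⇒
                                (b ≼ c) ⇒ ⊩ (num 1 ⊕ a ≼ d)) (r F) (r (F ∪ ⟨ u ⟩ ∪ ⟨ v ⟩)) (r ((F ∪ ⟨ u ⟩) ∪ ⟨ v ⟩))
                                (r (F ∪ ⟨ u ⟩)) s t m)
          one : ∀ q → 1 + r F ≤ r (F ∪ ⟨ φ q ⟩)
          one q = case kind q of λ where
            (k₁ _ eq)   → subst (λ v → 1 + r F ≤ r (F ∪ ⟨ v ⟩)) (sym eq) (off be)
            (k₂ _ eq)   → subst (λ v → 1 + r F ≤ r (F ∪ ⟨ v ⟩)) (sym eq) (off (swap-skew be))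
            (k₃ _ _ eq) → subst (λ v → 1 + r F ≤ r (F ∪ ⟨ v ⟩)) (sym eq) (off hb)
          skew : ∀ q q′ → q′ ∉ ⟨ q ⟩ → Kind q → Kind q′ → ∃₂ λ u v → φ q ≡ u × φ q′ ≡ v × Skew u v
          skew q q′ d (k₁ a _) (k₁ a′ _)         = ⊥-elim (differ d (trans (sym (same a)) (same a′)))
          skew q q′ d (k₁ _ x) (k₂ _ y)          = b , e , x , y , be
          skew q q′ d (k₁ _ x) (k₃ _ _ y)        = b , h , x , y , swap-skew hb
          skew q q′ d (k₂ _ x) (k₁ _ y)          = e , b , x , y , swap-skew be
          skew q q′ d (k₂ a _) (k₂ a′ _)         = ⊥-elim (differ d (trans (sym (same a)) (same a′)))
          skew q q′ d (k₂ _ x) (k₃ _ _ y)        = e , h , x , y , swap-skew he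
          skew q q′ d (k₃ _ _ x) (k₁ _ y)        = h , b , x , y , hb
          skew q q′ d (k₃ _ _ x) (k₂ _ y)        = h , e , x , y , he
          skew q q′ d (k₃ a₁ a₂ _) (k₃ b₁ b₂ _)  = ⊥-elim (few (q₁ , q₂ , q , q′ ,
            (differ q₂∉ , differ a₁ , differ b₁) , (differ a₂ , differ b₂) , differ d))
          two : ∀ q q′ → q′ ∉ ⟨ q ⟩ → 2 + r F ≤ r (F ∪ (⟨ φ q ⟩ ∪ ⟨ φ q′ ⟩))
          two q q′ d = let u , v , x , y , s = skew q q′ d (kind q) (kind q′) in
            subst₂ (λ u v → 2 + r F ≤ r (F ∪ (⟨ u ⟩ ∪ ⟨ v ⟩))) (sym x) (sym y) s
          top : r (img φ 𝕌 ∪ F) ≤ rN 𝕌 + r F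
          top = let m = mono {img φ 𝕌 ∪ F} {𝕌} (sets 2 (λ a b → ⊢ (a ⊔ b ⊑ 𝟙)) (img φ 𝕌) F) in (linear 4 (λ a b c d →
                      (num 2 ≼ a) ⇒ (b ≼ num 2 ⊕ c) ⇒ (d ≼ b) ⇒ ⊩ (d ≼ a ⊕ c)) (rN 𝕌) ρ (r F) (r (img φ 𝕌 ∪ F)) g big
                      m)

-- Skew families

module _ {P : Set} ⦃ _ : DecEq P ⦄ (M : Ranked P) where
  open Ranked M
  open Closure M

  ⋃ˡ : List (Sub P) → Sub P
  ⋃ˡ []       = ∅
  ⋃ˡ (X ∷ Xs) = X ∪ ⋃ˡ Xs

  -- A family is skew when this sum is at most the rank of its union; the reverse inequality always
  -- holds.
  Σr : List (Sub P) → ℕ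
  Σr []       = 0
  Σr (X ∷ Xs) = r X + Σr Xs

  r-⋃ˡ : ∀ B Xs → r (B ∪ ⋃ˡ Xs) ≤ r B + Σr Xs
  r-⋃ˡ B []       = ≤-trans (mono {B ∪ ∅} {B} (sets 1 (λ a → ⊢ (a ⊔ 𝟘 ⊑ a)) B)) (m≤m+n (r B) 0)
  r-⋃ˡ B (X ∷ Xs) = go (⋃ˡ Xs) (Σr Xs) (r-⋃ˡ (B ∪ X) Xs)
    where
    go : ∀ U σ → r ((B ∪ X) ∪ U) ≤ r (B ∪ X) + σ → r (B ∪ (X ∪ U)) ≤ r B + (r X + σ)
    go U σ a = let m = mono {B ∪ (X ∪ U)} {(B ∪ X) ∪ U} (sets 3 (λ a b c → ⊢ (a ⊔ b ⊔ c ⊑ (a ⊔ b) ⊔ c)) B X U)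
                   b = add B X
               in (linear 6 (λ a b c d e f → (a ≼ c ⊕ b) ⇒ (d ≼ a) ⇒ (c ≼ f ⊕ e) ⇒ ⊩ (d ≼ f ⊕ (e ⊕ b))) (r ((B ∪ X) ∪
                 U)) σ (r (B ∪ X)) (r (B ∪ X ∪ U)) (r X) (r B) a m b)

  ⋃ᵛ : ∀ {s} → (Fin s → Sub P) → Sub P
  ⋃ᵛ {zero}  V = ∅
  ⋃ᵛ {suc s} V = V Fin.zero ∪ ⋃ᵛ (V ∘ Fin.suc)

  Σᵛ : ∀ {s} → (Fin s → Sub P) → ℕ
  Σᵛ {zero}  V = 0
  Σᵛ {suc s} V = r (V Fin.zero) + Σᵛ (V ∘ Fin.suc)

  Σᵛ-mono : ∀ {s} (A B : Fin s → Sub P) → (∀ i → A i ⊆ B i) → Σᵛ A ≤ Σᵛ B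
  Σᵛ-mono {zero} A B h = z≤n
  Σᵛ-mono {suc s} A B h = +-mono-≤ (mono (h Fin.zero)) (Σᵛ-mono (A ∘ Fin.suc) (B ∘ Fin.suc) (h ∘ Fin.suc))

  ⋃ᵛ-mono : ∀ {s} (A B : Fin s → Sub P) → (∀ i → A i ⊆ B i) → ⋃ᵛ A ⊆ ⋃ᵛ B
  ⋃ᵛ-mono {zero}  A B h = sets 1 (λ a → ⊢ (a ⊑ a)) ∅
  ⋃ᵛ-mono {suc s} A B h = go (h Fin.zero) (⋃ᵛ-mono (A ∘ Fin.suc) (B ∘ Fin.suc) (h ∘ Fin.suc))
    where
    go : ∀ {A B C D : Sub P} → A ⊆ B → C ⊆ D → A ∪ C ⊆ B ∪ D
    go {A} {B} {C} {D} p q = (sets 4 (λ a b c d → (a ⊑ b) ⇛ (c ⊑ d) ⇛ ⊢ (a ⊔ c ⊑ b ⊔ d)) A B C D p q)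

  r-⋃ᵛ : ∀ {s} (V : Fin s → Sub P) → r (⋃ᵛ V) ≤ Σᵛ V
  r-⋃ᵛ {zero}  V = r-∅
  r-⋃ᵛ {suc s} V = ≤-trans (add (V Fin.zero) (⋃ᵛ (V ∘ Fin.suc))) (+-monoʳ-≤ (r (V Fin.zero)) (r-⋃ᵛ (V ∘ Fin.suc)))

  ⊆⋃ᵛ : ∀ {s} (V : Fin s → Sub P) i → V i ⊆ ⋃ᵛ V
  ⊆⋃ᵛ {suc s} V Fin.zero = left (V Fin.zero) (⋃ᵛ (V ∘ Fin.suc))
    where
    left : ∀ A B → A ⊆ A ∪ B
    left A B = (sets 2 (λ a b → ⊢ (a ⊑ a ⊔ b)) A B)
  ⊆⋃ᵛ {suc s} V (Fin.suc i) = right (V Fin.zero) (⊆⋃ᵛ (V ∘ Fin.suc) i)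
    where
    right : ∀ A {B C} → C ⊆ B → C ⊆ A ∪ B
    right A {B} {C} h = (sets 3 (λ a b c → (a ⊑ b) ⇛ ⊢ (a ⊑ c ⊔ b)) C B A h)

  cons : ∀ {A : Set} {s} → A → (Fin s → A) → Fin (suc s) → A
  cons x f Fin.zero    = x
  cons x f (Fin.suc i) = f i

  -- Dropping a member lowers the rank of the union by at most its own rank, so the first members of
  -- a skew family are skew. `B` collects the members already passed. The theorem asks for an exact
  -- number of members.
  prefix : ∀ {Q : Sub P → Set} s B Xs → s ≤ length Xs → All Q Xs →
    ∃ λ (V : Fin s → Sub P) → (∀ i → Q (V i)) × r (B ∪ ⋃ˡ Xs) + Σᵛ V ≤ r (B ∪ ⋃ᵛ V) + Σr Xs
  prefix zero B Xs _ _ = (λ ()) , (λ ()) ,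
    go (r (B ∪ ⋃ˡ Xs)) (Σr Xs) (r-⋃ˡ B Xs)
    where
    go : ∀ u σ → u ≤ r B + σ → u + 0 ≤ r (B ∪ ∅) + σ
    go u σ a = let m = mono {B} {B ∪ ∅} (sets 1 (λ a → ⊢ (a ⊑ a ⊔ 𝟘)) B) in (linear 4 (λ a b c d → (a ≼ c ⊕ b) ⇒ (c ≼
                     d) ⇒ ⊩ (a ⊕ num 0 ≼ d ⊕ b)) u σ (r B) (r (B ∪ ∅)) a m)
  prefix (suc s) B (X ∷ Xs) (s≤s le) (q ∷ qs) =
    let V , Q-V , h = prefix s (B ∪ X) Xs le qs
    in cons X V , (λ where
         Fin.zero → q
         (Fin.suc i) → Q-V i) , go (⋃ᵛ V) (Σᵛ V) h
    where
    go : ∀ W w → r ((B ∪ X) ∪ ⋃ˡ Xs) + w ≤ r ((B ∪ X) ∪ W) + Σr Xs →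
         r (B ∪ (X ∪ ⋃ˡ Xs)) + (r X + w) ≤ r (B ∪ (X ∪ W)) + (r X + Σr Xs)
    go W w h = let m = mono {B ∪ (X ∪ ⋃ˡ Xs)} {(B ∪ X) ∪ ⋃ˡ Xs} (sets 3 (λ a b c → ⊢ (a ⊔ b ⊔ c ⊑ (a ⊔ b) ⊔ c)) B X
                     (⋃ˡ Xs))
                   n = mono {(B ∪ X) ∪ W} {B ∪ (X ∪ W)} (sets 3 (λ a b c → ⊢ ((a ⊔ b) ⊔ c ⊑ a ⊔ b ⊔ c)) B X W) in
                     (linear 7 (λ a b c d e f g → (b ⊕ a ≼ d ⊕ c) ⇒ (e ≼ b) ⇒ (d ≼ f) ⇒ ⊩ (e ⊕ (g ⊕ a) ≼ f ⊕ (g ⊕ c)))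
                     w (r ((B ∪ X) ∪ ⋃ˡ Xs)) (Σr Xs) (r ((B ∪ X) ∪ W)) (r (B ∪ X ∪ ⋃ˡ Xs)) (r (B ∪ X ∪ W)) (r X) h m
                     n)

  -- Peeling off the first member twice turns the rank identity for the
  -- whole union into one for arbitrary traces on the members.
  skew-traces : ∀ {s} (V : Fin s → Sub P) → Σᵛ V ≤ r (⋃ᵛ V) → ∀ Y → Y ⊆ ⋃ᵛ V → Σᵛ (λ i → Y ∩ V i) ≤ r Y
  skew-traces {zero} V h Y Y⊆ = z≤n
  skew-traces {suc s} V h Y Y⊆ =
      go (V Fin.zero) (⋃ᵛ (V ∘ Fin.suc)) h (r-⋃ᵛ (V ∘ Fin.suc)) Y⊆
        (λ le → skew-traces (V ∘ Fin.suc) le (Y ∩ ⋃ᵛ (V ∘ Fin.suc)) ∩⊆ʳ)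
        (mono-Σ (V ∘ Fin.suc))
    where
    ∩⊆ʳ : ∀ {A B : Sub P} → A ∩ B ⊆ B
    ∩⊆ʳ {A} {B} = (sets 4 (λ a b c d → (a ⊑ b) ⇛ ⊢ (c ⊓ d ⊑ d)) Y (⋃ᵛ V) A B Y⊆)
    go : ∀ X U {σ τ τ′} → r X + σ ≤ r (X ∪ U) → r U ≤ σ → Y ⊆ X ∪ U → (σ ≤ r U → τ ≤ r (Y ∩ U)) → τ′ ≤ τ →
         r (Y ∩ X) + τ′ ≤ r Y
    go X U {σ} {τ} {τ′} h a Y⊆ rec e =
      let b = add X U
          t = rec (linear 4 (λ a b c d → (b ⊕ a ≼ c) ⇒ (c ≼ b ⊕ d) ⇒ ⊩ (a ≼ d)) σ (r X) (r (X ∪ U)) (r U) h b)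
          s₁ = sm {X ∪ U} {Y ∩ X} X ((Y ∩ X) ∪ U) (sets 3 (λ a b c → (a ⊑ b ⊔ c) ⇛ ⊢ (b ⊔ c ⊑ b ⊔ a ⊓ b ⊔ c)) Y X U
            Y⊆) (sets 3 (λ a b c → (a ⊑ b ⊔ c) ⇛ ⊢ (a ⊓ b ⊑ b ⊓ (a ⊓ b ⊔ c))) Y X U Y⊆)
          s₂ = sm {(Y ∩ X) ∪ U} {Y ∩ U} U Y (sets 3 (λ a b c → (a ⊑ b ⊔ c) ⇛ ⊢ (a ⊓ b ⊔ c ⊑ c ⊔ a)) Y X U Y⊆) (sets 3
            (λ a b c → (a ⊑ b ⊔ c) ⇛ ⊢ (a ⊓ c ⊑ c ⊓ a)) Y X U Y⊆)
      in (linear 10 (λ a b c d e f g h i j → (b ⊕ a ≼ c) ⇒ (d ≼ a) ⇒ (e ≼ f) ⇒ (f ≼ g) ⇒ (c ⊕ h ≼ b ⊕ i) ⇒ (i ⊕ g ≼ d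
        ⊕ j) ⇒ ⊩ (h ⊕ e ≼ j)) σ (r X) (r (X ∪ U)) (r U) τ′ τ (r (Y ∩ U)) (r (Y ∩ X)) (r (Y ∩ X ∪ U)) (r Y) h a e t s₁
        s₂)
    mono-Σ : ∀ {t} (W : Fin t → Sub P) → Σᵛ (λ i → Y ∩ W i) ≤ Σᵛ (λ i → (Y ∩ ⋃ᵛ W) ∩ W i)
    mono-Σ W = Σᵛ-mono _ _ λ i → trace (⊆⋃ᵛ W i)
      where
      trace : ∀ {A B : Sub P} → A ⊆ B → Y ∩ A ⊆ (Y ∩ B) ∩ A
      trace {A} {B} h = (sets 3 (λ y a b → (a ⊑ b) ⇛ ⊢ (y ⊓ a ⊑ (y ⊓ b) ⊓ a)) Y A B h)

  traces-cover : ∀ {s} (V : Fin s → Sub P) Y → Y ⊆ ⋃ᵛ V → r Y ≤ Σᵛ (λ i → Y ∩ V i)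
  traces-cover V Y h = ≤-trans (mono (go V Y h)) (r-⋃ᵛ (λ i → Y ∩ V i))
    where
    go : ∀ {s} (V : Fin s → Sub P) Y → Y ⊆ ⋃ᵛ V → Y ⊆ ⋃ᵛ (λ i → Y ∩ V i)
    go V Y h = ⊆-intro λ z z∈ z∉ → found V z (at-most h z z∈) z∈ z∉
      where
      at-most : ∀ {A B : Sub P} → A ⊆ B → ∀ z → z ∈ A → z ∈ B
      at-most {A} {B} h z a = (sets 3 (λ a b c → (a ⊑ b) ⇛ (c ⊑ a) ⇛ ⊢ (c ⊑ b)) A B ⟨ z ⟩ h a)
      found : ∀ {s} (V : Fin s → Sub P) z → z ∈ ⋃ᵛ V → z ∈ Y → z ∉ ⋃ᵛ (λ i → Y ∩ V i) → ⊥
      found {zero}  V z a _ _ = nonempty a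
      found {suc s} V z a b c = case z ∈? V Fin.zero of λ where
          (inj₁ h) → atHead (V Fin.zero) (⋃ᵛ (λ i → Y ∩ V (Fin.suc i))) h c
          (inj₂ h) → found (V ∘ Fin.suc) z (rest (V Fin.zero) (⋃ᵛ (V ∘ Fin.suc)) a h) b
                       (later (V Fin.zero) (⋃ᵛ (λ i → Y ∩ V (Fin.suc i))) c)
        where
        atHead : ∀ A B → z ∈ A → z ∉ (Y ∩ A) ∪ B → ⊥
        atHead A B h c = (nonempty (sets 4 (λ a b c d → (a ⊑ b) ⇛ (a ⊑ c) ⇛ (a ⊑ ∼ (b ⊓ c ⊔ d)) ⇛ ⊢ (a ⊑ 𝟘)) ⟨ z ⟩ Y A
          B b h c))
        rest : ∀ A B → z ∈ A ∪ B → z ∉ A → z ∈ B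
        rest A B p q = (sets 3 (λ a b c → (a ⊑ b ⊔ c) ⇛ (a ⊑ ∼ b) ⇛ ⊢ (a ⊑ c)) ⟨ z ⟩ A B p q)
        later : ∀ A B → z ∉ (Y ∩ A) ∪ B → z ∉ B
        later A B p = (sets 4 (λ a b c d → (a ⊑ ∼ (b ⊓ c ⊔ d)) ⇛ ⊢ (a ⊑ ∼ d)) ⟨ z ⟩ Y A B p)

  Σᵛ-one : ∀ {s} (V : Fin s → Sub P) i → r (V i) ≤ Σᵛ V
  Σᵛ-one V Fin.zero    = m≤m+n _ _
  Σᵛ-one V (Fin.suc i) = ≤-trans (Σᵛ-one (V ∘ Fin.suc) i) (m≤n+m _ _)

  Σᵛ-two : ∀ {s} (V : Fin s → Sub P) i j → ¬ i ≡ j → 1 ≤ r (V i) → 1 ≤ r (V j) → 2 ≤ Σᵛ V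
  Σᵛ-two V Fin.zero    Fin.zero    n _ _ = ⊥-elim (n refl)
  Σᵛ-two V Fin.zero    (Fin.suc j) n a b = +-mono-≤ a (≤-trans b (Σᵛ-one (V ∘ Fin.suc) j))
  Σᵛ-two V (Fin.suc i) Fin.zero    n a b = +-mono-≤ b (≤-trans a (Σᵛ-one (V ∘ Fin.suc) i))
  Σᵛ-two V (Fin.suc i) (Fin.suc j) n a b = ≤-trans (Σᵛ-two (V ∘ Fin.suc) i j (n ∘ cong Fin.suc) a b) (m≤n+m _ _)

-- Hyperplanes and cocircuits

module Hyperplanes {m : ℕ} (M : Matroid m) where
  open Hat M
  private
    E₀ = Matroid.E M
    r₀ = Matroid.r M

  -- Since `H` does not span, its complement is dependent in the dual. A proper subset of it leaves
  -- out a point off `H`, which together with `H` spans, so that subset is independent in the dual.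
  hyperplane-cocircuit : ∀ {H} → Flat H → ρ ≤ suc (r H) → r H < ρ → Cocircuit M (toSub (∁ H))
  hyperplane-cocircuit {H} H-flat corank lt = (toSub-⊆ , small) , minimal
    where
    D : Subset m
    D = toSub (∁ H)
    co : r₀ (E₀ ─ D) ≤ r H
    co = ≤-trans (≤-reflexive (cong r₀ (sym (toSub-∁ (∁ H))))) (mono {∁ (∁ H)} {H} (sets 1 (λ a → ⊢ (∼ (∼ a) ⊑ a)) H))
    -- Dual rank is a truncated subtraction, and for an empty set the strict inequality in `small`
    -- would fail.
    1≤D : 1 ≤ ∣ D ∣
    1≤D = let a = add H (∁ H)
              m = mono {𝕌} {H ∪ ∁ H} (sets 1 (λ a → ⊢ (𝟙 ⊑ a ⊔ ∼ a)) H)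
              c = r-card (∁ H)
          in go {∣ D ∣} c a m
      where
      go : ∀ {d} → r (∁ H) ≤ d → r (H ∪ ∁ H) ≤ r H + r (∁ H) → ρ ≤ r (H ∪ ∁ H) → 1 ≤ d
      go {d} x y z = (linear 5 (λ a b c d e → (↑ a ≼ b) ⇒ (c ≼ d) ⇒ (e ≼ a ⊕ c) ⇒ (b ≼ e) ⇒ ⊩ (num 1 ≼ d)) (r H) ρ (r
        (∁ H)) d (r (H ∪ ∁ H)) lt x y z)
    small : (∣ D ∣ + r₀ (E₀ ─ D)) ∸ Matroid.rank M < ∣ D ∣
    small = go ∣ D ∣ (r₀ (E₀ ─ D)) (Matroid.rank M) 1≤D (≤-trans (s≤s co) (≤-trans lt (≤-reflexive (sym rank-hat))))
      where
      go : ∀ d h t → 1 ≤ d → suc h ≤ t → (d + h) ∸ t < d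
      go (suc d) h t _ l = s≤s (m≤n+o⇒m∸n≤o (suc d + h) t (linear 3 (λ a b c → (↑ a ≼ b) ⇒ ⊩ (↑ c ⊕ a ≼ b ⊕ c)) h t d
        l))
    minimal : ∀ D′ → D′ S.⊂ D → Independent (M *) D′
    minimal D′ (D′⊆ , z , z∈ , z∉) = (λ h → toSub-⊆ (D′⊆ h)) ,
        trans (cong (λ v → (∣ D′ ∣ + v) ∸ Matroid.rank M) spanning) (m+n∸n≡m ∣ D′ ∣ (Matroid.rank M))
      where
      ẑ : Element M
      ẑ = z , proj₁ (toSub⁻ {∁ H} z∈)
      z∉H : ẑ ∉ H
      z∉H = proj₂ (toSub⁻ {∁ H} z∈)
      spanning : r₀ (E₀ ─ D′) ≡ Matroid.rank M
      spanning = ≤-antisym (Matroid.r-monotone M (S.p─q⊆p E₀ D′) id)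
        (≤-trans (≤-reflexive rank-hat) (≤-trans (≤-trans corank (out {H} {H} H-flat (sets 2 (λ a b → (a ⊑ ∼ b) ⇛ ⊢ (b
          ⊑ b)) ⟨ ẑ ⟩ H z∉H) z∉H))
          (Matroid.r-monotone M away (S.p─q⊆p E₀ D′))))
        where
        away : toSub (H ∪ ⟨ ẑ ⟩) S.⊆ E₀ ─ D′
        away {i} i∈ = let p , q = toSub⁻ i∈ in S.x∈p∧x∉q⇒x∈p─q p λ i∈D′ →
          let p′ , q′ = toSub⁻ {∁ H} (D′⊆ i∈D′) in
          z∉ (subst (S._∈ D′) (sym (cong proj₁ (same (only (i , p) q (subst (_∈ ∁ H) (Element-≡ refl) q′))))) i∈D′)
          where
          only : ∀ w → w ∈ H ∪ ⟨ ẑ ⟩ → w ∉ H → w ∈ ⟨ ẑ ⟩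
          only w a b = (sets 3 (λ a b c → (a ⊑ b ⊔ c) ⇛ (a ⊑ ∼ b) ⇛ ⊢ (a ⊑ c)) ⟨ w ⟩ H ⟨ ẑ ⟩ a b)

3≤∣∣ : ∀ {n} {x y z : Fin n} {p} → x S.∈ p → y S.∈ p → z S.∈ p → ¬ x ≡ y → ¬ x ≡ z → ¬ y ≡ z → 3 ≤ ∣ p ∣
3≤∣∣ {x = x} {y} {z} {p} x∈ y∈ z∈ xy xz yz =
  ≤-trans (s≤s (2≤∣∣ {x = y} {y = z} (S.x∈p∧x≢y⇒x∈p-y y∈ (xy ∘ sym)) (S.x∈p∧x≢y⇒x∈p-y z∈ (xz ∘ sym)) yz)) (S.x∈p⇒∣p-x∣<∣p∣ x∈)

-- Members of the family in terms of the definitions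

module Pieces {m n : ℕ} (M : Matroid m) (N : Matroid n) (tc : ThreeConnected M) (2≤ρ : 2 ≤ Hat.ρ M) where
  open Hat M
  open Hyperplanes M
  private
    module HN₃ = Hat N
    E₀ = Matroid.E M
    M-simple : ∀ {y z} → z ∉ ⟨ y ⟩ → 2 ≤ r (⟨ y ⟩ ∪ ⟨ z ⟩)
    M-simple = simple tc 2≤ρ
    M-loopless : ∀ z → 1 ≤ r ⟨ z ⟩
    M-loopless = loopless tc 2≤ρ
    M-vc3 : ∀ A B → 𝕌 ⊆ A ∪ B → r A < ρ → r B < ρ → 2 + ρ ≤ r A + r B
    M-vc3 = vc3 tc
  open Separations hat M-simple M-vc3

  Copied : Sub (Element M) → Set
  Copied X = ∃₂ λ φ C → X ⊆ C × Embeds M N φ C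

  Carambolic : Subset m → Set
  Carambolic X = Matroid.r M X ≡ 2 × 3 ≤ ∣ X ∣ ×
    (∀ y → y S.∈ X → ¬¬ (∃ λ x → x S.∈ E₀ × Cocircuit M ((X S.- y) S.∪ ⁅ x ⁆)))

  -- 3-connectivity is a negative statement and is obtained outright; the copy and the tips of a
  -- line are existential and stay doubly negated until the search.
  Piece : Sub (Element M) → Set
  Piece X = ThreeConnected (si (M / toSub X)) × (¬¬ Copied X) × ((∃ λ x → toSub X ≡ ⁅ x ⁆) ⊎ Carambolic (toSub X))

  VC : Sub (Element M) → Set
  VC X = ∀ A B → 𝕌 ⊆ A ∪ B → X ⊆ A → X ⊆ B → r A < ρ → r B < ρ → 2 + r X + ρ ≤ r A + r B

  VC⇒3-connected : ∀ {X} → VC X → ThreeConnected (si (M / toSub X))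
  VC⇒3-connected {X} vc = contraction-3-connected λ A B c XA XB lA lB →
      ≤-trans (+-monoˡ-≤ ρ (s≤s (s≤s (mono X̂⊆)))) (vc A B c (via XA) (via XB) lA lB)
    where
    open Contraction M (toSub X) toSub-⊆
    X̂⊆ : X̂ ⊆ X
    X̂⊆ = from-to⊆ X
    via : ∀ {A} → X̂ ⊆ A → X ⊆ A
    via {A} h = go (⊆from-to X)
      where
      go : X ⊆ X̂ → X ⊆ A
      go p = (sets 3 (λ a b c → (a ⊑ b) ⇛ (b ⊑ c) ⇛ ⊢ (a ⊑ c)) X X̂ A p h)

  module _ (tangles : Tangles)
    (realize : ∀ {X k} → X ⊆ Tangles.Con tangles k → VC X → HN₃.ρ + r X ≤ ρ → ¬¬ Copied X)
    (room : 2 + HN₃.ρ ≤ ρ) where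
    open Crossings tangles
    open Tangles tangles
    open Filaments hat M-simple M-vc3 tangles
    open FreeFamilies hat M-simple M-loopless M-vc3 tangles
    open Counting hat M-simple M-loopless M-vc3 tangles

    W-piece : ∀ {w} → W w → Piece ⟨ w ⟩
    W-piece {w} (ct , k , w∈) = VC⇒3-connected vc ,
        realize {k = k} w∈ vc (let p = r-point w in (linear 3 (λ a b c → (num 2 ⊕ a ≼ b) ⇒ (c ≼ num 1) ⇒ ⊩ (a ⊕ c ≼
                                     b)) HN₃.ρ ρ (r ⟨ w ⟩) room p)) ,
        inj₁ (proj₁ w , Simplification.sub₁ M (proj₁ w) (proj₂ w))
      where
      vc : VC ⟨ w ⟩
      vc A B c wA wB lA lB = let h = ct A B c wA wB lA lB
                                 p = r-point w in (linear 4 (λ a b c d → (num 3 ⊕ a ≼ c ⊕ b) ⇒ (d ≼ num 1) ⇒ ⊩ (num 2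
                                   ⊕ d ⊕ a ≼ c ⊕ b)) ρ (r B) (r A) (r ⟨ w ⟩) h p)

    Filament-piece : ∀ {l} → Filament l → Piece l
    Filament-piece {l} f = VC⇒3-connected vc ,
        realize {k = Filament.copy f} (Filament.l⊆Con f) vc (let p = Filament.l≤2 f in (linear 3 (λ a b c → (num 2 ⊕ a
                                                                   ≼ b) ⇒ (c ≼ num 2) ⇒ ⊩ (a ⊕ c ≼ b)) HN₃.ρ ρ (r l)
                                                                   room p)) ,
        inj₂ (rank-two , three , stars)
      where
      open Filament f
      vc : VC l
      vc A B c wA wB lA lB = let h = line-contractible f A B c wA wB lA lB
                                 p = l≤2 in (linear 4 (λ a b c d → (num 4 ⊕ a ≼ c ⊕ b) ⇒ (d ≼ num 2) ⇒ ⊩ (num 2 ⊕ d ⊕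
                                   a ≼ c ⊕ b)) ρ (r B) (r A) (r l) h p)
      rank-two : r l ≡ 2
      rank-two = let s = M-simple e₁≠e₂
                     m = mono {⟨ e₂ ⟩ ∪ ⟨ e₁ ⟩} {l} (go e₁∈ e₂∈) in ≤-antisym l≤2 (≤-trans s m)
        where
        go : ∀ {u v} → u ∈ l → v ∈ l → ⟨ v ⟩ ∪ ⟨ u ⟩ ⊆ l
        go {u} {v} a b = (sets 3 (λ a b c → (a ⊑ b) ⇛ (c ⊑ b) ⇛ ⊢ (c ⊔ a ⊑ b)) ⟨ u ⟩ l ⟨ v ⟩ a b)
      distinct : ∀ {u v : Element M} → u ∉ ⟨ v ⟩ → ¬ proj₁ u ≡ proj₁ v
      distinct {u} {v} h eq = go (subst (λ v → u ∉ ⟨ v ⟩) (Element-≡ (sym eq)) h)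
        where
        go : u ∉ ⟨ u ⟩ → ⊥
        go h = (nonempty (sets 1 (λ a → (a ⊑ ∼ a) ⇛ ⊢ (a ⊑ 𝟘)) ⟨ u ⟩ h))
      three : 3 ≤ ∣ toSub l ∣
      three = 3≤∣∣ (toSub⁺ e₁ e₁∈) (toSub⁺ e₂ e₂∈) (toSub⁺ e₃ e₃∈) (distinct e₁≠e₂) (distinct e₁≠e₃) (distinct e₂≠e₃)
      stars : ∀ y → y S.∈ toSub l → ¬¬ (∃ λ x → x S.∈ E₀ × Cocircuit M ((toSub l S.- y) S.∪ ⁅ x ⁆))
      stars y y∈ Q = let p , q = toSub⁻ {l} y∈ in star (y , p) q λ s →
          Q (proj₁ (Star.x s) , proj₂ (Star.x s) ,
             subst (Cocircuit M) (shape p s) (hyperplane-cocircuit (Star.H-flat s) (Star.corank s) (Star.ltH s)))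
        where
        shape : ∀ p (s : Star l (y , p)) → toSub (∁ (Star.H s)) ≡ (toSub l S.- y) S.∪ ⁅ proj₁ (Star.x s) ⁆
        shape p s = S.⊆-antisym
          (λ {i} i∈ → let p′ , q = toSub⁻ {∁ H} i∈ in S.x∈p∪q⁺ (case (i , p′) ∈? ⟨ x ⟩ of λ where
            (inj₁ h) → inj₂ (subst (λ v → i S.∈ ⁅ proj₁ v ⁆) (sym (same h)) (S.x∈⁅x⁆ i))
            (inj₂ h) → inj₁ (S.x∈p∧x≢y⇒x∈p-y (toSub⁺ (i , p′) (on-l (i , p′) q h)) (distinct (off-y (i , p′) q h)))))
          (λ {i} i∈ → case S.x∈p∪q⁻ (toSub l S.- y) ⁅ proj₁ x ⁆ i∈ of λ where
            (inj₂ h) → subst (S._∈ toSub (∁ H)) (sym (S.x∈⁅y⁆⇒x≡y (proj₁ x) h)) (toSub⁺ x x∉H)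
            (inj₁ h) → let p′ , q = toSub⁻ {l} (S.p─q⊆p (toSub l) ⁅ y ⁆ h) in
              toSub⁺ (i , p′) (outside (i , p′) q (apart λ eq →
                ─-∉ (toSub l) ⁅ y ⁆ h (subst (S._∈ ⁅ y ⁆) (sym (cong proj₁ eq)) (S.x∈⁅x⁆ y)))))
          where
          open Star s
          on-l : ∀ w → w ∉ H → w ∉ ⟨ x ⟩ → w ∈ l
          on-l w a b = go w C⊆ a b
            where
            go : ∀ w {H v x} → ∁ H ⊆ (l ∩ ∁ ⟨ v ⟩) ∪ ⟨ x ⟩ → w ∉ H → w ∉ ⟨ x ⟩ → w ∈ l
            go w {H} {v} {x} c a b = (sets 5 (λ a b c d e → (∼ a ⊑ b ⊓ ∼ c ⊔ d) ⇛ (e ⊑ ∼ a) ⇛ (e ⊑ ∼ d) ⇛ ⊢ (e ⊑ b)) H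
              l ⟨ v ⟩ ⟨ x ⟩ ⟨ w ⟩ c a b)
          off-y : ∀ w → w ∉ H → w ∉ ⟨ x ⟩ → w ∉ ⟨ y , p ⟩
          off-y w a b = go w C⊆ a b
            where
            go : ∀ w {H v x} → ∁ H ⊆ (l ∩ ∁ ⟨ v ⟩) ∪ ⟨ x ⟩ → w ∉ H → w ∉ ⟨ x ⟩ → w ∉ ⟨ v ⟩
            go w {H} {v} {x} c a b = (sets 5 (λ a b c d e → (∼ a ⊑ b ⊓ ∼ c ⊔ d) ⇛ (e ⊑ ∼ a) ⇛ (e ⊑ ∼ d) ⇛ ⊢ (e ⊑ ∼ c))
              H l ⟨ v ⟩ ⟨ x ⟩ ⟨ w ⟩ c a b)
          outside : ∀ w → w ∈ l → w ∉ ⟨ y , p ⟩ → w ∉ H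
          outside w a b = go w ⊆C a b
            where
            go : ∀ w {H v} → l ∩ ∁ ⟨ v ⟩ ⊆ ∁ H → w ∈ l → w ∉ ⟨ v ⟩ → w ∉ H
            go w {H} {v} c a b = (sets 4 (λ a b c d → (a ⊓ ∼ b ⊑ ∼ c) ⇛ (d ⊑ a) ⇛ (d ⊑ ∼ b) ⇛ ⊢ (d ⊑ ∼ c)) l ⟨ v ⟩ H ⟨
              w ⟩ c a b)

    pieces : ∀ k K → K ≤ r (Con k) → 2 ≤ K →
      ¬¬ (∃ λ Xs → All Piece Xs × 2 + K ≤ length Xs + length Xs × Σr hat Xs ≤ r (⋃ˡ hat Xs))
    pieces k K K≤ 2≤K Q = large-family k K K≤ 2≤K λ (f , big) → Q (family f big)
      where
      family : ∀ f → 2 + K ≤ Family.size f + Family.size f →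
        ∃ λ Xs → All Piece Xs × 2 + K ≤ length Xs + length Xs × Σr hat Xs ≤ r (⋃ˡ hat Xs)
      family f big = Xs , all I (λ w h → I-W w h) , subst (λ v → 2 + K ≤ v + v) (sym (len I)) big ,
          ≤-trans (weights I) (≤-trans indep (mono (union I)))
        where
        open Family f
        join : List (Element M) → List (Sub (Element M))
        join []       = ls
        join (w ∷ ws) = ⟨ w ⟩ ∷ join ws
        Xs = join I
        filaments : ∀ {ls} → All Filament ls → All Piece ls
        filaments []       = []
        filaments (f ∷ fs) = Filament-piece f ∷ filaments fs
        all : ∀ ws → (∀ w → w ∈ setOf ws → W w) → All Piece (join ws)
        all []       _ = filaments ls-F
        all (w ∷ ws) h = W-piece (h w (fst w ws)) ∷ all ws λ v g → h v (later w ws v g)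
          where
          fst : ∀ w ws → w ∈ ⟨ w ⟩ ∪ setOf ws
          fst w ws = (sets 2 (λ a b → ⊢ (a ⊑ a ⊔ b)) ⟨ w ⟩ (setOf ws))
          later : ∀ w ws v → v ∈ setOf ws → v ∈ ⟨ w ⟩ ∪ setOf ws
          later w ws v h = (sets 3 (λ a b c → (a ⊑ b) ⇛ ⊢ (a ⊑ c ⊔ b)) ⟨ v ⟩ (setOf ws) ⟨ w ⟩ h)
        len : ∀ ws → length (join ws) ≡ length ws + length ls
        len []       = refl
        len (w ∷ ws) = cong suc (len ws)
        lines : ∀ {ls} → All Filament ls → Σr hat ls ≤ length ls + length ls
        lines []              = z≤n
        lines {l ∷ ls} (f ∷ fs) = go (lines fs) (Filament.l≤2 f)
          where
          go : ∀ {a b c} → a ≤ b + b → c ≤ 2 → c + a ≤ suc b + suc b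
          go {a} {b} {c} x y = (linear 3 (λ a b c → (a ≼ b ⊕ b) ⇒ (c ≼ num 2) ⇒ ⊩ (c ⊕ a ≼ ↑ b ⊕ ↑ b)) a b c x y)
        weights : ∀ ws → Σr hat (join ws) ≤ length ws + (length ls + length ls)
        weights []       = lines ls-F
        weights (w ∷ ws) = +-mono-≤ (r-point w) (weights ws)
        unions : ∀ ls → ⋃ ls ⊆ ⋃ˡ hat ls
        unions []       = sets 1 (λ a → ⊢ (𝟘 ⊑ a)) ∅
        unions (l ∷ ls) = go l (unions ls)
          where
          go : ∀ l {A B} → A ⊆ B → l ∪ A ⊆ l ∪ B
          go l {A} {B} h = (sets 3 (λ a b c → (a ⊑ b) ⇛ ⊢ (c ⊔ a ⊑ c ⊔ b)) A B l h)
        union : ∀ ws → setOf ws ∪ ⋃ ls ⊆ ⋃ˡ hat (join ws)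
        union [] = go (unions ls)
          where
          go : ∀ {A B : Sub (Element M)} → A ⊆ B → ∅ ∪ A ⊆ B
          go {A} {B} h = (sets 2 (λ a b → (a ⊑ b) ⇛ ⊢ (𝟘 ⊔ a ⊑ b)) A B h)
        union (w ∷ ws) = go w (setOf ws) (union ws)
          where
          go : ∀ w S {A B : Sub (Element M)} → S ∪ A ⊆ B → (⟨ w ⟩ ∪ S) ∪ A ⊆ ⟨ w ⟩ ∪ B
          go w S {A} {B} h = (sets 4 (λ a b c d → (a ⊔ b ⊑ c) ⇛ ⊢ ((d ⊔ a) ⊔ b ⊑ d ⊔ c)) S A B ⟨ w ⟩ h)

module NFacts {n : ℕ} (N : Matroid n) (N-simple₀ : Simple N) where
  open Hat N
  private module SN = Simplification N

  N-loopless : ∀ e → 1 ≤ r ⟨ e ⟩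
  N-loopless e = ≤-trans (SN.nonloop (proj₂ e) (proj₁ N-simple₀ (proj₁ e))) (≤-reflexive (sym SN.r₁))

  N-simple : ∀ {e e′} → e′ ∉ ⟨ e ⟩ → 2 ≤ r (⟨ e ⟩ ∪ ⟨ e′ ⟩)
  N-simple {e} {e′} h = ≤-trans
    (SN.nonparallel (proj₂ e) (proj₂ e′) (≤-trans (N-loopless e) (≤-reflexive SN.r₁)) (≤-trans (N-loopless e′) (≤-reflexive SN.r₁))
      (λ eq → loop (subst (λ v → e′ ∉ ⟨ v ⟩) (Element-≡ eq) h)) (proj₂ N-simple₀ (proj₁ e) (proj₁ e′)))
    (≤-reflexive (sym SN.r₂))
    where
    loop : e′ ∉ ⟨ e′ ⟩ → ⊥
    loop h = (nonempty (sets 1 (λ a → (a ⊑ ∼ a) ⇛ ⊢ (a ⊑ 𝟘)) ⟨ e′ ⟩ h))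

module ManyPieces {m n : ℕ} (M : Matroid m) (N : Matroid n) (tc : ThreeConnected M) (tcN : ThreeConnected N)
  (N-simple₀ : Simple N) (minor : HasMinor M N) (room : 2 + Hat.ρ N ≤ Hat.ρ M) where
  open Hat M
  open NFacts N N-simple₀
  private
    module HN₄ = Hat N
    2≤ρ : 2 ≤ ρ
    2≤ρ = ≤-trans (m≤m+n 2 HN₄.ρ) room
  open Pieces M N tc 2≤ρ
  open SmallMinor hat HN₄.hat N-loopless N-simple
  open Image {Element M} {Element N} HN₄.hat

  -- With four elements in `N` the copies themselves form the structure `Tangles`. Otherwise the
  -- trivial one is used, for which `W` is plain contractibility, and `small-copy` supplies the copy
  -- for each member.
  many-pieces : ¬¬ (∃ λ Xs → All Piece Xs × 2 + (ρ ∸ HN₄.ρ) ≤ length Xs + length Xs × Σr hat Xs ≤ r (⋃ˡ hat Xs))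
  many-pieces Q = em Four λ where
      (inj₁ (q₁ , q₂ , q₃ , q₄ , (d₁₂ , d₁₃ , d₁₄) , (d₂₃ , d₂₄) , d₃₄)) → many q₁ q₂ q₃ q₄ d₁₂ d₁₃ d₁₄ d₂₃ d₂₄ d₃₄
      (inj₂ few) → pieces (trivial) (λ {X} {_} _ vc le → small-copy few vc (few⇒rank≤2 few (HN₄.conn tcN)) le) room
        tt (ρ ∸ HN₄.ρ) (m∸n≤m ρ HN₄.ρ) 2≤K Q
    where
    2≤K : 2 ≤ ρ ∸ HN₄.ρ
    2≤K = m+n≤o⇒m≤o∸n 2 room
    trivial : Separations.Tangles hat (simple tc 2≤ρ) (vc3 tc)
    trivial = record
      { Copy = ⊤ ; Con = λ _ → 𝕌 ; Small = λ _ _ _ → ⊤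
      ; Con-flat = λ _ z _ → all z
      ; orient = λ _ _ K → K (inj₁ tt)
      ; extend = λ {_} {y} {z} _ _ _ _ _ K → K (tt , all y , all z , tt)
      ; shrink = λ _ _ → tt
      ; opposite = λ _ _ _ _ _ → tt }
      where
      all : ∀ z → z ∈ 𝕌
      all z = sets 1 (λ a → ⊢ (a ⊑ 𝟙)) ⟨ z ⟩
    many : ∀ q₁ q₂ q₃ q₄ → ¬ q₁ ≡ q₂ → ¬ q₁ ≡ q₃ → ¬ q₁ ≡ q₄ → ¬ q₂ ≡ q₃ → ¬ q₂ ≡ q₄ → ¬ q₃ ≡ q₄ → ⊥
    many q₁ q₂ q₃ q₄ d₁₂ d₁₃ d₁₄ d₂₃ d₂₄ d₃₄ = go minor
      where
      open Copies hat HN₄.hat (simple tc 2≤ρ) (loopless tc 2≤ρ) (vc3 tc)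
      second : ∀ (e : Element N) → ∃ λ e′ → e′ ∉ ⟨ e ⟩
      second e = case q₁ ∈? ⟨ e ⟩ of λ where
        (inj₂ h) → q₁ , h
        (inj₁ h) → q₂ , apart (λ eq → d₁₂ (trans (sym (same h)) (sym eq)))
      tangle = tangles (HN₄.3-conn tcN) (HN₄.conn tcN) N-loopless second N-simple q₁ q₂ q₃ q₄ d₁₂ d₁₃ d₁₄ d₂₃ d₂₄ d₃₄
      go : HasMinor M N → ⊥
      go (C₀ , D₀ , C₀⊆ , _ , _ , iso) =
        grow M N ρ (φ-of M N C₀ D₀ C₀⊆ iso) (fromSub C₀) (m≤m+n ρ _) (minor-embeds M N C₀ D₀ C₀⊆ iso) λ (D , emb , full) →
        pieces tangle (λ {X} {k} X⊆ _ _ K → K (CopyOf.φ k , CopyOf.C k , X⊆ , CopyOf.rank-φ k)) room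
          (mkCopy _ D emb) (ρ ∸ HN₄.ρ) (m≤n+o⇒m∸n≤o ρ HN₄.ρ (enough (emb 𝕌) full (mono (⊆cl D)))) 2≤K Q
        where
        enough : ∀ {x d t} → HN₄.ρ + d ≡ x → ρ ≤ x → d ≤ t → ρ ≤ HN₄.ρ + t
        enough {x} {d} {t} a b c = (linear 5 (λ a b c d e → (a ≼ c ⊕ b) ⇒ (d ≼ a) ⇒ (b ≼ e) ⇒ ⊩ (d ≼ c ⊕ e)) x d HN₄.ρ
          ρ t (≤-reflexive (sym a)) b c)

-- Recovering witnesses by finite search

Searchable : Set → Set₁
Searchable A = ∀ {P : A → Set} → Decidable P → Dec (∃ P)

search-Vec : ∀ {A} → Searchable A → ∀ s → Searchable (Vec A s)
search-Vec any? zero    P? = map′ (λ p → [] , p) (λ where ([] , p) → p) (P? [])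
search-Vec any? (suc s) P? = map′ (λ (x , xs , p) → x ∷ xs , p) (λ where (x ∷ xs , p) → x , xs , p)
  (any? λ x → search-Vec any? s λ xs → P? (x ∷ xs))

all-subsets? : ∀ {n} {P : Subset n → Set} → Decidable P → Dec (∀ Y → P Y)
all-subsets? P? = map′
  (λ none Y → decidable-stable (P? Y) (λ ¬p → none (Y , ¬p)))
  (λ all (Y , ¬p) → ¬p (all Y))
  (¬? (S.anySubset? (λ Y → ¬? (P? Y))))

separation? : ∀ {m} (K : Matroid m) k X → Dec (Separation K k X)
separation? K k X = (X S.⊆? Matroid.E K) ×-dec ((k ≤? ∣ X ∣) ×-dec ((k ≤? ∣ Matroid.E K ─ X ∣) ×-dec
  (Matroid.r K X + Matroid.r K (Matroid.E K ─ X) <? Matroid.rank K + k)))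

three-connected? : ∀ {m} (K : Matroid m) → Dec (ThreeConnected K)
three-connected? K = map′ to (λ tc → tc 1 ≤-refl (s≤s (s≤s z≤n)) , tc 2 (s≤s z≤n) ≤-refl)
  ((¬? (S.anySubset? (separation? K 1))) ×-dec (¬? (S.anySubset? (separation? K 2))))
  where
  to : ¬ ∃ (Separation K 1) × ¬ ∃ (Separation K 2) → ThreeConnected K
  to (a , b) zero () _
  to (a , b) (suc zero) _ _ = a
  to (a , b) (suc (suc zero)) _ _ = b
  to (a , b) (suc (suc (suc _))) _ (s≤s (s≤s (s≤s ())))

enum : ∀ {n} (p : Subset n) → Fin ∣ p ∣ → Fin n
enum (true  ∷ p) Fin.zero    = Fin.zero
enum (true  ∷ p) (Fin.suc i) = Fin.suc (enum p i)
enum (false ∷ p) i           = Fin.suc (enum p i)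

enum-∈ : ∀ {n} (p : Subset n) i → enum p i S.∈ p
enum-∈ (true  ∷ p) Fin.zero    = Vec.here
enum-∈ (true  ∷ p) (Fin.suc i) = Vec.there (enum-∈ p i)
enum-∈ (false ∷ p) i           = Vec.there (enum-∈ p i)

enum-injective : ∀ {n} (p : Subset n) → Injective _≡_ _≡_ (enum p)
enum-injective (true  ∷ p) {Fin.zero}  {Fin.zero}  _ = refl
enum-injective (true  ∷ p) {Fin.suc i} {Fin.suc j} e = cong Fin.suc (enum-injective p (Fin.suc-injective e))
enum-injective (false ∷ p) e = enum-injective p (Fin.suc-injective e)

enum-onto : ∀ {n} (p : Subset n) {x} → x S.∈ p → ∃ λ i → enum p i ≡ x
enum-onto (true  ∷ p) {Fin.zero}  _ = Fin.zero , refl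
enum-onto (true  ∷ p) {Fin.suc x} (Vec.there h) = let i , e = enum-onto p h in Fin.suc i , cong Fin.suc e
enum-onto (false ∷ p) {Fin.suc x} (Vec.there h) = let i , e = enum-onto p h in i , cong Fin.suc e

⋃ᶠ⁺ : ∀ {n s} (X : Fin s → Subset n) i {x} → x S.∈ X i → x S.∈ ⋃ᶠ X
⋃ᶠ⁺ X Fin.zero    h = S.x∈p∪q⁺ (inj₁ h)
⋃ᶠ⁺ X (Fin.suc i) h = S.x∈p∪q⁺ (inj₂ (⋃ᶠ⁺ (X ∘ Fin.suc) i h))

⋃ᶠ⁻ : ∀ {n s} (X : Fin s → Subset n) {x} → x S.∈ ⋃ᶠ X → ∃ λ i → x S.∈ X i
⋃ᶠ⁻ {s = zero}  X h = ⊥-elim (S.∉⊥ h)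
⋃ᶠ⁻ {s = suc s} X h = case S.x∈p∪q⁻ (X Fin.zero) _ h of λ where
  (inj₁ g) → Fin.zero , g
  (inj₂ g) → let i , k = ⋃ᶠ⁻ (X ∘ Fin.suc) g in Fin.suc i , k

filament-enum : ∀ {n} (p : Subset n) → p ≡ filament (enum p)
filament-enum p = S.⊆-antisym
  (λ h → let i , e = enum-onto p h in ⋃ᶠ⁺ _ i (subst (λ v → v S.∈ ⁅ enum p i ⁆) e (S.x∈⁅x⁆ (enum p i))))
  (λ h → let i , g = ⋃ᶠ⁻ _ h in subst (S._∈ p) (sym (S.x∈⁅y⁆⇒x≡y (enum p i) g)) (enum-∈ p i))

module Extraction {m n : ℕ} (M : Matroid m) (N : Matroid n) (tc : ThreeConnected M) (tcN : ThreeConnected N)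
  (N-simple₀ : Simple N) (minor : HasMinor M N) (room : 2 + Hat.ρ N ≤ Hat.ρ M) where
  open Hat M
  open NFacts N N-simple₀
  private
    module HN₅ = Hat N
    2≤ρ : 2 ≤ ρ
    2≤ρ = ≤-trans (m≤m+n 2 HN₅.ρ) room
    E₀ = Matroid.E M
  open Pieces M N tc 2≤ρ
  open Image {Element M} {Element N} HN₅.hat

  some-element : Element M
  some-element = member (≤-trans (≤-trans (s≤s z≤n) 2≤ρ) (≤-trans (≤-reflexive (sym rank-hat)) (Matroid.r-bounded M id)))

  -- The default value makes every vector a total map; whether it embeds `N` is left to the rank
  -- identity in `Evidence`.
  φᵛ : Vec (Fin m) n → Element N → Element M
  φᵛ v (e , _) = case lookup v e S.∈? E₀ of λ where
    (yes p) → lookup v e , p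
    (no _)  → some-element

  -- An embedding coded by a vector of indices and a subset, so that it can be searched for; a minor
  -- proper contains a bijection of elements and is produced from it afterwards.
  Evidence : Subset m → Set
  Evidence X = ∃ λ (v : Vec (Fin m) n) → ∃ λ (C : Subset m) → X S.⊆ C ×
    (∀ (Y : Subset n) → HN₅.r (HN₅.fromSub Y) + r (fromSub C) ≡ r (img (φᵛ v) (HN₅.fromSub Y) ∪ fromSub C))

  evidence? : ∀ X → Dec (Evidence X)
  evidence? X = search-Vec Fin.any? n λ v → S.anySubset? λ C → (X S.⊆? C) ×-dec all-subsets? λ Y → _ ≟ _

  module _ (φ : Element N → Element M) where
    code : Fin n → Fin m
    code i = case i S.∈? Matroid.E N of λ where
      (yes p) → proj₁ (φ (i , p))
      (no _)  → proj₁ some-element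

    code-φ : ∀ i p → code i ≡ proj₁ (φ (i , p))
    code-φ i p with i S.∈? Matroid.E N
    ... | yes q = cong (λ q → proj₁ (φ (i , q))) ([]=-irrelevant q p)
    ... | no q  = ⊥-elim (q p)

    φᵛ-code : ∀ e → φᵛ (tabulate code) e ≡ φ e
    φᵛ-code (i , p) with lookup (tabulate code) i S.∈? E₀ | trans (lookup∘tabulate code i) (code-φ i p)
    ... | yes q | eq = Element-≡ eq
    ... | no q  | eq = ⊥-elim (q (subst (S._∈ E₀) (sym eq) (proj₂ (φ (i , p)))))

  img-cong : ∀ {φ ψ} → (∀ e → φ e ≡ ψ e) → ∀ Y → img φ Y ⊆ img ψ Y
  img-cong {φ} {ψ} h Y = img-⊆ φ λ e e∈ → subst (_∈ img ψ Y) (sym (h e)) (∈-img ψ e∈)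

  private
    r-cong : ∀ {A B} → A ⊆ B → B ⊆ A → r A ≡ r B
    r-cong p q = ≤-antisym (mono p) (mono q)

    ∪-mono : ∀ {A B C D : Sub (Element M)} → A ⊆ B → C ⊆ D → A ∪ C ⊆ B ∪ D
    ∪-mono {A} {B} {C} {D} p q = (sets 4 (λ a b c d → (a ⊑ b) ⇛ (c ⊑ d) ⇛ ⊢ (a ⊔ c ⊑ b ⊔ d)) A B C D p q)

  copied⇒evidence : ∀ {X} → Copied X → Evidence (toSub X)
  copied⇒evidence {X} (φ , C , X⊆ , emb) = tabulate (code φ) , toSub C , toSub-mono X⊆ , λ Y →
    trans (cong (HN₅.r (HN₅.fromSub Y) +_) (r-cong (from-to⊆ C) (⊆from-to C)))
      (trans (emb (HN₅.fromSub Y)) (r-cong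
        (∪-mono (img-cong (λ e → sym (φᵛ-code φ e)) (HN₅.fromSub Y)) (⊆from-to C))
        (∪-mono (img-cong (φᵛ-code φ) (HN₅.fromSub Y)) (from-to⊆ C))))

  evidence⇒minor : ∀ {X} → X S.⊆ E₀ → Evidence X → HasMinor (si (M / X)) N
  evidence⇒minor {X} X⊆ (v , C , X⊆C , emb) =
      embedding⇒minor M N X X⊆ N-loopless N-simple (CopyOf.φ copy) (CopyOf.C copy) (CopyOf.C-flat copy)
        (⊆-trans (fromSub-mono X⊆C) (⊆cl (fromSub C))) (CopyOf.rank-φ copy)
    where
    open Copies hat HN₅.hat (simple tc 2≤ρ) (loopless tc 2≤ρ) (vc3 tc)
    ⊆-trans : ∀ {A B C : Sub (Element M)} → A ⊆ B → B ⊆ C → A ⊆ C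
    ⊆-trans {A} {B} {C} p q = (sets 3 (λ a b c → (a ⊑ b) ⇛ (b ⊑ c) ⇛ ⊢ (a ⊑ c)) A B C p q)
    embed : ∀ Y → HN₅.r Y + r (fromSub C) ≡ r (img (φᵛ v) Y ∪ fromSub C)
    embed Y = trans (cong (_+ r (fromSub C)) (≤-antisym (HN₅.mono (HN₅.⊆from-to Y)) (HN₅.mono (HN₅.from-to⊆ Y))))
      (trans (emb (HN₅.toSub Y)) (r-cong
        (∪-mono (img-mono (φᵛ v) (HN₅.from-to⊆ Y)) (incl λ _ t → t))
        (∪-mono (img-mono (φᵛ v) (HN₅.⊆from-to Y)) (incl λ _ t → t))))
    copy : CopyOf
    copy = mkCopy (φᵛ v) (fromSub C) embed

  Line₃ : Subset m → Set
  Line₃ X = Matroid.r M X ≡ 2 × 3 ≤ ∣ X ∣ ×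
    (∀ y → y S.∈ X → ∃ λ x → x S.∈ E₀ × Cocircuit M ((X S.- y) S.∪ ⁅ x ⁆))

  Member : Subset m → Set
  Member X = X S.⊆ E₀ × ThreeConnected (si (M / X)) × Evidence X × ((∃ λ x → X ≡ ⁅ x ⁆) ⊎ Line₃ X)

  spoke? : ∀ X y → Dec (∃ λ x → x S.∈ E₀ × Cocircuit M ((X S.- y) S.∪ ⁅ x ⁆))
  spoke? X y = Fin.any? λ x → (x S.∈? E₀) ×-dec circuit? (M *) ((X S.- y) S.∪ ⁅ x ⁆)

  member? : ∀ X → Dec (Member X)
  member? X = (X S.⊆? E₀) ×-dec (three-connected? (si (M / X)) ×-dec (evidence? X ×-dec
    (Fin.any? (λ x → X ≡? ⁅ x ⁆) ⊎-dec
     ((Matroid.r M X ≟ 2) ×-dec ((3 ≤? ∣ X ∣) ×-dec Fin.all? (λ y → (y S.∈? X) →-dec spoke? X y))))))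
    where
    _≡?_ : (X Y : Subset m) → Dec (X ≡ Y)
    X ≡? Y = Vec-≡-dec Bool._≟_ X Y

  piece⇒member : ∀ {X} → Piece X → Member (toSub X)
  piece⇒member {X} (t , c , s) = toSub-⊆ , t ,
    decidable-stable (evidence? (toSub X)) (λ n → c (n ∘ copied⇒evidence)) , (case s of λ where
      (inj₁ p) → inj₁ p
      (inj₂ (a , b , f)) → inj₂ (a , b , λ y y∈ → decidable-stable (spoke? (toSub X) y) (f y y∈)))

  member⇒contractible : ∀ {X} → Member X → VerticallyContractible M N X
  member⇒contractible (X⊆ , t , e , _) = X⊆ , t , evidence⇒minor X⊆ e

  line⇒filament : ∀ {X} → Member X → Line₃ X → IsFilament M N X
  line⇒filament {X} mb (two , three , f) = ∣ X ∣ , (λ i → proj₁ (f (enum X i) (enum-∈ X i))) , enum X , record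
    { 3≤s = three
    ; x∈E = λ i → proj₁ (proj₂ (f (enum X i) (enum-∈ X i)))
    ; y∈E = λ i → proj₁ mb (enum-∈ X i)
    ; y-distinct = enum-injective X
    ; line = subst (λ L → L S.⊆ E₀ × Matroid.r M L ≡ 2) (filament-enum X) (proj₁ mb , two)
    ; contractible = subst (VerticallyContractible M N) (filament-enum X) (member⇒contractible mb)
    ; cocircuit = λ i → subst (λ L → Cocircuit M ((L S.- enum X i) S.∪ ⁅ proj₁ (f (enum X i) (enum-∈ X i)) ⁆))
        (filament-enum X) (proj₂ (proj₂ (f (enum X i) (enum-∈ X i))))
    } , filament-enum X

  Good : ∀ s → Vec (Subset m) s → Set
  Good s V = (∀ i → Member (lookup V i)) ×
    Σᵛ hat (λ i → fromSub (lookup V i)) ≤ r (⋃ᵛ hat (λ i → fromSub (lookup V i)))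

  good? : ∀ s V → Dec (Good s V)
  good? s V = Fin.all? (λ i → member? (lookup V i)) ×-dec (_ ≤? _)

  -- Parity: `2s ≤ K + 3` and `K + 2 ≤ 2t` give `2s ≤ 2t + 1`, hence `s ≤ t`, and the first `s`
  -- pieces are kept. As `Good` is decidable and its candidates are finite in number, the double
  -- negation can be removed.
  good-exists : ∀ s → s + s ≤ 3 + (ρ ∸ HN₅.ρ) → ∃ (Good s)
  good-exists s small = decidable-stable (search-Vec S.anySubset? s (good? s)) λ none →
    many-pieces λ (Xs , ps , big , skew) → build Xs ps (half {s} {length Xs} small big) skew none
    where
    open ManyPieces M N tc tcN N-simple₀ minor room
    half : ∀ {s t K} → s + s ≤ 3 + K → 2 + K ≤ t + t → s ≤ t
    half {s} {t} {K} a b = ≤-by-contra λ c → (linear 3 (λ a b c → (a ⊕ a ≼ num 3 ⊕ b) ⇒ (num 2 ⊕ b ≼ c ⊕ c) ⇒ (↑ c ≼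
      a) ⇒ (↑ c ≼ a) ⇒ ⊩⊥) s K t a b c c)
    build : ∀ Xs → All Piece Xs → s ≤ length Xs → Σr hat Xs ≤ r (⋃ˡ hat Xs) → ¬ ¬ ∃ (Good s)
    build Xs ps le skew none =
      let V , V-P , h = prefix hat s ∅ Xs le ps in
      none (tabulate (toSub ∘ V) ,
        (λ i → subst Member (sym (lookup∘tabulate (toSub ∘ V) i)) (piece⇒member (V-P i))) ,
        ≤-trans (Σᵛ-mono hat _ V (λ i → subst (λ W → fromSub W ⊆ V i) (sym (lookup∘tabulate (toSub ∘ V) i)) (from-to⊆ (V i))))
          (≤-trans (cancel (⋃ᵛ hat V) (⋃ˡ hat Xs) h skew)
            (mono (⋃ᵛ-mono hat V _ (λ i → subst (λ W → V i ⊆ fromSub W) (sym (lookup∘tabulate (toSub ∘ V) i)) (⊆from-to (V i)))))))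
      where
      cancel : ∀ A B {x y} → r (∅ ∪ B) + x ≤ r (∅ ∪ A) + y → y ≤ r B → x ≤ r A
      cancel A B {x} {y} p q = let a = mono {B} {∅ ∪ B} (sets 1 (λ a → ⊢ (a ⊑ 𝟘 ⊔ a)) B)
                                   b = mono {∅ ∪ A} {A} (sets 1 (λ a → ⊢ (𝟘 ⊔ a ⊑ a)) A) in (linear 6 (λ a b c d e f →
                                     (b ⊕ a ≼ d ⊕ c) ⇒ (c ≼ e) ⇒ (e ≼ b) ⇒ (d ≼ f) ⇒ ⊩ (a ≼ f)) x (r (∅ ∪ B)) y (r (∅
                                     ∪ A)) (r B) (r A) p q a b)

-- Cardinality, freeness and the conclusion

⌈/2⌉-double : ∀ k → (⌈ k /2⌉ + 1) + (⌈ k /2⌉ + 1) ≤ 3 + k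
⌈/2⌉-double k = go (⌊n/2⌋+⌈n/2⌉≡n (suc k)) (⌊n/2⌋≤⌈n/2⌉ (suc k))
  where
  go : ∀ {a b} → a + b ≡ suc k → a ≤ b → (a + 1) + (a + 1) ≤ 3 + k
  go {a} {b} e l = (linear 3 (λ a b c → (b ⊕ a ≼ ↑ c) ⇒ (b ≼ a) ⇒ ⊩ (b ⊕ num 1 ⊕ (b ⊕ num 1) ≼ num 3 ⊕ c)) b a k
    (≤-reflexive e) l)

module Freeness {m : ℕ} (M : Matroid m) (loops : ∀ z → 1 ≤ Hat.r M ⟨ z ⟩) {s} (X : Fin s → Subset m)
  (X⊆ : ∀ i → X i S.⊆ Matroid.E M)
  (skew : Σᵛ (Hat.hat M) (λ i → Hat.fromSub M (X i)) ≤ Hat.r M (⋃ᵛ (Hat.hat M) (λ i → Hat.fromSub M (X i)))) where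
  open Hat M
  private
    E₀ = Matroid.E M
    V : Fin s → Sub (Element M)
    V i = fromSub (X i)

  -- A common element would have a trace of rank 1 on two members, although by skewness the traces
  -- of one element have total rank at most 1.
  disjoint : ∀ {x} i j → ¬ i ≡ j → x S.∈ X i → x S.∈ X j → ⊥
  disjoint {x} i j i≢j x∈i x∈j = go i j i≢j (fromSub⁺ x∈i) (fromSub⁺ x∈j)
    where
    z : Element M
    z = x , X⊆ i x∈i
    go : ∀ i j → ¬ i ≡ j → z ∈ V i → z ∈ V j → ⊥
    go i j i≢j zi zj =
      1+n≰n (≤-trans (Σᵛ-two hat (λ i → ⟨ z ⟩ ∩ V i) i j i≢j (meets (V i) zi) (meets (V j) zj))
        (≤-trans (skew-traces hat V skew ⟨ z ⟩ (within (V i) (⋃ᵛ hat V) zi (⊆⋃ᵛ hat V i))) (r-point z)))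
      where
      meets : ∀ A → z ∈ A → 1 ≤ r (⟨ z ⟩ ∩ A)
      meets A h = ≤-trans (loops z) (mono {⟨ z ⟩} {⟨ z ⟩ ∩ A} (sets 2 (λ a b → (a ⊑ b) ⇛ ⊢ (a ⊑ a ⊓ b)) ⟨ z ⟩ A h))
      within : ∀ A B → z ∈ A → A ⊆ B → z ∈ B
      within A B p q = (sets 3 (λ a b c → (a ⊑ b) ⇛ (b ⊑ c) ⇛ ⊢ (a ⊑ c)) ⟨ z ⟩ A B p q)

  -- Disjoint nonempty sets are different, so the number of indices is the cardinality of the
  -- family.
  injective : (∀ i → ∃ (S._∈ X i)) → Injective _≡_ _≡_ X
  injective ne {i} {j} eq = case i Fin.≟ j of λ where
    (yes e) → e
    (no n)  → ⊥-elim (disjoint i j n (proj₂ (ne i)) (subst (proj₁ (ne i) S.∈_) eq (proj₂ (ne i))))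

  pairwise : PairwiseDisjoint (λ i → E₀ S.∩ X i)
  pairwise i j n (x , h) = let a , b = S.x∈p∩q⁻ _ _ h in
    disjoint i j n (proj₂ (S.x∈p∩q⁻ _ _ a)) (proj₂ (S.x∈p∩q⁻ _ _ b))

  ground : E₀ S.∩ ⋃ᶠ X ≡ ⋃ᶠ (λ i → E₀ S.∩ X i)
  ground = S.⊆-antisym
    (λ h → let a , b = S.x∈p∩q⁻ _ _ h
               i , c = ⋃ᶠ⁻ X b in ⋃ᶠ⁺ (λ i → E₀ S.∩ X i) i (S.x∈p∩q⁺ (a , c)))
    (λ h → let i , c = ⋃ᶠ⁻ (λ i → E₀ S.∩ X i) h
               a , b = S.x∈p∩q⁻ _ _ c in S.x∈p∩q⁺ (a , ⋃ᶠ⁺ X i b))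

  trace : ∀ {Y} i → Y S.⊆ E₀ → r (fromSub Y ∩ V i) ≡ Matroid.r M (Y S.∩ (E₀ S.∩ X i))
  trace {Y} i Y⊆ = cong (Matroid.r M) (S.⊆-antisym
    (λ {x} h → let p , q = toSub⁻ {fromSub Y ∩ V i} h in
      S.x∈p∩q⁺ (fromSub⁻ {Y} {x} {p} (left (x , p) (fromSub Y) (V i) q) ,
        S.x∈p∩q⁺ (p , fromSub⁻ {X i} {x} {p} (right (x , p) (fromSub Y) (V i) q))))
    (λ {x} h → let a , b = S.x∈p∩q⁻ _ _ h
                   c , d = S.x∈p∩q⁻ _ _ b in
      toSub⁺ (x , c) (both (x , c) (fromSub Y) (V i) (fromSub⁺ a) (fromSub⁺ d))))
    where
    left : ∀ z A B → z ∈ A ∩ B → z ∈ A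
    left z A B h = (sets 3 (λ a b c → (a ⊑ b ⊓ c) ⇛ ⊢ (a ⊑ b)) ⟨ z ⟩ A B h)
    right : ∀ z A B → z ∈ A ∩ B → z ∈ B
    right z A B h = (sets 3 (λ a b c → (a ⊑ b ⊓ c) ⇛ ⊢ (a ⊑ c)) ⟨ z ⟩ A B h)
    both : ∀ z A B → z ∈ A → z ∈ B → z ∈ A ∩ B
    both z A B p q = (sets 3 (λ a b c → (a ⊑ b) ⇛ (a ⊑ c) ⇛ ⊢ (a ⊑ b ⊓ c)) ⟨ z ⟩ A B p q)

  Σᵛ-sum : ∀ {t} (W : Fin t → Sub (Element M)) (f : Fin t → ℕ) → (∀ i → r (W i) ≡ f i) → Σᵛ hat W ≡ ∑[ i < t ] f i
  Σᵛ-sum {zero}  W f h = refl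
  Σᵛ-sum {suc t} W f h = cong₂ _+_ (h Fin.zero) (Σᵛ-sum (W ∘ Fin.suc) (f ∘ Fin.suc) (h ∘ Fin.suc))

  free : Free M X
  free = X⊆ , pairwise , ground , λ Y Y⊆ →
      let Y⊆E = λ {x} (h : x S.∈ Y) → proj₁ (S.x∈p∩q⁻ E₀ (⋃ᶠ X) (Y⊆ h)) in
      trans (r-sub Y⊆E) (trans (≤-antisym (traces-cover hat V (fromSub Y) (covered Y⊆)) (skew-traces hat V skew (fromSub Y) (covered Y⊆)))
        (Σᵛ-sum _ _ λ i → trace i Y⊆E))
    where
    covered : ∀ {Y} → Y S.⊆ E₀ S.∩ ⋃ᶠ X → fromSub Y ⊆ ⋃ᵛ hat V
    covered {Y} Y⊆ = ⊆-intro λ (x , p) a b →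
      let i , c = ⋃ᶠ⁻ X (proj₂ (S.x∈p∩q⁻ _ _ (Y⊆ (fromSub⁻ {Y} {x} {p} a)))) in
      not-covered (x , p) (V i) (⋃ᵛ hat V) (fromSub⁺ c) (⊆⋃ᵛ hat V i) b
      where
      not-covered : ∀ z A B → z ∈ A → A ⊆ B → z ∉ B → ⊥
      not-covered z A B p q c = (nonempty (sets 3 (λ a b c → (a ⊑ b) ⇛ (b ⊑ c) ⇛ (a ⊑ ∼ c) ⇛ ⊢ (a ⊑ 𝟘)) ⟨ z ⟩ A B p q
        c))

theorem1p4 : ∀ {m n : ℕ} (M : Matroid m) (N : Matroid n) →
    ThreeConnected M → ThreeConnected N → Simple N → HasMinor M N →
    (k : ℕ) → k ≡ rank M ∸ rank N → 2 ≤ k →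
    ∃ λ (X : Fin (⌈ k /2⌉ + 1) → Subset m) →
      Injective _≡_ _≡_ X × Free M X ×
      (∀ i → (∃ λ x → X i ≡ ⁅ x ⁆ × VerticallyContractible M N ⁅ x ⁆)
             ⊎ IsFilament M N (X i))
theorem1p4 M N tcM tcN N-simple minor k k≡ 2≤k =
    conclude (good-exists (⌈ k /2⌉ + 1) (≤-trans (⌈/2⌉-double k) (≤-reflexive (cong (3 +_) k≡′))))
  where
  k≡′ : k ≡ Hat.ρ M ∸ Hat.ρ N
  k≡′ = trans k≡ (cong₂ _∸_ (Hat.rank-hat M) (Hat.rank-hat N))
  -- As `k` is at least 2, the subtraction that defines it is not truncated.
  room : 2 + Hat.ρ N ≤ Hat.ρ M
  room = ≤-by-contra λ lt → 1+n≰n (≤-trans 2≤k (≤-trans (≤-reflexive k≡′)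
    (≤-trans (∸-monoˡ-≤ (Hat.ρ N) (≤-pred lt)) (≤-reflexive (m+n∸n≡m 1 (Hat.ρ N))))))
  open Extraction M N tcM tcN N-simple minor room
  conclude : ∃ (Good (⌈ k /2⌉ + 1)) → _
  conclude (V , members , skew) = lookup V , (λ {i} {j} → injective nonempty-member {i} {j}) , free , λ i → classify (members i)
    where
    open Freeness M (Hat.loopless M tcM (≤-trans (m≤m+n 2 _) room)) (lookup V) (λ i → proj₁ (members i)) skew
    nonempty-member : ∀ i → ∃ (S._∈ lookup V i)
    nonempty-member i = case proj₂ (proj₂ (proj₂ (members i))) of λ where
      (inj₁ (x , eq)) → x , subst (x S.∈_) (sym eq) (S.x∈⁅x⁆ x)
      (inj₂ (_ , three , _)) → member (≤-trans (s≤s z≤n) three)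
    classify : ∀ {X} → Member X → (∃ λ x → X ≡ ⁅ x ⁆ × VerticallyContractible M N ⁅ x ⁆) ⊎ IsFilament M N X
    classify mb@(_ , _ , _ , inj₁ (x , eq)) = inj₁ (x , eq , subst (VerticallyContractible M N) eq (member⇒contractible mb))
    classify mb@(_ , _ , _ , inj₂ l)        = inj₂ (line⇒filament mb l)
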